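{- As identities of $q$-series (for $|q|<1$): \begin{align*} \varphi^3(q) \varphi (q^2) =& -2 E_{\chi_0,\chi_2}(q) + 8 E_{\chi_2,\chi_0}(q) ,\\ \varphi^2(q) \varphi (q^5) \varphi (q^{10}) =& \tfrac{2}{13}\big(2 E_{\chi_0,\chi_2}(q) - 15E_{\chi_0,\chi_2}(q^5) +8 E_{\chi_2,\chi_0}(q) + 60E_{\chi_2,\chi_0}(q^5)\big) + \tfrac{8}{13}\big(6 C_1(q) - 4C_2(q) - 3 C_3(q) + 4 C_4(q)\big),\\ \varphi(q) \varphi^3 (q^2) =& -2 E_{\chi_0,\chi_2}(q) + 4 E_{\chi_2,\chi_0}(q) ,\\ \varphi(q) \varphi (q^2) \varphi^2 (q^5)=& \tfrac{2}{13}\big(-3 E_{\chi_0,\chi_2}(q) -10E_{\chi_0,\chi_2}(q^5) +12E_{\chi_2,\chi_0}(q) \big) -\tfrac{80}{13}E_{\chi_2,\chi_0}(q^5) + \tfrac{8}{13}\big(-2 C_2(q) - 5 C_3(q) + C_4(q)\big),\\ \varphi(q) \varphi (q^2) \varphi^2 (q^{10})=&\tfrac{2}{13}\big(-3 E_{\chi_0,\chi_2}(q) -10E_{\chi_0,\chi_2}(q^5) +6 E_{\chi_2,\chi_0}(q)\big) -\tfrac{40}{13}E_{\chi_2,\chi_0}(q^5) + \tfrac{4}{13}\big(2 C_1(q) - 2 C_3(q) + 5 C_4(q)\big),\\ \varphi^2(q^2) \varphi (q^5) \varphi (q^{10}) =& \tfrac{2}{13}\big(2 E_{\chi_0,\chi_2}(q)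 -15E_{\chi_0,\chi_2}(q^5) +4 E_{\chi_2,\chi_0}(q) +30E_{\chi_2,\chi_0}(q^5)\big) + \tfrac{4}{13}\big(-4 C_1(q) + 12 C_2(q) + 8 C_3(q) - 3 C_4(q)\big). \end{align*}
   Context: $\varphi(q)=\sum_{m=-\infty}^{\infty}q^{m^2}$. $\chi_0$ is the trivial character and $\chi_2(m)=\left(\frac{8}{m}\right)$ (Kronecker symbol). For $n\in\mathbb{N}$, $\sigma_{\chi,\psi}(n)=\sum_{m\mid n}\psi(m)\chi(n/m)m$. $E_{\chi_0,\chi_2}(q)=-\frac12+\sum_{n\ge1}\sigma_{\chi_0,\chi_2}(n)q^n$ and $E_{\chi_2,\chi_0}(q)=\sum_{n\ge1}\sigma_{\chi_2,\chi_0}(n)q^n$. With $q=e^{2\pi i z}$ and $\eta(z)=q^{1/24}\prod_{m\ge1}(1-q^m)$: $C_1(q)=\frac{\eta^2(z)\eta(8z)\eta^2(10z)\eta(40z)}{\eta(2z)\eta(20z)}$, $C_2(q)=\frac{\eta(z)\eta(5z)\eta^2(8z)\eta^2(20z)}{\eta(4z)\eta(10z)}$, $C_3(q)=\frac{\eta^6(2z)\eta(10z)\eta^2(40z)}{\eta^2(z)\eta^2(4z)\eta(20z)}$, $C_4(q)=\frac{\eta^6(4z)\eta^2(5z)\eta(20z)}{\eta^2(2z)\eta^2(8z)\eta(10z)}$. -}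

module Defs where

open import Data.Nat as ℕ using (ℕ; zero; suc; _∸_; _≡ᵇ_; _<ᵇ_; _%_)
open import Data.Nat.Divisibility using (_∣?_; divides)
open import Data.Integer as ℤ using (ℤ; +_; -[1+_])
open import Data.Rational using (ℚ; 0ℚ; 1ℚ; _+_; _*_; -_; _/_)
open import Data.Bool using (if_then_else_)
open import Data.List using (List; []; _∷_; foldr)
open import Data.Product using (_×_; _,_)
open import Relation.Nullary using (yes; no)
open import Relation.Binary.PropositionalEquality using (_≡_; refl)

-- Formal power series in q with rational coefficients:
-- a series is its coefficient sequence  n ↦ [q^n] f.
-- Identities of q-series (|q| < 1) are identities of coefficients.

PS : Set
PS = ℕ → ℚ

ℕ→ℚ : ℕ → ℚ
ℕ→ℚ n = (+ n) / 1

sumTo : ℕ → (ℕ → ℚ) → ℚ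
sumTo zero    f = f 0
sumTo (suc n) f = sumTo n f + f (suc n)

oneₛ : PS
oneₛ n = if n ≡ᵇ 0 then 1ℚ else 0ℚ

_+ₛ_ : PS → PS → PS
(f +ₛ g) n = f n + g n
infixl 6 _+ₛ_

_·ₛ_ : ℚ → PS → PS
(c ·ₛ f) n = c * f n
infixl 7 _·ₛ_

_⊛_ : PS → PS → PS
(f ⊛ g) n = sumTo n (λ i → f i * g (n ∸ i))
infixl 7 _⊛_

_^ₛ_ : PS → ℕ → PS
f ^ₛ zero  = oneₛ
f ^ₛ suc k = f ⊛ (f ^ₛ k)

dil : ℕ → PS → PS
dil d f n with d ∣? n
... | yes (divides k _) = f k
... | no  _             = 0ℚ

shift : ℕ → PS → PS
shift s f n = if n <ᵇ s then 0ℚ else f (n ∸ s)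

-- φ(q) = Σ_{m ∈ ℤ} q^{m²}: [q^n]φ = #{m ∈ ℤ : m² = n}
-- (k = 0 contributes m = 0; each k ≥ 1 with k² = n contributes m = ±k).

φ : PS
φ n = sumTo n (λ k → if (k ℕ.* k) ≡ᵇ n then (if k ≡ᵇ 0 then 1ℚ else ℕ→ℚ 2) else 0ℚ)

-- Characters.  χ₂(m) = (8/m) Kronecker symbol:
-- 0 for m even, 1 for m ≡ ±1 (mod 8), −1 for m ≡ ±3 (mod 8).

χ₂ : ℕ → ℚ
χ₂ m with m % 8
... | 1 = 1ℚ
... | 7 = 1ℚ
... | 3 = - 1ℚ
... | 5 = - 1ℚ
... | _ = 0ℚ

χ₀ : ℕ → ℚ
χ₀ _ = 1ℚ

σ : (ℕ → ℚ) → (ℕ → ℚ) → ℕ → ℚ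
σ χ ψ n = sumTo n term
  where
  term : ℕ → ℚ
  term zero = 0ℚ
  term m@(suc _) with m ∣? n
  ... | yes (divides k _) = ψ m * χ k * ℕ→ℚ m
  ... | no  _             = 0ℚ

E₀₂ : PS
E₀₂ zero      = - ((+ 1) / 2)
E₀₂ n@(suc _) = σ χ₀ χ₂ n

E₂₀ : PS
E₂₀ zero      = 0ℚ
E₂₀ n@(suc _) = σ χ₂ χ₀ n

-- Eta quotients.  An eta quotient Π_k η(kz)^{e_k} is given by the list of
-- pairs (k , e_k) (k ≥ 1).  It equals q^{(Σ k e_k)/24} Π_{m≥1} Π_k (1 − q^{km})^{e_k}.

oneMinus : ℕ → PS
oneMinus k n = if n ≡ᵇ 0 then 1ℚ else (if n ≡ᵇ k then - 1ℚ else 0ℚ)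

-- (1 − q^k)^{-1} = Σ_{j≥0} q^{kj}   (k ≥ 1)
geomInv : ℕ → PS
geomInv k n with k ∣? n
... | yes _ = 1ℚ
... | no  _ = 0ℚ

factor : ℕ → ℤ → PS
factor k (+ j)      = oneMinus k ^ₛ j
factor k -[1+ j ]   = geomInv k ^ₛ suc j

factorsAt : List (ℕ × ℤ) → ℕ → PS
factorsAt L m = foldr (λ { (k , e) acc → factor (k ℕ.* m) e ⊛ acc }) oneₛ L

prodUpTo : List (ℕ × ℤ) → ℕ → PS
prodUpTo L zero    = oneₛ
prodUpTo L (suc N) = factorsAt L (suc N) ⊛ prodUpTo L N

-- The infinite product Π_{m≥1} Π_k (1 − q^{km})^{e_k}: each factor with index
-- m is 1 + O(q^m), so the coefficient of q^n is that of the product over m ≤ n.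
etaProd : List (ℕ × ℤ) → PS
etaProd L n = prodUpTo L n n

weight : List (ℕ × ℤ) → ℤ
weight = foldr (λ { (k , e) acc → (+ k) ℤ.* e ℤ.+ acc }) (+ 0)

-- Eta quotient with explicit leading exponent s, where 24 s = Σ k e_k
-- (checked below by refl for each quotient used).
etaQuot : ℕ → List (ℕ × ℤ) → PS
etaQuot s L = shift s (etaProd L)

L₁ : List (ℕ × ℤ)
L₁ = (1 , + 2) ∷ (8 , + 1) ∷ (10 , + 2) ∷ (40 , + 1) ∷ (2 , ℤ.- (+ 1)) ∷ (20 , ℤ.- (+ 1)) ∷ []
L₂ : List (ℕ × ℤ)
L₂ = (1 , + 1) ∷ (5 , + 1) ∷ (8 , + 2) ∷ (20 , + 2) ∷ (4 , ℤ.- (+ 1)) ∷ (10 , ℤ.- (+ 1)) ∷ []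
L₃ : List (ℕ × ℤ)
L₃ = (2 , + 6) ∷ (10 , + 1) ∷ (40 , + 2) ∷ (1 , ℤ.- (+ 2)) ∷ (4 , ℤ.- (+ 2)) ∷ (20 , ℤ.- (+ 1)) ∷ []
L₄ : List (ℕ × ℤ)
L₄ = (4 , + 6) ∷ (5 , + 2) ∷ (20 , + 1) ∷ (2 , ℤ.- (+ 2)) ∷ (8 , ℤ.- (+ 2)) ∷ (10 , ℤ.- (+ 1)) ∷ []

C₁ C₂ C₃ C₄ : PS
C₁ = etaQuot 2 L₁
C₂ = etaQuot 2 L₂
C₃ = etaQuot 3 L₃
C₄ = etaQuot 1 L₄

w₁ : weight L₁ ≡ + (24 ℕ.* 2)
w₁ = refl
w₂ : weight L₂ ≡ + (24 ℕ.* 2)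
w₂ = refl
w₃ : weight L₃ ≡ + (24 ℕ.* 3)
w₃ = refl
w₄ : weight L₄ ≡ + (24 ℕ.* 1)
w₄ = refl

ℤ/ : ℤ → ℕ → ℚ
ℤ/ a zero    = 0ℚ
ℤ/ a (suc d) = a / suc d

{-# OPTIONS --safe #-}
module Submission where

-- With a = φ(q), b = φ(q²), c = φ(q⁵), d = φ(q¹⁰), the Eisenstein series and the eta quotients are rational linear
-- combinations of the eight products a b v² and c d v² with v ∈ {a, b, c, d}; the identities then are linear algebra.
--
-- An infinite product is determined by its logarithmic derivative, so an identity between products is a comparison of
-- exponents modulo a level. Jacobi's triple product turns theta series into products; the Wronskian of the two theta
-- series attached to ± 1 and ± 3 modulo 8 is on the one hand their product times the Lambert series of E₀₂, on the
-- other hand η(z)³ η(4z)³, which gives − 2 E₀₂ = φ(− q)² φ(q) φ(q²). Twisting by χ₂ and descending along q ↦ q² gives E₂₀.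
--
-- At level 40 the Gaussian prime 2 + i yields product formulas for φ(q)² − φ(q⁵)² and ψ(q)² − q ψ(q⁵)², and the lattice
-- of x² + 5y² expresses η(z)η(5z) through theta series. With a descent along q ↦ q² they write all forms involved
-- through three series l, M, N satisfying one relation, which reduces the remaining identities to polynomial ones.

open import Defs
open import Data.Rational as ℚ using (ℚ; 0ℚ; 1ℚ; ½)
open import Data.Rational.Solver using (module +-*-Solver)
open import Data.Nat as ℕ using (ℕ; zero; suc; _∸_; _≤_; z≤n; _<_; s≤s; NonZero; _≡ᵇ_; _%_; _/_)
open import Data.Integer as ℤ using (ℤ; +_; -[1+_]; _/ℕ_; _%ℕ_)
open import Data.Product using (_,_; _×_; ∃; proj₁; proj₂)
open import Data.Bool using (if_then_else_; true; false; T)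
open import Relation.Nullary using (¬_; yes; no; contradiction; ¬?; Dec; _×-dec_)
open import Function using (_∘_; mk⇔; id)
open import Algebra.Bundles using (CommutativeRing)
open import Algebra.Solver.Ring.AlmostCommutativeRing using (fromCommutativeRing; _-Raw-AlmostCommutative⟶_)
open import Data.Sign as Sign using (Sign)
open import Data.Fin using (#_)
open import Level using (0ℓ)
import Algebra.Solver.Ring
import Data.Nat.Properties as ℕP
import Data.Integer.Properties as ℤP
import Data.Rational.Properties as ℚP
import Data.Maybe
import Relation.Nullary.Decidable
import Data.Sum
import Data.List.Relation.Unary.Unique.Propositional.Properties as Unique
import Data.Nat.DivMod as DM
import Data.Integer.Tactic.RingSolver as ℤS
import Data.Nat.Solver
import Data.Integer.DivMod as ℤD
import Data.List.Relation.Unary.All as All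
import Data.List.Relation.Unary.AllPairs as AllPairs
import Relation.Binary.PropositionalEquality as ≡
import Data.Vec.Relation.Binary.Pointwise.Inductive as Pointwise

-- No identity is decided by a dimension count and finitely many coefficients; each is derived by
-- exact algebra of formal series, with division replaced by the cancellation of non-zero-divisors.
-- The obstacle is that `a`, `b`, `c`, `d` enter the eta quotients with odd powers, whereas the
-- quadratic theta identities only govern their squares. Two products of four theta series are
-- therefore computed through squares: φ(q)φ(q²)φ(q⁵)φ(q¹⁰) and φ(q)φ(q⁵)φ(-q)φ(-q⁵). Once an eta
-- quotient is multiplied by `a b` or `c d`, nothing else of odd degree is left. The series `l` is
-- an eta quotient of weight 0, while `M` and `N` have weight 1. The relation `Pᶜ` = 0 is quadratic
-- in M/N with discriminant l⁸ + 8l⁶ - 2l⁴ + 8l² + 1, the hyperelliptic model of the modular curve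
-- X₀(40). Its genus is 3, so a parametrisation by a single function is impossible, and computing
-- modulo one relation is the next best form.

module PolynomialIdentities where

  -- When 4D = N + lM and so on, every form below becomes a polynomial in l, M and N, modulo the single relation Pᶜ = 0.
  module Parametrisation {S : Set} (_⊕_ _⊖_ _⊙_ : S → S → S) (κ : ℤ → S) (l M N : S) where

    private
      infixl 6 _+_ _-_
      infixl 7 _*_
      _+_ _-_ _*_ : S → S → S
      _+_ = _⊕_
      _-_ = _⊖_
      _*_ = _⊙_

    Bᶜ Dᶜ Xᶜ Yᶜ Aᶜ Cᶜ gᶜ fᶜ wᶜ Pᶜ : S
    Bᶜ = N + κ (+ 5) * (l * M)
    Dᶜ = N + l * M
    Xᶜ = κ (+ 5) * M - l * N
    Yᶜ = M - l * N
    Aᶜ = Bᶜ + Xᶜ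
    Cᶜ = Dᶜ + Yᶜ
    gᶜ = l * l * (Xᶜ * Dᶜ)
    fᶜ = κ (+ 2) * (M * N) - l * (N * N) + l * (M * N) + κ (+ 10) * (l * (M * M)) + l * l * (N * N) - κ (+ 6) * (l * l * (M * N)) +
        κ (+ 5) * (l * l * (M * M)) + l * l * l * (M * N) - κ (+ 5) * (l * l * l * (M * M))
    wᶜ = Aᶜ * (Dᶜ - Yᶜ) + Cᶜ * (Bᶜ - Xᶜ) - κ (+ 16) * (l * (M * N))
    Pᶜ = gᶜ - Dᶜ * Yᶜ - κ (+ 4) * (l * (M * M))

  -- Certificates for polynomial identities in a commutative ring

  module Alg (R : CommutativeRing 0ℓ 0ℓ) (morphism : CommutativeRing.rawRing ℤP.+-*-commutativeRing -Raw-AlmostCommutative⟶ fromCommutativeRing R)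
      where

    open CommutativeRing R hiding (zero)
    open _-Raw-AlmostCommutative⟶_ morphism public using () renaming (⟦_⟧ to κ)
    open import Relation.Binary.Reasoning.Setoid setoid

    κ-equal? : ∀ x y → Data.Maybe.Maybe (κ x ≈ κ y)
    κ-equal? x y = Data.Maybe.map (λ { ≡.refl → refl }) (Relation.Nullary.Decidable.dec⇒maybe (x ℤ.≟ y))

    open Algebra.Solver.Ring (CommutativeRing.rawRing ℤP.+-*-commutativeRing) (fromCommutativeRing R) morphism κ-equal?
      using (solve; _:=_; _:+_; _:*_; _:-_; :-_; con)

    module Values = Parametrisation _+_ _-_ _*_ κ
    private module Formal {k} = Parametrisation (_:+_ {k}) _:-_ _:*_ con
    open Formal using () renaming (Bᶜ to :Bᶜ; Dᶜ to :Dᶜ; Xᶜ to :Xᶜ; Yᶜ to :Yᶜ; Aᶜ to :Aᶜ; Cᶜ to :Cᶜ; gᶜ to :gᶜ; fᶜ to :fᶜ; wᶜ to :wᶜ; Pᶜ to :Pᶜ)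

    -- One step of an ideal membership certificate: `c` is the cofactor of the hypothesis `l ≈ r`.
    -- Nested uses leave a single identity with explicit cofactors, which the ring solver checks by
    -- normalisation.
    use : ∀ {x y c l r} → l ≈ r → x ≈ y + c * (l - r) → x ≈ y
    use {x} {y} {c} {l} {r} l≈r eq = begin
      x                ≈⟨ eq ⟩
      y + c * (l - r)  ≈⟨ +-cong refl (*-cong refl (+-cong l≈r refl)) ⟩
      y + c * (r - r)  ≈⟨ +-cong refl (trans (*-cong refl (-‿inverseʳ r)) (zeroʳ c)) ⟩
      y + 0#           ≈⟨ +-identityʳ y ⟩
      y                ∎

    -- With `tA`, `tB` the derivatives q d/dq of the products `A`, `B`, the Wronskian is `A B` times
    -- the difference of their logarithmic derivatives. That difference is the Lambert series `lχ`
    -- of χ₂, so the right side is `A B` times - 2 E₀₂.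
    wronskian-lambert : ∀ A B lA lB lχ tA tB →
      tA ≈ - (lA * A) →
      tB ≈ - (lB * B) →
      lA ≈ lB + lχ →
      A * B + (κ (+ 2) * (tA * B) - κ (+ 2) * (A * tB)) ≈ A * B * (κ (+ 1) - κ (+ 2) * lχ)
    wronskian-lambert A B lA lB lχ tA tB hA hB hl = use hA (use hB (use
        hl (solve 7 (λ A B tA tB lA lB lχ → A :* B :+ (con (+ 2) :* (tA :* B) :- con (+ 2) :* (A :* tB)) :=
        A :* B :* (con (+ 1) :- con (+ 2) :* lχ) :+ con (+ 2) :* B :* (tA :- :- (lA :* A)) :+ (:- (con (+ 2))) :*
        A :* (tB :- :- (lB :* B)) :+ (:- (con (+ 2))) :* (A :* B) :* (lA :- (lB :+ lχ))) refl A B tA tB lA lB lχ)))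

    -- For p = φ(q⁴), r = 2qψ(q⁸), s = φ(q⁸), t = 2q²ψ(q¹⁶) the first term has even exponents only,
    -- and r s³, r s² t, r s t², r t³ have exponents congruent to 1, 3, 5, 7 modulo 8. Twisting by
    -- χ₂ can thus be done term by term. The computation uses p² - r² = (s - t)².
    eisenstein-expand : ∀ a b m p r s t →
      a ≈ p + r →
      m ≈ p - r →
      b ≈ s + t →
      p * p ≈ s * s + t * t →
      r * r ≈ κ (+ 2) * (s * t) →
      m * m * (a * b) ≈ p * ((s - t) * (s - t) * (s + t)) - r * (s * (s * s)) + r * (s * (s * t)) + r * (s * (t * t)) - r * (t * (t * t))
    eisenstein-expand a b m p r s t ha hm hb hp hr = use hm (use ha (use
        hb (use hp (use hr (solve 7 (λ m a b r p s t → m :* m :* (a :* b) :=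
        p :* ((s :- t) :* (s :- t) :* (s :+ t)) :- r :* (s :* (s :* s)) :+ r :* (s :* (s :* t)) :+ r :* (s :* (t :* t)) :-
        r :* (t :* (t :* t)) :+ (m :+ (p :- r)) :* (a :* b) :* (m :- (p :- r)) :+ (p :- r) :* (p :- r) :*
        b :* (a :- (p :+ r)) :+ (p :- r) :* (p :- r) :* (p :+ r) :* (b :- (s :+ t)) :+ (p :- r) :* (s :+ t) :* (p :* p :- (s :* s :+ t :* t))
        :+ (:- ((p :- r) :* (s :+ t))) :* (r :* r :- con (+ 2) :* (s :* t))) refl m a b r p s t)))))

    -- The twist makes the four signs of the odd part equal, and then the sum factors as r (s +
    -- t)(s² + t²).
    twisted-sum : ∀ b p r s t →
      b ≈ s + t →
      p * p ≈ s * s + t * t →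
      r * (s * (s * s)) + r * (s * (s * t)) + r * (s * (t * t)) + r * (t * (t * t)) ≈ r * b * (p * p)
    twisted-sum b p r s t hb hp = use hb (use hp (solve 5 (λ r t s b p →
        r :* (s :* (s :* s)) :+ r :* (s :* (s :* t)) :+ r :* (s :* (t :* t)) :+ r :* (t :* (t :* t)) :=
        r :* b :* (p :* p) :+ (:- (r :* (p :* p))) :* (b :- (s :+ t)) :+ (:- (r :* (s :+ t))) :* (p :* p :- (s :* s :+ t :* t))) refl r t s b p))

    -- The difference a² - m² is 2X by the square formulas and 4pr by the splitting into even and
    -- odd parts. The common factor 2 is cancelled where the lemma is applied.
    odd-part : ∀ B X a m p r →
      a ≈ p + r →
      m ≈ p - r →
      a * a ≈ B + X →
      m * m ≈ B - X →
      κ (+ 2) * X ≈ κ (+ 2) * (κ (+ 2) * (p * r))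
    odd-part B X a m p r ha hm hA hM = use hA (use hM (use ha (use hm
        (solve 6 (λ X m a p r B → con (+ 2) :* X := con (+ 2) :* (con (+ 2) :* (p :* r)) :+ (:- (con (+ 1))) :* (a :* a :- (B :+ X)) :+
        con (+ 1) :* (m :* m :- (B :- X)) :+ (a :+ (p :+ r)) :* (a :- (p :+ r)) :+ (:- (m :+ (p :- r))) :* (m :- (p :- r))) refl X m a p r B))))

    -- The first summand consists of odd powers of q and the second is twice the image of `a b X`
    -- under q ↦ q². This is the shape of the recursion that `E₂₀` satisfies.
    cross-product : ∀ X a b p r →
      a ≈ p + r →
      X ≈ κ (+ 2) * (p * r) →
      a * b * X ≈ κ (+ 2) * (r * b * (p * p)) + κ (+ 2) * (b * p * (r * r))
    cross-product X a b p r ha hX = use ha (use hX (solve 5 (λ X a b p r → a :* b :* X :=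
        con (+ 2) :* (r :* b :* (p :* p)) :+ con (+ 2) :* (b :* p :* (r :* r)) :+ b :* X :* (a :- (p :+ r)) :+
        b :* (p :+ r) :* (X :- con (+ 2) :* (p :* r))) refl X a b p r))

    -- The left side is 16q³ R2 S4 = 16q³ y10² S2 = 16q³ y10² (y2² - q² y10²), and the squares of
    -- y2, y10 turn this into 16q³ b d y4 y20 - 16q⁵ d² y20². It is a modular equation of degree
    -- five in terms of squares and `g` alone.
    quintic-product : ∀ R2 S2 S4 X Y b d g q y10 y2 y20 y4 →
      b * b - d * d ≈ κ (+ 4) * (q * q * R2) →
      y4 * y4 - q * q * q * q * (y20 * y20) ≈ S4 →
      R2 * S4 ≈ y10 * y10 * S2 →
      y2 * y2 - q * q * (y10 * y10) ≈ S2 →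
      y2 * y2 ≈ b * y4 →
      y10 * y10 ≈ d * y20 →
      X ≈ κ (+ 4) * (q * (y4 * y4)) →
      Y ≈ κ (+ 4) * (q * q * q * q * q * (y20 * y20)) →
      g ≈ κ (+ 4) * (q * q * q * (b * d * (y4 * y20))) →
      (b * b - d * d) * (X - Y) ≈ κ (+ 4) * g - κ (+ 4) * (d * d * Y)
    quintic-product R2 S2 S4 X Y b d g q y10 y2 y20 y4 hβ hS4 hRS hS2 h2 h10 hX hY hg =
        use hX (use hY (use hS4 (use hβ (use hRS (use hS2 (use h10 (use
        h2 (use hg (solve 13 (λ X Y b d g y10 y2 y4 S2 y20 q S4 R2 → (b :* b :- d :* d) :* (X :- Y) :=
        con (+ 4) :* g :- con (+ 4) :* (d :* d :* Y) :+ (b :* b :- d :* d) :* (X :- con (+ 4) :* (q :* (y4 :* y4)))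
        :+ (con (+ 4) :* (d :* d) :- (b :* b :- d :* d)) :* (Y :- con (+ 4) :* (q :* q :* q :* q :* q :* (y20 :* y20))) :+ con (+ 4) :*
        q :* (b :* b :- d :* d) :* (y4 :* y4 :- q :* q :* q :* q :* (y20 :* y20) :- S4) :+ con (+ 4) :* q :*
        S4 :* (b :* b :- d :* d :- con (+ 4) :* (q :* q :* R2)) :+ con (+ 16) :* (q :* q :* q) :* (R2 :* S4 :- y10 :* y10 :* S2)
        :+ (:- (con (+ 16) :* (q :* q :* q) :* (y10 :* y10))) :* (y2 :* y2 :- q :* q :* (y10 :* y10) :- S2)
        :+ (con (+ 16) :* (q :* q :* q) :* (b :* y4) :- con (+ 16) :* (q :* q :* q :* q :* q) :* (y10 :* y10 :+ d :* y20)) :*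
        (y10 :* y10 :- d :* y20) :+ con (+ 16) :* (q :* q :* q) :* (y10 :* y10) :* (y2 :* y2 :- b :* y4)
        :+ (:- (con (+ 4))) :* (g :- con (+ 4) :* (q :* q :* q :* (b :* d :* (y4 :* y20))))) refl X Y b d g y10 y2 y4 S2 y20 q S4 R2)))))))))

    -- With r and s the odd parts of φ(q) and φ(q⁵), the products p f and r s cancel in a n - c m,
    -- leaving 2(r f - p s).
    difference-eta : ∀ a c e f m n p q y40 y8 →
      a ≈ p + κ (+ 2) * (q * y8) →
      m ≈ p - κ (+ 2) * (q * y8) →
      c ≈ f + κ (+ 2) * (q * q * q * q * q * y40) →
      n ≈ f - κ (+ 2) * (q * q * q * q * q * y40) →
      e ≈ y8 * f - q * q * q * q * (p * y40) →
      κ (+ 4) * (q * e) ≈ a * n - c * m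
    difference-eta a c e f m n p q y40 y8 ha hm hc hn hK = use hK (use
        ha (use hn (use hc (use hm (solve 10 (λ q e m f c p n y40 a y8 → con (+ 4) :* (q :* e) :=
        a :* n :- c :* m :+ con (+ 4) :* q :* (e :- (y8 :* f :- q :* q :* q :* q :* (p :* y40))) :+ (:- n) :* (a :- (p :+ con (+ 2) :* (q :* y8)))
        :+ (:- (p :+ con (+ 2) :* (q :* y8))) :* (n :- (f :- con (+ 2) :* (q :* q :* q :* q :* q :* y40))) :+
        m :* (c :- (f :+ con (+ 2) :* (q :* q :* q :* q :* q :* y40))) :+ (f :+ con (+ 2) :* (q :* q :* q :* q :* q :* y40)) :*
        (m :- (p :- con (+ 2) :* (q :* y8)))) refl q e m f c p n y40 a y8)))))

    -- Since 4qe = 2(r f - p s), its square is 4(r² f² + p² s²) - 8 p f r s. The last hypothesis,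
    -- the quintic relation at q², replaces r² f² + p² s² by p² r² + 5 f² s² - 4 p f r s, which
    -- gives X² - 6XY + 5Y².
    eta-square : ∀ X Y a c e f m n p q r s →
      κ (+ 4) * (q * e) ≈ a * n - c * m →
      a ≈ p + r →
      m ≈ p - r →
      c ≈ f + s →
      n ≈ f - s →
      X ≈ κ (+ 2) * (p * r) →
      Y ≈ κ (+ 2) * (f * s) →
      (p * p - f * f) * (r * r - s * s) ≈ κ (+ 4) * (p * f * (r * s)) - κ (+ 4) * (f * f * (s * s)) →
      κ (+ 4) * (q * e) * (κ (+ 4) * (q * e)) ≈ (X - Y) * (X - κ (+ 5) * Y)
    eta-square X Y a c e f m n p q r s hE ha hm hc hn hX hY hQ = use
        hE (use ha (use hn (use hc (use hm (use hQ (use hX (use hY (solve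
        12 (λ q e Y X f s m p r c n a → con (+ 4) :* (q :* e) :* (con (+ 4) :* (q :* e))
        := (X :- Y) :* (X :- con (+ 5) :* Y) :+ (con (+ 4) :* (q :* e) :+ (a :* n :- c :* m)) :* (con (+ 4) :* (q :* e) :- (a :* n :- c :* m)) :+
        n :* (a :* n :- c :* m :+ con (+ 2) :* (r :* f :- p :* s)) :* (a :- (p :+ r))
        :+ (p :+ r) :* (a :* n :- c :* m :+ con (+ 2) :* (r :* f :- p :* s)) :* (n :- (f :- s))
        :+ (:- (m :* (a :* n :- c :* m :+ con (+ 2) :* (r :* f :- p :* s)))) :* (c :- (f :+ s))
        :+ (:- ((f :+ s) :* (a :* n :- c :* m :+ con (+ 2) :* (r :* f :- p :* s)))) :* (m :- (p :- r))
        :+ (:- (con (+ 4))) :* ((p :* p :- f :* f) :* (r :* r :- s :* s) :- (con (+ 4) :* (p :* f :* (r :* s)) :- con (+ 4) :* (f :* f :* (s :* s))))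
        :+ (:- (X :+ con (+ 2) :* (p :* r) :- con (+ 6) :* Y)) :* (X :- con (+ 2) :* (p :* r))
        :+ (:- (con (+ 5) :* Y :+ con (+ 10) :* (f :* s) :- con (+ 12) :* (p :* r))) :* (Y :- con (+ 2) :* (f :* s))) refl q e Y X f s m p r c n
        a))))))))

    -- Write B = b², D = d². The left product is (B - D + X - Y)(5D - B + 5Y - X), and 16 q h²
    -- expands to 4XD - 8g + 4BY. The term - (X - Y)(X - 5Y) accounts for - 16 q² e², and the
    -- remaining mixed terms cancel by twice the quintic relation.
    descent : ∀ X Y a b c d e g h q y20 y4 →
      a * a ≈ b * b + X →
      c * c ≈ d * d + Y →
      h ≈ y4 * d - q * q * (b * y20) →
      X ≈ κ (+ 4) * (q * (y4 * y4)) →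
      Y ≈ κ (+ 4) * (q * q * q * q * q * (y20 * y20)) →
      g ≈ κ (+ 4) * (q * q * q * (b * d * (y4 * y20))) →
      (b * b - d * d) * (X - Y) ≈ κ (+ 4) * g - κ (+ 4) * (d * d * Y) →
      κ (+ 4) * (q * e) * (κ (+ 4) * (q * e)) ≈ (X - Y) * (X - κ (+ 5) * Y) →
      (a * a - c * c) * (κ (+ 5) * (c * c) - a * a) - κ (+ 16) * (q * (h * h)) ≈ (b * b - d * d) * (κ (+ 5) * (d * d) - b * b) -
          κ (+ 16) * (q * q * (e * e))
    descent X Y a b c d e g h q y20 y4 hA hC hK hX hY hg hQ hU = use
        hA (use hC (use hK (use hX (use hY (use hg (use hQ (use hU (solve
        12 (λ q a c h g X Y e b d y20 y4 → (a :* a :- c :* c) :* (con (+ 5) :* (c :* c) :- a :* a) :- con (+ 16) :* (q :* (h :* h))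
        := (b :* b :- d :* d) :* (con (+ 5) :* (d :* d) :- b :* b) :-
        con (+ 16) :* (q :* q :* (e :* e)) :+ (con (+ 6) :* (c :* c) :- (a :* a :+ (b :* b :+ X))) :* (a :* a :- (b :* b :+ X))
        :+ (con (+ 6) :* (b :* b :+ X) :- con (+ 5) :* (c :* c :+ (d :* d :+ Y))) :* (c :* c :- (d :* d :+ Y))
        :+ (:- (con (+ 16) :* (q :* (h :+ (y4 :* d :- q :* q :* (b :* y20)))))) :* (h :- (y4 :* d :- q :* q :* (b :* y20))) :+
        con (+ 4) :* (d :* d) :* (X :- con (+ 4) :* (q :* (y4 :* y4))) :+
        con (+ 4) :* (b :* b) :* (Y :- con (+ 4) :* (q :* q :* q :* q :* q :* (y20 :* y20)))
        :+ (:- (con (+ 8))) :* (g :- con (+ 4) :* (q :* q :* q :* (b :* d :* (y4 :* y20))))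
        :+ (:- (con (+ 2))) :* ((b :* b :- d :* d) :* (X :- Y) :- (con (+ 4) :* g :- con (+ 4) :* (d :* d :* Y))) :+
        con (+ 1) :* (con (+ 4) :* (q :* e) :* (con (+ 4) :* (q :* e)) :- (X :- Y) :* (X :- con (+ 5) :* Y))) refl q a c h g X Y e b d y20 y4))))))))

    ratio : ∀ R2 S4 X Y b d k q →
      b * b - d * d ≈ κ (+ 4) * (q * q * R2) →
      k * S4 ≈ R2 →
      X - Y ≈ κ (+ 4) * (q * S4) →
      b * b - d * d ≈ q * k * (X - Y)
    ratio R2 S4 X Y b d k q hβ hl hM = use hβ (use hl (use hM (solve
        8 (λ b d R2 q k X Y S4 → b :* b :- d :* d := q :* k :* (X :- Y) :+ con (+ 1) :* (b :* b :- d :* d :- con (+ 4) :* (q :* q :* R2))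
        :+ (:- (con (+ 4) :* (q :* q))) :* (k :* S4 :- R2) :+ (:- (q :* k)) :* (X :- Y :- con (+ 4) :* (q :* S4))) refl b d R2 q k X Y S4)))

    XY-difference : ∀ S4 X Y q y20 y4 →
      X ≈ κ (+ 4) * (q * (y4 * y4)) →
      Y ≈ κ (+ 4) * (q * q * q * q * q * (y20 * y20)) →
      y4 * y4 - q * q * q * q * (y20 * y20) ≈ S4 →
      X - Y ≈ κ (+ 4) * (q * S4)
    XY-difference S4 X Y q y20 y4 hX hY hS4 = use hX (use hY (use hS4
        (solve 6 (λ X Y q S4 y4 y20 → X :- Y := con (+ 4) :* (q :* S4) :+ con (+ 1) :* (X :- con (+ 4) :* (q :* (y4 :* y4)))
        :+ (:- (con (+ 1))) :* (Y :- con (+ 4) :* (q :* q :* q :* q :* q :* (y20 :* y20))) :+ con (+ 4) :*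
        q :* (y4 :* y4 :- q :* q :* q :* q :* (y20 :* y20) :- S4)) refl X Y q S4 y4 y20)))

    -- Both (X - Y)(X - 5Y) and (b² - d²)(5d² - b²) equal 16 q² e², so the ratio `l` of b² - d² to X
    -- - Y is also that of X - 5Y to 5d² - b².
    dual-ratio : ∀ X Y b d e l q →
      κ (+ 4) * (q * e) * (κ (+ 4) * (q * e)) ≈ (X - Y) * (X - κ (+ 5) * Y) →
      (b * b - d * d) * (κ (+ 5) * (d * d) - b * b) - κ (+ 16) * (q * q * (e * e)) ≈ κ (+ 0) →
      b * b - d * d ≈ l * (X - Y) →
      (X - Y) * (X - κ (+ 5) * Y) ≈ (X - Y) * (l * (κ (+ 5) * (d * d) - b * b))
    dual-ratio X Y b d e l q hU hΨ hβ = use hU (use hΨ (use hβ (solve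
        7 (λ X Y b l d q e → (X :- Y) :* (X :- con (+ 5) :* Y) := (X :- Y) :* (l :* (con (+ 5) :* (d :* d) :- b :* b))
        :+ (:- (con (+ 1))) :* (con (+ 4) :* (q :* e) :* (con (+ 4) :* (q :* e)) :- (X :- Y) :* (X :- con (+ 5) :* Y))
        :+ (:- (con (+ 1))) :* ((b :* b :- d :* d) :* (con (+ 5) :* (d :* d) :- b :* b) :- con (+ 16) :* (q :* q :* (e :* e)) :- con (+ 0))
        :+ (con (+ 5) :* (d :* d) :- b :* b) :* (b :* b :- d :* d :- l :* (X :- Y))) refl X Y b l d q e)))

    cross-term : ∀ X b d g k q y20 y4 →
      X ≈ κ (+ 4) * (q * (y4 * y4)) →
      g ≈ κ (+ 4) * (q * q * q * (b * d * (y4 * y20))) →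
      k * k * (y4 * d) ≈ b * y20 →
      g ≈ q * k * (q * k) * (X * (d * d))
    cross-term X b d g k q y20 y4 hX hg hl = use hg (use hX (use hl (solve
        8 (λ g X b y20 k y4 d q → g := q :* k :* (q :* k) :* (X :* (d :* d)) :+
        con (+ 1) :* (g :- con (+ 4) :* (q :* q :* q :* (b :* d :* (y4 :* y20)))) :+ (:- (q :* q :* (k :* k) :* (d :* d))) :*
        (X :- con (+ 4) :* (q :* (y4 :* y4))) :+ (:- (con (+ 4) :* (q :* q :* q :* (y4 :* d)))) :* (k :* k :* (y4 :* d) :- b :* y20)) refl g X b y20
        k y4 d q)))

    -- The equations B - D = lM, 5D - B = N, and likewise X - Y = M, X - 5Y = lN, are linear systems
    -- of determinant ± 4; hence the factor 4 here and in the next three lemmas.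
    param-B : ∀ B D M N l →
      B - D ≈ l * M →
      N ≈ κ (+ 5) * D - B →
      κ (+ 4) * B ≈ Values.Bᶜ l M N
    param-B B D M N l hβ hN = use hβ (use hN (solve 5 (λ B N l M D → con (+ 4) :* B :=
        :Bᶜ l M N :+ con (+ 5) :* (B :- D :- l :* M) :+ (:- (con (+ 1))) :* (N :- (con (+ 5) :* D :- B))) refl B N l M D))

    param-D : ∀ B D M N l →
      B - D ≈ l * M →
      N ≈ κ (+ 5) * D - B →
      κ (+ 4) * D ≈ Values.Dᶜ l M N
    param-D B D M N l hβ hN = use hβ (use hN (solve 5 (λ D N l M B → con (+ 4) :* D :=
        :Dᶜ l M N :+ con (+ 1) :* (B :- D :- l :* M) :+ (:- (con (+ 1))) :* (N :- (con (+ 5) :* D :- B))) refl D N l M B))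

    param-X : ∀ M N X Y l →
      X - κ (+ 5) * Y ≈ l * N →
      M ≈ X - Y →
      κ (+ 4) * X ≈ Values.Xᶜ l M N
    param-X M N X Y l hξ hM = use hξ (use hM (solve 5 (λ X M l N Y → con (+ 4) :* X :=
        :Xᶜ l M N :+ (:- (con (+ 1))) :* (X :- con (+ 5) :* Y :- l :* N) :+ (:- (con (+ 5))) :* (M :- (X :- Y))) refl X M l N Y))

    param-Y : ∀ M N X Y l →
      X - κ (+ 5) * Y ≈ l * N →
      M ≈ X - Y →
      κ (+ 4) * Y ≈ Values.Yᶜ l M N
    param-Y M N X Y l hξ hM = use hξ (use hM (solve 5 (λ Y M l N X → con (+ 4) :* Y :=
        :Yᶜ l M N :+ (:- (con (+ 1))) :* (X :- con (+ 5) :* Y :- l :* N) :+ (:- (con (+ 1))) :* (M :- (X :- Y))) refl Y M l N X))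

    param-A : ∀ A B M N X l →
      A ≈ B + X →
      κ (+ 4) * B ≈ Values.Bᶜ l M N →
      κ (+ 4) * X ≈ Values.Xᶜ l M N →
      κ (+ 4) * A ≈ Values.Aᶜ l M N
    param-A A B M N X l hA hB hX = use hA (use hB (use hX (solve 6 (λ A X N B M l → con (+ 4) :* A :=
        :Aᶜ l M N :+ con (+ 4) :* (A :- (B :+ X)) :+ con (+ 1) :* (con (+ 4) :* B :- :Bᶜ l M N) :+ con (+ 1) :* (con (+ 4) :* X :- :Xᶜ l M N)) refl A
        X N B M l)))

    param-C : ∀ C D M N Y l →
      C ≈ D + Y →
      κ (+ 4) * D ≈ Values.Dᶜ l M N →
      κ (+ 4) * Y ≈ Values.Yᶜ l M N →
      κ (+ 4) * C ≈ Values.Cᶜ l M N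
    param-C C D M N Y l hC hD hY = use hC (use hD (use hY (solve 6 (λ C Y M N D l → con (+ 4) :* C :=
        :Cᶜ l M N :+ con (+ 4) :* (C :- (D :+ Y)) :+ con (+ 1) :* (con (+ 4) :* D :- :Dᶜ l M N) :+ con (+ 1) :* (con (+ 4) :* Y :- :Yᶜ l M N)) refl C
        Y M N D l)))

    param-g : ∀ D M N X g l →
      g ≈ l * l * (X * D) →
      κ (+ 4) * X ≈ Values.Xᶜ l M N →
      κ (+ 4) * D ≈ Values.Dᶜ l M N →
      κ (+ 16) * g ≈ Values.gᶜ l M N
    param-g D M N X g l hg hX hD = use hg (use hX (use hD (solve 6 (λ g l D N X M → con (+ 16) :* g :=
        :gᶜ l M N :+ con (+ 16) :* (g :- l :* l :* (X :* D)) :+ l :* l :* (con (+ 4) :* D) :* (con (+ 4) :* X :- :Xᶜ l M N) :+ l :* l :* :Xᶜ l M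
        N :* (con (+ 4) :* D :- :Dᶜ l M N)) refl g l D N X M)))

    -- Four times the quintic relation, with B - D = lM and X - Y = M on its left side and the
    -- parametrised `g`, `D`, `Y` on its right.
    curve : ∀ B D M N X Y g l →
      κ (+ 16) * g ≈ Values.gᶜ l M N →
      κ (+ 4) * D ≈ Values.Dᶜ l M N →
      κ (+ 4) * Y ≈ Values.Yᶜ l M N →
      B - D ≈ l * M →
      M ≈ X - Y →
      (B - D) * (X - Y) ≈ κ (+ 4) * g - κ (+ 4) * (D * Y) →
      Values.Pᶜ l M N ≈ κ (+ 0)
    curve B D M N X Y g l hg hD hY hβ hM hQ = use hg (use hD (use hY
        (use hQ (use hβ (use hM (solve 8 (λ l N M X Y B D g → :Pᶜ l M N :=
        con (+ 0) :+ (:- (con (+ 1))) :* (con (+ 16) :* g :- :gᶜ l M N) :+ :Yᶜ l M N :* (con (+ 4) :* D :- :Dᶜ l M N) :+ con (+ 4) :*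
        D :* (con (+ 4) :* Y :- :Yᶜ l M N) :+ (:- (con (+ 4))) :* ((B :- D) :* (X :- Y) :- (con (+ 4) :* g :- con (+ 4) :* (D :* Y))) :+
        con (+ 4) :* (X :- Y) :* (B :- D :- l :* M) :+ (:- (con (+ 4) :* (l :* M))) :* (M :- (X :- Y))) refl l N M X Y B D g))))))

    -- The same chain as for the quintic relation, one step of q ↦ q² earlier: 4q R1 S2 = 4q y5²
    -- (y1² - q y5²). Here y1² y5² = a c y2 y10, which makes the product of four different series
    -- accessible.
    mixed-product : ∀ R1 S1 S2 a c q y1 y10 y2 y5 →
      a * a - c * c ≈ κ (+ 4) * (q * R1) →
      R1 * S2 ≈ y5 * y5 * S1 →
      y1 * y1 - q * (y5 * y5) ≈ S1 →
      y2 * y2 - q * q * (y10 * y10) ≈ S2 →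
      y1 * y1 ≈ a * y2 →
      y5 * y5 ≈ c * y10 →
      κ (+ 4) * (q * (a * c * (y2 * y10))) ≈ (a * a - c * c) * (y2 * y2 - q * q * (y10 * y10)) + κ (+ 4) * (q * q * (c * c * (y10 * y10)))
    mixed-product R1 S1 S2 a c q y1 y10 y2 y5 hR hRS hS1 hS2 h1 h5 =
        use hR (use hS2 (use hRS (use hS1 (use h1 (use h5 (solve 10 (λ q a c y2 y10 y5 S1 y1 S2 R1 → con (+ 4) :* (q :* (a :* c :* (y2 :* y10)))
        := (a :* a :- c :* c) :* (y2 :* y2 :- q :* q :* (y10 :* y10)) :+ con (+ 4) :* (q :* q :* (c :* c :* (y10 :* y10)))
        :+ (:- (y2 :* y2 :- q :* q :* (y10 :* y10))) :* (a :* a :- c :* c :- con (+ 4) :* (q :* R1))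
        :+ (:- (con (+ 4) :* (q :* R1))) :* (y2 :* y2 :- q :* q :* (y10 :* y10) :- S2) :+ (:- (con (+ 4) :* q)) :* (R1 :* S2 :- y5 :* y5 :* S1) :+
        con (+ 4) :* (q :* (y5 :* y5)) :* (y1 :* y1 :- q :* (y5 :* y5) :- S1) :+ (:- (con (+ 4) :* (q :* (y5 :* y5)))) :* (y1 :* y1 :- a :* y2)
        :+ (con (+ 4) :* (q :* q) :* (y5 :* y5 :+ c :* y10) :- con (+ 4) :* (q :* (a :* y2))) :* (y5 :* y5 :- c :* y10)) refl q a c y2 y10 y5 S1 y1
        S2 R1))))))

    g-squares : ∀ b d g q y10 y2 y20 y4 →
      g ≈ κ (+ 4) * (q * q * q * (b * d * (y4 * y20))) →
      y2 * y2 ≈ b * y4 →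
      y10 * y10 ≈ d * y20 →
      g ≈ κ (+ 4) * (q * q * q * (y2 * y2 * (y10 * y10)))
    g-squares b d g q y10 y2 y20 y4 hg h2 h10 = use hg (use h2 (use h10
        (solve 8 (λ g y10 d y20 y2 b y4 q → g := con (+ 4) :* (q :* q :* q :* (y2 :* y2 :* (y10 :* y10))) :+
        con (+ 1) :* (g :- con (+ 4) :* (q :* q :* q :* (b :* d :* (y4 :* y20)))) :+ (:- (con (+ 4) :* (q :* q :* q :* (y10 :* y10)))) :*
        (y2 :* y2 :- b :* y4) :+ (:- (con (+ 4) :* (q :* q :* q :* (b :* y4)))) :* (y10 :* y10 :- d :* y20)) refl g y10 d y20 y2 b y4 q)))

    BX-squares : ∀ X b q y2 y4 →
      X ≈ κ (+ 4) * (q * (y4 * y4)) →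
      y2 * y2 ≈ b * y4 →
      b * b * X ≈ κ (+ 4) * (q * (y2 * y2 * (y2 * y2)))
    BX-squares X b q y2 y4 hX h2 = use hX (use h2 (solve 5 (λ X b q y2 y4 → b :* b :* X :=
        con (+ 4) :* (q :* (y2 :* y2 :* (y2 :* y2))) :+ b :* b :* (X :- con (+ 4) :* (q :* (y4 :* y4)))
        :+ (:- (con (+ 4) :* (q :* (y2 :* y2 :+ b :* y4)))) :* (y2 :* y2 :- b :* y4)) refl X b q y2 y4))

    DY-squares : ∀ Y d q y10 y20 →
      Y ≈ κ (+ 4) * (q * q * q * q * q * (y20 * y20)) →
      y10 * y10 ≈ d * y20 →
      d * d * Y ≈ κ (+ 4) * (q * q * q * q * q * (y10 * y10 * (y10 * y10)))
    DY-squares Y d q y10 y20 hY h10 = use hY (use h10 (solve 5 (λ Y d y10 y20 q → d :* d :* Y :=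
        con (+ 4) :* (q :* q :* q :* q :* q :* (y10 :* y10 :* (y10 :* y10))) :+ d :* d :* (Y :- con (+ 4) :* (q :* q :* q :* q :* q :* (y20 :* y20)))
        :+ (:- (con (+ 4) :* (q :* q :* q :* q :* q :* (y10 :* y10 :+ d :* y20)))) :* (y10 :* y10 :- d :* y20)) refl Y d y10 y20 q))

    -- By e² = y2 y10 h the left side is 4q b d h times the mixed product 4q a c y2 y10. Since b d h
    -- = d² y2² - q² b² y10², expansion produces only 4q y2⁴ = b² X, 4q³ y2² y10² = g and 4q⁵ y10⁴ =
    -- d² Y. In this way `a b c d` is expressed through squares and `g`.
    four-thetas : ∀ X Y a b c d e g h q y10 y2 y20 y4 →
      κ (+ 4) * (q * (a * c * (y2 * y10))) ≈ (a * a - c * c) * (y2 * y2 - q * q * (y10 * y10)) + κ (+ 4) * (q * q * (c * c * (y10 * y10))) →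
      h ≈ y4 * d - q * q * (b * y20) →
      y2 * y10 * h ≈ e * e →
      y2 * y2 ≈ b * y4 →
      y10 * y10 ≈ d * y20 →
      g ≈ κ (+ 4) * (q * q * q * (y2 * y2 * (y10 * y10))) →
      b * b * X ≈ κ (+ 4) * (q * (y2 * y2 * (y2 * y2))) →
      d * d * Y ≈ κ (+ 4) * (q * q * q * q * q * (y10 * y10 * (y10 * y10))) →
      κ (+ 4) * (q * e) * (κ (+ 4) * (q * e)) * (a * b * (c * d)) ≈ (a * a - c * c) *
          (d * d * (b * b * X) - (b * b + d * d) * g + b * b * (d * d * Y)) + κ (+ 4) * (c * c * (d * d * g - b * b * (d * d * Y)))
    four-thetas X Y a b c d e g h q y10 y2 y20 y4 hJ hK h7 h2 h10 hg hBX hDY =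
        use h7 (use hK (use hJ (use h2 (use h10 (use hBX (use hg (use
        hDY (solve 14 (λ a b c d q e g Y X y10 y20 y2 y4 h → con (+ 4) :* (q :* e) :* (con (+ 4) :* (q :* e)) :* (a :* b :* (c :* d))
        := (a :* a :- c :* c) :* (d :* d :* (b :* b :* X) :- (b :* b :+ d :* d) :* g :+ b :* b :* (d :* d :* Y)) :+
        con (+ 4) :* (c :* c :* (d :* d :* g :- b :* b :* (d :* d :* Y))) :+ (:- (con (+ 16) :* (q :* q) :* (a :* b :* (c :* d)))) :*
        (y2 :* y10 :* h :- e :* e) :+ con (+ 16) :* (q :* q) :* (a :* b :* (c :* d)) :* (y2 :* y10) :* (h :- (y4 :* d :- q :* q :* (b :* y20))) :+
        con (+ 4) :* q :* (b :* d :* (y4 :* d :- q :* q :* (b :* y20))) :*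
        (con (+ 4) :* (q :* (a :* c :* (y2 :* y10))) :- ((a :* a :- c :* c) :* (y2 :* y2 :- q :* q :* (y10 :* y10)) :+
        con (+ 4) :* (q :* q :* (c :* c :* (y10 :* y10))))) :+ (:- (con (+ 4) :*
        q :* ((a :* a :- c :* c) :* (y2 :* y2 :- q :* q :* (y10 :* y10)) :+ con (+ 4) :* (q :* q :* (c :* c :* (y10 :* y10)))) :* (d :* d))) :*
        (y2 :* y2 :- b :* y4) :+ con (+ 4) :* (q :* q :* q) :* ((a :* a :- c :* c) :* (y2 :* y2 :- q :* q :* (y10 :* y10)) :+
        con (+ 4) :* (q :* q :* (c :* c :* (y10 :* y10)))) :* (b :* b) :* (y10 :* y10 :- d :* y20) :+ (:- ((a :* a :- c :* c) :* (d :* d))) :*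
        (b :* b :* X :- con (+ 4) :* (q :* (y2 :* y2 :* (y2 :* y2))))
        :+ ((a :* a :- c :* c) :* (b :* b :+ d :* d) :- con (+ 4) :* (c :* c :* (d :* d))) :*
        (g :- con (+ 4) :* (q :* q :* q :* (y2 :* y2 :* (y10 :* y10)))) :+ (con (+ 4) :* (c :* c :* (b :* b)) :- (a :* a :- c :* c) :* (b :* b)) :*
        (d :* d :* Y :- con (+ 4) :* (q :* q :* q :* q :* q :* (y10 :* y10 :* (y10 :* y10))))) refl a b c d q e g Y X y10 y20 y2 y4 h))))))))

    module OnCurve (A B C D M N X Y g l : Carrier)
      (hA : κ (+ 4) * A ≈ Values.Aᶜ l M N)
      (hB : κ (+ 4) * B ≈ Values.Bᶜ l M N)
      (hC : κ (+ 4) * C ≈ Values.Cᶜ l M N)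
      (hD : κ (+ 4) * D ≈ Values.Dᶜ l M N)
      (hX : κ (+ 4) * X ≈ Values.Xᶜ l M N)
      (hY : κ (+ 4) * Y ≈ Values.Yᶜ l M N)
      (hg : κ (+ 16) * g ≈ Values.gᶜ l M N)
      (hP : Values.Pᶜ l M N ≈ κ (+ 0))
      where

      open Parametrisation _+_ _-_ _*_ κ l M N

      -- Each term of the hypothesis is a product of four of A, B, C, D, X, Y, with `g` counting
      -- twice, so 256 = 4⁴ clears all denominators. Modulo `Pᶜ` the resulting polynomial is
      -- divisible by lMN, and `fᶜ` is read off from the quotient.
      f-relation : ∀ f u →
        u ≈ l * (M * N) →
        u * f ≈ (A - C) * (D * (B * X) - (B + D) * g + B * (D * Y)) + κ (+ 4) * (C * (D * g - B * (D * Y))) →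
        u * (κ (+ 256) * (l * f)) ≈ u * (κ (+ 16) * fᶜ)
      f-relation f u hu hH = begin
        u * (κ (+ 256) * (l * f))
          ≈⟨ solve 3 (λ u l f → u :* (con (+ 256) :* (l :* f)) := con (+ 256) :* l :* (u :* f)) refl u l f ⟩
        κ (+ 256) * l * (u * f)
          ≈⟨ *-cong refl hH ⟩
        κ (+ 256) * l * ((A - C) * (D * (B * X) - (B + D) * g + B * (D * Y)) + κ (+ 4) * (C * (D * g - B * (D * Y))))
          ≈⟨ solve 8 (λ l A C B D g Y X → con (+ 256) :* l :* ((A :- C) :* (D :* (B :* X) :- (B :+ D) :* g :+ B :* (D :* Y)) :+
              con (+ 4) :* (C :* (D :* g :- B :* (D :* Y)))) := l :*
              ((con (+ 4) :* A :- con (+ 4) :* C) :* (con (+ 4) :* D :* (con (+ 4) :* B :* (con (+ 4) :* X)) :- (con (+ 4) :* B :+ con (+ 4) :* D) :*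
              (con (+ 16) :* g) :+ con (+ 4) :* B :* (con (+ 4) :* D :* (con (+ 4) :* Y))) :+
              con (+ 4) :* (con (+ 4) :* C :* (con (+ 4) :* D :* (con (+ 16) :* g) :- con (+ 4) :* B :* (con (+ 4) :* D :* (con (+ 4) :* Y)))))) refl
              l A C B D g Y X ⟩
        l * ((κ (+ 4) * A - κ (+ 4) * C) * (κ (+ 4) * D * (κ (+ 4) * B * (κ (+ 4) * X)) - (κ (+ 4) * B + κ (+ 4) * D) * (κ (+ 16) * g) + κ (+ 4) *
            B * (κ (+ 4) * D * (κ (+ 4) * Y))) + κ (+ 4) * (κ (+ 4) *
            C * (κ (+ 4) * D * (κ (+ 16) * g) - κ (+ 4) * B * (κ (+ 4) * D * (κ (+ 4) * Y)))))
          ≈⟨ *-cong refl (+-cong (*-cong (+-cong hA (-‿cong hC)) (+-cong (+-cong (*-cong hD (*-cong hB hX)) (-‿cong (*-cong (+-cong hB hD) hg)))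
              (*-cong hB (*-cong hD hY)))) (*-cong refl (*-cong hC (+-cong (*-cong hD hg) (-‿cong (*-cong hB (*-cong hD hY))))))) ⟩
        l * ((Aᶜ - Cᶜ) * (Dᶜ * (Bᶜ * Xᶜ) - (Bᶜ + Dᶜ) * gᶜ + Bᶜ * (Dᶜ * Yᶜ)) + κ (+ 4) * (Cᶜ * (Dᶜ * gᶜ - Bᶜ * (Dᶜ * Yᶜ))))
          -- The factor in front of `Pᶜ` is the quotient of the difference of both sides by `Pᶜ`.
          ≈⟨ use hP (solve 3 (λ l N M → l :* ((:Aᶜ l M N :- :Cᶜ l M N) :*
              (:Dᶜ l M N :* (:Bᶜ l M N :* :Xᶜ l M N) :- (:Bᶜ l M N :+ :Dᶜ l M N) :* :gᶜ l M N :+ :Bᶜ l M N :* (:Dᶜ l M N :* :Yᶜ l M N)) :+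
              con (+ 4) :* (:Cᶜ l M N :* (:Dᶜ l M N :* :gᶜ l M N :- :Bᶜ l M N :* (:Dᶜ l M N :* :Yᶜ l M N)))) :=
              l :* (M :* N) :* (con (+ 16) :* :fᶜ l M N) :+ l :* (con (+ 4) :* (N :* N) :+ con (+ 12) :* (M :* N) :- con (+ 4) :* (l :* N :* N) :-
              con (+ 20) :* (l :* M :* M) :- con (+ 4) :* (l :* l :* M :* N) :- con (+ 20) :* (l :* l :* M :* M)) :* (:Pᶜ l M N :- con (+ 0))) refl l
              N M) ⟩
        l * (M * N) * (κ (+ 16) * fᶜ)
          ≈⟨ *-cong (sym hu) refl ⟩
        u * (κ (+ 16) * fᶜ) ∎

      -- Inside `64 l`, the left side is `a b · 8 C₃` and the right side is `a b` times the asserted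
      -- combination of the eight products. The factor 64 l turns A, ..., Y, `g` and `l f` into
      -- polynomials in l, M, N, which agree modulo `Pᶜ`. The relations for the other three
      -- quotients follow the same pattern.
      relation₃ : ∀ f →
        κ (+ 16) * (l * f) ≈ fᶜ →
        κ (+ 64) * (l * (κ (+ 2) * (A * g) - κ (+ 2) * (A * (B * Y)))) ≈
            κ (+ 1) * (κ (+ 64) * (l * (f * (- A - κ (+ 2) * B - κ (+ 5) * C + κ (+ 10) * D) + A *
            B * (κ (+ 2) * A - κ (+ 2) * B - κ (+ 4) * C + κ (+ 2) * D))))
      relation₃ f hF = begin
        κ (+ 64) * (l * (κ (+ 2) * (A * g) - κ (+ 2) * (A * (B * Y))))
          ≈⟨ solve 5 (λ l A g B Y → con (+ 64) :* (l :* (con (+ 2) :* (A :* g) :- con (+ 2) :* (A :* (B :* Y)))) :=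
              l :* (con (+ 2) :* (con (+ 4) :* A :* (con (+ 16) :* g)) :- con (+ 2) :* (con (+ 4) :* A :* (con (+ 4) :* B :* (con (+ 4) :* Y)))))
              refl l A g B Y ⟩
        l * (κ (+ 2) * (κ (+ 4) * A * (κ (+ 16) * g)) - κ (+ 2) * (κ (+ 4) * A * (κ (+ 4) * B * (κ (+ 4) * Y))))
          ≈⟨ *-cong refl (+-cong (*-cong refl (*-cong hA hg)) (-‿cong (*-cong refl (*-cong hA (*-cong hB hY))))) ⟩
        l * (κ (+ 2) * (Aᶜ * gᶜ) - κ (+ 2) * (Aᶜ * (Bᶜ * Yᶜ)))
          ≈⟨ use hP (solve 3 (λ l N M → l :* (con (+ 2) :* (:Aᶜ l M N :* :gᶜ l M N) :- con (+ 2) :* (:Aᶜ l M N :* (:Bᶜ l M N :* :Yᶜ l M N))) :=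
              con (+ 1) :* (:fᶜ l M N :* (:- :Aᶜ l M N :- con (+ 2) :* :Bᶜ l M N :- con (+ 5) :* :Cᶜ l M N :+ con (+ 10) :* :Dᶜ l M N) :+
              l :* (:Aᶜ l M N :* :Bᶜ l M N :* (con (+ 2) :* :Aᶜ l M N :- con (+ 2) :* :Bᶜ l M N :- con (+ 4) :* :Cᶜ l M N :+ con (+ 2) :* :Dᶜ l M
              N))) :+ (con (+ 4) :* N :- con (+ 20) :* M :+ con (+ 2) :* (l :* N) :+ con (+ 10) :* (l :* M) :- con (+ 2) :* (l :* l :* N) :+
              con (+ 10) :* (l :* l :* M)) :* (:Pᶜ l M N :- con (+ 0))) refl l N M) ⟩
        κ (+ 1) * (fᶜ * (- Aᶜ - κ (+ 2) * Bᶜ - κ (+ 5) * Cᶜ + κ (+ 10) * Dᶜ) +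
            l * (Aᶜ * Bᶜ * (κ (+ 2) * Aᶜ - κ (+ 2) * Bᶜ - κ (+ 4) * Cᶜ + κ (+ 2) * Dᶜ)))
          ≈⟨ *-cong refl (+-cong (*-cong (sym hF) (+-cong (+-cong (+-cong (-‿cong (sym hA)) (-‿cong (*-cong refl (sym hB))))
              (-‿cong (*-cong refl (sym hC)))) (*-cong refl (sym hD))))
              (*-cong refl (*-cong (*-cong (sym hA) (sym hB)) (+-cong
              (+-cong (+-cong (*-cong refl (sym hA)) (-‿cong (*-cong refl (sym hB)))) (-‿cong (*-cong refl (sym hC)))) (*-cong refl (sym hD)))))) ⟩
        κ (+ 1) * (κ (+ 16) * (l * f) * (- (κ (+ 4) * A) - κ (+ 2) * (κ (+ 4) * B) - κ (+ 5) * (κ (+ 4) * C) + κ (+ 10) * (κ (+ 4) * D)) +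
            l * (κ (+ 4) * A * (κ (+ 4) * B) * (κ (+ 2) * (κ (+ 4) * A) - κ (+ 2) * (κ (+ 4) * B) - κ (+ 4) * (κ (+ 4) * C) +
            κ (+ 2) * (κ (+ 4) * D))))
          ≈⟨ solve 6 (λ l f D A B C → con (+ 1) :* (con (+ 16) :* (l :* f) :*
              (:- (con (+ 4) :* A) :- con (+ 2) :* (con (+ 4) :* B) :- con (+ 5) :* (con (+ 4) :* C) :+ con (+ 10) :* (con (+ 4) :* D)) :+
              l :* (con (+ 4) :* A :* (con (+ 4) :* B) :* (con (+ 2) :* (con (+ 4) :* A) :- con (+ 2) :* (con (+ 4) :* B) :-
              con (+ 4) :* (con (+ 4) :* C) :+ con (+ 2) :* (con (+ 4) :* D)))) :=
              con (+ 1) :* (con (+ 64) :* (l :* (f :* (:- A :- con (+ 2) :* B :- con (+ 5) :* C :+ con (+ 10) :* D) :+ A :*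
              B :* (con (+ 2) :* A :- con (+ 2) :* B :- con (+ 4) :* C :+ con (+ 2) :* D))))) refl l f D A B C ⟩
        κ (+ 1) * (κ (+ 64) * (l * (f * (- A - κ (+ 2) * B - κ (+ 5) * C + κ (+ 10) * D) + A *
            B * (κ (+ 2) * A - κ (+ 2) * B - κ (+ 4) * C + κ (+ 2) * D)))) ∎

      relation₂ : ∀ f →
        κ (+ 16) * (l * f) ≈ fᶜ →
        κ (+ 64) * (l * ((A - C) * (B * X - g) + κ (+ 4) * (C * g) - κ (+ 4) * (A * g))) ≈
            κ (+ 1) * (κ (+ 64) * (l * (f * (κ (+ 3) * A + κ (+ 8) * B + κ (+ 5) * C - κ (+ 20) * D) + A *
            B * ((- (κ (+ 5))) * A + κ (+ 6) * B + κ (+ 5) * C - κ (+ 2) * D))))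
      relation₂ f hF = begin
        κ (+ 64) * (l * ((A - C) * (B * X - g) + κ (+ 4) * (C * g) - κ (+ 4) * (A * g)))
          ≈⟨ solve 6 (λ l A g C B X → con (+ 64) :* (l :* ((A :- C) :* (B :* X :- g) :+ con (+ 4) :* (C :* g) :- con (+ 4) :* (A :* g))) :=
              l :* ((con (+ 4) :* A :- con (+ 4) :* C) :* (con (+ 4) :* B :* (con (+ 4) :* X) :- con (+ 16) :* g) :+
              con (+ 4) :* (con (+ 4) :* C :* (con (+ 16) :* g)) :- con (+ 4) :* (con (+ 4) :* A :* (con (+ 16) :* g)))) refl l A g C B X ⟩
        l * ((κ (+ 4) * A - κ (+ 4) * C) * (κ (+ 4) * B * (κ (+ 4) * X) - κ (+ 16) * g) + κ (+ 4) * (κ (+ 4) * C * (κ (+ 16) * g)) -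
            κ (+ 4) * (κ (+ 4) * A * (κ (+ 16) * g)))
          ≈⟨ *-cong refl (+-cong (+-cong (*-cong (+-cong hA (-‿cong hC)) (+-cong (*-cong hB hX) (-‿cong hg))) (*-cong refl (*-cong hC hg)))
              (-‿cong (*-cong refl (*-cong hA hg)))) ⟩
        l * ((Aᶜ - Cᶜ) * (Bᶜ * Xᶜ - gᶜ) + κ (+ 4) * (Cᶜ * gᶜ) - κ (+ 4) * (Aᶜ * gᶜ))
          ≈⟨ use hP (solve 3 (λ l N M → l :* ((:Aᶜ l M N :- :Cᶜ l M N) :* (:Bᶜ l M N :* :Xᶜ l M N :- :gᶜ l M N) :+
              con (+ 4) :* (:Cᶜ l M N :* :gᶜ l M N) :- con (+ 4) :* (:Aᶜ l M N :* :gᶜ l M N)) :=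
              con (+ 1) :* (:fᶜ l M N :* (con (+ 3) :* :Aᶜ l M N :+ con (+ 8) :* :Bᶜ l M N :+ con (+ 5) :* :Cᶜ l M N :- con (+ 20) :* :Dᶜ l M N) :+
              l :* (:Aᶜ l M N :* :Bᶜ l M N :* ((:- (con (+ 5))) :* :Aᶜ l M N :+ con (+ 6) :* :Bᶜ l M N :+ con (+ 5) :* :Cᶜ l M N :- con (+ 2) :* :Dᶜ
              l M N))) :+ (con (+ 0) :- con (+ 8) :* N :+ con (+ 40) :* M :- con (+ 20) :* (l :* M) :- con (+ 20) :* (l :* l :* M)) :*
              (:Pᶜ l M N :- con (+ 0))) refl l N M) ⟩
        κ (+ 1) * (fᶜ * (κ (+ 3) * Aᶜ + κ (+ 8) * Bᶜ + κ (+ 5) * Cᶜ - κ (+ 20) * Dᶜ) +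
            l * (Aᶜ * Bᶜ * ((- (κ (+ 5))) * Aᶜ + κ (+ 6) * Bᶜ + κ (+ 5) * Cᶜ - κ (+ 2) * Dᶜ)))
          ≈⟨ *-cong refl (+-cong (*-cong (sym hF) (+-cong (+-cong (+-cong (*-cong refl (sym hA)) (*-cong refl (sym hB))) (*-cong refl (sym hC)))
              (-‿cong (*-cong refl (sym hD))))) (*-cong refl (*-cong (*-cong (sym hA) (sym hB))
              (+-cong (+-cong (+-cong (*-cong refl (sym hA)) (*-cong refl (sym hB))) (*-cong refl (sym hC))) (-‿cong (*-cong refl (sym hD))))))) ⟩
        κ (+ 1) * (κ (+ 16) * (l * f) * (κ (+ 3) * (κ (+ 4) * A) + κ (+ 8) * (κ (+ 4) * B) + κ (+ 5) * (κ (+ 4) * C) - κ (+ 20) * (κ (+ 4) * D)) +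
            l * (κ (+ 4) * A * (κ (+ 4) * B) * ((- (κ (+ 5))) * (κ (+ 4) * A) + κ (+ 6) * (κ (+ 4) * B) + κ (+ 5) * (κ (+ 4) * C) -
            κ (+ 2) * (κ (+ 4) * D))))
          ≈⟨ solve 6 (λ l f D A B C → con (+ 1) :* (con (+ 16) :* (l :* f) :*
              (con (+ 3) :* (con (+ 4) :* A) :+ con (+ 8) :* (con (+ 4) :* B) :+ con (+ 5) :* (con (+ 4) :* C) :- con (+ 20) :* (con (+ 4) :* D)) :+
              l :* (con (+ 4) :* A :* (con (+ 4) :* B) :* ((:- (con (+ 5))) :* (con (+ 4) :* A) :+ con (+ 6) :* (con (+ 4) :* B) :+
              con (+ 5) :* (con (+ 4) :* C) :- con (+ 2) :* (con (+ 4) :* D)))) :=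
              con (+ 1) :* (con (+ 64) :* (l :* (f :* (con (+ 3) :* A :+ con (+ 8) :* B :+ con (+ 5) :* C :- con (+ 20) :* D) :+ A :*
              B :* ((:- (con (+ 5))) :* A :+ con (+ 6) :* B :+ con (+ 5) :* C :- con (+ 2) :* D))))) refl l f D A B C ⟩
        κ (+ 1) * (κ (+ 64) * (l * (f * (κ (+ 3) * A + κ (+ 8) * B + κ (+ 5) * C - κ (+ 20) * D) + A *
            B * ((- (κ (+ 5))) * A + κ (+ 6) * B + κ (+ 5) * C - κ (+ 2) * D)))) ∎

      relation₄ : ∀ f w →
        κ (+ 16) * (l * f) ≈ fᶜ →
        κ (+ 16) * w ≈ wᶜ →
        κ (+ 64) * (l * (κ (+ 2) * (A * (B * (D - Y))) - B * w)) ≈ κ (+ 2) *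
            (κ (+ 64) * (l * (f * (- A - B + κ (+ 5) * C - κ (+ 5) * D) + A * B * (A - κ (+ 2) * B - C + κ (+ 4) * D))))
      relation₄ f w hF hw = begin
        κ (+ 64) * (l * (κ (+ 2) * (A * (B * (D - Y))) - B * w))
          ≈⟨ solve 6 (λ l B w A D Y → con (+ 64) :* (l :* (con (+ 2) :* (A :* (B :* (D :- Y))) :- B :* w)) :=
              l :* (con (+ 2) :* (con (+ 4) :* A :* (con (+ 4) :* B :* (con (+ 4) :* D :- con (+ 4) :* Y))) :- con (+ 4) :* B :* (con (+ 16) :* w)))
              refl l B w A D Y ⟩
        l * (κ (+ 2) * (κ (+ 4) * A * (κ (+ 4) * B * (κ (+ 4) * D - κ (+ 4) * Y))) - κ (+ 4) * B * (κ (+ 16) * w))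
          ≈⟨ *-cong refl (+-cong (*-cong refl (*-cong hA (*-cong hB (+-cong hD (-‿cong hY))))) (-‿cong (*-cong hB hw))) ⟩
        l * (κ (+ 2) * (Aᶜ * (Bᶜ * (Dᶜ - Yᶜ))) - Bᶜ * wᶜ)
          ≈⟨ use hP (solve 3 (λ l N M → l :* (con (+ 2) :* (:Aᶜ l M N :* (:Bᶜ l M N :* (:Dᶜ l M N :- :Yᶜ l M N))) :- :Bᶜ l M N :* :wᶜ l M N) :=
              con (+ 2) :* (:fᶜ l M N :* (:- :Aᶜ l M N :- :Bᶜ l M N :+ con (+ 5) :* :Cᶜ l M N :- con (+ 5) :* :Dᶜ l M N) :+
              l :* (:Aᶜ l M N :* :Bᶜ l M N :* (:Aᶜ l M N :- con (+ 2) :* :Bᶜ l M N :- :Cᶜ l M N :+ con (+ 4) :* :Dᶜ l M N)))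
              :+ (con (+ 0) :- con (+ 8) :* N) :* (:Pᶜ l M N :- con (+ 0))) refl l N M) ⟩
        κ (+ 2) * (fᶜ * (- Aᶜ - Bᶜ + κ (+ 5) * Cᶜ - κ (+ 5) * Dᶜ) + l * (Aᶜ * Bᶜ * (Aᶜ - κ (+ 2) * Bᶜ - Cᶜ + κ (+ 4) * Dᶜ)))
          ≈⟨ *-cong refl (+-cong (*-cong (sym hF) (+-cong (+-cong (+-cong (-‿cong (sym hA)) (-‿cong (sym hB))) (*-cong refl (sym hC)))
              (-‿cong (*-cong refl (sym hD))))) (*-cong refl (*-cong (*-cong (sym hA) (sym hB))
              (+-cong (+-cong (+-cong (sym hA) (-‿cong (*-cong refl (sym hB)))) (-‿cong (sym hC))) (*-cong refl (sym hD)))))) ⟩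
        κ (+ 2) * (κ (+ 16) * (l * f) * (- (κ (+ 4) * A) - κ (+ 4) * B + κ (+ 5) * (κ (+ 4) * C) - κ (+ 5) * (κ (+ 4) * D)) +
            l * (κ (+ 4) * A * (κ (+ 4) * B) * (κ (+ 4) * A - κ (+ 2) * (κ (+ 4) * B) - κ (+ 4) * C + κ (+ 4) * (κ (+ 4) * D))))
          ≈⟨ solve 6 (λ l f D A B C → con (+ 2) :* (con (+ 16) :* (l :* f) :*
              (:- (con (+ 4) :* A) :- con (+ 4) :* B :+ con (+ 5) :* (con (+ 4) :* C) :- con (+ 5) :* (con (+ 4) :* D)) :+
              l :* (con (+ 4) :* A :* (con (+ 4) :* B) :* (con (+ 4) :* A :- con (+ 2) :* (con (+ 4) :* B) :- con (+ 4) :* C :+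
              con (+ 4) :* (con (+ 4) :* D)))) := con (+ 2) :* (con (+ 64) :*
              (l :* (f :* (:- A :- B :+ con (+ 5) :* C :- con (+ 5) :* D) :+ A :* B :* (A :- con (+ 2) :* B :- C :+ con (+ 4) :* D))))) refl l f D A
              B C ⟩
        κ (+ 2) * (κ (+ 64) * (l * (f * (- A - B + κ (+ 5) * C - κ (+ 5) * D) + A * B * (A - κ (+ 2) * B - C + κ (+ 4) * D)))) ∎

      relation₁ : ∀ f w →
        κ (+ 16) * (l * f) ≈ fᶜ →
        κ (+ 16) * w ≈ wᶜ →
        κ (+ 64) * (l * (M * (w - κ (+ 2) * (C * (B - X))))) ≈ κ (+ 4) *
            (κ (+ 64) * (l * (f * ((- (κ (+ 3))) * A + κ (+ 5) * B + C - κ (+ 5) * D) + C *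
            D * (κ (+ 4) * A + κ (+ 3) * B - κ (+ 10) * C + κ (+ 5) * D))))
      relation₁ f w hF hw = begin
        κ (+ 64) * (l * (M * (w - κ (+ 2) * (C * (B - X)))))
          ≈⟨ solve 6 (λ l M w C B X → con (+ 64) :* (l :* (M :* (w :- con (+ 2) :* (C :* (B :- X))))) :=
              l :* (con (+ 4) :* M :* (con (+ 16) :* w :- con (+ 2) :* (con (+ 4) :* C :* (con (+ 4) :* B :- con (+ 4) :* X))))) refl l M w C B X ⟩
        l * (κ (+ 4) * M * (κ (+ 16) * w - κ (+ 2) * (κ (+ 4) * C * (κ (+ 4) * B - κ (+ 4) * X))))
          ≈⟨ *-cong refl (*-cong refl (+-cong hw (-‿cong (*-cong refl (*-cong hC (+-cong hB (-‿cong hX))))))) ⟩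
        l * (κ (+ 4) * M * (wᶜ - κ (+ 2) * (Cᶜ * (Bᶜ - Xᶜ))))
          ≈⟨ use hP (solve 3 (λ l M N → l :* (con (+ 4) :* M :* (:wᶜ l M N :- con (+ 2) :* (:Cᶜ l M N :* (:Bᶜ l M N :- :Xᶜ l M N)))) :=
              con (+ 4) :* (:fᶜ l M N :* ((:- (con (+ 3))) :* :Aᶜ l M N :+ con (+ 5) :* :Bᶜ l M N :+ :Cᶜ l M N :- con (+ 5) :* :Dᶜ l M N) :+
              l :* (:Cᶜ l M N :* :Dᶜ l M N :* (con (+ 4) :* :Aᶜ l M N :+ con (+ 3) :* :Bᶜ l M N :- con (+ 10) :* :Cᶜ l M N :+ con (+ 5) :* :Dᶜ l M
              N))) :+ (con (+ 0) :- con (+ 16) :* N :- con (+ 112) :* M) :* (:Pᶜ l M N :- con (+ 0))) refl l M N) ⟩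
        κ (+ 4) * (fᶜ * ((- (κ (+ 3))) * Aᶜ + κ (+ 5) * Bᶜ + Cᶜ - κ (+ 5) * Dᶜ) +
            l * (Cᶜ * Dᶜ * (κ (+ 4) * Aᶜ + κ (+ 3) * Bᶜ - κ (+ 10) * Cᶜ + κ (+ 5) * Dᶜ)))
          ≈⟨ *-cong refl (+-cong (*-cong (sym hF) (+-cong (+-cong (+-cong (*-cong refl (sym hA)) (*-cong refl (sym hB))) (sym hC))
              (-‿cong (*-cong refl (sym hD))))) (*-cong refl (*-cong (*-cong (sym hC) (sym hD))
              (+-cong (+-cong (+-cong (*-cong refl (sym hA)) (*-cong refl (sym hB))) (-‿cong (*-cong refl (sym hC)))) (*-cong refl (sym hD)))))) ⟩
        κ (+ 4) * (κ (+ 16) * (l * f) * ((- (κ (+ 3))) * (κ (+ 4) * A) + κ (+ 5) * (κ (+ 4) * B) + κ (+ 4) * C - κ (+ 5) * (κ (+ 4) * D)) +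
            l * (κ (+ 4) * C * (κ (+ 4) * D) * (κ (+ 4) * (κ (+ 4) * A) + κ (+ 3) * (κ (+ 4) * B) - κ (+ 10) * (κ (+ 4) * C) +
            κ (+ 5) * (κ (+ 4) * D))))
          ≈⟨ solve 6 (λ l f C D A B → con (+ 4) :* (con (+ 16) :* (l :* f) :*
              ((:- (con (+ 3))) :* (con (+ 4) :* A) :+ con (+ 5) :* (con (+ 4) :* B) :+ con (+ 4) :* C :- con (+ 5) :* (con (+ 4) :* D)) :+
              l :* (con (+ 4) :* C :* (con (+ 4) :* D) :* (con (+ 4) :* (con (+ 4) :* A) :+ con (+ 3) :* (con (+ 4) :* B) :-
              con (+ 10) :* (con (+ 4) :* C) :+ con (+ 5) :* (con (+ 4) :* D)))) :=
              con (+ 4) :* (con (+ 64) :* (l :* (f :* ((:- (con (+ 3))) :* A :+ con (+ 5) :* B :+ C :- con (+ 5) :* D) :+ C :*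
              D :* (con (+ 4) :* A :+ con (+ 3) :* B :- con (+ 10) :* C :+ con (+ 5) :* D))))) refl l f C D A B ⟩
        κ (+ 4) * (κ (+ 64) * (l * (f * ((- (κ (+ 3))) * A + κ (+ 5) * B + C - κ (+ 5) * D) + C *
            D * (κ (+ 4) * A + κ (+ 3) * B - κ (+ 10) * C + κ (+ 5) * D)))) ∎

      param-w : ∀ w →
        w ≈ A * (D - Y) + C * (B - X) - l * (M * N) →
        κ (+ 16) * w ≈ wᶜ
      param-w w hw = use hw (use hA (use hC (use hD (use hY (use hB (use
          hX (solve 10 (λ w X N M B l Y D C A → con (+ 16) :* w := :wᶜ l M N :+
          con (+ 16) :* (w :- (A :* (D :- Y) :+ C :* (B :- X) :- l :* (M :* N))) :+ con (+ 4) :* (D :- Y) :* (con (+ 4) :* A :- :Aᶜ l M N) :+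
          con (+ 4) :* (B :- X) :* (con (+ 4) :* C :- :Cᶜ l M N) :+ :Aᶜ l M
          N :* (con (+ 4) :* D :- :Dᶜ l M N) :+ (:- :Aᶜ l M N) :* (con (+ 4) :* Y :- :Yᶜ l M N) :+ :Cᶜ l M
          N :* (con (+ 4) :* B :- :Bᶜ l M N) :+ (:- :Cᶜ l M N) :* (con (+ 4) :* X :- :Xᶜ l M N)) refl w X N M B l Y D C A)))))))

    -- Squaring 4qe = a n - c m isolates the cross term 2 a c m n; the squares of m and n are
    -- already known.
    w-formula : ∀ B D X Y a c e m n q u →
      κ (+ 4) * (q * e) ≈ a * n - c * m →
      κ (+ 4) * (q * e) * (κ (+ 4) * (q * e)) ≈ u →
      m * m ≈ B - X →
      n * n ≈ D - Y →
      κ (+ 2) * (a * c * (m * n)) ≈ a * a * (D - Y) + c * c * (B - X) - u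
    w-formula B D X Y a c e m n q u hE hu hm hn = use hE (use hu (use
        hm (use hn (solve 11 (λ a c m n D Y u B X q e → con (+ 2) :* (a :* c :* (m :* n)) :=
        a :* a :* (D :- Y) :+ c :* c :* (B :- X) :- u :+ (con (+ 4) :* (q :* e) :+ (a :* n :- c :* m)) :*
        (con (+ 4) :* (q :* e) :- (a :* n :- c :* m)) :+ (:- (con (+ 1))) :* (con (+ 4) :* (q :* e) :* (con (+ 4) :* (q :* e)) :- u) :+ c :*
        c :* (m :* m :- (B :- X)) :+ a :* a :* (n :* n :- (D :- Y))) refl a c m n D Y u B X q e))))

    -- Multiplication by `a b` completes the odd powers of the theta series to squares or to `g`.
    -- The same multiplier serves for `C₄` and `C₂`, where the product a c m n and the mixed
    -- product, respectively, take care of what remains.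
    C₃-form : ∀ Y Z a b d g h q y20 y4 →
      Z ≈ q * q * q * (a * y20 * h) →
      h ≈ y4 * d - q * q * (b * y20) →
      g ≈ κ (+ 4) * (q * q * q * (b * d * (y4 * y20))) →
      Y ≈ κ (+ 4) * (q * q * q * q * q * (y20 * y20)) →
      a * b * (κ (+ 8) * Z) ≈ κ (+ 2) * (a * a * g) - κ (+ 2) * (a * a * (b * b * Y))
    C₃-form Y Z a b d g h q y20 y4 hC3 hK hg hY = use hC3 (use hK (use
        hg (use hY (solve 10 (λ a b Z Y g h y20 q y4 d → a :* b :* (con (+ 8) :* Z) :=
        con (+ 2) :* (a :* a :* g) :- con (+ 2) :* (a :* a :* (b :* b :* Y)) :+ con (+ 8) :* (a :* b) :* (Z :- q :* q :* q :* (a :* y20 :* h)) :+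
        con (+ 8) :* (q :* q :* q) :* (a :* a) :* (b :* y20) :* (h :- (y4 :* d :- q :* q :* (b :* y20)))
        :+ (:- (con (+ 2) :* (a :* a))) :* (g :- con (+ 4) :* (q :* q :* q :* (b :* d :* (y4 :* y20)))) :+
        con (+ 2) :* (a :* a :* (b :* b)) :* (Y :- con (+ 4) :* (q :* q :* q :* q :* q :* (y20 :* y20)))) refl a b Z Y g h y20 q y4 d))))

    C₄-form : ∀ Y Z a b c d e m n q →
      Z ≈ q * (b * n * e) →
      κ (+ 4) * (q * e) ≈ a * n - c * m →
      n * n ≈ d * d - Y →
      a * b * (κ (+ 8) * Z) ≈ κ (+ 2) * (a * a * (b * b * (d * d - Y))) - b * b * (κ (+ 2) * (a * c * (m * n)))
    C₄-form Y Z a b c d e m n q hC4 hE hn = use hC4 (use hE (use hn (solve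
        10 (λ a b Z n Y d q e c m → a :* b :* (con (+ 8) :* Z) := con (+ 2) :* (a :* a :* (b :* b :* (d :* d :- Y))) :- b :*
        b :* (con (+ 2) :* (a :* c :* (m :* n))) :+ con (+ 8) :* (a :* b) :* (Z :- q :* (b :* n :* e)) :+
        con (+ 2) :* (a :* (b :* b) :* n) :* (con (+ 4) :* (q :* e) :- (a :* n :- c :* m)) :+
        con (+ 2) :* (a :* a :* (b :* b)) :* (n :* n :- (d :* d :- Y))) refl a b Z n Y d q e c m)))

    C₂-form : ∀ X Z a b c g k q y10 y2 y4 →
      Z ≈ q * q * (k * (y4 * y10)) →
      k ≈ y2 * c - q * (a * y10) →
      κ (+ 4) * (q * (a * c * (y2 * y10))) ≈ (a * a - c * c) * (y2 * y2 - q * q * (y10 * y10)) + κ (+ 4) * (q * q * (c * c * (y10 * y10))) →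
      y2 * y2 ≈ b * y4 →
      g ≈ κ (+ 4) * (q * q * q * (y2 * y2 * (y10 * y10))) →
      b * b * X ≈ κ (+ 4) * (q * (y2 * y2 * (y2 * y2))) →
      a * b * (κ (+ 16) * Z) ≈ (a * a - c * c) * (b * b * X - g) + κ (+ 4) * (c * c * g) - κ (+ 4) * (a * a * g)
    C₂-form X Z a b c g k q y10 y2 y4 hC2 hK hJ h2 hg hBX = use hC2 (use
        hK (use hJ (use h2 (use hBX (use hg (solve 11 (λ a b Z g X y2 y4 c q k y10 →
        a :* b :* (con (+ 16) :* Z) := (a :* a :- c :* c) :* (b :* b :* X :- g) :+ con (+ 4) :* (c :* c :* g) :- con (+ 4) :* (a :* a :* g) :+
        con (+ 16) :* (a :* b) :* (Z :- q :* q :* (k :* (y4 :* y10))) :+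
        con (+ 16) :* (q :* q) :* (a :* b) :* (y4 :* y10) :* (k :- (y2 :* c :- q :* (a :* y10))) :+ con (+ 4) :*
        q :* (b :* y4) :* (con (+ 4) :* (q :* (a :* c :* (y2 :* y10)))
        :- ((a :* a :- c :* c) :* (y2 :* y2 :- q :* q :* (y10 :* y10)) :+ con (+ 4) :* (q :* q :* (c :* c :* (y10 :* y10)))))
        :+ (con (+ 16) :* (q :* q :* q) :* (a :* a) :* (y10 :* y10) :- con (+ 4) :*
        q :* ((a :* a :- c :* c) :* (y2 :* y2 :- q :* q :* (y10 :* y10)) :+ con (+ 4) :* (q :* q :* (c :* c :* (y10 :* y10))))) :*
        (y2 :* y2 :- b :* y4) :+ (:- (a :* a :- c :* c)) :* (b :* b :* X :- con (+ 4) :* (q :* (y2 :* y2 :* (y2 :* y2))))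
        :+ (a :* a :- c :* c :- con (+ 4) :* (c :* c) :+ con (+ 4) :* (a :* a)) :* (g :- con (+ 4) :* (q :* q :* q :* (y2 :* y2 :* (y10 :* y10)))))
        refl a b Z g X y2 y4 c q k y10))))))

    -- Here the multiplier is `c d`: the factor `d` turns η(8z)η(40z)φ(-q¹⁰) into `S4 e`, which is M
    -- e up to 4q, and the factor `c` completes m (a n - c m).
    C₁-form : ∀ B M S4 X Z a c d e m n o q t →
      Z ≈ q * q * (m * (o * t)) →
      d * o * t ≈ S4 * e →
      M ≈ κ (+ 4) * (q * S4) →
      κ (+ 4) * (q * e) ≈ a * n - c * m →
      m * m ≈ B - X →
      c * d * (κ (+ 32) * Z) ≈ M * (κ (+ 2) * (a * c * (m * n)) - κ (+ 2) * (c * c * (B - X)))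
    C₁-form B M S4 X Z a c d e m n o q t hC1 h9 hM hE hm = use hC1 (use
        h9 (use hM (use hE (use hm (solve 14 (λ c d Z M m B X q e a n t S4 o → c :* d :* (con (+ 32) :* Z) :=
        M :* (con (+ 2) :* (a :* c :* (m :* n)) :- con (+ 2) :* (c :* c :* (B :- X))) :+ con (+ 32) :* (c :* d) :* (Z :- q :* q :* (m :* (o :* t)))
        :+ con (+ 32) :* (q :* q) :* (c :* m) :* (d :* o :* t :- S4 :* e) :+ (:- (con (+ 8) :* (c :* m :* (q :* e)))) :*
        (M :- con (+ 4) :* (q :* S4)) :+ con (+ 2) :* (c :* m :* M) :* (con (+ 4) :* (q :* e) :- (a :* n :- c :* m))
        :+ (:- (con (+ 2) :* (c :* c) :* M)) :* (m :* m :- (B :- X))) refl c d Z M m B X q e a n t S4 o)))))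

open PolynomialIdentities
open import Relation.Binary.PropositionalEquality hiding ([_]; J)

private module ℚS = +-*-Solver

-- The commutative ring of formal power series

module PowerSeries where

  open import Data.Rational using (_+_; _*_; -_)

  sumTo-cong : ∀ n {f g : ℕ → ℚ} → (∀ i → i ≤ n → f i ≡ g i) → sumTo n f ≡ sumTo n g
  sumTo-cong zero    h = h 0 z≤n
  sumTo-cong (suc n) h = cong₂ _+_ (sumTo-cong n λ i i≤n → h i (ℕP.m≤n⇒m≤1+n i≤n)) (h (suc n) ℕP.≤-refl)

  private
    interchange : ∀ a b c d → (a + b) + (c + d) ≡ (a + c) + (b + d)
    interchange = solve 4 (λ a b c d → (a :+ b) :+ (c :+ d) := (a :+ c) :+ (b :+ d)) refl
      where open +-*-Solver

  sumTo-+ : ∀ n (f g : ℕ → ℚ) → sumTo n (λ i → f i + g i) ≡ sumTo n f + sumTo n g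
  sumTo-+ zero    f g = refl
  sumTo-+ (suc n) f g = trans (cong (_+ (f (suc n) + g (suc n))) (sumTo-+ n f g)) (interchange (sumTo n f) (sumTo n g) (f (suc n)) (g (suc n)))

  sumTo-*ˡ : ∀ n c (f : ℕ → ℚ) → sumTo n (λ i → c * f i) ≡ c * sumTo n f
  sumTo-*ˡ zero    c f = refl
  sumTo-*ˡ (suc n) c f = trans (cong (_+ c * f (suc n)) (sumTo-*ˡ n c f)) (sym (ℚP.*-distribˡ-+ c (sumTo n f) (f (suc n))))

  sumTo-0 : ∀ n {f : ℕ → ℚ} → (∀ i → i ≤ n → f i ≡ 0ℚ) → sumTo n f ≡ 0ℚ
  sumTo-0 zero    h = h 0 z≤n
  sumTo-0 (suc n) h = cong₂ _+_ (sumTo-0 n λ i i≤n → h i (ℕP.m≤n⇒m≤1+n i≤n)) (h (suc n) ℕP.≤-refl)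

  sumTo-head : ∀ n (f : ℕ → ℚ) → sumTo (suc n) f ≡ f 0 + sumTo n (λ i → f (suc i))
  sumTo-head zero    f = refl
  sumTo-head (suc n) f = trans (cong (_+ f (suc (suc n))) (sumTo-head n f)) (ℚP.+-assoc (f 0) (sumTo n (λ i → f (suc i))) (f (suc (suc n))))

  infix 4 _≈_
  _≈_ : PS → PS → Set
  f ≈ g = ∀ n → f n ≡ g n

  tail : PS → PS
  tail f n = f (suc n)

  0ₛ : PS
  0ₛ _ = 0ℚ

  -ₛ_ : PS → PS
  (-ₛ f) n = - f n

  ⊛-head : ∀ f g n → (f ⊛ g) (suc n) ≡ f 0 * g (suc n) + (tail f ⊛ g) n
  ⊛-head f g n = sumTo-head n (λ i → f i * g (suc n ∸ i))

  ⊛-last : ∀ f g n → (f ⊛ g) (suc n) ≡ (f ⊛ tail g) n + f (suc n) * g 0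
  ⊛-last f g n = cong₂ _+_
    (sumTo-cong n λ i i≤n → cong (λ k → f i * g k) (ℕP.+-∸-assoc 1 i≤n))
    (cong (λ k → f (suc n) * g k) (ℕP.n∸n≡0 n))

  ⊛-congˡ≤ : ∀ {f f′} g n → (∀ i → i ≤ n → f i ≡ f′ i) → (f ⊛ g) n ≡ (f′ ⊛ g) n
  ⊛-congˡ≤ g n h = sumTo-cong n λ i i≤n → cong (_* g (n ∸ i)) (h i i≤n)

  ⊛-congʳ≤ : ∀ f {g g′} n → (∀ i → i ≤ n → g i ≡ g′ i) → (f ⊛ g) n ≡ (f ⊛ g′) n
  ⊛-congʳ≤ f n h = sumTo-cong n λ i i≤n → cong (f i *_) (h (n ∸ i) (ℕP.m∸n≤m n i))

  -- Induction on the degree: removing the first summand of `f ⊛ g` and the last of `g ⊛ f` leaves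
  -- the product of `tail f` and `g` in both.
  ⊛-comm : ∀ f g → f ⊛ g ≈ g ⊛ f
  ⊛-comm f g zero    = ℚP.*-comm (f 0) (g 0)
  ⊛-comm f g (suc n) = begin
    (f ⊛ g) (suc n)                  ≡⟨ ⊛-head f g n ⟩
    f 0 * g (suc n) + (tail f ⊛ g) n ≡⟨ cong₂ _+_ (ℚP.*-comm (f 0) (g (suc n))) (⊛-comm (tail f) g n) ⟩
    g (suc n) * f 0 + (g ⊛ tail f) n ≡⟨ ℚP.+-comm (g (suc n) * f 0) ((g ⊛ tail f) n) ⟩
    (g ⊛ tail f) n + g (suc n) * f 0 ≡⟨ sym (⊛-last g f n) ⟩
    (g ⊛ f) (suc n)                  ∎
    where open ≡-Reasoning

  ⊛-cong : ∀ {f f′ g g′} → f ≈ f′ → g ≈ g′ → f ⊛ g ≈ f′ ⊛ g′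
  ⊛-cong {f′ = f′} {g} f≈ g≈ n = trans (⊛-congˡ≤ g n λ i _ → f≈ i) (⊛-congʳ≤ f′ n λ i _ → g≈ i)

  ⊛-distribʳ : ∀ h f g → (f +ₛ g) ⊛ h ≈ f ⊛ h +ₛ g ⊛ h
  ⊛-distribʳ h f g n = trans (sumTo-cong n λ i _ → ℚP.*-distribʳ-+ (h (n ∸ i)) (f i) (g i))
      (sumTo-+ n (λ i → f i * h (n ∸ i)) (λ i → g i * h (n ∸ i)))

  ·-⊛ : ∀ c f g → (c ·ₛ f) ⊛ g ≈ c ·ₛ (f ⊛ g)
  ·-⊛ c f g n = trans (sumTo-cong n λ i _ → ℚP.*-assoc c (f i) (g (n ∸ i))) (sumTo-*ˡ n c (λ i → f i * g (n ∸ i)))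

  -- The tail of `f ⊛ g` is f 0 · tail g + tail f ⊛ g, so degree n + 1 follows from distributivity
  -- and from degree n for `tail f`.
  ⊛-assoc : ∀ f g h → (f ⊛ g) ⊛ h ≈ f ⊛ (g ⊛ h)
  ⊛-assoc f g h zero    = ℚP.*-assoc (f 0) (g 0) (h 0)
  ⊛-assoc f g h (suc n) = begin
    ((f ⊛ g) ⊛ h) (suc n)
      ≡⟨ ⊛-head (f ⊛ g) h n ⟩
    f 0 * g 0 * h (suc n) + (tail (f ⊛ g) ⊛ h) n
      ≡⟨ cong (λ z → f 0 * g 0 * h (suc n) + z) (⊛-congˡ≤ h n λ i _ → ⊛-head f g i) ⟩
    f 0 * g 0 * h (suc n) + ((f 0 ·ₛ tail g +ₛ tail f ⊛ g) ⊛ h) n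
      ≡⟨ cong (λ z → f 0 * g 0 * h (suc n) + z) (⊛-distribʳ h (f 0 ·ₛ tail g) (tail f ⊛ g) n) ⟩
    f 0 * g 0 * h (suc n) + (((f 0 ·ₛ tail g) ⊛ h) n + ((tail f ⊛ g) ⊛ h) n)
      ≡⟨ cong (λ z → f 0 * g 0 * h (suc n) + z) (cong₂ _+_ (·-⊛ (f 0) (tail g) h n) (⊛-assoc (tail f) g h n)) ⟩
    f 0 * g 0 * h (suc n) + (f 0 * (tail g ⊛ h) n + (tail f ⊛ (g ⊛ h)) n)
      ≡⟨ rearrange (f 0) (g 0) (h (suc n)) ((tail g ⊛ h) n) ((tail f ⊛ (g ⊛ h)) n) ⟩
    f 0 * (g 0 * h (suc n) + (tail g ⊛ h) n) + (tail f ⊛ (g ⊛ h)) n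
      ≡⟨ cong (λ z → f 0 * z + (tail f ⊛ (g ⊛ h)) n) (sym (⊛-head g h n)) ⟩
    f 0 * (g ⊛ h) (suc n) + (tail f ⊛ (g ⊛ h)) n
      ≡⟨ sym (⊛-head f (g ⊛ h) n) ⟩
    (f ⊛ (g ⊛ h)) (suc n) ∎
    where
    open ≡-Reasoning
    rearrange : ∀ x y z u v → x * y * z + (x * u + v) ≡ x * (y * z + u) + v
    rearrange = solve 5 (λ x y z u v → x :* y :* z :+ (x :* u :+ v) := x :* (y :* z :+ u) :+ v) refl
      where open +-*-Solver

  ⊛-identityˡ : ∀ f → oneₛ ⊛ f ≈ f
  ⊛-identityˡ f zero    = ℚP.*-identityˡ (f 0)
  ⊛-identityˡ f (suc n) = begin
    (oneₛ ⊛ f) (suc n)                     ≡⟨ ⊛-head oneₛ f n ⟩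
    1ℚ * f (suc n) + (tail oneₛ ⊛ f) n     ≡⟨ cong₂ _+_ (ℚP.*-identityˡ (f (suc n))) (sumTo-0 n λ i _ → ℚP.*-zeroˡ (f (n ∸ i))) ⟩
    f (suc n) + 0ℚ                         ≡⟨ ℚP.+-identityʳ (f (suc n)) ⟩
    f (suc n)                              ∎
    where open ≡-Reasoning

  ⊛-identityʳ : ∀ f → f ⊛ oneₛ ≈ f
  ⊛-identityʳ f n = trans (⊛-comm f oneₛ n) (⊛-identityˡ f n)

  PS-ring : CommutativeRing 0ℓ 0ℓ
  PS-ring = record
    { Carrier = PS ; _≈_ = _≈_ ; _+_ = _+ₛ_ ; _*_ = _⊛_ ; -_ = -ₛ_ ; 0# = 0ₛ ; 1# = oneₛ
    ; isCommutativeRing = record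
      { isRing = record
        { +-isAbelianGroup = record
          { isGroup = record
            { isMonoid = record
              { isSemigroup = record
                { isMagma = record
                  { isEquivalence = record { refl = λ _ → refl ; sym = λ h n → sym (h n) ; trans = λ h k n → trans (h n) (k n) }
                  ; ∙-cong = λ h k n → cong₂ _+_ (h n) (k n) }
                ; assoc = λ f g h n → ℚP.+-assoc (f n) (g n) (h n) }
              ; identity = (λ f n → ℚP.+-identityˡ (f n)) , (λ f n → ℚP.+-identityʳ (f n)) }
            ; inverse = (λ f n → ℚP.+-inverseˡ (f n)) , (λ f n → ℚP.+-inverseʳ (f n))
            ; ⁻¹-cong = λ h n → cong -_ (h n) }
          ; comm = λ f g n → ℚP.+-comm (f n) (g n) }
        ; *-cong = ⊛-cong
        ; *-assoc = ⊛-assoc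
        ; *-identity = ⊛-identityˡ , ⊛-identityʳ
        ; distrib = (λ h f g n → trans (⊛-comm h (f +ₛ g) n) (trans (⊛-distribʳ h f g n) (cong₂ _+_ (⊛-comm f h n) (⊛-comm g h n))))
                  , ⊛-distribʳ }
      ; *-comm = ⊛-comm } }

  module R = CommutativeRing PS-ring

  fromℤ : ℤ → ℚ
  fromℤ z = z ℚ./ 1

  constₛ : ℚ → PS
  constₛ c = c ·ₛ oneₛ

  ι : ℤ → PS
  ι z = constₛ (fromℤ z)

  private
    module U where
      open import Data.Rational.Unnormalised public using (mkℚᵘ; _≃_; *≡*; _+_; _*_; -_)
      open import Data.Rational.Unnormalised.Properties public using (+-cong; *-cong; -‿cong; ≃-sym; ≃-trans; ≃-reflexive; module ≤-Reasoning)

    toℚᵘ-fromℤ : ∀ z → ℚ.toℚᵘ (fromℤ z) U.≃ U.mkℚᵘ z 0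
    toℚᵘ-fromℤ z = ℚP.toℚᵘ-fromℚᵘ (U.mkℚᵘ z 0)

  -- Computed with unnormalised fractions, where denominator 1 persists and no greatest common
  -- divisor interferes.
  fromℤ-+ : ∀ x y → fromℤ (x ℤ.+ y) ≡ fromℤ x + fromℤ y
  fromℤ-+ x y = ℚP.toℚᵘ-injective (begin-equality
    ℚ.toℚᵘ (fromℤ (x ℤ.+ y))                  ≃⟨ toℚᵘ-fromℤ (x ℤ.+ y) ⟩
    U.mkℚᵘ (x ℤ.+ y) 0                        ≡⟨ cong₂ (λ u v → U.mkℚᵘ (u ℤ.+ v) 0) (sym (ℤP.*-identityʳ x)) (sym (ℤP.*-identityʳ y)) ⟩
    U.mkℚᵘ x 0 U.+ U.mkℚᵘ y 0                 ≃⟨ U.+-cong (U.≃-sym (toℚᵘ-fromℤ x)) (U.≃-sym (toℚᵘ-fromℤ y)) ⟩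
    ℚ.toℚᵘ (fromℤ x) U.+ ℚ.toℚᵘ (fromℤ y)     ≃⟨ U.≃-sym (ℚP.toℚᵘ-homo-+ (fromℤ x) (fromℤ y)) ⟩
    ℚ.toℚᵘ (fromℤ x + fromℤ y)                ∎)
    where open U.≤-Reasoning

  fromℤ-* : ∀ x y → fromℤ (x ℤ.* y) ≡ fromℤ x * fromℤ y
  fromℤ-* x y = ℚP.toℚᵘ-injective (begin-equality
    ℚ.toℚᵘ (fromℤ (x ℤ.* y))                  ≃⟨ toℚᵘ-fromℤ (x ℤ.* y) ⟩
    U.mkℚᵘ x 0 U.* U.mkℚᵘ y 0                 ≃⟨ U.*-cong (U.≃-sym (toℚᵘ-fromℤ x)) (U.≃-sym (toℚᵘ-fromℤ y)) ⟩
    ℚ.toℚᵘ (fromℤ x) U.* ℚ.toℚᵘ (fromℤ y)     ≃⟨ U.≃-sym (ℚP.toℚᵘ-homo-* (fromℤ x) (fromℤ y)) ⟩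
    ℚ.toℚᵘ (fromℤ x * fromℤ y)                ∎)
    where open U.≤-Reasoning

  fromℤ-neg : ∀ x → fromℤ (ℤ.- x) ≡ - fromℤ x
  fromℤ-neg x = ℚP.toℚᵘ-injective (begin-equality
    ℚ.toℚᵘ (fromℤ (ℤ.- x))   ≃⟨ toℚᵘ-fromℤ (ℤ.- x) ⟩
    U.- U.mkℚᵘ x 0           ≃⟨ U.-‿cong (U.≃-sym (toℚᵘ-fromℤ x)) ⟩
    U.- ℚ.toℚᵘ (fromℤ x)     ≃⟨ U.≃-sym (ℚP.toℚᵘ-homo‿- (fromℤ x)) ⟩
    ℚ.toℚᵘ (- fromℤ x)       ∎)
    where open U.≤-Reasoning

  fromℤ-injective : ∀ {x y} → fromℤ x ≡ fromℤ y → x ≡ y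
  fromℤ-injective {x} {y} eq with U.≃-trans (U.≃-sym (toℚᵘ-fromℤ x)) (U.≃-trans (U.≃-reflexive (cong ℚ.toℚᵘ eq)) (toℚᵘ-fromℤ y))
  ... | U.*≡* e = trans (sym (ℤP.*-identityʳ x)) (trans e (ℤP.*-identityʳ y))

  ·-one : ∀ c f → constₛ c ⊛ f ≈ c ·ₛ f
  ·-one c f n = trans (·-⊛ c oneₛ f n) (cong (c *_) (⊛-identityˡ f n))

  -- Equality of series is undecidable, so the ring solver takes its coefficients from the integers;
  -- rational scalars are dealt with separately.
  ι-morphism : CommutativeRing.rawRing ℤP.+-*-commutativeRing -Raw-AlmostCommutative⟶ fromCommutativeRing PS-ring
  ι-morphism = record
    { ⟦_⟧    = ι
    ; +-homo = λ x y n → trans (cong (_* oneₛ n) (fromℤ-+ x y)) (ℚP.*-distribʳ-+ (oneₛ n) (fromℤ x) (fromℤ y))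
    ; *-homo = λ x y n → trans (cong (_* oneₛ n) (fromℤ-* x y)) (trans (ℚP.*-assoc (fromℤ x) (fromℤ y) (oneₛ n)) (sym (·-one (fromℤ x) (ι y) n)))
    ; -‿homo = λ x n → trans (cong (_* oneₛ n) (fromℤ-neg x)) (sym (ℚP.neg-distribˡ-* (fromℤ x) (oneₛ n)))
    ; 0-homo = λ n → ℚP.*-zeroˡ (oneₛ n)
    ; 1-homo = λ n → ℚP.*-identityˡ (oneₛ n)
    }

  ι-equal? : ∀ x y → Data.Maybe.Maybe (ι x ≈ ι y)
  ι-equal? x y = Data.Maybe.map (λ { refl _ → refl }) (Relation.Nullary.Decidable.dec⇒maybe (x ℤ.≟ y))

  module PSSolver = Algebra.Solver.Ring (CommutativeRing.rawRing ℤP.+-*-commutativeRing)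
    (fromCommutativeRing PS-ring) ι-morphism ι-equal?

open PowerSeries

-- Powers of q, cancellation, and the substitution q ↦ q^d

module Substitution where

  open import Data.Nat.Divisibility
  open import Data.Nat.Induction using (<-rec)
  open import Data.Rational using (_+_; _*_; -_)

  mono : ℕ → PS
  mono k = shift k oneₛ

  shift-cong : ∀ s {f g} → f ≈ g → shift s f ≈ shift s g
  shift-cong zero    h n       = h n
  shift-cong (suc s) h zero    = refl
  shift-cong (suc s) h (suc n) = shift-cong s h n

  shift-⊛ : ∀ s f g → shift s f ⊛ g ≈ shift s (f ⊛ g)
  shift-⊛ zero    f g n       = refl
  shift-⊛ (suc s) f g zero    = ℚP.*-zeroˡ (g 0)
  shift-⊛ (suc s) f g (suc n) = trans (⊛-head (shift (suc s) f) g n)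
    (trans (cong (_+ (shift s f ⊛ g) n) (ℚP.*-zeroˡ (g (suc n)))) (trans (ℚP.+-identityˡ _) (shift-⊛ s f g n)))

  shift≈mono : ∀ s f → shift s f ≈ mono s ⊛ f
  shift≈mono s f n = sym (trans (shift-⊛ s oneₛ f n) (shift-cong s (⊛-identityˡ f) n))

  shift-shift : ∀ s t f → shift s (shift t f) ≈ shift (s ℕ.+ t) f
  shift-shift zero    t f n       = refl
  shift-shift (suc s) t f zero    = refl
  shift-shift (suc s) t f (suc n) = shift-shift s t f n

  mono-+ : ∀ s t → mono (s ℕ.+ t) ≈ mono s ⊛ mono t
  mono-+ s t n = trans (sym (shift-shift s t oneₛ n)) (shift≈mono s (mono t) n)

  shift-at : ∀ s f n → shift s f (s ℕ.+ n) ≡ f n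
  shift-at zero    f n = refl
  shift-at (suc s) f n = shift-at s f n

  shift-below : ∀ s f {n} → n < s → shift s f n ≡ 0ℚ
  shift-below (suc s) f {zero}  _         = refl
  shift-below (suc s) f {suc n} (s≤s n<s) = shift-below s f n<s

  -- The substitute for division: q and its multiples have no inverse in the ring of power series
  -- but can be cancelled. Constant coefficient 1, powers of q, nonzero integers and products of
  -- these suffice for all that follows.
  record Regular (u : PS) : Set where
    constructor regular
    field nonZeroDivisor : ∀ f → u ⊛ f ≈ 0ₛ → f ≈ 0ₛ
  open Regular

  regular-cancel : ∀ {u} → Regular u → ∀ f g → u ⊛ f ≈ u ⊛ g → f ≈ g
  regular-cancel {u} reg f g h n = begin
    f n                     ≡⟨ sym (ℚP.+-identityʳ (f n)) ⟩
    f n + 0ℚ                ≡⟨ cong (λ z → f n + z) (sym (ℚP.+-inverseˡ (g n))) ⟩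
    f n + (- g n + g n)     ≡⟨ sym (ℚP.+-assoc (f n) (- g n) (g n)) ⟩
    (f +ₛ (-ₛ g)) n + g n   ≡⟨ cong (_+ g n) (nonZeroDivisor reg (f +ₛ (-ₛ g)) diff n) ⟩
    0ℚ + g n                ≡⟨ ℚP.+-identityˡ (g n) ⟩
    g n                     ∎
    where
    open ≡-Reasoning
    diff : u ⊛ (f +ₛ (-ₛ g)) ≈ 0ₛ
    diff m = trans (solve 3 (λ u f g → u :* (f :+ (:- g)) := u :* f :+ (:- (u :* g))) (λ _ → refl) u f g m)
      (trans (cong (λ z → z + - (u ⊛ g) m) (h m)) (ℚP.+-inverseʳ ((u ⊛ g) m)))
      where open PSSolver

  regular-⊛ : ∀ {u v} → Regular u → Regular v → Regular (u ⊛ v)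
  regular-⊛ {u} {v} ru rv = regular λ f h → nonZeroDivisor rv f (nonZeroDivisor ru (v ⊛ f) λ n → trans (sym (⊛-assoc u v f n)) (h n))

  -- If f vanishes up to degree n, the coefficient of u f in degree n + 1 is u 0 · f (n + 1).
  regular-unit : ∀ u → u 0 ≡ 1ℚ → Regular u
  regular-unit u u0 = regular cancel
    where
    module _ (f : PS) (h : u ⊛ f ≈ 0ₛ) where
      step : ∀ n → (∀ i → i ≤ n → f i ≡ 0ℚ) → f (suc n) ≡ 0ℚ
      step n ih = begin
        f (suc n)                          ≡⟨ sym (ℚP.*-identityˡ (f (suc n))) ⟩
        1ℚ * f (suc n)                     ≡⟨ cong (_* f (suc n)) (sym u0) ⟩
        u 0 * f (suc n)                    ≡⟨ sym (ℚP.+-identityʳ (u 0 * f (suc n))) ⟩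
        u 0 * f (suc n) + 0ℚ               ≡⟨ cong (λ z → u 0 * f (suc n) + z)
            (sym (sumTo-0 n λ i i≤n → trans (cong (tail u i *_) (ih (n ∸ i) (ℕP.m∸n≤m n i))) (ℚP.*-zeroʳ (tail u i)))) ⟩
        u 0 * f (suc n) + (tail u ⊛ f) n   ≡⟨ sym (⊛-head u f n) ⟩
        (u ⊛ f) (suc n)                    ≡⟨ h (suc n) ⟩
        0ℚ                                 ∎
        where open ≡-Reasoning
      upTo : ∀ n i → i ≤ n → f i ≡ 0ℚ
      upTo zero    .0 z≤n = trans (sym (ℚP.*-identityˡ (f 0))) (trans (cong (_* f 0) (sym u0)) (h 0))
      upTo (suc n) i i≤n with ℕP.m≤n⇒m<n∨m≡n i≤n
      ... | Data.Sum.inj₁ (s≤s i≤n′) = upTo n i i≤n′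
      ... | Data.Sum.inj₂ refl = step n (upTo n)
    cancel : ∀ f → u ⊛ f ≈ 0ₛ → f ≈ 0ₛ
    cancel f h n = upTo f h n n ℕP.≤-refl

  regular-mono : ∀ s → Regular (mono s)
  regular-mono s = regular λ f h n → trans (sym (shift-at s f n)) (trans (shift≈mono s f (s ℕ.+ n)) (h (s ℕ.+ n)))

  regular-ι : ∀ z → z ≢ + 0 → Regular (ι z)
  regular-ι z z≢0 = regular λ f h n → trans (sym (ℚP.*-identityˡ (f n))) (trans (cong (_* f n) (sym inv))
    (trans (ℚP.*-assoc (ℚ.1/ c) c (f n)) (trans (cong (ℚ.1/ c *_) (trans (sym (·-one c f n)) (h n))) (ℚP.*-zeroʳ (ℚ.1/ c)))))
    where
    c = fromℤ z
    instance
      c≢0 : ℚ.NonZero c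
      c≢0 = ℚ.≢-nonZero λ c≡0 → z≢0 (fromℤ-injective {z} {+ 0} c≡0)
    inv : ℚ.1/ c * c ≡ 1ℚ
    inv = ℚP.*-inverseˡ c

  module _ (d : ℕ) .{{_ : NonZero d}} where

    dil-at : ∀ f k → dil d f (k ℕ.* d) ≡ f k
    dil-at f k with d ∣? k ℕ.* d
    ... | yes (divides j eq) = cong f (ℕP.*-cancelʳ-≡ j k d (sym eq))
    ... | no  d∤n = contradiction (divides k refl) d∤n

    dil-off : ∀ f n → ¬ d ∣ n → dil d f n ≡ 0ℚ
    dil-off f n d∤n with d ∣? n
    ... | yes d∣n = contradiction d∣n d∤n
    ... | no _ = refl

    -- Determines the dilated series by its values on and off the multiples of `d`, so that later
    -- proofs need not inspect a divisibility witness.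
    dil-unique : ∀ f g → (∀ k → g (k ℕ.* d) ≡ f k) → (∀ n → ¬ d ∣ n → g n ≡ 0ℚ) → g ≈ dil d f
    dil-unique f g at off n with d ∣? n
    ... | yes (divides k eq) = trans (cong g eq) (at k)
    ... | no d∤n = off n d∤n

    dil-cong : ∀ {f g} → f ≈ g → dil d f ≈ dil d g
    dil-cong h n with d ∣? n
    ... | yes (divides k _) = h k
    ... | no _ = refl

    dil-+ : ∀ f g → dil d (f +ₛ g) ≈ dil d f +ₛ dil d g
    dil-+ f g n with d ∣? n
    ... | yes _ = refl
    ... | no _  = refl

    dil-neg : ∀ f → dil d (-ₛ f) ≈ -ₛ dil d f
    dil-neg f n with d ∣? n
    ... | yes _ = refl
    ... | no _  = refl

    dil-· : ∀ c f → dil d (c ·ₛ f) ≈ c ·ₛ dil d f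
    dil-· c f n with d ∣? n
    ... | yes _ = refl
    ... | no _  = sym (ℚP.*-zeroʳ c)

    dil-shift : ∀ s f → dil d (shift s f) ≈ shift (s ℕ.* d) (dil d f)
    dil-shift s f n = sym (dil-unique (shift s f) (shift (s ℕ.* d) (dil d f)) at off n)
      where
      at : ∀ k → shift (s ℕ.* d) (dil d f) (k ℕ.* d) ≡ shift s f k
      at k with ℕP.<-≤-connex k s
      ... | Data.Sum.inj₁ k<s = trans (shift-below (s ℕ.* d) (dil d f) (ℕP.*-monoˡ-< d k<s)) (sym (shift-below s f k<s))
      ... | Data.Sum.inj₂ s≤k = begin
        shift (s ℕ.* d) (dil d f) (k ℕ.* d)                        ≡⟨ cong (λ j → shift (s ℕ.* d) (dil d f) (j ℕ.* d)) (sym (ℕP.m+[n∸m]≡n s≤k)) ⟩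
        shift (s ℕ.* d) (dil d f) ((s ℕ.+ (k ∸ s)) ℕ.* d)          ≡⟨ cong (shift (s ℕ.* d) (dil d f)) (ℕP.*-distribʳ-+ d s (k ∸ s)) ⟩
        shift (s ℕ.* d) (dil d f) (s ℕ.* d ℕ.+ (k ∸ s) ℕ.* d)      ≡⟨ shift-at (s ℕ.* d) (dil d f) ((k ∸ s) ℕ.* d) ⟩
        dil d f ((k ∸ s) ℕ.* d)                                    ≡⟨ dil-at f (k ∸ s) ⟩
        f (k ∸ s)                                                  ≡⟨ sym (shift-at s f (k ∸ s)) ⟩
        shift s f (s ℕ.+ (k ∸ s))                                  ≡⟨ cong (shift s f) (ℕP.m+[n∸m]≡n s≤k) ⟩
        shift s f k                                                ∎
        where open ≡-Reasoning
      off : ∀ n → ¬ d ∣ n → shift (s ℕ.* d) (dil d f) n ≡ 0ℚ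
      off n d∤n with ℕP.<-≤-connex n (s ℕ.* d)
      ... | Data.Sum.inj₁ n<sd = shift-below (s ℕ.* d) (dil d f) n<sd
      ... | Data.Sum.inj₂ sd≤n = trans (cong (shift (s ℕ.* d) (dil d f)) (sym eq))
        (trans (shift-at (s ℕ.* d) (dil d f) (n ∸ s ℕ.* d))
          (dil-off f (n ∸ s ℕ.* d) λ d∣ → d∤n (subst (d ∣_) eq (∣m∣n⇒∣m+n (n∣m*n s) d∣))))
        where
        eq : s ℕ.* d ℕ.+ (n ∸ s ℕ.* d) ≡ n
        eq = ℕP.m+[n∸m]≡n sd≤n

    dil-one : dil d oneₛ ≈ oneₛ
    dil-one n = sym (dil-unique oneₛ oneₛ at off n)
      where
      at : ∀ k → oneₛ (k ℕ.* d) ≡ oneₛ k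
      at zero    = refl
      at (suc k) = cong (λ m → if m ℕ.≡ᵇ 0 then 1ℚ else 0ℚ) (sym (ℕP.suc-pred (d ℕ.+ k ℕ.* d)
          {{ℕ.>-nonZero (ℕP.≤-trans (ℕ.>-nonZero⁻¹ d) (ℕP.m≤m+n d (k ℕ.* d)))}}))
      off : ∀ n → ¬ d ∣ n → oneₛ n ≡ 0ℚ
      off zero    d∤0 = contradiction (d ∣0) d∤0
      off (suc n) _   = refl

    dil-mono : ∀ s → dil d (mono s) ≈ mono (s ℕ.* d)
    dil-mono s n = trans (dil-shift s oneₛ n) (shift-cong (s ℕ.* d) dil-one n)

  head-tail : ∀ f → f ≈ f 0 ·ₛ oneₛ +ₛ shift 1 (tail f)
  head-tail f zero    = sym (trans (cong (_+ 0ℚ) (ℚP.*-identityʳ (f 0))) (ℚP.+-identityʳ (f 0)))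
  head-tail f (suc n) = sym (trans (cong (_+ f (suc n)) (ℚP.*-zeroʳ (f 0))) (ℚP.+-identityˡ (f (suc n))))

  ⊛-head-tail : ∀ f g → f ⊛ g ≈ f 0 ·ₛ g +ₛ shift 1 (tail f ⊛ g)
  ⊛-head-tail f g zero    = sym (ℚP.+-identityʳ (f 0 * g 0))
  ⊛-head-tail f g (suc n) = ⊛-head f g n

  module _ (d : ℕ) .{{_ : NonZero d}} where

    private
      dil-split : ∀ f → dil d f ≈ f 0 ·ₛ oneₛ +ₛ shift d (dil d (tail f))
      dil-split f n = begin
        dil d f n                                             ≡⟨ dil-cong d (head-tail f) n ⟩
        dil d (f 0 ·ₛ oneₛ +ₛ shift 1 (tail f)) n             ≡⟨ dil-+ d (f 0 ·ₛ oneₛ) (shift 1 (tail f)) n ⟩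
        dil d (f 0 ·ₛ oneₛ) n + dil d (shift 1 (tail f)) n    ≡⟨ cong₂ _+_ (trans (dil-· d (f 0) oneₛ n) (cong (f 0 *_) (dil-one d n)))
                                                                  (trans (dil-shift d 1 (tail f) n)
                                                                      (cong (λ k → shift k (dil d (tail f)) n) (ℕP.*-identityˡ d))) ⟩
        f 0 * oneₛ n + shift d (dil d (tail f)) n             ∎
        where open ≡-Reasoning

    -- Strong induction on the degree: splitting f = f 0 + q · tail f, the second part of the
    -- product is multiplied by q^d after dilation, and its coefficient comes from degree n - d < n.
    dil-⊛ : ∀ f g → dil d (f ⊛ g) ≈ dil d f ⊛ dil d g
    dil-⊛ f g n = <-rec (λ n → ∀ f → dil d (f ⊛ g) n ≡ (dil d f ⊛ dil d g) n) step n f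
      where
      step : ∀ n → (∀ {m} → m < n → ∀ f → dil d (f ⊛ g) m ≡ (dil d f ⊛ dil d g) m) → ∀ f → dil d (f ⊛ g) n ≡ (dil d f ⊛ dil d g) n
      step n ih f = begin
        dil d (f ⊛ g) n
          ≡⟨ dil-cong d (⊛-head-tail f g) n ⟩
        dil d (f 0 ·ₛ g +ₛ shift 1 (tail f ⊛ g)) n
          ≡⟨ dil-+ d (f 0 ·ₛ g) (shift 1 (tail f ⊛ g)) n ⟩
        dil d (f 0 ·ₛ g) n + dil d (shift 1 (tail f ⊛ g)) n
          ≡⟨ cong₂ _+_ (dil-· d (f 0) g n) (trans (dil-shift d 1 (tail f ⊛ g) n) (cong (λ k → shift k (dil d (tail f ⊛ g)) n) (ℕP.*-identityˡ d))) ⟩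
        f 0 * dil d g n + shift d (dil d (tail f ⊛ g)) n
          ≡⟨ cong (λ z → f 0 * dil d g n + z) rec ⟩
        f 0 * dil d g n + shift d (dil d (tail f) ⊛ dil d g) n
          ≡⟨ cong₂ _+_ (sym (trans (·-⊛ (f 0) oneₛ (dil d g) n) (cong (f 0 *_) (⊛-identityˡ (dil d g) n))))
              (sym (shift-⊛ d (dil d (tail f)) (dil d g) n)) ⟩
        ((f 0 ·ₛ oneₛ) ⊛ dil d g) n + (shift d (dil d (tail f)) ⊛ dil d g) n
          ≡⟨ sym (⊛-distribʳ (dil d g) (f 0 ·ₛ oneₛ) (shift d (dil d (tail f))) n) ⟩
        ((f 0 ·ₛ oneₛ +ₛ shift d (dil d (tail f))) ⊛ dil d g) n
          ≡⟨ ⊛-congˡ≤ (dil d g) n (λ i _ → sym (dil-split f i)) ⟩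
        (dil d f ⊛ dil d g) n ∎
        where
        open ≡-Reasoning
        rec : shift d (dil d (tail f ⊛ g)) n ≡ shift d (dil d (tail f) ⊛ dil d g) n
        rec with ℕP.<-≤-connex n d
        ... | Data.Sum.inj₁ n<d = trans (shift-below d (dil d (tail f ⊛ g)) n<d) (sym (shift-below d (dil d (tail f) ⊛ dil d g) n<d))
        ... | Data.Sum.inj₂ d≤n = begin
          shift d (dil d (tail f ⊛ g)) n                    ≡⟨ cong (shift d (dil d (tail f ⊛ g))) (sym (ℕP.m+[n∸m]≡n d≤n)) ⟩
          shift d (dil d (tail f ⊛ g)) (d ℕ.+ (n ∸ d))      ≡⟨ shift-at d (dil d (tail f ⊛ g)) (n ∸ d) ⟩
          dil d (tail f ⊛ g) (n ∸ d)                        ≡⟨ ih (ℕP.∸-monoʳ-< (ℕ.>-nonZero⁻¹ d) d≤n) (tail f) ⟩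
          (dil d (tail f) ⊛ dil d g) (n ∸ d)                ≡⟨ sym (shift-at d (dil d (tail f) ⊛ dil d g) (n ∸ d)) ⟩
          shift d (dil d (tail f) ⊛ dil d g) (d ℕ.+ (n ∸ d)) ≡⟨ cong (shift d (dil d (tail f) ⊛ dil d g)) (ℕP.m+[n∸m]≡n d≤n) ⟩
          shift d (dil d (tail f) ⊛ dil d g) n              ∎

  dil-dil : ∀ c d .{{_ : NonZero c}} .{{_ : NonZero d}} f → dil c (dil d f) ≈ dil (c ℕ.* d) f
  dil-dil c d f n with c ∣? n
  ... | no c∤n = sym (dil-off (c ℕ.* d) {{ℕP.m*n≢0 c d}} f n λ cd∣n → c∤n (∣-trans (m∣m*n d) cd∣n))
  ... | yes (divides k eq) with d ∣? k
  ...   | yes (divides j eq′) = sym (trans (cong (dil (c ℕ.* d) f) n≡) (dil-at (c ℕ.* d) {{ℕP.m*n≢0 c d}} f j))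
    where
    n≡ : n ≡ j ℕ.* (c ℕ.* d)
    n≡ = trans eq (trans (cong (ℕ._* c) eq′) (trans (ℕP.*-assoc j d c) (cong (j ℕ.*_) (ℕP.*-comm d c))))
  ...   | no d∤k = sym (dil-off (c ℕ.* d) {{ℕP.m*n≢0 c d}} f n λ cd∣n → d∤k (*-cancelˡ-∣ c (subst (c ℕ.* d ∣_) (trans eq (ℕP.*-comm k c)) cd∣n)))

open Substitution

-- Generating series of indexed families

module Families where

  open import Data.Nat.Divisibility using (_∣_; divides)
  open import Data.Rational using (_+_; _*_)
  open import Data.List using (List; []; _∷_; _++_; map; filter; upTo; cartesianProduct)
  open import Data.List.Membership.Propositional using (_∈_)
  open import Data.List.Membership.Propositional.Properties
  open import Data.List.Membership.Propositional.Properties.WithK using (unique∧set⇒bag)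
  open import Data.List.Relation.Unary.Unique.Propositional using (Unique)
  open import Data.List.Relation.Binary.Permutation.Propositional as ↭ using (_↭_)
  open import Data.List.Relation.Binary.BagAndSetEquality using (∼bag⇒↭)
  open import Data.Sum using (_⊎_; inj₁; inj₂; [_,_])
  open import Data.Sum.Properties using (inj₁-injective; inj₂-injective)

  private variable I K : Set

  ∑ : List I → (I → ℚ) → ℚ
  ∑ []       f = 0ℚ
  ∑ (i ∷ is) f = f i + ∑ is f

  ∑-cong : ∀ (is : List I) {f g} → (∀ i → f i ≡ g i) → ∑ is f ≡ ∑ is g
  ∑-cong []       h = refl
  ∑-cong (i ∷ is) h = cong₂ _+_ (h i) (∑-cong is h)

  ∑-++ : ∀ (is js : List I) f → ∑ (is ++ js) f ≡ ∑ is f + ∑ js f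
  ∑-++ []       js f = sym (ℚP.+-identityˡ (∑ js f))
  ∑-++ (i ∷ is) js f = trans (cong (λ z → f i + z) (∑-++ is js f)) (sym (ℚP.+-assoc (f i) (∑ is f) (∑ js f)))

  ∑-map : ∀ (g : I → K) is f → ∑ (map g is) f ≡ ∑ is (f ∘ g)
  ∑-map g []       f = refl
  ∑-map g (i ∷ is) f = cong (λ z → f (g i) + z) (∑-map g is f)

  ∑-*ˡ : ∀ (is : List I) c f → ∑ is (λ i → c * f i) ≡ c * ∑ is f
  ∑-*ˡ []       c f = sym (ℚP.*-zeroʳ c)
  ∑-*ˡ (i ∷ is) c f = trans (cong (λ z → c * f i + z) (∑-*ˡ is c f)) (sym (ℚP.*-distribˡ-+ c (f i) (∑ is f)))

  ∑-+ : ∀ (is : List I) f g → ∑ is (λ i → f i + g i) ≡ ∑ is f + ∑ is g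
  ∑-+ []       f g = refl
  ∑-+ (i ∷ is) f g = trans (cong (λ z → f i + g i + z) (∑-+ is f g)) (lemma (f i) (g i) (∑ is f) (∑ is g))
    where
    lemma : ∀ a b c d → a + b + (c + d) ≡ a + c + (b + d)
    lemma = solve 4 (λ a b c d → a :+ b :+ (c :+ d) := a :+ c :+ (b :+ d)) refl
      where open +-*-Solver

  ∑-↭ : ∀ {is js : List I} f → is ↭ js → ∑ is f ≡ ∑ js f
  ∑-↭ f ↭.refl = refl
  ∑-↭ f (↭.prep i p) = cong (λ z → f i + z) (∑-↭ f p)
  ∑-↭ f (↭.swap {xs} {ys} i j p) = trans (cong (λ z → f i + (f j + z)) (∑-↭ f p)) (lemma (f i) (f j) (∑ ys f))
    where
    lemma : ∀ a b c → a + (b + c) ≡ b + (a + c)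
    lemma = solve 3 (λ a b c → a :+ (b :+ c) := b :+ (a :+ c)) refl
      where open +-*-Solver
  ∑-↭ f (↭.trans p p′) = trans (∑-↭ f p) (∑-↭ f p′)

  ∑-filter : ∀ (is : List I) f → ∑ (filter (λ i → ¬? (f i ℚP.≟ 0ℚ)) is) f ≡ ∑ is f
  ∑-filter []       f = refl
  ∑-filter (i ∷ is) f with f i ℚP.≟ 0ℚ
  ... | yes fi≡0 = trans (∑-filter is f) (sym (trans (cong (_+ ∑ is f) fi≡0) (ℚP.+-identityˡ (∑ is f))))
  ... | no  _    = cong (λ z → f i + z) (∑-filter is f)

  -- After the indices with value 0 are removed, two duplicate-free lists that both cover the
  -- support are permutations of each other.
  ∑-support : ∀ {is js : List I} f → Unique is → Unique js →
    (∀ i → f i ≢ 0ℚ → i ∈ is) → (∀ i → f i ≢ 0ℚ → i ∈ js) → ∑ is f ≡ ∑ js f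
  ∑-support {is = is} {js} f uis ujs ⊆is ⊆js = begin
    ∑ is f             ≡⟨ sym (∑-filter is f) ⟩
    ∑ (filter P? is) f ≡⟨ ∑-↭ f (∼bag⇒↭ (unique∧set⇒bag (Unique.filter⁺ P? uis) (Unique.filter⁺ P? ujs) (mk⇔ (to is js ⊆js) (to js is ⊆is)))) ⟩
    ∑ (filter P? js) f ≡⟨ ∑-filter js f ⟩
    ∑ js f             ∎
    where
    open ≡-Reasoning
    P? = λ i → ¬? (f i ℚP.≟ 0ℚ)
    to : ∀ ks ls → (∀ i → f i ≢ 0ℚ → i ∈ ls) → ∀ {i} → i ∈ filter P? ks → i ∈ filter P? ls
    to ks ls ⊆ls i∈ with ∈-filter⁻ P? {xs = ks} i∈
    ... | _ , fi≢0 = ∈-filter⁺ P? (⊆ls _ fi≢0) fi≢0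

  -- Stands for Σ_i coeff i · q^{exponent i}; enum n may also contain indices of exponent other than n.
  record Family : Set₁ where
    field
      Index    : Set
      exponent : Index → ℕ
      coeff    : Index → ℚ
      enum     : ℕ → List Index
      unique   : ∀ n → Unique (enum n)
      complete : ∀ n i → exponent i ≤ n → i ∈ enum n

  open Family

  mono-off : ∀ k n → k ≢ n → mono k n ≡ 0ℚ
  mono-off zero    zero    k≢n = contradiction refl k≢n
  mono-off zero    (suc n) k≢n = refl
  mono-off (suc k) zero    k≢n = refl
  mono-off (suc k) (suc n) k≢n = mono-off k n (k≢n ∘ cong suc)

  mono-at : ∀ k → mono k k ≡ 1ℚ
  mono-at zero    = refl
  mono-at (suc k) = mono-at k

  term : (F : Family) → ℕ → Index F → ℚ
  term F n i = coeff F i * mono (exponent F i) n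

  gf : Family → PS
  gf F n = ∑ (enum F n) (term F n)

  private
    term≢0 : ∀ F n i → term F n i ≢ 0ℚ → exponent F i ≡ n
    term≢0 F n i t≢0 with exponent F i ℕ.≟ n
    ... | yes e≡n = e≡n
    ... | no  e≢n = contradiction (trans (cong (coeff F i *_) (mono-off (exponent F i) n e≢n)) (ℚP.*-zeroʳ (coeff F i))) t≢0

  gf-enum : ∀ F n {is} → Unique is → (∀ i → exponent F i ≡ n → i ∈ is) → gf F n ≡ ∑ is (term F n)
  gf-enum F n uis ⊆is = ∑-support (term F n) (unique F n) uis
    (λ i t≢0 → complete F n i (ℕP.≤-reflexive (term≢0 F n i t≢0))) (λ i t≢0 → ⊆is i (term≢0 F n i t≢0))

  record _≅_ (F G : Family) : Set where
    field
      to       : Index F → Index G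
      from     : Index G → Index F
      to-from  : ∀ j → to (from j) ≡ j
      from-to  : ∀ i → from (to i) ≡ i
      exponent-to : ∀ i → exponent G (to i) ≡ exponent F i
      coeff-to    : ∀ i → coeff G (to i) ≡ coeff F i

  gf-≅ : ∀ {F G} → F ≅ G → gf F ≈ gf G
  gf-≅ {F} {G} iso n = sym (begin
    gf G n                                  ≡⟨ gf-enum G n (Unique.map⁺ inj (unique F n)) cover ⟩
    ∑ (map to (enum F n)) (term G n)        ≡⟨ ∑-map to (enum F n) (term G n) ⟩
    ∑ (enum F n) (term G n ∘ to)            ≡⟨ ∑-cong (enum F n) (λ i → cong₂ (λ w e → w * mono e n) (coeff-to i) (exponent-to i)) ⟩
    gf F n                                  ∎)
    where
    open _≅_ iso
    open ≡-Reasoning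
    inj : ∀ {i j} → to i ≡ to j → i ≡ j
    inj {i} {j} eq = trans (sym (from-to i)) (trans (cong from eq) (from-to j))
    cover : ∀ j → exponent G j ≡ n → j ∈ map to (enum F n)
    cover j e≡n = subst (_∈ map to (enum F n)) (to-from j) (∈-map⁺ to (complete F n (from j)
      (ℕP.≤-reflexive (trans (sym (exponent-to (from j))) (trans (cong (exponent G) (to-from j)) e≡n)))))

  _⊕_ : Family → Family → Family
  F ⊕ G = record
    { Index    = Index F ⊎ Index G
    ; exponent = [ exponent F , exponent G ]
    ; coeff    = [ coeff F , coeff G ]
    ; enum     = λ n → map inj₁ (enum F n) ++ map inj₂ (enum G n)
    ; unique   = λ n → Unique.++⁺ (Unique.map⁺ inj₁-injective (unique F n)) (Unique.map⁺ inj₂-injective (unique G n)) (disjoint n)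
    ; complete = λ where
        n (inj₁ i) e≤n → ∈-++⁺ˡ (∈-map⁺ inj₁ (complete F n i e≤n))
        n (inj₂ j) e≤n → ∈-++⁺ʳ (map inj₁ (enum F n)) (∈-map⁺ inj₂ (complete G n j e≤n))
    }
    where
    disjoint : ∀ n {x} → ¬ (x ∈ map inj₁ (enum F n) × x ∈ map inj₂ (enum G n))
    disjoint n (p , p′) with ∈-map⁻ inj₁ p | ∈-map⁻ inj₂ p′
    ... | _ , _ , refl | _ , _ , ()
  infixr 6 _⊕_

  gf-⊕ : ∀ F G → gf (F ⊕ G) ≈ gf F +ₛ gf G
  gf-⊕ F G n = trans (∑-++ (map inj₁ (enum F n)) (map inj₂ (enum G n)) (term (F ⊕ G) n))
    (cong₂ _+_ (∑-map inj₁ (enum F n) (term (F ⊕ G) n)) (∑-map inj₂ (enum G n) (term (F ⊕ G) n)))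

  _⊗_ : Family → Family → Family
  F ⊗ G = record
    { Index    = Index F × Index G
    ; exponent = λ (i , j) → exponent F i ℕ.+ exponent G j
    ; coeff    = λ (i , j) → coeff F i * coeff G j
    ; enum     = λ n → cartesianProduct (enum F n) (enum G n)
    ; unique   = λ n → Unique.cartesianProduct⁺ (unique F n) (unique G n)
    ; complete = λ n (i , j) e≤n → ∈-cartesianProduct⁺
        (complete F n i (ℕP.≤-trans (ℕP.m≤m+n (exponent F i) (exponent G j)) e≤n))
        (complete G n j (ℕP.≤-trans (ℕP.m≤n+m (exponent G j) (exponent F i)) e≤n))
    }
  infixr 7 _⊗_

  private
    polynomial : (F : Family) → List (Index F) → PS
    polynomial F is n = ∑ is (term F n)

    gf≈polynomial : ∀ F N n → n ≤ N → gf F n ≡ polynomial F (enum F N) n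
    gf≈polynomial F N n n≤N = gf-enum F n (unique F N) (λ i e≡n → complete F N i (subst (_≤ N) (sym e≡n) n≤N))

    polynomial-⊗ : ∀ F G is js → polynomial F is ⊛ polynomial G js ≈ polynomial (F ⊗ G) (cartesianProduct is js)
    polynomial-⊗ F G []       js n = sumTo-0 n λ i _ → ℚP.*-zeroˡ (polynomial G js (n ℕ.∸ i))
    polynomial-⊗ F G (i ∷ is) js n = begin
      (polynomial F (i ∷ is) ⊛ polynomial G js) n
        ≡⟨ ⊛-distribʳ (polynomial G js) (coeff F i ·ₛ mono (exponent F i)) (polynomial F is) n ⟩
      ((coeff F i ·ₛ mono (exponent F i)) ⊛ polynomial G js) n + (polynomial F is ⊛ polynomial G js) n
        ≡⟨ cong₂ _+_ (monomial-⊗ js n) (polynomial-⊗ F G is js n) ⟩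
      polynomial (F ⊗ G) (map (i ,_) js) n + polynomial (F ⊗ G) (cartesianProduct is js) n
        ≡⟨ sym (∑-++ (map (i ,_) js) (cartesianProduct is js) (term (F ⊗ G) n)) ⟩
      polynomial (F ⊗ G) (cartesianProduct (i ∷ is) js) n ∎
      where
      open ≡-Reasoning
      m = coeff F i ·ₛ mono (exponent F i)
      monomial-⊗ : ∀ js → m ⊛ polynomial G js ≈ polynomial (F ⊗ G) (map (i ,_) js)
      monomial-⊗ []       n = sumTo-0 n λ k _ → ℚP.*-zeroʳ (m k)
      monomial-⊗ (j ∷ js) n = begin
        (m ⊛ polynomial G (j ∷ js)) n
          ≡⟨ R.distribˡ m (coeff G j ·ₛ mono (exponent G j)) (polynomial G js) n ⟩
        (m ⊛ (coeff G j ·ₛ mono (exponent G j))) n + (m ⊛ polynomial G js) n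
          ≡⟨ cong₂ _+_ product (monomial-⊗ js n) ⟩
        term (F ⊗ G) n (i , j) + polynomial (F ⊗ G) (map (i ,_) js) n ∎
        where
        w = coeff F i
        w′ = coeff G j
        e = exponent F i
        e′ = exponent G j
        product : (m ⊛ (w′ ·ₛ mono e′)) n ≡ w * w′ * mono (e ℕ.+ e′) n
        product = begin
          (m ⊛ (w′ ·ₛ mono e′)) n          ≡⟨ ·-⊛ w (mono e) (w′ ·ₛ mono e′) n ⟩
          w * (mono e ⊛ (w′ ·ₛ mono e′)) n ≡⟨ cong (w *_) (trans (⊛-comm (mono e) (w′ ·ₛ mono e′) n) (·-⊛ w′ (mono e′) (mono e) n)) ⟩
          w * (w′ * (mono e′ ⊛ mono e) n)  ≡⟨ sym (ℚP.*-assoc w w′ ((mono e′ ⊛ mono e) n)) ⟩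
          w * w′ * (mono e′ ⊛ mono e) n    ≡⟨ cong (w * w′ *_) (trans (⊛-comm (mono e′) (mono e) n) (sym (mono-+ e e′ n))) ⟩
          w * w′ * mono (e ℕ.+ e′) n       ∎

  -- In degree n both factors may be replaced by the polynomials over the finite lists `enum n`, for
  -- which the product is plain distributivity.
  gf-⊗ : ∀ F G → gf (F ⊗ G) ≈ gf F ⊛ gf G
  gf-⊗ F G n = sym (begin
    (gf F ⊛ gf G) n
      ≡⟨ ⊛-congˡ≤ (gf G) n (λ i i≤n → gf≈polynomial F n i i≤n) ⟩
    (polynomial F (enum F n) ⊛ gf G) n
      ≡⟨ ⊛-congʳ≤ (polynomial F (enum F n)) n (λ i i≤n → gf≈polynomial G n i i≤n) ⟩
    (polynomial F (enum F n) ⊛ polynomial G (enum G n)) n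
      ≡⟨ polynomial-⊗ F G (enum F n) (enum G n) n ⟩
    gf (F ⊗ G) n ∎)
    where open ≡-Reasoning

  reweight : (F : Family) → (Index F → ℚ) → Family
  reweight F w = record { Index = Index F ; exponent = exponent F ; coeff = w ; enum = enum F ; unique = unique F ; complete = complete F }

  scale : ℚ → Family → Family
  scale c F = reweight F (λ i → c * coeff F i)

  gf-scale : ∀ c F → gf (scale c F) ≈ c ·ₛ gf F
  gf-scale c F n = trans (∑-cong (enum F n) λ i → ℚP.*-assoc c (coeff F i) (mono (exponent F i) n)) (∑-*ˡ (enum F n) c (term F n))

  gf-reweight-+ : ∀ F w w′ → gf (reweight F (λ i → w i + w′ i)) ≈ gf (reweight F w) +ₛ gf (reweight F w′)
  gf-reweight-+ F w w′ n = trans (∑-cong (enum F n) λ i → ℚP.*-distribʳ-+ (mono (exponent F i) n) (w i) (w′ i))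
    (∑-+ (enum F n) (term (reweight F w) n) (term (reweight F w′) n))

  raise : ℕ → Family → Family
  raise s F = record
    { Index = Index F ; exponent = λ i → s ℕ.+ exponent F i ; coeff = coeff F ; enum = enum F ; unique = unique F
    ; complete = λ n i e≤n → complete F n i (ℕP.≤-trans (ℕP.m≤n+m (exponent F i) s) e≤n) }

  gf-raise : ∀ s F → gf (raise s F) ≈ shift s (gf F)
  gf-raise s F n with ℕP.<-≤-connex n s
  ... | inj₁ n<s = trans (∑0 (enum F n)) (sym (shift-below s (gf F) n<s))
    where
    ∑0 : ∀ is → ∑ is (term (raise s F) n) ≡ 0ℚ
    ∑0 []       = refl
    ∑0 (i ∷ is) = cong₂ _+_ (trans (cong (coeff F i *_) (mono-off (s ℕ.+ exponent F i) n
      λ e≡n → ℕP.<-irrefl refl (ℕP.≤-trans n<s (ℕP.≤-trans (ℕP.m≤m+n s (exponent F i)) (ℕP.≤-reflexive e≡n))))) (ℚP.*-zeroʳ (coeff F i))) (∑0 is)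
  ... | inj₂ s≤n = begin
    gf (raise s F) n                                     ≡⟨ cong (gf (raise s F)) (sym eq) ⟩
    gf (raise s F) (s ℕ.+ (n ℕ.∸ s))                     ≡⟨ ∑-cong (enum F (s ℕ.+ (n ℕ.∸ s))) (λ i → cong (coeff F i *_)
                                                              (trans (sym (shift-shift s (exponent F i) oneₛ (s ℕ.+ (n ℕ.∸ s))))
                                                                  (shift-at s (mono (exponent F i)) (n ℕ.∸ s)))) ⟩
    ∑ (enum F (s ℕ.+ (n ℕ.∸ s))) (term F (n ℕ.∸ s))      ≡⟨ sym (gf≈polynomial F (s ℕ.+ (n ℕ.∸ s)) (n ℕ.∸ s) (ℕP.m≤n+m (n ℕ.∸ s) s)) ⟩
    gf F (n ℕ.∸ s)                                       ≡⟨ sym (shift-at s (gf F) (n ℕ.∸ s)) ⟩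
    shift s (gf F) (s ℕ.+ (n ℕ.∸ s))                     ≡⟨ cong (shift s (gf F)) eq ⟩
    shift s (gf F) n                                     ∎
    where
    open ≡-Reasoning
    eq = ℕP.m+[n∸m]≡n s≤n

  dilate : (d : ℕ) .{{_ : NonZero d}} → Family → Family
  dilate d F = record
    { Index = Index F ; exponent = λ i → exponent F i ℕ.* d ; coeff = coeff F ; enum = enum F ; unique = unique F
    ; complete = λ n i e≤n → complete F n i (ℕP.≤-trans (ℕP.m≤m*n (exponent F i) d) e≤n) }

  gf-dilate : ∀ d .{{_ : NonZero d}} F → gf (dilate d F) ≈ dil d (gf F)
  gf-dilate d F = dil-unique d (gf F) (gf (dilate d F)) at off
    where
    at : ∀ k → gf (dilate d F) (k ℕ.* d) ≡ gf F k
    at k = trans (∑-cong (enum F (k ℕ.* d)) λ i → cong (coeff F i *_)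
        (trans (sym (dil-mono d (exponent F i) (k ℕ.* d))) (dil-at d (mono (exponent F i)) k)))
      (sym (gf≈polynomial F (k ℕ.* d) k (ℕP.m≤m*n k d)))
    off : ∀ n → ¬ d ∣ n → gf (dilate d F) n ≡ 0ℚ
    off n d∤n = ∑0 (enum F n)
      where
      ∑0 : ∀ is → ∑ is (term (dilate d F) n) ≡ 0ℚ
      ∑0 []       = refl
      ∑0 (i ∷ is) = cong₂ _+_ (trans (cong (coeff F i *_) (mono-off (exponent F i ℕ.* d) n
        λ e≡n → d∤n (divides (exponent F i) (sym e≡n)))) (ℚP.*-zeroʳ (coeff F i))) (∑0 is)

  -- The bound makes the enumeration finite. The extra 1 is needed because k(k+1)/2 already vanishes
  -- at k = - 1.
  intFamily : (e : ℤ → ℕ) → (ℤ → ℚ) → (∀ k → ℤ.∣ k ∣ ≤ suc (e k)) → Family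
  intFamily e w bound = record
    { Index = ℤ ; exponent = e ; coeff = w
    ; enum = λ n → map ℤ.+_ (upTo (suc (suc n))) ++ map -[1+_] (upTo (suc n))
    ; unique = λ n → Unique.++⁺ (Unique.map⁺ ℤP.+-injective (Unique.upTo⁺ (suc (suc n)))) (Unique.map⁺ ℤP.-[1+-injective (Unique.upTo⁺ (suc n)))
        (disjoint n)
    ; complete = λ where
        n (ℤ.+ k)  e≤n → ∈-++⁺ˡ (∈-map⁺ ℤ.+_ (∈-upTo⁺ (s≤s (ℕP.≤-trans (bound (ℤ.+ k)) (s≤s e≤n)))))
        n -[1+ k ] e≤n → ∈-++⁺ʳ (map ℤ.+_ (upTo (suc (suc n)))) (∈-map⁺ -[1+_] (∈-upTo⁺ (ℕP.≤-trans (bound -[1+ k ]) (s≤s e≤n))))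
    }
    where
    disjoint : ∀ n {x} → ¬ (x ∈ map ℤ.+_ (upTo (suc (suc n))) × x ∈ map -[1+_] (upTo (suc n)))
    disjoint n (p , p′) with ∈-map⁻ ℤ.+_ p | ∈-map⁻ -[1+_] p′
    ... | _ , _ , refl | _ , _ , ()

open Families

-- Logarithmic derivatives and Lambert series

module LogarithmicDerivatives where

  open import Data.Nat.Divisibility
  open import Data.Rational using (_+_; _*_; -_)

  Θ : PS → PS
  Θ f n = ℕ→ℚ n * f n

  Θ-cong : ∀ {f g} → f ≈ g → Θ f ≈ Θ g
  Θ-cong h n = cong (ℕ→ℚ n *_) (h n)

  -- The Leibniz rule for q d/dq: in each summand of the coefficient n = i + (n - i).
  Θ-⊛ : ∀ f g → Θ (f ⊛ g) ≈ Θ f ⊛ g +ₛ f ⊛ Θ g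
  Θ-⊛ f g n = begin
    ℕ→ℚ n * sumTo n (λ i → f i * g (n ∸ i))                                        ≡⟨ sym (sumTo-*ˡ n (ℕ→ℚ n) (λ i → f i * g (n ∸ i))) ⟩
    sumTo n (λ i → ℕ→ℚ n * (f i * g (n ∸ i)))                                      ≡⟨ sumTo-cong n split ⟩
    sumTo n (λ i → ℕ→ℚ i * f i * g (n ∸ i) + f i * (ℕ→ℚ (n ∸ i) * g (n ∸ i)))      ≡⟨ sumTo-+ n (λ i → Θ f i * g (n ∸ i)) (λ i → f i * Θ g (n ∸ i)) ⟩
    (Θ f ⊛ g +ₛ f ⊛ Θ g) n                                                         ∎
    where
    open ≡-Reasoning
    leibniz : ∀ i j x y → (i + j) * (x * y) ≡ i * x * y + x * (j * y)
    leibniz = solve 4 (λ i j x y → (i :+ j) :* (x :* y) := i :* x :* y :+ x :* (j :* y)) refl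
      where open +-*-Solver
    split : ∀ i → i ≤ n → ℕ→ℚ n * (f i * g (n ∸ i)) ≡ ℕ→ℚ i * f i * g (n ∸ i) + f i * (ℕ→ℚ (n ∸ i) * g (n ∸ i))
    split i i≤n = trans (cong (_* (f i * g (n ∸ i))) (trans (cong ℕ→ℚ (sym (ℕP.m+[n∸m]≡n i≤n))) (fromℤ-+ (+ i) (+ (n ∸ i)))))
      (leibniz (ℕ→ℚ i) (ℕ→ℚ (n ∸ i)) (f i) (g (n ∸ i)))

  -- q f′ = − Λ f, so that Λ = Σ e_m m q^m/(1 − q^m) when f = Π (1 − q^m)^{e_m}.
  record LogDeriv (f Λ : PS) : Set where
    constructor logDeriv
    field
      head≡1 : f 0 ≡ 1ℚ
      ode    : Θ f ≈ -ₛ (Λ ⊛ f)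

  open LogDeriv

  logDeriv-resp : ∀ {f f′ Λ Λ′} → f ≈ f′ → Λ ≈ Λ′ → LogDeriv f Λ → LogDeriv f′ Λ′
  logDeriv-resp {f} {f′} {Λ} {Λ′} f≈ Λ≈ (logDeriv h o) = logDeriv (trans (sym (f≈ 0)) h)
    (λ n → trans (sym (Θ-cong f≈ n)) (trans (o n) (cong -_ (⊛-cong Λ≈ f≈ n))))

  logDeriv-one : LogDeriv oneₛ 0ₛ
  logDeriv-one = logDeriv refl λ where
    zero    → refl
    (suc n) → trans (ℚP.*-zeroʳ (ℕ→ℚ (suc n))) (sym (cong -_ (sumTo-0 (suc n) λ i _ → ℚP.*-zeroˡ (oneₛ (suc n ∸ i)))))

  logDeriv-⊛ : ∀ {f g Λ Λ′} → LogDeriv f Λ → LogDeriv g Λ′ → LogDeriv (f ⊛ g) (Λ +ₛ Λ′)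
  logDeriv-⊛ {f} {g} {Λ} {Λ′} (logDeriv hf of) (logDeriv hg og) = logDeriv (cong₂ _*_ hf hg) λ n →
    trans (Θ-⊛ f g n) (trans (cong₂ _+_ (⊛-cong {g = g} of (λ _ → refl) n) (⊛-cong {f = f} (λ _ → refl) og n))
      (solve 4 (λ f g l l′ → (:- (l :* f)) :* g :+ f :* (:- (l′ :* g)) := :- ((l :+ l′) :* (f :* g))) (λ _ → refl) f g Λ Λ′ n))
    where open PSSolver

  private
    suc≢0 : ∀ n → ℕ→ℚ (suc n) ≢ 0ℚ
    suc≢0 n eq with fromℤ-injective {+ suc n} {+ 0} eq
    ... | ()

    cancel-suc : ∀ n {x y} → ℕ→ℚ (suc n) * x ≡ ℕ→ℚ (suc n) * y → x ≡ y
    cancel-suc n {x} {y} eq = begin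
      x                   ≡⟨ sym (undo x) ⟩
      ℚ.1/ c * (c * x)    ≡⟨ cong (ℚ.1/ c *_) eq ⟩
      ℚ.1/ c * (c * y)    ≡⟨ undo y ⟩
      y                   ∎
      where
      open ≡-Reasoning
      c = ℕ→ℚ (suc n)
      instance
        c≢0 : ℚ.NonZero c
        c≢0 = ℚ.≢-nonZero (suc≢0 n)
      undo : ∀ x → ℚ.1/ c * (c * x) ≡ x
      undo x = trans (sym (ℚP.*-assoc (ℚ.1/ c) c x)) (trans (cong (_* x) (ℚP.*-inverseˡ c)) (ℚP.*-identityˡ x))

  logDeriv-Λ0 : ∀ {f Λ} → LogDeriv f Λ → Λ 0 ≡ 0ℚ
  logDeriv-Λ0 {f} {Λ} (logDeriv h o) = begin
    Λ 0               ≡⟨ sym (ℚP.*-identityʳ (Λ 0)) ⟩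
    Λ 0 * 1ℚ          ≡⟨ cong (Λ 0 *_) (sym h) ⟩
    Λ 0 * f 0         ≡⟨ sym (neg-neg (Λ 0 * f 0)) ⟩
    - - (Λ 0 * f 0)   ≡⟨ cong -_ (sym (o 0)) ⟩
    - (0ℚ * f 0)      ≡⟨ cong -_ (ℚP.*-zeroˡ (f 0)) ⟩
    0ℚ                ∎
    where
    open ≡-Reasoning
    neg-neg : ∀ x → - - x ≡ x
    neg-neg = solve 1 (λ x → :- (:- x) := x) refl
      where open +-*-Solver

  -- As Λ 0 = 0, the differential equation reads (n + 1) f (n + 1) = - Σ Λ (i + 1) f (n - i): a
  -- recursion for f from f 0 = 1 that in degree n uses Λ only up to degree n. The truncated form is
  -- what makes limits of products accessible.
  logDeriv-unique≤ : ∀ {f g Λ Λ′} → LogDeriv f Λ → LogDeriv g Λ′ → ∀ N → (∀ i → i ≤ N → Λ i ≡ Λ′ i) → ∀ n → n ≤ N → f n ≡ g n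
  logDeriv-unique≤ {f} {g} {Λ} {Λ′} lf lg N Λ≡ n n≤N = below n n ℕP.≤-refl n≤N
    where
    step : ∀ {f Λ} → LogDeriv f Λ → ∀ n → ℕ→ℚ (suc n) * f (suc n) ≡ - (tail Λ ⊛ f) n
    step {f} {Λ} lf n = trans (ode lf (suc n)) (cong -_ (trans (⊛-head Λ f n)
      (trans (cong (λ z → z * f (suc n) + (tail Λ ⊛ f) n) (logDeriv-Λ0 lf))
          (trans (cong (_+ (tail Λ ⊛ f) n) (ℚP.*-zeroˡ (f (suc n)))) (ℚP.+-identityˡ ((tail Λ ⊛ f) n))))))
    below : ∀ m n → n ≤ m → n ≤ N → f n ≡ g n
    below m       zero    _         _   = trans (head≡1 lf) (sym (head≡1 lg))
    below (suc m) (suc n) (s≤s n≤m) n<N = cancel-suc n (trans (step lf n) (trans (cong -_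
      (trans (⊛-congˡ≤ f n λ i i≤n → Λ≡ (suc i) (ℕP.≤-trans (s≤s i≤n) n<N))
             (⊛-congʳ≤ (tail Λ′) n λ i i≤n → below m i (ℕP.≤-trans i≤n n≤m) (ℕP.≤-trans i≤n (ℕP.<⇒≤ n<N))))) (sym (step lg n))))

  logDeriv-unique : ∀ {f g Λ Λ′} → LogDeriv f Λ → LogDeriv g Λ′ → Λ ≈ Λ′ → f ≈ g
  logDeriv-unique lf lg Λ≈ n = logDeriv-unique≤ lf lg n (λ i _ → Λ≈ i) n ℕP.≤-refl

  -- The equation in degree n involves finitely many coefficients, so it passes to infinite products
  -- from approximations that are exact up to degree n.
  logDeriv-limit : ∀ {f Λ} → (∀ n → ∃ λ g → ∃ λ Λ′ → LogDeriv g Λ′ × (∀ i → i ≤ n → f i ≡ g i) × (∀ i → i ≤ n → Λ i ≡ Λ′ i)) → LogDeriv f Λ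
  logDeriv-limit {f} {Λ} approx = logDeriv head ode′
    where
    head : f 0 ≡ 1ℚ
    head with approx 0
    ... | g , Λ′ , lg , f≡ , _ = trans (f≡ 0 z≤n) (head≡1 lg)
    ode′ : Θ f ≈ -ₛ (Λ ⊛ f)
    ode′ n with approx n
    ... | g , Λ′ , lg , f≡ , Λ≡ = trans (cong (ℕ→ℚ n *_) (f≡ n ℕP.≤-refl)) (trans (ode lg n)
      (cong -_ (sym (trans (⊛-congˡ≤ f n Λ≡) (⊛-congʳ≤ Λ′ n f≡)))))

  -- Gives the logarithmic derivative of a quotient known only through `f ⊛ g ≈ h`. Leibniz applied
  -- to f g yields the equation for g multiplied by f, and f can be cancelled.
  logDeriv-quotient : ∀ {f g h Λ Λ′} → LogDeriv f Λ → LogDeriv h Λ′ → f ⊛ g ≈ h → LogDeriv g (Λ′ +ₛ (-ₛ Λ))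
  logDeriv-quotient {f} {g} {h} {Λ} {Λ′} lf lh fg≈h = logDeriv g0 (regular-cancel (regular-unit f (head≡1 lf)) (Θ g) _ eq)
    where
    g0 : g 0 ≡ 1ℚ
    g0 = trans (sym (ℚP.*-identityˡ (g 0))) (trans (cong (_* g 0) (sym (head≡1 lf))) (trans (fg≈h 0) (head≡1 lh)))
    eq : f ⊛ Θ g ≈ f ⊛ (-ₛ ((Λ′ +ₛ (-ₛ Λ)) ⊛ g))
    eq n = begin
      (f ⊛ Θ g) n                                               ≡⟨ solve 3 (λ u g t → u := (t :* g :+ u) :+ (:- (t :* g))) (λ _ → refl) (f ⊛ Θ g)
          g (Θ f) n ⟩
      (Θ f ⊛ g +ₛ f ⊛ Θ g) n + - (Θ f ⊛ g) n                    ≡⟨ cong₂ _+_ (sym (Θ-⊛ f g n)) (cong -_ (⊛-cong {g = g} (ode lf) (λ _ → refl) n)) ⟩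
      Θ (f ⊛ g) n + - ((-ₛ (Λ ⊛ f)) ⊛ g) n                      ≡⟨ cong (_+ - ((-ₛ (Λ ⊛ f)) ⊛ g) n)
          (trans (Θ-cong fg≈h n) (trans (ode lh n) (cong -_ (⊛-cong {f = Λ′} (λ _ → refl) (λ m → sym (fg≈h m)) n)))) ⟩
      - (Λ′ ⊛ (f ⊛ g)) n + - ((-ₛ (Λ ⊛ f)) ⊛ g) n               ≡⟨ solve
          4 (λ f g l l′ → :- (l′ :* (f :* g)) :+ (:- ((:- (l :* f)) :* g)) := f :* (:- ((l′ :+ (:- l)) :* g))) (λ _ → refl) f g Λ Λ′ n ⟩
      (f ⊛ (-ₛ ((Λ′ +ₛ (-ₛ Λ)) ⊛ g))) n                         ∎
      where
      open ≡-Reasoning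
      open PSSolver

  -- m q^m/(1 − q^m)
  lambert : ℕ → PS
  lambert m zero    = 0ℚ
  lambert m (suc n) with m ∣? suc n
  ... | yes _ = ℕ→ℚ m
  ... | no  _ = 0ℚ

  lambert≢0 : ∀ m n → lambert m n ≢ 0ℚ → 1 ≤ m × m ≤ n
  lambert≢0 m zero    l≢0 = contradiction refl l≢0
  lambert≢0 m (suc n) l≢0 with m ∣? suc n
  lambert≢0 zero    (suc n) l≢0 | yes m∣n = contradiction refl l≢0
  lambert≢0 (suc m) (suc n) l≢0 | yes m∣n = s≤s z≤n , ∣⇒≤ m∣n
  ... | no _ = contradiction refl l≢0

  oneMinus≈ : ∀ m → oneMinus (suc m) ≈ oneₛ +ₛ (-ₛ mono (suc m))
  oneMinus≈ m zero    = refl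
  oneMinus≈ m (suc n) with n ℕ.≟ m
  ... | yes refl = trans (cong (if_then - 1ℚ else 0ℚ) (≡ᵇ-refl n)) (sym (cong (λ z → 0ℚ + - z) (mono-at n)))
    where
    ≡ᵇ-refl : ∀ n → (n ≡ᵇ n) ≡ true
    ≡ᵇ-refl zero    = refl
    ≡ᵇ-refl (suc n) = ≡ᵇ-refl n
  ... | no  n≢m = trans (cong (if_then - 1ℚ else 0ℚ) (≡ᵇ-false n m n≢m)) (sym (cong (λ z → 0ℚ + - z) (mono-off m n (n≢m ∘ sym))))
    where
    ≡ᵇ-false : ∀ n m → n ≢ m → (n ≡ᵇ m) ≡ false
    ≡ᵇ-false zero    zero    ne = contradiction refl ne
    ≡ᵇ-false zero    (suc m) ne = refl
    ≡ᵇ-false (suc n) zero    ne = refl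
    ≡ᵇ-false (suc n) (suc m) ne = ≡ᵇ-false n m (ne ∘ cong suc)

  -- q^m/(1 − q^m), as the image of q/(1 − q) under q ↦ q^m
  private
    ones : PS
    ones n = 1ℚ

    oneMinus-ones : oneMinus 1 ⊛ ones ≈ oneₛ
    oneMinus-ones n = trans (⊛-cong {g = ones} (oneMinus≈ 0) (λ _ → refl) n) (trans (⊛-distribʳ ones oneₛ (-ₛ mono 1) n)
      (trans (cong₂ _+_ (⊛-identityˡ ones n) (trans (solve 2 (λ x y → (:- x) :* y := :- (x :* y)) (λ _ → refl) (mono 1) ones n)
          (cong -_ (sym (shift≈mono 1 ones n))))) (telescope n)))
      where
      open PSSolver
      telescope : ∀ n → 1ℚ + - shift 1 ones n ≡ oneₛ n
      telescope zero    = refl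
      telescope (suc n) = refl

  module _ (m : ℕ) where

    private
      instance _ = ℕ.nonZero {m}

    geomInv≈ : geomInv (suc m) ≈ dil (suc m) ones
    geomInv≈ n with suc m ∣? n
    ... | yes _ = refl
    ... | no _  = refl

    oneMinus-dil : oneMinus (suc m) ≈ dil (suc m) (oneMinus 1)
    oneMinus-dil n = sym (begin
      dil (suc m) (oneMinus 1) n                             ≡⟨ dil-cong (suc m) (oneMinus≈ 0) n ⟩
      dil (suc m) (oneₛ +ₛ (-ₛ mono 1)) n                    ≡⟨ dil-+ (suc m) oneₛ (-ₛ mono 1) n ⟩
      dil (suc m) oneₛ n + dil (suc m) (-ₛ mono 1) n         ≡⟨ cong₂
          _+_ (dil-one (suc m) n) (trans (dil-neg (suc m) (mono 1) n) (cong -_ (dil-mono (suc m) 1 n))) ⟩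
      oneₛ n + - mono (1 ℕ.* suc m) n                        ≡⟨ cong (λ k → oneₛ n + - mono k n) (ℕP.*-identityˡ (suc m)) ⟩
      oneₛ n + - mono (suc m) n                              ≡⟨ sym (oneMinus≈ m n) ⟩
      oneMinus (suc m) n                                     ∎)
      where open ≡-Reasoning

    oneMinus-geomInv : oneMinus (suc m) ⊛ geomInv (suc m) ≈ oneₛ
    oneMinus-geomInv n = trans (⊛-cong oneMinus-dil geomInv≈ n)
      (trans (sym (dil-⊛ (suc m) (oneMinus 1) ones n)) (trans (dil-cong (suc m) oneMinus-ones n) (dil-one (suc m) n)))

    lambert≈ : lambert (suc m) ≈ ℕ→ℚ (suc m) ·ₛ (geomInv (suc m) +ₛ (-ₛ oneₛ))
    lambert≈ zero with suc m ∣? 0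
    ... | yes _ = sym (ℚP.*-zeroʳ (ℕ→ℚ (suc m)))
    ... | no ∤0 = contradiction (suc m ∣0) ∤0
    lambert≈ (suc n) with suc m ∣? suc n
    ... | yes _ = sym (ℚP.*-identityʳ (ℕ→ℚ (suc m)))
    ... | no  _ = sym (ℚP.*-zeroʳ (ℕ→ℚ (suc m)))

    Θ-mono : ∀ k → Θ (mono k) ≈ ℕ→ℚ k ·ₛ mono k
    Θ-mono k n with k ℕ.≟ n
    ... | yes refl = refl
    ... | no k≢n = trans (cong (ℕ→ℚ n *_) (mono-off k n k≢n)) (trans (ℚP.*-zeroʳ (ℕ→ℚ n))
        (sym (trans (cong (ℕ→ℚ k *_) (mono-off k n k≢n)) (ℚP.*-zeroʳ (ℕ→ℚ k)))))

    logDeriv-oneMinus : LogDeriv (oneMinus (suc m)) (lambert (suc m))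
    logDeriv-oneMinus = logDeriv refl λ n → begin
      ℕ→ℚ n * oneMinus (suc m) n                                ≡⟨ cong (ℕ→ℚ n *_) (oneMinus≈ m n) ⟩
      ℕ→ℚ n * (oneₛ n + - mono (suc m) n)                       ≡⟨ distrib (ℕ→ℚ n) (oneₛ n) (mono (suc m) n) ⟩
      Θ oneₛ n + - Θ (mono (suc m)) n                           ≡⟨ cong₂ (λ x y → x + - y) (Θ-one n) (Θ-mono (suc m) n) ⟩
      0ℚ + - (c * mono (suc m) n)                               ≡⟨ ℚP.+-identityˡ (- (c * mono (suc m) n)) ⟩
      - (c * mono (suc m) n)                                    ≡⟨ cong (λ z → - (c * z)) (numerator n) ⟩
      - (c * ((geomInv (suc m) +ₛ (-ₛ oneₛ)) ⊛ oneMinus (suc m)) n)  ≡⟨ cong -_ (sym (·-⊛ c (geomInv (suc m) +ₛ (-ₛ oneₛ)) (oneMinus (suc m)) n)) ⟩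
      - ((c ·ₛ (geomInv (suc m) +ₛ (-ₛ oneₛ))) ⊛ oneMinus (suc m)) n
          ≡⟨ cong -_ (⊛-cong {g = oneMinus (suc m)} (λ k → sym (lambert≈ k)) (λ _ → refl) n) ⟩
      - (lambert (suc m) ⊛ oneMinus (suc m)) n                  ∎
      where
      open ≡-Reasoning
      c = ℕ→ℚ (suc m)
      distrib : ∀ x y z → x * (y + - z) ≡ x * y + - (x * z)
      distrib = solve 3 (λ x y z → x :* (y :+ (:- z)) := x :* y :+ (:- (x :* z))) refl
        where open +-*-Solver
      Θ-one : Θ oneₛ ≈ 0ₛ
      Θ-one zero    = refl
      Θ-one (suc n) = ℚP.*-zeroʳ (ℕ→ℚ (suc n))
      numerator : mono (suc m) ≈ (geomInv (suc m) +ₛ (-ₛ oneₛ)) ⊛ oneMinus (suc m)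
      numerator n = sym (begin
        ((geomInv (suc m) +ₛ (-ₛ oneₛ)) ⊛ oneMinus (suc m)) n
          ≡⟨ solve 3 (λ g o u → (g :+ (:- u)) :* o := o :* g :+ (:- (u :* o))) (λ _ → refl) (geomInv (suc m)) (oneMinus (suc m)) oneₛ n ⟩
        (oneMinus (suc m) ⊛ geomInv (suc m)) n + - (oneₛ ⊛ oneMinus (suc m)) n
          ≡⟨ cong (λ z → (oneMinus (suc m) ⊛ geomInv (suc m)) n + - z) (⊛-identityˡ (oneMinus (suc m)) n) ⟩
        (oneMinus (suc m) ⊛ geomInv (suc m)) n + - oneMinus (suc m) n
          ≡⟨ cong₂ (λ x y → x + - y) (oneMinus-geomInv n) (oneMinus≈ m n) ⟩
        oneₛ n + - (oneₛ n + - mono (suc m) n)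
          ≡⟨ cancel (oneₛ n) (mono (suc m) n) ⟩
        mono (suc m) n ∎)
        where
        open PSSolver
        cancel : ∀ x y → x + - (x + - y) ≡ y
        cancel = Q.solve 2 (λ x y → x Q.:+ (Q.:- (x Q.:+ (Q.:- y))) Q.:= y) refl
          where module Q = +-*-Solver

    logDeriv-geomInv : LogDeriv (geomInv (suc m)) (-ₛ lambert (suc m))
    logDeriv-geomInv = logDeriv-resp (λ _ → refl) (λ n → ℚP.+-identityˡ (- lambert (suc m) n))
      (logDeriv-quotient logDeriv-oneMinus logDeriv-one oneMinus-geomInv)

    logDeriv-power : ∀ {f Λ} → LogDeriv f Λ → ∀ j → LogDeriv (f ^ₛ j) (fromℤ (+ j) ·ₛ Λ)
    logDeriv-power {f} {Λ} lf zero    = logDeriv-resp (λ _ → refl) (λ n → sym (ℚP.*-zeroˡ (Λ n))) logDeriv-one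
    logDeriv-power {f} {Λ} lf (suc j) = logDeriv-resp (λ _ → refl) sucΛ (logDeriv-⊛ lf (logDeriv-power lf j))
      where
      sucΛ : Λ +ₛ fromℤ (+ j) ·ₛ Λ ≈ fromℤ (+ suc j) ·ₛ Λ
      sucΛ n = trans (cong (_+ fromℤ (+ j) * Λ n) (sym (ℚP.*-identityˡ (Λ n))))
          (trans (sym (ℚP.*-distribʳ-+ (Λ n) 1ℚ (fromℤ (+ j)))) (cong (_* Λ n) (sym (fromℤ-+ (+ 1) (+ j)))))

    logDeriv-factor : ∀ e → LogDeriv (factor (suc m) e) (fromℤ e ·ₛ lambert (suc m))
    logDeriv-factor (+ j)    = logDeriv-power logDeriv-oneMinus j
    logDeriv-factor -[1+ j ] = logDeriv-resp (λ _ → refl)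
      (λ n → trans (neg (fromℤ (+ suc j)) (lambert (suc m) n)) (cong (_* lambert (suc m) n) (sym (fromℤ-neg (+ suc j)))))
      (logDeriv-power logDeriv-geomInv (suc j))
      where
      neg : ∀ x y → x * - y ≡ - x * y
      neg = solve 2 (λ x y → x :* (:- y) := (:- x) :* y) refl
        where open +-*-Solver

open LogarithmicDerivatives

-- Infinite products over residue classes and their comparison

module ProductSpecifications where

  open import Data.Nat.Divisibility
  open import Data.Rational using (_+_; _*_)
  open import Data.List using (List; []; _∷_; _++_; map; upTo; [_])
  open import Data.List.Properties using (applyUpTo-∷ʳ)
  open import Data.List.Relation.Unary.All as All using (All; []; _∷_)
  open import Data.List.Membership.Propositional using (_∈_)
  open import Data.List.Membership.Propositional.Properties
  open import Data.Sum using (inj₁; inj₂)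
  open import Relation.Nullary.Decidable using (True; toWitness)

  ∑-upTo-suc : ∀ N f → ∑ (upTo (suc N)) f ≡ ∑ (upTo N) f + f N
  ∑-upTo-suc N f = trans (cong (λ is → ∑ is f) (sym (applyUpTo-∷ʳ id N)))
      (trans (∑-++ (upTo N) [ N ] f) (cong (λ z → ∑ (upTo N) f + z) (ℚP.+-identityʳ (f N))))

  sumTo≡∑ : ∀ n f → sumTo n f ≡ ∑ (upTo (suc n)) f
  sumTo≡∑ zero    f = sym (ℚP.+-identityʳ (f 0))
  sumTo≡∑ (suc n) f = trans (cong (_+ f (suc n)) (sumTo≡∑ n f)) (sym (∑-upTo-suc (suc n) f))

  -- A specification lists triples (k , r , e), each standing for Π_{m ≡ r (mod k)} (1 − q^m)^e.
  Spec : Set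
  Spec = List (ℕ × ℕ × ℤ)

  _mod_ : ℕ → ℕ → ℕ
  m mod zero  = m
  m mod suc k = m % suc k

  indicator : ℕ → ℕ → ℕ → ℤ → ℤ
  indicator k r m e = if (m mod k) ≡ᵇ (r mod k) then e else + 0

  mult : Spec → ℕ → ℤ
  mult []                m = + 0
  mult ((k , r , e) ∷ l) m = indicator k r m e ℤ.+ mult l m

  -- The Lambert series Σ mult(m) m q^m/(1 - q^m). In degree n the sum may stop at m = n, and the
  -- term m = 0 is 0.
  Λ : Spec → PS
  Λ l n = ∑ (upTo (suc n)) (λ m → fromℤ (mult l m) * lambert m n)

  mult-++ : ∀ l l′ m → mult (l ++ l′) m ≡ mult l m ℤ.+ mult l′ m
  mult-++ []                l′ m = sym (ℤP.+-identityˡ (mult l′ m))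
  mult-++ ((k , r , e) ∷ l) l′ m = trans (cong (λ z → indicator k r m e ℤ.+ z) (mult-++ l l′ m))
      (sym (ℤP.+-assoc (indicator k r m e) (mult l m) (mult l′ m)))

  Λ-cong : ∀ l l′ → (∀ m → mult l m ≡ mult l′ m) → Λ l ≈ Λ l′
  Λ-cong l l′ h n = ∑-cong (upTo (suc n)) λ m → cong (λ z → fromℤ z * lambert m n) (h m)

  Λ-++ : ∀ l l′ → Λ (l ++ l′) ≈ Λ l +ₛ Λ l′
  Λ-++ l l′ n = trans (∑-cong (upTo (suc n)) λ m → trans (cong (_* lambert m n)
      (trans (cong fromℤ (mult-++ l l′ m)) (fromℤ-+ (mult l m) (mult l′ m))))
    (ℚP.*-distribʳ-+ (lambert m n) (fromℤ (mult l m)) (fromℤ (mult l′ m))))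
    (∑-+ (upTo (suc n)) (λ m → fromℤ (mult l m) * lambert m n) (λ m → fromℤ (mult l′ m) * lambert m n))

  private
    ≡ᵇ-refl : ∀ n → (n ≡ᵇ n) ≡ true
    ≡ᵇ-refl zero    = refl
    ≡ᵇ-refl (suc n) = ≡ᵇ-refl n

    progression-index : ∀ k r m → 1 ≤ r → r ≤ suc k → 1 ≤ m → m % suc k ≡ r % suc k → ∃ λ i → m ≡ r ℕ.+ i ℕ.* suc k
    progression-index k r m 1≤r r≤k 1≤m eq with ℕP.m≤n⇒m<n∨m≡n r≤k
    ... | inj₁ r<k = m / suc k , trans (DM.m≡m%n+[m/n]*n m (suc k)) (cong (ℕ._+ m / suc k ℕ.* suc k) (trans eq (DM.m<n⇒m%n≡m r<k)))
    ... | inj₂ refl with m / suc k | trans (DM.m≡m%n+[m/n]*n m (suc k)) (cong (ℕ._+ m / suc k ℕ.* suc k) (trans eq (DM.n%n≡0 (suc k))))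
    ...   | zero  | refl = contradiction 1≤m λ ()
    ...   | suc i | m≡   = i , m≡

  -- For residues taken from 1, ..., k the map i ↦ r + i k enumerates exactly the positive m in the
  -- class; those with m ≤ n have i < N.
  Λ-progression : ∀ k r e → 1 ≤ r → r ≤ suc k → ∀ N n → n ≤ N →
    Λ [ (suc k , r , e) ] n ≡ ∑ (upTo N) (λ i → fromℤ e * lambert (r ℕ.+ i ℕ.* suc k) n)
  Λ-progression k r e 1≤r r≤k N n n≤N = sym (begin
    ∑ (upTo N) (λ i → fromℤ e * lambert (g i) n)     ≡⟨ ∑-cong (upTo N) (λ i → cong (λ z → fromℤ z * lambert (g i) n) (sym (on i))) ⟩
    ∑ (upTo N) (f ∘ g)                               ≡⟨ sym (∑-map g (upTo N) f) ⟩
    ∑ (map g (upTo N)) f                             ≡⟨ ∑-support f (Unique.map⁺ g-inj (Unique.upTo⁺ N)) (Unique.upTo⁺ (suc n)) left right ⟩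
    ∑ (upTo (suc n)) f                               ∎)
    where
    open ≡-Reasoning
    g : ℕ → ℕ
    g i = r ℕ.+ i ℕ.* suc k
    f : ℕ → ℚ
    f m = fromℤ (mult [ (suc k , r , e) ] m) * lambert m n
    g-inj : ∀ {i j} → g i ≡ g j → i ≡ j
    g-inj {i} {j} eq = ℕP.*-cancelʳ-≡ i j (suc k) (ℕP.+-cancelˡ-≡ r (i ℕ.* suc k) (j ℕ.* suc k) eq)
    on : ∀ i → mult [ (suc k , r , e) ] (g i) ≡ e
    on i = trans (ℤP.+-identityʳ _) (cong (if_then e else + 0) (trans (cong (_≡ᵇ r % suc k) (DM.[m+kn]%n≡m%n r i (suc k))) (≡ᵇ-refl (r % suc k))))
    bounds : ∀ m → f m ≢ 0ℚ → 1 ≤ m × m ≤ n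
    bounds m f≢0 = lambert≢0 m n λ l≡0 → f≢0 (trans (cong (fromℤ (mult [ (suc k , r , e) ] m) *_) l≡0)
        (ℚP.*-zeroʳ (fromℤ (mult [ (suc k , r , e) ] m))))
    right : ∀ m → f m ≢ 0ℚ → m ∈ upTo (suc n)
    right m f≢0 = ∈-upTo⁺ (s≤s (proj₂ (bounds m f≢0)))
    left : ∀ m → f m ≢ 0ℚ → m ∈ map g (upTo N)
    left m f≢0 with m % suc k ℕ.≟ r % suc k
    ... | no m≢r = contradiction (trans (cong (λ b → fromℤ ((if b then e else + 0) ℤ.+ + 0) * lambert m n) (≡ᵇ-false (m % suc k) (r % suc k) m≢r))
        (ℚP.*-zeroˡ (lambert m n))) f≢0
      where
      ≡ᵇ-false : ∀ a b → a ≢ b → (a ≡ᵇ b) ≡ false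
      ≡ᵇ-false a b a≢b with a ≡ᵇ b in eq
      ... | true  = contradiction (ℕP.≡ᵇ⇒≡ a b (subst T (sym eq) _)) a≢b
      ... | false = refl
    ... | yes eq with progression-index k r m 1≤r r≤k (proj₁ (bounds m f≢0)) eq
    ...   | i , refl = ∈-map⁺ g (∈-upTo⁺ (ℕP.≤-trans (ℕP.≤-trans (s≤s (ℕP.m≤m*n i (suc k))) (ℕP.+-monoˡ-≤ (i ℕ.* suc k) 1≤r))
        (ℕP.≤-trans (proj₂ (bounds m f≢0)) n≤N)))

  finProd : ℕ → (ℕ → PS) → PS
  finProd zero    u = oneₛ
  finProd (suc N) u = u N ⊛ finProd N u

  logDeriv-finProd : ∀ N (u Λs : ℕ → PS) → (∀ i → LogDeriv (u i) (Λs i)) → LogDeriv (finProd N u) (λ n → ∑ (upTo N) (λ i → Λs i n))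
  logDeriv-finProd zero    u Λs h = logDeriv-one
  logDeriv-finProd (suc N) u Λs h = logDeriv-resp (λ _ → refl)
    (λ n → trans (ℚP.+-comm (Λs N n) (∑ (upTo N) (λ i → Λs i n))) (sym (∑-upTo-suc N (λ i → Λs i n)))) (logDeriv-⊛ (h N) (logDeriv-finProd N u Λs h))

  -- The multiples of k are written as the residue k rather than 0, so that the progression starts
  -- at k.
  etaSpec : List (ℕ × ℤ) → Spec
  etaSpec = map (λ (k , e) → k , k , e)

  -- `etaProd` is a diagonal: its coefficient i comes from the partial product of length i. To
  -- compare it with one partial product of length n, the uniqueness theorem up to degree i is
  -- applied to the lengths i and n.
  logDeriv-etaProd : ∀ L → All (λ (k , e) → NonZero k) L → LogDeriv (etaProd L) (Λ (etaSpec L))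
  logDeriv-etaProd L nz = logDeriv-limit λ n → prodUpTo L n , Λ≤ L n , upTo-N L nz n
    , (λ i i≤n → logDeriv-unique≤ (upTo-N L nz i) (upTo-N L nz n) i (λ j j≤i → trans (Λ≤≡Λ L nz i j j≤i) (sym (Λ≤≡Λ L nz n j (ℕP.≤-trans j≤i i≤n))))
        i ℕP.≤-refl)
    , (λ i i≤n → sym (Λ≤≡Λ L nz n i i≤n))
    where
    at : List (ℕ × ℤ) → ℕ → PS
    at []            m = 0ₛ
    at ((k , e) ∷ L) m = fromℤ e ·ₛ lambert (k ℕ.* m) +ₛ at L m
    Λ≤ : List (ℕ × ℤ) → ℕ → PS
    Λ≤ L N n = ∑ (upTo N) (λ i → at L (suc i) n)
    logDeriv-at : ∀ L → All (λ (k , e) → NonZero k) L → ∀ m → LogDeriv (factorsAt L (suc m)) (at L (suc m))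
    logDeriv-at []                   []       m = logDeriv-one
    logDeriv-at ((suc k , e) ∷ L) (_ ∷ nz) m = logDeriv-⊛ (logDeriv-factor (m ℕ.+ k ℕ.* suc m) e) (logDeriv-at L nz m)
    upTo-N : ∀ L → All (λ (k , e) → NonZero k) L → ∀ N → LogDeriv (prodUpTo L N) (Λ≤ L N)
    upTo-N L nz zero    = logDeriv-one
    upTo-N L nz (suc N) = logDeriv-resp (λ _ → refl)
      (λ n → trans (ℚP.+-comm (at L (suc N) n) (∑ (upTo N) (λ i → at L (suc i) n))) (sym (∑-upTo-suc N (λ i → at L (suc i) n))))
          (logDeriv-⊛ (logDeriv-at L nz N) (upTo-N L nz N))
    Λ≤≡Λ : ∀ L → All (λ (k , e) → NonZero k) L → ∀ N n → n ≤ N → Λ≤ L N n ≡ Λ (etaSpec L) n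
    Λ≤≡Λ []                []       N n n≤N = trans (zeros (upTo N))
        (sym (trans (∑-cong (upTo (suc n)) λ m → ℚP.*-zeroˡ (lambert m n)) (zeros (upTo (suc n)))))
      where
      zeros : ∀ (is : List ℕ) → ∑ is (λ _ → 0ℚ) ≡ 0ℚ
      zeros []       = refl
      zeros (i ∷ is) = trans (ℚP.+-identityˡ _) (zeros is)
    Λ≤≡Λ ((suc k , e) ∷ L) (_ ∷ nz) N n n≤N = begin
      ∑ (upTo N) (λ i → fromℤ e * lambert (suc k ℕ.* suc i) n + at L (suc i) n)
        ≡⟨ ∑-+ (upTo N) (λ i → fromℤ e * lambert (suc k ℕ.* suc i) n) (λ i → at L (suc i) n) ⟩
      ∑ (upTo N) (λ i → fromℤ e * lambert (suc k ℕ.* suc i) n) + Λ≤ L N n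
        ≡⟨ cong₂ _+_ (trans (∑-cong (upTo N) λ i → cong (λ m → fromℤ e * lambert m n) (ℕP.*-comm (suc k) (suc i)))
             (sym (Λ-progression k (suc k) e (s≤s z≤n) ℕP.≤-refl N n n≤N))) (Λ≤≡Λ L nz N n n≤N) ⟩
      Λ [ (suc k , suc k , e) ] n + Λ (etaSpec L) n
        ≡⟨ sym (Λ-++ [ (suc k , suc k , e) ] (etaSpec L) n) ⟩
      Λ (etaSpec ((suc k , e) ∷ L)) n ∎
      where open ≡-Reasoning

  module _ (N : ℕ) .{{_ : NonZero N}} where

    Level : ℕ × ℕ × ℤ → Set
    Level (k , _) = k ∣ N × k ≢ 0

    level? : ∀ x → Dec (Level x)
    level? (k , _) = k ∣? N ×-dec ¬? (k ℕ.≟ 0)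

    periodic : ∀ l → All Level l → ∀ m → mult l m ≡ mult l (m % N)
    periodic []                    []                m = refl
    periodic ((zero  , r , e) ∷ l) ((_ , 0≢0) ∷ ks) m = contradiction refl 0≢0
    periodic ((suc k , r , e) ∷ l) ((k∣N , _) ∷ ks) m = cong₂ ℤ._+_
      (cong (λ z → if z ≡ᵇ (r mod suc k) then e else + 0) (sym (DM.m∣n⇒o%n%m≡o%m (suc k) N m k∣N))) (periodic l ks m)

    -- If all moduli divide N, the exponent of 1 - q^m depends on m modulo N only, and comparing two
    -- products is a finite check. The implicit decision arguments have it evaluated during type
    -- checking.
    spec-≡ : ∀ l l′ {_ : True (All.all? level? l)} {_ : True (All.all? level? l′)}
      {_ : True (All.all? (λ m → mult l m ℤ.≟ mult l′ m) (upTo N))} → ∀ m → mult l m ≡ mult l′ m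
    spec-≡ l l′ {p} {p′} {q} m = trans (periodic l (toWitness p) m)
      (trans (All.lookup (toWitness q) (∈-upTo⁺ (DM.m%n<n m N))) (sym (periodic l′ (toWitness p′) m)))

  record HasSpec (f : PS) (l : Spec) : Set where
    constructor hasSpec
    field isLogDeriv : LogDeriv f (Λ l)
  open HasSpec public

  spec-⊛ : ∀ {f g l l′} → HasSpec f l → HasSpec g l′ → HasSpec (f ⊛ g) (l ++ l′)
  spec-⊛ {l = l} {l′} (hasSpec hf) (hasSpec hg) = hasSpec (logDeriv-resp (λ _ → refl) (λ n → sym (Λ-++ l l′ n)) (logDeriv-⊛ hf hg))

  spec-unique : ∀ {f g l l′} → HasSpec f l → HasSpec g l′ → (∀ m → mult l m ≡ mult l′ m) → f ≈ g
  spec-unique {l = l} {l′} (hasSpec hf) (hasSpec hg) h = logDeriv-unique hf hg (Λ-cong l l′ h)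

  spec-resp : ∀ {f g l} l′ → f ≈ g → (∀ m → mult l m ≡ mult l′ m) → HasSpec f l → HasSpec g l′
  spec-resp {l = l} l′ f≈g h (hasSpec hf) = hasSpec (logDeriv-resp f≈g (Λ-cong l l′ h) hf)

open ProductSpecifications

-- Triangular exponents and Gaussian binomial coefficients

module GaussianBinomials where

  open import Data.Rational using (_+_; _*_; -_)
  open import Data.Sum using (inj₁; inj₂)

  -- k(k+1)/2
  triℕ : ℕ → ℕ
  triℕ zero    = 0
  triℕ (suc n) = suc n ℕ.+ triℕ n

  -- The polynomial k(k + 1)/2 is invariant under k ↦ - 1 - k, hence the same value on `+ n` and
  -- `-[1+ n ]`.
  tri : ℤ → ℕ
  tri (+ n)    = triℕ n
  tri -[1+ n ] = triℕ n

  private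
    2triℕ : ∀ n → + 2 ℤ.* + triℕ n ≡ + n ℤ.* (+ n ℤ.+ + 1)
    2triℕ zero    = refl
    2triℕ (suc n) = begin
      + 2 ℤ.* (+ suc n ℤ.+ + triℕ n)                ≡⟨ ℤP.*-distribˡ-+ (+ 2) (+ suc n) (+ triℕ n) ⟩
      + 2 ℤ.* + suc n ℤ.+ + 2 ℤ.* + triℕ n          ≡⟨ cong (λ z → + 2 ℤ.* + suc n ℤ.+ z) (2triℕ n) ⟩
      + 2 ℤ.* (+ 1 ℤ.+ + n) ℤ.+ + n ℤ.* (+ n ℤ.+ + 1)    ≡⟨ identity (+ n) ⟩
      (+ 1 ℤ.+ + n) ℤ.* (+ 1 ℤ.+ + n ℤ.+ + 1)       ∎
      where
      open ≡-Reasoning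
      identity : ∀ x → + 2 ℤ.* (+ 1 ℤ.+ x) ℤ.+ x ℤ.* (x ℤ.+ + 1) ≡ (+ 1 ℤ.+ x) ℤ.* (+ 1 ℤ.+ x ℤ.+ + 1)
      identity = ℤS.solve-∀

  2tri : ∀ k → + 2 ℤ.* + tri k ≡ k ℤ.* (k ℤ.+ + 1)
  2tri (+ n)    = 2triℕ n
  2tri -[1+ n ] = trans (2triℕ n) (identity (+ n))
    where
    identity : ∀ x → x ℤ.* (x ℤ.+ + 1) ≡ ℤ.- (+ 1 ℤ.+ x) ℤ.* (ℤ.- (+ 1 ℤ.+ x) ℤ.+ + 1)
    identity = ℤS.solve-∀

  triℕ≥ : ∀ n → n ≤ triℕ n
  triℕ≥ zero    = z≤n
  triℕ≥ (suc n) = ℕP.m≤m+n (suc n) (triℕ n)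

  tri≥ : ∀ k → ℤ.∣ k ∣ ≤ suc (tri k)
  tri≥ (+ n)    = ℕP.≤-trans (triℕ≥ n) (ℕP.n≤1+n (triℕ n))
  tri≥ -[1+ n ] = s≤s (triℕ≥ n)

  -- The exponent of x^{k(k+1)/2} y^{k(k-1)/2} at x = q^r, y = q^s
  thetaExp : ℕ → ℕ → ℤ → ℕ
  thetaExp r s k = r ℕ.* tri k ℕ.+ s ℕ.* tri (ℤ.- k)

  -- Doubling removes the halves, so that exponents can be compared by polynomial identities over ℤ.
  2thetaExp : ∀ r s k → + 2 ℤ.* + thetaExp r s k ≡ + r ℤ.* (k ℤ.* (k ℤ.+ + 1)) ℤ.+ + s ℤ.* (k ℤ.* (k ℤ.- + 1))
  2thetaExp r s k = begin
    + 2 ℤ.* + thetaExp r s k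
      ≡⟨ cong (+ 2 ℤ.*_) (cong₂ ℤ._+_ (ℤP.pos-* r (tri k)) (ℤP.pos-* s (tri (ℤ.- k)))) ⟩
    + 2 ℤ.* (+ r ℤ.* + tri k ℤ.+ + s ℤ.* + tri (ℤ.- k))
      ≡⟨ distrib (+ r) (+ s) (+ tri k) (+ tri (ℤ.- k)) ⟩
    + r ℤ.* (+ 2 ℤ.* + tri k) ℤ.+ + s ℤ.* (+ 2 ℤ.* + tri (ℤ.- k))
      ≡⟨ cong₂ (λ u v → + r ℤ.* u ℤ.+ + s ℤ.* v) (2tri k) (trans (2tri (ℤ.- k)) (negate k)) ⟩
    + r ℤ.* (k ℤ.* (k ℤ.+ + 1)) ℤ.+ + s ℤ.* (k ℤ.* (k ℤ.- + 1)) ∎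
    where
    open ≡-Reasoning
    distrib : ∀ r s t u → + 2 ℤ.* (r ℤ.* t ℤ.+ s ℤ.* u) ≡ r ℤ.* (+ 2 ℤ.* t) ℤ.+ s ℤ.* (+ 2 ℤ.* u)
    distrib = ℤS.solve-∀
    negate : ∀ k → ℤ.- k ℤ.* (ℤ.- k ℤ.+ + 1) ≡ k ℤ.* (k ℤ.- + 1)
    negate = ℤS.solve-∀

  double-injective : ∀ {m n : ℕ} → + 2 ℤ.* + m ≡ + 2 ℤ.* + n → m ≡ n
  double-injective {m} {n} eq = ℤP.+-injective (ℤP.*-cancelˡ-≡ (+ 2) (+ m) (+ n) eq)

  alternate : ℕ → ℚ
  alternate zero    = 1ℚ
  alternate (suc n) = - alternate n

  signAt : Sign → ℤ → ℚ
  signAt Sign.+ k = 1ℚ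
  signAt Sign.- k = alternate ℤ.∣ k ∣

  signℚ : Sign → ℚ
  signℚ Sign.+ = 1ℚ
  signℚ Sign.- = - 1ℚ

  private
    neg-neg : ∀ x → - - x ≡ x
    neg-neg = solve 1 (λ x → :- (:- x) := x) refl
      where open +-*-Solver

    -1* : ∀ x → - 1ℚ * x ≡ - x
    -1* x = trans (sym (ℚP.neg-distribˡ-* 1ℚ x)) (cong -_ (ℚP.*-identityˡ x))

  signAt-suc : ∀ ε k → signAt ε (k ℤ.+ + 1) ≡ signℚ ε * signAt ε k
  signAt-suc Sign.+ k          = refl
  signAt-suc Sign.- (+ n)      = trans (cong (λ m → alternate m) (ℕP.+-comm n 1)) (sym (-1* (alternate n)))
  signAt-suc Sign.- -[1+ zero ]  = refl
  signAt-suc Sign.- -[1+ suc n ] = trans (sym (neg-neg (alternate (suc n)))) (sym (-1* (- alternate (suc n))))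

  thetaExp-bound : ∀ r s → 1 ≤ r ℕ.+ s → ∀ k → ℤ.∣ k ∣ ≤ suc (thetaExp r s k)
  thetaExp-bound zero zero () k
  thetaExp-bound (suc r) s _ k = ℕP.≤-trans (tri≥ k) (s≤s (ℕP.≤-trans (ℕP.m≤m+n (tri k) (r ℕ.* tri k)) (ℕP.m≤m+n _ _)))
  thetaExp-bound zero (suc s) _ k = ℕP.≤-trans (subst (_≤ suc (tri (ℤ.- k))) (ℤP.∣-i∣≡∣i∣ k) (tri≥ (ℤ.- k)))
      (s≤s (ℕP.m≤m+n (tri (ℤ.- k)) (s ℕ.* tri (ℤ.- k))))

  sumₛ : ℕ → (ℕ → PS) → PS
  sumₛ N f n = sumTo N (λ j → f j n)

  sumₛ-⊛ : ∀ g N f → g ⊛ sumₛ N f ≈ sumₛ N (λ j → g ⊛ f j)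
  sumₛ-⊛ g zero    f n = refl
  sumₛ-⊛ g (suc N) f n = trans (R.distribˡ g (sumₛ N f) (f (suc N)) n) (cong (_+ (g ⊛ f (suc N)) n) (sumₛ-⊛ g N f n))

  -- Q = q^K
  module Gauss (K : ℕ) where

    Q^ : ℕ → PS
    Q^ n = mono (K ℕ.* n)

    Q^-+ : ∀ m n → Q^ m ⊛ Q^ n ≈ Q^ (m ℕ.+ n)
    Q^-+ m n i = trans (sym (mono-+ (K ℕ.* m) (K ℕ.* n) i)) (cong (λ e → mono e i) (sym (ℕP.*-distribˡ-+ K m n)))

    -- The Gaussian binomial coefficient, defined by one of its two Pascal rules. The truncated
    -- difference n ∸ j is harmless because the coefficient vanishes for j > n.
    gauss : ℕ → ℕ → PS
    gauss n       zero    = oneₛ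
    gauss zero    (suc j) = 0ₛ
    gauss (suc n) (suc j) = gauss n (suc j) +ₛ Q^ (n ∸ j) ⊛ gauss n j

    gauss-> : ∀ n j → n < j → gauss n j ≈ 0ₛ
    gauss-> zero    (suc j) _         i = refl
    gauss-> (suc n) (suc j) (s≤s n<j) i = trans (cong₂ _+_ (gauss-> n (suc j) (ℕP.m≤n⇒m≤1+n n<j) i)
      (trans (⊛-cong {f = Q^ (n ∸ j)} (λ _ → refl) (gauss-> n j n<j) i) (R.zeroʳ (Q^ (n ∸ j)) i))) refl

    private
      -- For j ≤ n both powers multiply to Q^(n+1); for j > n, where truncated subtraction would
      -- spoil this, the binomial coefficient is zero.
      absorb : ∀ n j → Q^ (suc n ∸ j) ⊛ (Q^ j ⊛ gauss n j) ≈ Q^ (suc j) ⊛ (Q^ (n ∸ j) ⊛ gauss n j)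
      absorb n j i with ℕP.<-≤-connex n j
      ... | inj₁ n<j = trans (vanish (Q^ (suc n ∸ j)) (Q^ j)) (sym (vanish (Q^ (suc j)) (Q^ (n ∸ j))))
        where
        vanish : ∀ u v → (u ⊛ (v ⊛ gauss n j)) i ≡ 0ℚ
        vanish u v = trans (⊛-cong {f = u} (λ _ → refl) (⊛-cong {f = v} (λ _ → refl) (gauss-> n j n<j)) i)
          (trans (⊛-cong {f = u} (λ _ → refl) (R.zeroʳ v) i) (R.zeroʳ u i))
      ... | inj₂ j≤n = trans (sym (⊛-assoc (Q^ (suc n ∸ j)) (Q^ j) (gauss n j) i))
          (trans (⊛-cong {g = gauss n j} eq (λ _ → refl) i) (⊛-assoc (Q^ (suc j)) (Q^ (n ∸ j)) (gauss n j) i))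
        where
        eq : Q^ (suc n ∸ j) ⊛ Q^ j ≈ Q^ (suc j) ⊛ Q^ (n ∸ j)
        eq m = trans (Q^-+ (suc n ∸ j) j m) (trans (cong (λ e → Q^ e m) (trans (ℕP.m∸n+n≡m (ℕP.m≤n⇒m≤1+n j≤n)) (cong suc (sym (ℕP.m+[n∸m]≡n j≤n)))))
            (sym (Q^-+ (suc j) (n ∸ j) m)))

      Q^0 : Q^ 0 ≈ oneₛ
      Q^0 i = cong (λ e → mono e i) (ℕP.*-zeroʳ K)

    -- The second Pascal rule, corresponding to the symmetry j ↦ n - j. The induction expands by the
    -- first rule, applies the hypothesis twice and regroups by `absorb`.
    gauss-dual : ∀ n j → gauss (suc n) (suc j) ≈ Q^ (suc j) ⊛ gauss n (suc j) +ₛ gauss n j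
    gauss-dual zero zero i = trans (ℚP.+-identityˡ _) (trans (⊛-identityʳ (Q^ 0) i) (trans (Q^0 i)
      (sym (trans (cong (_+ oneₛ i) (R.zeroʳ (Q^ 1) i)) (ℚP.+-identityˡ (oneₛ i))))))
    gauss-dual zero (suc j) i = trans (ℚP.+-identityˡ _) (trans (R.zeroʳ (Q^ 0) i) (sym (trans (cong (_+ 0ℚ) (R.zeroʳ (Q^ (suc (suc j))) i)) refl)))
    gauss-dual (suc n) zero i = begin
      (gauss (suc n) 1 +ₛ Q^ (suc n) ⊛ oneₛ) i
        ≡⟨ cong₂ _+_ (gauss-dual n 0 i) (⊛-identityʳ (Q^ (suc n)) i) ⟩
      (Q^ 1 ⊛ gauss n 1) i + oneₛ i + Q^ (suc n) i
        ≡⟨ swap ((Q^ 1 ⊛ gauss n 1) i) (oneₛ i) (Q^ (suc n) i) ⟩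
      (Q^ 1 ⊛ gauss n 1) i + Q^ (suc n) i + oneₛ i
        ≡⟨ cong (λ z → (Q^ 1 ⊛ gauss n 1) i + z + oneₛ i) (sym (trans (⊛-cong {f = Q^ 1} (λ _ → refl) (⊛-identityʳ (Q^ n)) i) (Q^-+ 1 n i))) ⟩
      (Q^ 1 ⊛ gauss n 1) i + (Q^ 1 ⊛ (Q^ n ⊛ oneₛ)) i + oneₛ i
        ≡⟨ cong (_+ oneₛ i) (sym (R.distribˡ (Q^ 1) (gauss n 1) (Q^ n ⊛ oneₛ) i)) ⟩
      (Q^ 1 ⊛ gauss (suc n) 1 +ₛ oneₛ) i ∎
      where
      open ≡-Reasoning
      swap : ∀ x y z → x + y + z ≡ x + z + y
      swap = solve 3 (λ x y z → x :+ y :+ z := x :+ z :+ y) refl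
        where open +-*-Solver
    gauss-dual (suc n) (suc j) i = begin
      (gauss (suc n) (suc (suc j)) +ₛ Q^ (n ∸ j) ⊛ gauss (suc n) (suc j)) i
        ≡⟨ cong₂ _+_ (gauss-dual n (suc j) i) (⊛-cong {f = Q^ (n ∸ j)} (λ _ → refl) (gauss-dual n j) i) ⟩
      (Q^ (suc (suc j)) ⊛ gauss n (suc (suc j)) +ₛ gauss n (suc j) +ₛ Q^ (n ∸ j) ⊛ (Q^ (suc j) ⊛ gauss n (suc j) +ₛ gauss n j)) i
        ≡⟨ S.solve 6 (λ a g₂ g₁ b c g₀ → a S.:* g₂ S.:+ g₁ S.:+ b S.:* (c S.:* g₁ S.:+ g₀) S.:=
            a S.:* g₂ S.:+ b S.:* (c S.:* g₁) S.:+ (g₁ S.:+ b S.:* g₀)) (λ _ → refl)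
             (Q^ (suc (suc j))) (gauss n (suc (suc j))) (gauss n (suc j)) (Q^ (n ∸ j)) (Q^ (suc j)) (gauss n j) i ⟩
      (Q^ (suc (suc j)) ⊛ gauss n (suc (suc j))) i + (Q^ (n ∸ j) ⊛ (Q^ (suc j) ⊛ gauss n (suc j))) i + gauss (suc n) (suc j) i
        ≡⟨ cong (λ z → (Q^ (suc (suc j)) ⊛ gauss n (suc (suc j))) i + z + gauss (suc n) (suc j) i) (absorb n (suc j) i) ⟩
      (Q^ (suc (suc j)) ⊛ gauss n (suc (suc j))) i + (Q^ (suc (suc j)) ⊛ (Q^ (n ∸ suc j) ⊛ gauss n (suc j))) i + gauss (suc n) (suc j) i
        ≡⟨ cong (_+ gauss (suc n) (suc j) i) (sym (R.distribˡ (Q^ (suc (suc j))) (gauss n (suc (suc j))) (Q^ (n ∸ suc j) ⊛ gauss n (suc j)) i)) ⟩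
      (Q^ (suc (suc j)) ⊛ gauss (suc n) (suc (suc j)) +ₛ gauss (suc n) (suc j)) i ∎
      where
      open ≡-Reasoning
      module S = PSSolver

    poch : ℕ → PS
    poch n = finProd n (λ i → oneₛ +ₛ (-ₛ Q^ (suc i)))

    -- The formula by Q-factorials, without division. The induction rests on (1 - Q^(i+1)) + Q^(i+1)
    -- (1 - Q^(j+1)) = 1 - Q^(i+j+2).
    gauss-poch : ∀ i j → poch j ⊛ poch i ⊛ gauss (i ℕ.+ j) j ≈ poch (i ℕ.+ j)
    gauss-poch i zero n = trans (⊛-identityʳ (oneₛ ⊛ poch i) n) (trans (⊛-identityˡ (poch i) n) (cong (λ m → poch m n) (sym (ℕP.+-identityʳ i))))
    gauss-poch zero (suc j) n = trans (⊛-cong (⊛-identityʳ (poch (suc j))) (diagonal (suc j)) n) (⊛-identityʳ (poch (suc j)) n)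
      where
      diagonal : ∀ j → gauss j j ≈ oneₛ
      diagonal zero    n = refl
      diagonal (suc j) n = trans (cong₂ _+_ (gauss-> j (suc j) ℕP.≤-refl n)
          (⊛-cong (λ m → trans (cong (λ e → Q^ e m) (ℕP.n∸n≡0 j)) (Q^0 m)) (diagonal j) n))
        (trans (ℚP.+-identityˡ _) (⊛-identityˡ oneₛ n))
    gauss-poch (suc i) (suc j) n = begin
      (poch (suc j) ⊛ poch (suc i) ⊛ (g₁ +ₛ Q^ (i ℕ.+ suc j ∸ j) ⊛ g₀)) n
        ≡⟨ ⊛-cong {f = poch (suc j) ⊛ poch (suc i)} (λ _ → refl) (λ m →
            cong (λ z → g₁ m + z) (⊛-cong {g = g₀} (λ l → cong (λ e → Q^ e l) (trans (cong (_∸ j) (ℕP.+-suc i j)) (ℕP.m+n∸n≡m (suc i) j)))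
            (λ _ → refl) m)) n ⟩
      (poch (suc j) ⊛ poch (suc i) ⊛ (g₁ +ₛ c ⊛ g₀)) n
        ≡⟨ S.solve 7 (λ o b c pj pi g₁ g₀ → (o S.:+ (S.:- b)) S.:* pj S.:* ((o S.:+ (S.:- c)) S.:* pi) S.:* (g₁ S.:+ c S.:* g₀)
              S.:= (o S.:+ (S.:- c)) S.:* ((o S.:+ (S.:- b)) S.:* pj S.:* pi S.:* g₁) S.:+ c S.:* (o S.:+ (S.:- b))
                  S.:* (pj S.:* ((o S.:+ (S.:- c)) S.:* pi) S.:* g₀)) (λ _ → refl)
             oneₛ b c (poch j) (poch i) g₁ g₀ n ⟩
      ((oneₛ +ₛ (-ₛ c)) ⊛ (poch (suc j) ⊛ poch i ⊛ g₁) +ₛ c ⊛ (oneₛ +ₛ (-ₛ b)) ⊛ (poch j ⊛ poch (suc i) ⊛ g₀)) n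
        ≡⟨ cong₂ _+_ (⊛-cong {f = oneₛ +ₛ (-ₛ c)} (λ _ → refl) (gauss-poch i (suc j)) n) (⊛-cong {f = c ⊛ (oneₛ +ₛ (-ₛ b))} (λ _ → refl) ih₀ n) ⟩
      ((oneₛ +ₛ (-ₛ c)) ⊛ p +ₛ c ⊛ (oneₛ +ₛ (-ₛ b)) ⊛ p) n
        ≡⟨ S.solve 4 (λ o b c p → (o S.:+ (S.:- c)) S.:* p S.:+ c S.:* (o S.:+ (S.:- b)) S.:* p S.:=
            (o S.:+ (S.:- (c S.:* b))) S.:* p S.:+ (c S.:* o S.:+ (S.:- c)) S.:* p) (λ _ → refl) oneₛ b c p n ⟩
      ((oneₛ +ₛ (-ₛ (c ⊛ b))) ⊛ p +ₛ (c ⊛ oneₛ +ₛ (-ₛ c)) ⊛ p) n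
        ≡⟨ cong₂ _+_ (⊛-cong {g = p} (λ m → cong (λ z → oneₛ m + - z) (Q^-+ (suc i) (suc j) m)) (λ _ → refl) n)
             (trans (⊛-cong {g = p} (λ m → trans (cong (_+ - c m) (⊛-identityʳ c m)) (ℚP.+-inverseʳ (c m))) (λ _ → refl) n) (R.zeroˡ p n)) ⟩
      poch (suc (i ℕ.+ suc j)) n + 0ℚ
        ≡⟨ ℚP.+-identityʳ _ ⟩
      poch (suc (i ℕ.+ suc j)) n ∎
      where
      open ≡-Reasoning
      module S = PSSolver
      g₁ = gauss (i ℕ.+ suc j) (suc j)
      g₀ = gauss (i ℕ.+ suc j) j
      b = Q^ (suc j)
      c = Q^ (suc i)
      p = poch (i ℕ.+ suc j)
      ih₀ : poch j ⊛ poch (suc i) ⊛ g₀ ≈ p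
      ih₀ = subst (λ L → poch j ⊛ poch (suc i) ⊛ gauss L j ≈ poch L) (sym (ℕP.+-suc i j)) (gauss-poch (suc i) j)

open GaussianBinomials

-- The finite triple product

module RotheIdentity where

  open import Data.Rational using (_+_; _*_; -_)

  monomial-⊛ : ∀ w e w′ e′ → (w ·ₛ mono e) ⊛ (w′ ·ₛ mono e′) ≈ (w * w′) ·ₛ mono (e ℕ.+ e′)
  monomial-⊛ w e w′ e′ n = begin
    ((w ·ₛ mono e) ⊛ (w′ ·ₛ mono e′)) n ≡⟨ ·-⊛ w (mono e) (w′ ·ₛ mono e′) n ⟩
    w * (mono e ⊛ (w′ ·ₛ mono e′)) n    ≡⟨ cong (w *_) (trans (⊛-comm (mono e) (w′ ·ₛ mono e′) n) (·-⊛ w′ (mono e′) (mono e) n)) ⟩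
    w * (w′ * (mono e′ ⊛ mono e) n)     ≡⟨ sym (ℚP.*-assoc w w′ ((mono e′ ⊛ mono e) n)) ⟩
    w * w′ * (mono e′ ⊛ mono e) n       ≡⟨ cong (w * w′ *_) (trans (⊛-comm (mono e′) (mono e) n) (sym (mono-+ e e′ n))) ⟩
    w * w′ * mono (e ℕ.+ e′) n          ∎
    where open ≡-Reasoning

  private
    mono-monomial-⊛ : ∀ e w′ e′ → mono e ⊛ (w′ ·ₛ mono e′) ≈ w′ ·ₛ mono (e ℕ.+ e′)
    mono-monomial-⊛ e w′ e′ n = trans (⊛-comm (mono e) (w′ ·ₛ mono e′) n) (trans (·-⊛ w′ (mono e′) (mono e) n)
      (cong (w′ *_) (trans (⊛-comm (mono e′) (mono e) n) (sym (mono-+ e e′ n)))))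

    sign² : ∀ ε → signℚ ε * signℚ ε ≡ 1ℚ
    sign² Sign.+ = refl
    sign² Sign.- = refl

  module FiniteTripleProduct (ε : Sign) (r s : ℕ) where

    K = r ℕ.+ s
    open Gauss K public

    M : (ℤ → ℚ) → ℤ → PS
    M u k = (u k * signAt ε k) ·ₛ mono (thetaExp r s k)

    X Y : ℕ → PS
    X i = signℚ ε ·ₛ mono (r ℕ.+ i ℕ.* K)
    Y i = signℚ ε ·ₛ mono (s ℕ.+ i ℕ.* K)

    -- The finite theta sum, with its centre at j = m. The weight `u` is 1 for the product formula
    -- and k for its derivative in x; it is kept general because adding a factor shifts it.
    S : (ℤ → ℚ) → ℕ → ℕ → PS
    S u L m = sumₛ L (λ j → gauss L j ⊛ M u (+ j ℤ.- + m))

    private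
      exponent-step : ∀ k → + 2 ℤ.* + thetaExp r s (k ℤ.+ + 1) ≡ + 2 ℤ.* + thetaExp r s k ℤ.+ + 2 ℤ.* (+ r ℤ.+ + K ℤ.* k)
      exponent-step k = trans (2thetaExp r s (k ℤ.+ + 1)) (trans (identity (+ r) (+ s) k)
          (cong (ℤ._+ + 2 ℤ.* (+ r ℤ.+ + K ℤ.* k)) (sym (2thetaExp r s k))))
        where
        identity : ∀ r s k → r ℤ.* ((k ℤ.+ + 1) ℤ.* (k ℤ.+ + 1 ℤ.+ + 1)) ℤ.+ s ℤ.* ((k ℤ.+ + 1) ℤ.* (k ℤ.+ + 1 ℤ.- + 1))
          ≡ r ℤ.* (k ℤ.* (k ℤ.+ + 1)) ℤ.+ s ℤ.* (k ℤ.* (k ℤ.- + 1)) ℤ.+ + 2 ℤ.* (r ℤ.+ (r ℤ.+ s) ℤ.* k)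
        identity = ℤS.solve-∀

      shift-x : ∀ u k a b → + a ≡ + b ℤ.- k → Q^ a ⊛ M u (k ℤ.+ + 1) ≈ X b ⊛ M (λ i → u (i ℤ.+ + 1)) k
      shift-x u k a b a≡b-k n = begin
        (Q^ a ⊛ M u (k ℤ.+ + 1)) n
            ≡⟨ mono-monomial-⊛ (K ℕ.* a) (u (k ℤ.+ + 1) * signAt ε (k ℤ.+ + 1)) (thetaExp r s (k ℤ.+ + 1)) n ⟩
        u (k ℤ.+ + 1) * signAt ε (k ℤ.+ + 1) * mono (K ℕ.* a ℕ.+ thetaExp r s (k ℤ.+ + 1)) n ≡⟨ cong₂ (λ w e → w * mono e n) coeffs exponents ⟩
        signℚ ε * (u (k ℤ.+ + 1) * signAt ε k) * mono (r ℕ.+ b ℕ.* K ℕ.+ thetaExp r s k) n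
            ≡⟨ sym (monomial-⊛ (signℚ ε) (r ℕ.+ b ℕ.* K) (u (k ℤ.+ + 1) * signAt ε k) (thetaExp r s k) n) ⟩
        (X b ⊛ M (λ i → u (i ℤ.+ + 1)) k) n                                           ∎
        where
        open ≡-Reasoning
        coeffs : u (k ℤ.+ + 1) * signAt ε (k ℤ.+ + 1) ≡ signℚ ε * (u (k ℤ.+ + 1) * signAt ε k)
        coeffs = trans (cong (u (k ℤ.+ + 1) *_) (signAt-suc ε k)) (swap (u (k ℤ.+ + 1)) (signℚ ε) (signAt ε k))
          where
          swap : ∀ x y z → x * (y * z) ≡ y * (x * z)
          swap = solve 3 (λ x y z → x :* (y :* z) := y :* (x :* z)) refl
            where open +-*-Solver
        exponents : K ℕ.* a ℕ.+ thetaExp r s (k ℤ.+ + 1) ≡ r ℕ.+ b ℕ.* K ℕ.+ thetaExp r s k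
        exponents = double-injective (begin
          + 2 ℤ.* (+ (K ℕ.* a) ℤ.+ + e′)                                    ≡⟨ cong (λ z → + 2 ℤ.* (z ℤ.+ + e′)) (ℤP.pos-* K a) ⟩
          + 2 ℤ.* (+ K ℤ.* + a ℤ.+ + e′)                                    ≡⟨ ℤP.*-distribˡ-+ (+ 2) (+ K ℤ.* + a) (+ e′) ⟩
          + 2 ℤ.* (+ K ℤ.* + a) ℤ.+ + 2 ℤ.* + e′                            ≡⟨ cong₂ (λ y z → + 2 ℤ.* (+ K ℤ.* y) ℤ.+ z) a≡b-k (exponent-step k) ⟩
          + 2 ℤ.* (+ K ℤ.* (+ b ℤ.- k)) ℤ.+ (+ 2 ℤ.* + e ℤ.+ + 2 ℤ.* (+ r ℤ.+ + K ℤ.* k))  ≡⟨ identity (+ K) (+ b) k (+ e) (+ r) ⟩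
          + 2 ℤ.* (+ r ℤ.+ + b ℤ.* + K ℤ.+ + e)                             ≡⟨ cong (λ z → + 2 ℤ.* (+ r ℤ.+ z ℤ.+ + e)) (sym (ℤP.pos-* b K)) ⟩
          + 2 ℤ.* + (r ℕ.+ b ℕ.* K ℕ.+ e)                                   ∎)
          where
          e = thetaExp r s k
          e′ = thetaExp r s (k ℤ.+ + 1)
          identity : ∀ K b k e r → + 2 ℤ.* (K ℤ.* (b ℤ.- k)) ℤ.+ (+ 2 ℤ.* e ℤ.+ + 2 ℤ.* (r ℤ.+ K ℤ.* k)) ≡ + 2 ℤ.* (r ℤ.+ b ℤ.* K ℤ.+ e)
          identity = ℤS.solve-∀

      shift-y : ∀ u k a b → + a ≡ + b ℤ.+ k ℤ.+ + 1 → Q^ a ⊛ M u k ≈ Y b ⊛ M (λ i → u (i ℤ.- + 1)) (k ℤ.+ + 1)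
      shift-y u k a b a≡ n = begin
        (Q^ a ⊛ M u k) n
            ≡⟨ mono-monomial-⊛ (K ℕ.* a) (u k * signAt ε k) (thetaExp r s k) n ⟩
        u k * signAt ε k * mono (K ℕ.* a ℕ.+ thetaExp r s k) n                        ≡⟨ cong₂ (λ w e → w * mono e n) coeffs exponents ⟩
        signℚ ε * (u (k ℤ.+ + 1 ℤ.- + 1) * signAt ε (k ℤ.+ + 1)) * mono (s ℕ.+ b ℕ.* K ℕ.+ thetaExp r s (k ℤ.+ + 1)) n
            ≡⟨ sym (monomial-⊛ (signℚ ε) (s ℕ.+ b ℕ.* K) (u (k ℤ.+ + 1 ℤ.- + 1) * signAt ε (k ℤ.+ + 1)) (thetaExp r s (k ℤ.+ + 1)) n) ⟩
        (Y b ⊛ M (λ i → u (i ℤ.- + 1)) (k ℤ.+ + 1)) n                                 ∎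
        where
        open ≡-Reasoning
        back : ∀ k → k ≡ k ℤ.+ + 1 ℤ.- + 1
        back = ℤS.solve-∀
        coeffs : u k * signAt ε k ≡ signℚ ε * (u (k ℤ.+ + 1 ℤ.- + 1) * signAt ε (k ℤ.+ + 1))
        coeffs = sym (begin
          signℚ ε * (u (k ℤ.+ + 1 ℤ.- + 1) * signAt ε (k ℤ.+ + 1))  ≡⟨ cong₂ (λ i z → signℚ ε * (u i * z)) (sym (back k)) (signAt-suc ε k) ⟩
          signℚ ε * (u k * (signℚ ε * signAt ε k))                  ≡⟨ swap (signℚ ε) (u k) (signAt ε k) ⟩
          signℚ ε * signℚ ε * (u k * signAt ε k)                    ≡⟨ cong (_* (u k * signAt ε k)) (sign² ε) ⟩
          1ℚ * (u k * signAt ε k)                                   ≡⟨ ℚP.*-identityˡ (u k * signAt ε k) ⟩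
          u k * signAt ε k                                          ∎)
          where
          swap : ∀ x y z → x * (y * (x * z)) ≡ x * x * (y * z)
          swap = solve 3 (λ x y z → x :* (y :* (x :* z)) := x :* x :* (y :* z)) refl
            where open +-*-Solver
        exponents : K ℕ.* a ℕ.+ thetaExp r s k ≡ s ℕ.+ b ℕ.* K ℕ.+ thetaExp r s (k ℤ.+ + 1)
        exponents = double-injective (begin
          + 2 ℤ.* (+ (K ℕ.* a) ℤ.+ + e)
              ≡⟨ cong (λ z → + 2 ℤ.* (z ℤ.+ + e)) (trans (ℤP.pos-* K a) (cong (+ K ℤ.*_) a≡)) ⟩
          + 2 ℤ.* (+ K ℤ.* (+ b ℤ.+ k ℤ.+ + 1) ℤ.+ + e)                     ≡⟨ identity (+ r) (+ s) (+ b) k (+ e) ⟩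
          + 2 ℤ.* (+ s ℤ.+ + b ℤ.* + K) ℤ.+ (+ 2 ℤ.* + e ℤ.+ + 2 ℤ.* (+ r ℤ.+ + K ℤ.* k))
              ≡⟨ cong₂ (λ y z → + 2 ℤ.* (+ s ℤ.+ y) ℤ.+ z) (sym (ℤP.pos-* b K)) (sym (exponent-step k)) ⟩
          + 2 ℤ.* (+ s ℤ.+ + (b ℕ.* K)) ℤ.+ + 2 ℤ.* + e′                    ≡⟨ sym (ℤP.*-distribˡ-+ (+ 2) (+ s ℤ.+ + (b ℕ.* K)) (+ e′)) ⟩
          + 2 ℤ.* + (s ℕ.+ b ℕ.* K ℕ.+ e′)                                  ∎)
          where
          e = thetaExp r s k
          e′ = thetaExp r s (k ℤ.+ + 1)
          identity : ∀ r s b k e → + 2 ℤ.* ((r ℤ.+ s) ℤ.* (b ℤ.+ k ℤ.+ + 1) ℤ.+ e) ≡ + 2 ℤ.* (s ℤ.+ b ℤ.* (r ℤ.+ s))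
              ℤ.+ (+ 2 ℤ.* e ℤ.+ + 2 ℤ.* (r ℤ.+ (r ℤ.+ s) ℤ.* k))
          identity = ℤS.solve-∀

      drop-last : ∀ L (u : ℕ → PS) → sumₛ (suc L) (λ j → u j ⊛ gauss L j) ≈ sumₛ L (λ j → u j ⊛ gauss L j)
      drop-last L u n = trans (cong (λ z → sumₛ L (λ j → u j ⊛ gauss L j) n + z)
        (trans (⊛-cong {f = u (suc L)} (λ _ → refl) (gauss-> L (suc L) ℕP.≤-refl) n) (R.zeroʳ (u (suc L)) n))) (ℚP.+-identityʳ _)

      sumₛ-cong : ∀ L {f g : ℕ → PS} → (∀ j → j ≤ L → f j ≈ g j) → sumₛ L f ≈ sumₛ L g
      sumₛ-cong L h n = sumTo-cong L λ j j≤L → h j j≤L n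

      sumₛ-head : ∀ L (f : ℕ → PS) → sumₛ (suc L) f ≈ f 0 +ₛ sumₛ L (λ j → f (suc j))
      sumₛ-head L f n = sumTo-head L (λ j → f j n)

      sumₛ-+ : ∀ L (f g : ℕ → PS) → sumₛ L (λ j → f j +ₛ g j) ≈ sumₛ L f +ₛ sumₛ L g
      sumₛ-+ L f g n = sumTo-+ L (λ j → f j n) (λ j → g j n)

      reassoc : ∀ x y z → x ⊛ y ⊛ z ≈ y ⊛ (x ⊛ z)
      reassoc = PSSolver.solve 3 (λ x y z → x :* y :* z := y :* (x :* z)) (λ _ → refl)
        where open PSSolver

    -- Pascal's rule splits the sum. In the second part the power Q^(L-j) and the change of exponent
    -- from k to k + 1 combine to `X (L ∸ m)`, independently of j, and the weight moves with the
    -- index.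
    S-x : ∀ u L m → m ≤ L → S u (suc L) m ≈ S u L m +ₛ X (L ∸ m) ⊛ S (λ i → u (i ℤ.+ + 1)) L m
    S-x u L m m≤L n = begin
      S u (suc L) m n
        ≡⟨ sumₛ-head L (λ j → gauss (suc L) j ⊛ Mj j) n ⟩
      (oneₛ ⊛ Mj 0) n + sumₛ L (λ j → (gauss L (suc j) +ₛ Q^ (L ∸ j) ⊛ gauss L j) ⊛ Mj (suc j)) n
        ≡⟨ cong (λ z → (oneₛ ⊛ Mj 0) n + z) (trans (sumₛ-cong L (λ j _ → ⊛-distribʳ (Mj (suc j)) (gauss L (suc j)) (Q^ (L ∸ j) ⊛ gauss L j)) n)
             (sumₛ-+ L (λ j → gauss L (suc j) ⊛ Mj (suc j)) (λ j → Q^ (L ∸ j) ⊛ gauss L j ⊛ Mj (suc j)) n)) ⟩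
      (oneₛ ⊛ Mj 0) n + (sumₛ L (λ j → gauss L (suc j) ⊛ Mj (suc j)) n + sumₛ L (λ j → Q^ (L ∸ j) ⊛ gauss L j ⊛ Mj (suc j)) n)
        ≡⟨ sym (ℚP.+-assoc ((oneₛ ⊛ Mj 0) n) (sumₛ L (λ j → gauss L (suc j) ⊛ Mj (suc j)) n) (sumₛ L (λ j → Q^ (L ∸ j) ⊛ gauss L j ⊛ Mj (suc j)) n)) ⟩
      (oneₛ ⊛ Mj 0) n + sumₛ L (λ j → gauss L (suc j) ⊛ Mj (suc j)) n + sumₛ L (λ j → Q^ (L ∸ j) ⊛ gauss L j ⊛ Mj (suc j)) n
        ≡⟨ cong₂ _+_ (trans (sym (sumₛ-head L (λ j → gauss L j ⊛ Mj j) n)) first) second ⟩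
      (S u L m +ₛ X (L ∸ m) ⊛ S u⁺ L m) n ∎
      where
      open ≡-Reasoning
      u⁺ = λ i → u (i ℤ.+ + 1)
      Mj = λ (j : ℕ) → M u (+ j ℤ.- + m)
      first : sumₛ (suc L) (λ j → gauss L j ⊛ Mj j) n ≡ S u L m n
      first = trans (sumₛ-cong (suc L) (λ j _ → ⊛-comm (gauss L j) (Mj j)) n)
          (trans (drop-last L Mj n) (sumₛ-cong L (λ j _ → ⊛-comm (Mj j) (gauss L j)) n))
      index : ∀ j m → + 1 ℤ.+ j ℤ.- m ≡ j ℤ.- m ℤ.+ + 1
      index = ℤS.solve-∀
      difference : ∀ j → j ≤ L → + (L ∸ j) ≡ + (L ∸ m) ℤ.- (+ j ℤ.- + m)
      difference j j≤L = begin
        + (L ∸ j)                                  ≡⟨ sub L j j≤L ⟩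
        + L ℤ.- + j                                ≡⟨ identity (+ L) (+ m) (+ j) ⟩
        + L ℤ.- + m ℤ.- (+ j ℤ.- + m)              ≡⟨ cong (ℤ._- (+ j ℤ.- + m)) (sym (sub L m m≤L)) ⟩
        + (L ∸ m) ℤ.- (+ j ℤ.- + m)                ∎
        where
        sub : ∀ L j → j ≤ L → + (L ∸ j) ≡ + L ℤ.- + j
        sub L j j≤L = sym (trans (ℤP.m-n≡m⊖n L j) (ℤP.⊖-≥ j≤L))
        identity : ∀ L m j → L ℤ.- j ≡ L ℤ.- m ℤ.- (j ℤ.- m)
        identity = ℤS.solve-∀
      second : sumₛ L (λ j → Q^ (L ∸ j) ⊛ gauss L j ⊛ Mj (suc j)) n ≡ (X (L ∸ m) ⊛ S u⁺ L m) n
      second = trans (sumₛ-cong L term-eq n) (sym (sumₛ-⊛ (X (L ∸ m)) L (λ j → gauss L j ⊛ M u⁺ (+ j ℤ.- + m)) n))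
        where
        term-eq : ∀ j → j ≤ L → Q^ (L ∸ j) ⊛ gauss L j ⊛ Mj (suc j) ≈ X (L ∸ m) ⊛ (gauss L j ⊛ M u⁺ (+ j ℤ.- + m))
        term-eq j j≤L i = begin
          (Q^ (L ∸ j) ⊛ gauss L j ⊛ Mj (suc j)) i                            ≡⟨ reassoc (Q^ (L ∸ j)) (gauss L j) (Mj (suc j)) i ⟩
          (gauss L j ⊛ (Q^ (L ∸ j) ⊛ M u (+ suc j ℤ.- + m))) i
              ≡⟨ cong (λ k → (gauss L j ⊛ (Q^ (L ∸ j) ⊛ M u k)) i) (index (+ j) (+ m)) ⟩
          (gauss L j ⊛ (Q^ (L ∸ j) ⊛ M u (+ j ℤ.- + m ℤ.+ + 1))) i
              ≡⟨ ⊛-cong {f = gauss L j} (λ _ → refl) (shift-x u (+ j ℤ.- + m) (L ∸ j) (L ∸ m) (difference j j≤L)) i ⟩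
          (gauss L j ⊛ (X (L ∸ m) ⊛ M u⁺ (+ j ℤ.- + m))) i
              ≡⟨ sym (trans (sym (⊛-assoc (X (L ∸ m)) (gauss L j) (M u⁺ (+ j ℤ.- + m)) i)) (reassoc (X (L ∸ m)) (gauss L j) (M u⁺ (+ j ℤ.- + m)) i)) ⟩
          (X (L ∸ m) ⊛ (gauss L j ⊛ M u⁺ (+ j ℤ.- + m))) i                   ∎

    -- Raising m as well recentres the sum, and now the dual Pascal rule fits: Q^j together with the
    -- step from k to k + 1 gives `Y m` for every j, with the weight shifted the other way.
    S-y : ∀ u L m → S u (suc L) (suc m) ≈ S u L m +ₛ Y m ⊛ S (λ i → u (i ℤ.- + 1)) L m
    S-y u L m n = begin
      S u (suc L) (suc m) n
        ≡⟨ sumₛ-head L (λ j → gauss (suc L) j ⊛ Mj j) n ⟩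
      (oneₛ ⊛ Mj 0) n + sumₛ L (λ j → gauss (suc L) (suc j) ⊛ Mj (suc j)) n
        -- The factor Q^0 is inserted so that the term j = 0 joins the sum with general power Q^j.
        ≡⟨ cong₂ _+_ (⊛-cong {g = Mj 0} (λ i → sym (trans (⊛-identityʳ (Q^ 0) i) (cong (λ e → mono e i) (ℕP.*-zeroʳ K)))) (λ _ → refl) n)
            (trans (sumₛ-cong L (λ j _ i → trans (⊛-cong {g = Mj (suc j)} (gauss-dual L j) (λ _ → refl) i)
                (⊛-distribʳ (Mj (suc j)) (Q^ (suc j) ⊛ gauss L (suc j)) (gauss L j) i)) n)
             (sumₛ-+ L (λ j → Q^ (suc j) ⊛ gauss L (suc j) ⊛ Mj (suc j)) (λ j → gauss L j ⊛ Mj (suc j)) n)) ⟩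
      (Q^ 0 ⊛ gauss L 0 ⊛ Mj 0) n + (sumₛ L (λ j → Q^ (suc j) ⊛ gauss L (suc j) ⊛ Mj (suc j)) n + sumₛ L (λ j → gauss L j ⊛ Mj (suc j)) n)
        ≡⟨ regroup ((Q^ 0 ⊛ gauss L 0 ⊛ Mj 0) n) (sumₛ L (λ j → Q^ (suc j) ⊛ gauss L (suc j) ⊛ Mj (suc j)) n)
            (sumₛ L (λ j → gauss L j ⊛ Mj (suc j)) n) ⟩
      sumₛ L (λ j → gauss L j ⊛ Mj (suc j)) n + ((Q^ 0 ⊛ gauss L 0 ⊛ Mj 0) n + sumₛ L (λ j → Q^ (suc j) ⊛ gauss L (suc j) ⊛ Mj (suc j)) n)
        ≡⟨ cong₂ _+_ (sumₛ-cong L (λ j _ i → cong (λ k → (gauss L j ⊛ M u k) i) (index (+ j) (+ m))) n)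
                     (trans (sym (sumₛ-head L (λ j → Q^ j ⊛ gauss L j ⊛ Mj j) n)) second) ⟩
      (S u L m +ₛ Y m ⊛ S u⁻ L m) n ∎
      where
      open ≡-Reasoning
      u⁻ = λ i → u (i ℤ.- + 1)
      Mj = λ (j : ℕ) → M u (+ j ℤ.- + suc m)
      regroup : ∀ x y z → x + (y + z) ≡ z + (x + y)
      regroup = solve 3 (λ x y z → x :+ (y :+ z) := z :+ (x :+ y)) refl
        where open +-*-Solver
      index : ∀ j m → + 1 ℤ.+ j ℤ.- (+ 1 ℤ.+ m) ≡ j ℤ.- m
      index = ℤS.solve-∀
      index′ : ∀ j m → j ℤ.- (+ 1 ℤ.+ m) ℤ.+ + 1 ≡ j ℤ.- m
      index′ = ℤS.solve-∀
      recover : ∀ j m → j ≡ m ℤ.+ (j ℤ.- (+ 1 ℤ.+ m)) ℤ.+ + 1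
      recover = ℤS.solve-∀
      second : sumₛ (suc L) (λ j → Q^ j ⊛ gauss L j ⊛ Mj j) n ≡ (Y m ⊛ S u⁻ L m) n
      second = begin
        sumₛ (suc L) (λ j → Q^ j ⊛ gauss L j ⊛ Mj j) n
          ≡⟨ sumₛ-cong (suc L) term-eq n ⟩
        sumₛ (suc L) (λ j → Y m ⊛ M u⁻ (+ j ℤ.- + m) ⊛ gauss L j) n
          ≡⟨ drop-last L (λ j → Y m ⊛ M u⁻ (+ j ℤ.- + m)) n ⟩
        sumₛ L (λ j → Y m ⊛ M u⁻ (+ j ℤ.- + m) ⊛ gauss L j) n
          ≡⟨ sumₛ-cong L (λ j _ i → trans (⊛-assoc (Y m) (M u⁻ (+ j ℤ.- + m)) (gauss L j) i)
              (⊛-cong {f = Y m} (λ _ → refl) (⊛-comm (M u⁻ (+ j ℤ.- + m)) (gauss L j)) i)) n ⟩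
        sumₛ L (λ j → Y m ⊛ (gauss L j ⊛ M u⁻ (+ j ℤ.- + m))) n
          ≡⟨ sym (sumₛ-⊛ (Y m) L (λ j → gauss L j ⊛ M u⁻ (+ j ℤ.- + m)) n) ⟩
        (Y m ⊛ S u⁻ L m) n ∎
        where
        term-eq : ∀ j → j ≤ suc L → Q^ j ⊛ gauss L j ⊛ Mj j ≈ Y m ⊛ M u⁻ (+ j ℤ.- + m) ⊛ gauss L j
        term-eq j _ i = begin
          (Q^ j ⊛ gauss L j ⊛ Mj j) i
              ≡⟨ trans (reassoc (Q^ j) (gauss L j) (Mj j) i) (⊛-comm (gauss L j) (Q^ j ⊛ Mj j) i) ⟩
          (Q^ j ⊛ M u (+ j ℤ.- + suc m) ⊛ gauss L j) i
              ≡⟨ ⊛-cong {g = gauss L j} (shift-y u (+ j ℤ.- + suc m) j m (recover (+ j) (+ m))) (λ _ → refl) i ⟩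
          (Y m ⊛ M u⁻ (+ j ℤ.- + suc m ℤ.+ + 1) ⊛ gauss L j) i               ≡⟨ cong (λ k → (Y m ⊛ M u⁻ k ⊛ gauss L j) i) (index′ (+ j) (+ m)) ⟩
          (Y m ⊛ M u⁻ (+ j ℤ.- + m) ⊛ gauss L j) i                           ∎

    S-0 : ∀ u → S u 0 0 ≈ u (+ 0) ·ₛ oneₛ
    S-0 u n = trans (⊛-identityˡ (M u (+ 0)) n) (cong₂ (λ w e → w * mono e n) (trans (cong (u (+ 0) *_) (sign0 ε)) (ℚP.*-identityʳ (u (+ 0))))
      (cong₂ ℕ._+_ (ℕP.*-zeroʳ r) (ℕP.*-zeroʳ s)))
      where
      sign0 : ∀ ε → signAt ε (+ 0) ≡ 1ℚ
      sign0 Sign.+ = refl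
      sign0 Sign.- = refl

    private
      one : ℤ → ℚ
      one _ = 1ℚ

      factor-out : ∀ x y → y +ₛ x ⊛ y ≈ (oneₛ +ₛ x) ⊛ y
      factor-out x y n = sym (trans (⊛-distribʳ y oneₛ x n) (cong (_+ (x ⊛ y) n) (⊛-identityˡ y n)))

    -- Rothe's identity: for constant weight the two recursions above multiply the sum by 1 + X and
    -- 1 + Y, so the factors are attached one at a time.
    finiteTripleProduct : ∀ m n → finProd m (λ i → oneₛ +ₛ Y i) ⊛ finProd n (λ i → oneₛ +ₛ X i) ≈ S one (m ℕ.+ n) m
    finiteTripleProduct zero zero i = trans (⊛-identityˡ oneₛ i) (sym (trans (S-0 one i) (ℚP.*-identityˡ (oneₛ i))))
    finiteTripleProduct zero (suc n) i = begin
      (oneₛ ⊛ ((oneₛ +ₛ X n) ⊛ finProd n (λ i → oneₛ +ₛ X i))) i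
        ≡⟨ ⊛-identityˡ ((oneₛ +ₛ X n) ⊛ finProd n (λ i → oneₛ +ₛ X i)) i ⟩
      ((oneₛ +ₛ X n) ⊛ finProd n (λ i → oneₛ +ₛ X i)) i
        ≡⟨ ⊛-cong {f = oneₛ +ₛ X n} (λ _ → refl) (λ j → trans (sym (⊛-identityˡ (finProd n (λ i → oneₛ +ₛ X i)) j)) (finiteTripleProduct zero n j)) i
            ⟩
      ((oneₛ +ₛ X n) ⊛ S one n 0) i
        ≡⟨ sym (factor-out (X n) (S one n 0) i) ⟩
      (S one n 0 +ₛ X n ⊛ S one n 0) i
        ≡⟨ sym (S-x one n 0 z≤n i) ⟩
      S one (suc n) 0 i ∎
      where open ≡-Reasoning
    finiteTripleProduct (suc m) n i = begin
      ((oneₛ +ₛ Y m) ⊛ finProd m (λ i → oneₛ +ₛ Y i) ⊛ finProd n (λ i → oneₛ +ₛ X i)) i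
        ≡⟨ ⊛-assoc (oneₛ +ₛ Y m) (finProd m (λ i → oneₛ +ₛ Y i)) (finProd n (λ i → oneₛ +ₛ X i)) i ⟩
      ((oneₛ +ₛ Y m) ⊛ (finProd m (λ i → oneₛ +ₛ Y i) ⊛ finProd n (λ i → oneₛ +ₛ X i))) i
        ≡⟨ ⊛-cong {f = oneₛ +ₛ Y m} (λ _ → refl) (finiteTripleProduct m n) i ⟩
      ((oneₛ +ₛ Y m) ⊛ S one (m ℕ.+ n) m) i
        ≡⟨ sym (factor-out (Y m) (S one (m ℕ.+ n) m) i) ⟩
      (S one (m ℕ.+ n) m +ₛ Y m ⊛ S one (m ℕ.+ n) m) i
        ≡⟨ sym (S-y one (m ℕ.+ n) m i) ⟩
      S one (suc (m ℕ.+ n)) (suc m) i ∎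
      where open ≡-Reasoning

open RotheIdentity

-- Jacobi's triple product and Jacobi's formula for the cube

module JacobiTripleProduct where

  open import Data.Rational using (_+_; _*_; -_)
  open import Data.List using ([]; _∷_; _++_; map; upTo; [_])
  open import Data.List.Membership.Propositional using (_∈_)
  open import Data.List.Membership.Propositional.Properties
  open import Data.Sum using (inj₁; inj₂)

  module ℕS = Data.Nat.Solver.+-*-Solver
  thetaFamily : (u : ℤ → ℚ) (ε : Sign) (r s : ℕ) → 1 ≤ r ℕ.+ s → Family
  thetaFamily u ε r s pos = intFamily (thetaExp r s) (λ k → u k * signAt ε k) (thetaExp-bound r s pos)

  logDeriv-1-mono : ∀ m → 1 ≤ m → LogDeriv (oneₛ +ₛ (-ₛ mono m)) (lambert m)
  logDeriv-1-mono (suc m) _ = logDeriv-resp (oneMinus≈ m) (λ _ → refl) (logDeriv-oneMinus m)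

  -- The factor is the quotient of 1 - q^(2m) by 1 - q^m.
  logDeriv-1+mono : ∀ m → 1 ≤ m → LogDeriv (oneₛ +ₛ mono m) (lambert (m ℕ.+ m) +ₛ (-ₛ lambert m))
  logDeriv-1+mono m 1≤m = logDeriv-quotient (logDeriv-1-mono m 1≤m) (logDeriv-1-mono (m ℕ.+ m) (ℕP.≤-trans 1≤m (ℕP.m≤m+n m m))) difference-of-squares
    where
    difference-of-squares : (oneₛ +ₛ (-ₛ mono m)) ⊛ (oneₛ +ₛ mono m) ≈ oneₛ +ₛ (-ₛ mono (m ℕ.+ m))
    difference-of-squares n = trans (solve 2 (λ o x → (o :+ (:- x)) :* (o :+ x) := o :* o :+ (:- (x :* x))) (λ _ → refl) oneₛ (mono m) n)
      (cong₂ (λ y z → y + - z) (⊛-identityˡ oneₛ n) (sym (mono-+ m m n)))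
      where open PSSolver

  Λ-arith : ∀ K r e → 1 ≤ r → r ≤ K → ∀ N n → n ≤ N → Λ [ (K , r , e) ] n ≡ ∑ (upTo N) (λ i → fromℤ e * lambert (r ℕ.+ i ℕ.* K) n)
  Λ-arith zero    r e 1≤r r≤K = contradiction (ℕP.≤-trans 1≤r r≤K) λ ()
  Λ-arith (suc k) r e 1≤r r≤K = Λ-progression k r e 1≤r r≤K

  Λ-arith₁ : ∀ K r → 1 ≤ r → r ≤ K → ∀ N n → n ≤ N → Λ [ (K , r , + 1) ] n ≡ ∑ (upTo N) (λ i → lambert (r ℕ.+ i ℕ.* K) n)
  Λ-arith₁ K r 1≤r r≤K N n n≤N = trans (Λ-arith K r (+ 1) 1≤r r≤K N n n≤N) (∑-cong (upTo N) λ i → ℚP.*-identityˡ (lambert (r ℕ.+ i ℕ.* K) n))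

  module TripleProductLimit (ε : Sign) (r s : ℕ) (pos : 1 ≤ r ℕ.+ s) where

    open FiniteTripleProduct ε r s

    pochΛ : ℕ → PS
    pochΛ N n = ∑ (upTo N) (λ i → lambert (K ℕ.* suc i) n)

    logDeriv-poch : ∀ N → LogDeriv (poch N) (pochΛ N)
    logDeriv-poch N = logDeriv-finProd N (λ i → oneₛ +ₛ (-ₛ Q^ (suc i))) (λ i → lambert (K ℕ.* suc i))
      λ i → logDeriv-1-mono (K ℕ.* suc i) (ℕP.≤-trans pos (ℕP.m≤m*n K (suc i)))

    pochΛ≡ : ∀ N n → n ≤ N → pochΛ N n ≡ Λ [ (K , K , + 1) ] n
    pochΛ≡ N n n≤N = trans (∑-cong (upTo N) λ i → cong (λ m → lambert m n) (ℕP.*-comm K (suc i))) (sym (Λ-arith₁ K K pos ℕP.≤-refl N n n≤N))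

    -- The binomial is (Q)_(i+j) / ((Q)_i (Q)_j); once all lengths are at least n₀, the four
    -- logarithmic derivatives agree up to degree n₀ and cancel in pairs.
    gauss-limit : ∀ n₀ N i j → n₀ ≤ N → n₀ ≤ i → n₀ ≤ j → ∀ n → n ≤ n₀ → (poch N ⊛ gauss (i ℕ.+ j) j) n ≡ oneₛ n
    gauss-limit n₀ N i j n₀≤N n₀≤i n₀≤j n n≤n₀ = logDeriv-unique≤ (logDeriv-⊛ (logDeriv-poch N) gaussΛ) logDeriv-one n₀ cancel n n≤n₀
      where
      gaussΛ : LogDeriv (gauss (i ℕ.+ j) j) (pochΛ (i ℕ.+ j) +ₛ (-ₛ (pochΛ j +ₛ pochΛ i)))
      gaussΛ = logDeriv-quotient (logDeriv-⊛ (logDeriv-poch j) (logDeriv-poch i)) (logDeriv-poch (i ℕ.+ j)) (gauss-poch i j)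
      cancel : ∀ m → m ≤ n₀ → pochΛ N m + (pochΛ (i ℕ.+ j) m + - (pochΛ j m + pochΛ i m)) ≡ 0ℚ
      cancel m m≤n₀ = trans (cong₂ _+_ (at N n₀≤N) (cong₂ (λ y z → y + - z) (at (i ℕ.+ j) (ℕP.≤-trans n₀≤i (ℕP.m≤m+n i j)))
          (cong₂ _+_ (at j n₀≤j) (at i n₀≤i))))
        (zero-sum (Λ [ (K , K , + 1) ] m))
        where
        at : ∀ M → n₀ ≤ M → pochΛ M m ≡ Λ [ (K , K , + 1) ] m
        at M n₀≤M = pochΛ≡ M m (ℕP.≤-trans m≤n₀ n₀≤M)
        zero-sum : ∀ x → x + (x + - (x + x)) ≡ 0ℚ
        zero-sum = solve 1 (λ x → x :+ (x :+ (:- (x :+ x))) := con 0ℚ) refl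
          where open +-*-Solver

    private
      -- A term of exponent at most n₀ has index of absolute value at most n₀ + 1, and 2n₀ + 1
      -- leaves n₀ on either side of it.
      large : ℕ → ℕ
      large n₀ = suc (n₀ ℕ.+ n₀)

      monomial-below : ∀ f w e n → n < e → (f ⊛ (w ·ₛ mono e)) n ≡ 0ℚ
      monomial-below f w e n n<e = trans (⊛-comm f (w ·ₛ mono e) n) (trans (·-⊛ w (mono e) f n)
        (trans (cong (w *_) (trans (sym (shift≈mono e f n)) (shift-below e f n<e))) (ℚP.*-zeroʳ w)))

      term-limit : ∀ u n₀ j → j ≤ large n₀ ℕ.+ large n₀ → ∀ n → n ≤ n₀ →
        (poch (large n₀) ⊛ (gauss (large n₀ ℕ.+ large n₀) j ⊛ M u (+ j ℤ.- + large n₀))) n ≡ M u (+ j ℤ.- + large n₀) n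
      term-limit u n₀ j j≤2N n n≤n₀ = trans (sym (⊛-assoc (poch N) (gauss (N ℕ.+ N) j) (M u k) n)) main
        where
        N = large n₀
        k = + j ℤ.- + N
        i = N ℕ.+ N ∸ j
        i+j : i ℕ.+ j ≡ N ℕ.+ N
        i+j = ℕP.m∸n+n≡m j≤2N
        main : (poch N ⊛ gauss (N ℕ.+ N) j ⊛ M u k) n ≡ M u k n
        main with ℕP.<-≤-connex n (thetaExp r s k)
        ... | inj₁ n<e = trans (monomial-below (poch N ⊛ gauss (N ℕ.+ N) j) (u k * signAt ε k) (thetaExp r s k) n n<e)
          (sym (trans (cong (u k * signAt ε k *_) (shift-below (thetaExp r s k) oneₛ n<e)) (ℚP.*-zeroʳ (u k * signAt ε k))))
        ... | inj₂ e≤n = trans (⊛-congˡ≤ (M u k) n λ m m≤n → near m (ℕP.≤-trans m≤n n≤n₀)) (⊛-identityˡ (M u k) n)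
          where
          ∣k∣≤ : ℤ.∣ k ∣ ≤ suc n₀
          ∣k∣≤ = ℕP.≤-trans (thetaExp-bound r s pos k) (s≤s (ℕP.≤-trans e≤n n≤n₀))
          -- N − ∣k∣ ≥ n₀, in both cases j ≤ N and j ≥ N
          n₀≤j×i : n₀ ≤ j × n₀ ≤ i
          n₀≤j×i with ℕP.≤-total j N
          ... | inj₁ j≤N = lower , ℕP.≤-trans (ℕP.m≤n⇒m≤1+n (ℕP.m≤m+n n₀ n₀))
              (ℕP.+-cancelʳ-≤ j N i (ℕP.≤-trans (ℕP.+-monoʳ-≤ N j≤N) (ℕP.≤-reflexive (sym i+j))))
            where
            lower : n₀ ≤ j
            lower = ℕP.+-cancelˡ-≤ (suc n₀) n₀ j (ℕP.≤-trans (ℕP.≤-reflexive (sym (ℕP.m∸n+n≡m j≤N))) (ℕP.+-monoˡ-≤ j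
              (subst (_≤ suc n₀) (trans (cong ℤ.∣_∣ (ℤP.m-n≡m⊖n j N)) (ℤP.∣⊖∣-≤ j≤N)) ∣k∣≤)))
          ... | inj₂ N≤j = ℕP.≤-trans (ℕP.m≤n⇒m≤1+n (ℕP.m≤m+n n₀ n₀)) N≤j , lower
            where
            j≤ : j ≤ suc n₀ ℕ.+ N
            j≤ = ℕP.≤-trans (ℕP.≤-reflexive (sym (ℕP.m∸n+n≡m N≤j))) (ℕP.+-monoˡ-≤ N
              (subst (_≤ suc n₀) (trans (cong ℤ.∣_∣ (trans (ℤP.m-n≡m⊖n j N) (ℤP.⊖-≥ N≤j))) refl) ∣k∣≤))
            lower : n₀ ≤ i
            lower = ℕP.+-cancelʳ-≤ (suc n₀ ℕ.+ N) n₀ i (ℕP.≤-trans (ℕP.≤-reflexive n₀+) (ℕP.≤-trans (ℕP.≤-reflexive (sym i+j)) (ℕP.+-monoʳ-≤ i j≤)))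
              where
              n₀+ : n₀ ℕ.+ (suc n₀ ℕ.+ N) ≡ N ℕ.+ N
              n₀+ = trans (sym (ℕP.+-assoc n₀ (suc n₀) N)) (cong (ℕ._+ N) (ℕP.+-suc n₀ n₀))
          near : ∀ m → m ≤ n₀ → (poch N ⊛ gauss (N ℕ.+ N) j) m ≡ oneₛ m
          near m m≤n₀ = subst (λ L → (poch N ⊛ gauss L j) m ≡ oneₛ m) i+j
            (gauss-limit n₀ N i j (ℕP.m≤n⇒m≤1+n (ℕP.m≤m+n n₀ n₀)) (proj₂ n₀≤j×i) (proj₁ n₀≤j×i) m m≤n₀)

    -- Within the window - N ≤ k ≤ N every binomial times (Q)_N acts as 1 up to degree n₀, and all
    -- indices of exponent n lie in the window.
    limit : ∀ u n₀ n → n ≤ n₀ → gf (thetaFamily u ε r s pos) n ≡ (poch (large n₀) ⊛ S u (large n₀ ℕ.+ large n₀) (large n₀)) n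
    limit u n₀ n n≤n₀ = sym (begin
      (poch N ⊛ S u (N ℕ.+ N) N) n
        ≡⟨ sumₛ-⊛ (poch N) (N ℕ.+ N) (λ j → gauss (N ℕ.+ N) j ⊛ M u (k j)) n ⟩
      sumTo (N ℕ.+ N) (λ j → (poch N ⊛ (gauss (N ℕ.+ N) j ⊛ M u (k j))) n)
        ≡⟨ sumTo-cong (N ℕ.+ N) (λ j j≤2N → term-limit u n₀ j j≤2N n n≤n₀) ⟩
      sumTo (N ℕ.+ N) (λ j → M u (k j) n)
        ≡⟨ sumTo≡∑ (N ℕ.+ N) (λ j → M u (k j) n) ⟩
      ∑ (upTo (suc (N ℕ.+ N))) (λ j → M u (k j) n)
        ≡⟨ sym (∑-map k (upTo (suc (N ℕ.+ N))) (λ i → M u i n)) ⟩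
      ∑ (map k (upTo (suc (N ℕ.+ N)))) (λ i → M u i n)
        ≡⟨ sym (gf-enum (thetaFamily u ε r s pos) n (Unique.map⁺ k-inj (Unique.upTo⁺ (suc (N ℕ.+ N)))) cover) ⟩
      gf (thetaFamily u ε r s pos) n ∎)
      where
      open ≡-Reasoning
      N = large n₀
      k : ℕ → ℤ
      k j = + j ℤ.- + N
      k-inj : ∀ {i j} → k i ≡ k j → i ≡ j
      k-inj {i} {j} eq = ℤP.+-injective (trans (sym (restore (+ i) (+ N))) (trans (cong (ℤ._+ + N) eq) (restore (+ j) (+ N))))
        where
        restore : ∀ x y → x ℤ.- y ℤ.+ y ≡ x
        restore = ℤS.solve-∀
      cover : ∀ l → thetaExp r s l ≡ n → l ∈ map k (upTo (suc (N ℕ.+ N)))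
      cover l e≡n = at ∣l+N∣ bound (trans (cong (ℤ._- + N) (ℤP.0≤i⇒+∣i∣≡i 0≤l+N)) (cancel l (+ N)))
        where
        ∣l∣≤N : ℤ.∣ l ∣ ≤ N
        ∣l∣≤N = (ℕP.≤-trans (thetaExp-bound r s pos l) (s≤s (ℕP.≤-trans (ℕP.≤-reflexive e≡n) (ℕP.≤-trans n≤n₀ (ℕP.m≤m+n n₀ n₀)))))
        ∣l+N∣ = ℤ.∣ l ℤ.+ + N ∣
        bound : ∣l+N∣ ≤ N ℕ.+ N
        bound = ℕP.≤-trans (ℤP.∣i+j∣≤∣i∣+∣j∣ l (+ N)) (ℕP.+-monoˡ-≤ N ∣l∣≤N)
        0≤l+N : + 0 ℤ.≤ l ℤ.+ + N
        0≤l+N = nonneg l ∣l∣≤N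
          where
          nonneg : ∀ l → ℤ.∣ l ∣ ≤ N → + 0 ℤ.≤ l ℤ.+ + N
          nonneg (+ m)    _ = ℤ.+≤+ z≤n
          nonneg -[1+ m ] h = subst (+ 0 ℤ.≤_) (sym (ℤP.⊖-≥ h)) (ℤ.+≤+ z≤n)
        at : ∀ j → j ≤ N ℕ.+ N → k j ≡ l → l ∈ map k (upTo (suc (N ℕ.+ N)))
        at j j≤2N eq = subst (_∈ map k (upTo (suc (N ℕ.+ N)))) eq (∈-map⁺ k (∈-upTo⁺ (s≤s j≤2N)))
        cancel : ∀ x y → x ℤ.+ y ℤ.- y ≡ x
        cancel = ℤS.solve-∀

  θ : Sign → (r s : ℕ) → .{{_ : NonZero r}} → .{{_ : NonZero s}} → PS
  θ ε (suc r) s = gf (thetaFamily (λ _ → 1ℚ) ε (suc r) s (s≤s z≤n))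

  -- Σ ε^k q^{r k(k+1)/2 + s k(k−1)/2} = Π (1 − Q^n)(1 + ε q^r Q^{n−1})(1 + ε q^s Q^{n−1}), Q = q^{r+s}
  factorΛ : Sign → ℕ → PS
  factorΛ Sign.+ m = lambert (m ℕ.+ m) +ₛ (-ₛ lambert m)
  factorΛ Sign.- m = lambert m

  -- The factors 1 + q^m over a progression are (1 - q^(2m))/(1 - q^m), and 2m runs through a
  -- progression with doubled modulus and residue.
  arithSpec : Sign → ℕ → ℕ → Spec
  arithSpec Sign.+ K r = (K ℕ.+ K , r ℕ.+ r , + 1) ∷ (K , r , ℤ.- + 1) ∷ []
  arithSpec Sign.- K r = (K , r , + 1) ∷ []

  thetaSpec : Sign → ℕ → ℕ → Spec
  thetaSpec ε r s = (r ℕ.+ s , r ℕ.+ s , + 1) ∷ arithSpec ε (r ℕ.+ s) s ++ arithSpec ε (r ℕ.+ s) r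

  logDeriv-signed : ∀ ε m → 1 ≤ m → LogDeriv (oneₛ +ₛ signℚ ε ·ₛ mono m) (factorΛ ε m)
  logDeriv-signed Sign.+ m 1≤m = logDeriv-resp (λ n → cong (λ z → oneₛ n + z) (sym (ℚP.*-identityˡ (mono m n)))) (λ _ → refl) (logDeriv-1+mono m 1≤m)
  logDeriv-signed Sign.- m 1≤m = logDeriv-resp (λ n → cong (λ z → oneₛ n + z)
      (trans (cong -_ (sym (ℚP.*-identityˡ (mono m n)))) (ℚP.neg-distribˡ-* 1ℚ (mono m n)))) (λ _ → refl) (logDeriv-1-mono m 1≤m)

  factorΛ-arith : ∀ ε K r → 1 ≤ r → r ≤ K → ∀ N n → n ≤ N → Λ (arithSpec ε K r) n ≡ ∑ (upTo N) (λ i → factorΛ ε (r ℕ.+ i ℕ.* K) n)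
  factorΛ-arith Sign.- K r 1≤r r≤K N n n≤N = Λ-arith₁ K r 1≤r r≤K N n n≤N
  factorΛ-arith Sign.+ K r 1≤r r≤K N n n≤N = begin
    Λ (arithSpec Sign.+ K r) n
      ≡⟨ Λ-++ [ (K ℕ.+ K , r ℕ.+ r , + 1) ] [ (K , r , ℤ.- + 1) ] n ⟩
    Λ [ (K ℕ.+ K , r ℕ.+ r , + 1) ] n + Λ [ (K , r , ℤ.- + 1) ] n
      ≡⟨ cong₂ _+_ (Λ-arith₁ (K ℕ.+ K) (r ℕ.+ r) (ℕP.≤-trans 1≤r (ℕP.m≤m+n r r)) (ℕP.+-mono-≤ r≤K r≤K) N n n≤N)
          (Λ-arith K r (ℤ.- + 1) 1≤r r≤K N n n≤N) ⟩
    ∑ (upTo N) (λ i → lambert (r ℕ.+ r ℕ.+ i ℕ.* (K ℕ.+ K)) n) + ∑ (upTo N) (λ i → - 1ℚ * lambert (r ℕ.+ i ℕ.* K) n)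
      ≡⟨ sym (∑-+ (upTo N) (λ i → lambert (r ℕ.+ r ℕ.+ i ℕ.* (K ℕ.+ K)) n) (λ i → - 1ℚ * lambert (r ℕ.+ i ℕ.* K) n)) ⟩
    ∑ (upTo N) (λ i → lambert (r ℕ.+ r ℕ.+ i ℕ.* (K ℕ.+ K)) n + - 1ℚ * lambert (r ℕ.+ i ℕ.* K) n)
      ≡⟨ ∑-cong (upTo N) (λ i → cong₂ _+_ (cong (λ m → lambert m n) (double i))
          (trans (sym (ℚP.neg-distribˡ-* 1ℚ (lambert (r ℕ.+ i ℕ.* K) n))) (cong -_ (ℚP.*-identityˡ (lambert (r ℕ.+ i ℕ.* K) n))))) ⟩
    ∑ (upTo N) (λ i → factorΛ Sign.+ (r ℕ.+ i ℕ.* K) n) ∎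
    where
    open ≡-Reasoning
    double : ∀ i → r ℕ.+ r ℕ.+ i ℕ.* (K ℕ.+ K) ≡ r ℕ.+ i ℕ.* K ℕ.+ (r ℕ.+ i ℕ.* K)
    double i = trans (cong (r ℕ.+ r ℕ.+_) (ℕP.*-distribˡ-+ i K K)) (ℕS.solve
        2 (λ a b → a ℕS.:+ a ℕS.:+ (b ℕS.:+ b) ℕS.:= a ℕS.:+ b ℕS.:+ (a ℕS.:+ b)) refl r (i ℕ.* K))

  -- The approximations are (Q)_N times N factors of each kind, N = 2n + 1; up to degree n they
  -- agree with the theta series and their Lambert series with that of the infinite product.
  tripleProduct : ∀ ε r s .{{_ : NonZero r}} .{{_ : NonZero s}} → HasSpec (θ ε r s) (thetaSpec ε r s)
  tripleProduct ε r@(suc r′) s@(suc s′) = hasSpec (logDeriv-limit approx)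
    where
    open FiniteTripleProduct ε r s
    open TripleProductLimit ε r s (s≤s z≤n)
    XΛ YΛ : ℕ → PS
    XΛ N n = ∑ (upTo N) (λ i → factorΛ ε (r ℕ.+ i ℕ.* K) n)
    YΛ N n = ∑ (upTo N) (λ i → factorΛ ε (s ℕ.+ i ℕ.* K) n)
    approx : ∀ n → ∃ λ g → ∃ λ Λ′ → LogDeriv g Λ′ × (∀ i → i ≤ n → θ ε r s i ≡ g i) × (∀ i → i ≤ n → Λ (thetaSpec ε r s) i ≡ Λ′ i)
    approx n = poch N ⊛ (finProd N (λ i → oneₛ +ₛ Y i) ⊛ finProd N (λ i → oneₛ +ₛ X i)) , pochΛ N +ₛ (YΛ N +ₛ XΛ N)
      , logDeriv-⊛ (logDeriv-poch N) (logDeriv-⊛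
          (logDeriv-finProd N (λ i → oneₛ +ₛ Y i) (λ i → factorΛ ε (s ℕ.+ i ℕ.* K)) λ i → logDeriv-signed ε (s ℕ.+ i ℕ.* K) (s≤s z≤n))
          (logDeriv-finProd N (λ i → oneₛ +ₛ X i) (λ i → factorΛ ε (r ℕ.+ i ℕ.* K)) λ i → logDeriv-signed ε (r ℕ.+ i ℕ.* K) (s≤s z≤n)))
      , (λ i i≤n → trans (limit (λ _ → 1ℚ) n i i≤n) (⊛-cong {f = poch N} (λ _ → refl) (λ j → sym (finiteTripleProduct N N j)) i))
      , λ i i≤n → trans (Λ-++ [ (K , K , + 1) ] (arithSpec ε K s ++ arithSpec ε K r) i)
          (cong₂ _+_ (sym (pochΛ≡ N i (i≤N i i≤n)))
            (trans (Λ-++ (arithSpec ε K s) (arithSpec ε K r) i) (cong₂ _+_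
              (factorΛ-arith ε K s (s≤s z≤n) (ℕP.m≤n+m s r) N i (i≤N i i≤n)) (factorΛ-arith ε K r (s≤s z≤n) (ℕP.m≤m+n r s) N i (i≤N i i≤n)))))
      where
      N = suc (n ℕ.+ n)
      i≤N : ∀ i → i ≤ n → i ≤ N
      i≤N i i≤n = ℕP.≤-trans i≤n (ℕP.m≤n⇒m≤1+n (ℕP.m≤m+n n n))

  -- Jacobi's identity: differentiating the triple product with respect to x at x = − 1
  module Jacobi where

    -- The choice r = 0 with sign - is the point x = - 1: `X i` is - q^i and `Y i` is - q^(i+1).
    open FiniteTripleProduct Sign.- 0 1
    open TripleProductLimit Sign.- 0 1 (s≤s z≤n)

    private
      one : ℤ → ℚ
      one _ = 1ℚ

      S-cong : ∀ {u v} → (∀ k → u k ≡ v k) → ∀ L m → S u L m ≈ S v L m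
      S-cong h L m n = sumTo-cong L λ j _ → ⊛-cong {f = gauss L j} (λ _ → refl)
          (λ i → cong (λ w → w * signAt Sign.- (+ j ℤ.- + m) * mono (thetaExp 0 1 (+ j ℤ.- + m)) i) (h (+ j ℤ.- + m))) n

      S-+ : ∀ u c L m → S (λ k → u k + c) L m ≈ S u L m +ₛ c ·ₛ S one L m
      S-+ u c L m n = trans (sumTo-cong L λ j _ → each j) (trans (sumTo-+ L (λ j → (gauss L j ⊛ M u (k j)) n) (λ j → c * (gauss L j ⊛ M one (k j)) n))
        (cong (λ z → S u L m n + z) (sumTo-*ˡ L c (λ j → (gauss L j ⊛ M one (k j)) n))))
        where
        k = λ (j : ℕ) → + j ℤ.- + m
        distrib : ∀ x c w e → (x + c) * w * e ≡ x * w * e + c * (1ℚ * w * e)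
        distrib = solve 4 (λ x c w e → (x :+ c) :* w :* e := x :* w :* e :+ c :* (con 1ℚ :* w :* e)) refl
          where open +-*-Solver
        each : ∀ j → (gauss L j ⊛ M (λ k → u k + c) (k j)) n ≡ (gauss L j ⊛ M u (k j)) n + c * (gauss L j ⊛ M one (k j)) n
        each j = trans (⊛-cong {f = gauss L j} (λ _ → refl) (λ i → distrib (u (k j)) c (signAt Sign.- (k j)) (mono (thetaExp 0 1 (k j)) i)) n)
          (trans (R.distribˡ (gauss L j) (M u (k j)) (c ·ₛ M one (k j)) n) (cong (λ z → (gauss L j ⊛ M u (k j)) n + z)
            (trans (⊛-comm (gauss L j) (c ·ₛ M one (k j)) n) (trans (·-⊛ c (M one (k j)) (gauss L j) n)
                (cong (c *_) (⊛-comm (M one (k j)) (gauss L j) n))))))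

      X0 : oneₛ +ₛ X 0 ≈ 0ₛ
      X0 n = cancel (oneₛ n)
        where
        cancel : ∀ x → x + - 1ℚ * x ≡ 0ℚ
        cancel = solve 1 (λ x → x :+ con (- 1ℚ) :* x := con 0ℚ) refl
          where open +-*-Solver

      -- The factor 1 + X 0 is 1 - 1 = 0, so the undifferentiated product vanishes.
      finProd-X : ∀ n → finProd (suc n) (λ i → oneₛ +ₛ X i) ≈ 0ₛ
      finProd-X zero    i = trans (⊛-identityʳ (oneₛ +ₛ X 0) i) (X0 i)
      finProd-X (suc n) i = trans (⊛-cong {f = oneₛ +ₛ X (suc n)} (λ _ → refl) (finProd-X n) i) (R.zeroʳ (oneₛ +ₛ X (suc n)) i)

      S-one : ∀ m n → S one (m ℕ.+ suc n) m ≈ 0ₛ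
      S-one m n i = trans (sym (finiteTripleProduct m (suc n) i)) (trans (⊛-cong {f = finProd m (λ i → oneₛ +ₛ Y i)} (λ _ → refl) (finProd-X n) i)
          (R.zeroʳ (finProd m (λ i → oneₛ +ₛ Y i)) i))

      step : ∀ x D z c e → z ≈ 0ₛ → x ≈ signℚ Sign.- ·ₛ mono e → D +ₛ x ⊛ (D +ₛ c ·ₛ z) ≈ (oneₛ +ₛ (-ₛ mono e)) ⊛ D
      step x D z c e z≈0 x≈ n = begin
        D n + (x ⊛ (D +ₛ c ·ₛ z)) n         ≡⟨ cong (λ y → D n + y) (⊛-cong {g = D +ₛ c ·ₛ z}
            {g′ = D} (λ i → trans (x≈ i) (trans (sym (ℚP.neg-distribˡ-* 1ℚ (mono e i))) (cong -_ (ℚP.*-identityˡ (mono e i)))))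
                                                  (λ i → trans (cong (λ y → D i + c * y) (z≈0 i))
                                                      (trans (cong (λ y → D i + y) (ℚP.*-zeroʳ c)) (ℚP.+-identityʳ (D i)))) n) ⟩
        D n + ((-ₛ mono e) ⊛ D) n           ≡⟨ cong (_+ ((-ₛ mono e) ⊛ D) n) (sym (⊛-identityˡ D n)) ⟩
        (oneₛ ⊛ D) n + ((-ₛ mono e) ⊛ D) n  ≡⟨ sym (⊛-distribʳ D oneₛ (-ₛ mono e) n) ⟩
        ((oneₛ +ₛ (-ₛ mono e)) ⊛ D) n       ∎
        where open ≡-Reasoning

      -- The weight k is the effect of x d/dx, so only the term in which the vanishing factor is
      -- differentiated survives. In the induction the weight k ± 1 differs from k by a constant,
      -- whose contribution is a multiple of the vanishing sum.
      S-id : ∀ m n → S fromℤ (m ℕ.+ suc n) m ≈ -ₛ (poch m ⊛ poch n)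
      S-id zero zero i = begin
        S fromℤ 1 0 i                                      ≡⟨ S-x fromℤ 0 0 z≤n i ⟩
        S fromℤ 0 0 i + (X 0 ⊛ S (λ k → fromℤ (k ℤ.+ + 1)) 0 0) i  ≡⟨ cong₂ _+_ (trans (S-0 fromℤ i) (ℚP.*-zeroˡ (oneₛ i)))
                                                                (⊛-cong {f = X 0} (λ _ → refl) (λ j →
                                                                    trans (S-0 (λ k → fromℤ (k ℤ.+ + 1)) j) (ℚP.*-identityˡ (oneₛ j))) i) ⟩
        0ℚ + (X 0 ⊛ oneₛ) i                                ≡⟨ trans (ℚP.+-identityˡ ((X 0 ⊛ oneₛ) i)) (⊛-identityʳ (X 0) i) ⟩
        - 1ℚ * oneₛ i                                      ≡⟨ trans (sym (ℚP.neg-distribˡ-* 1ℚ (oneₛ i))) (cong -_ (ℚP.*-identityˡ (oneₛ i))) ⟩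
        - oneₛ i                                           ≡⟨ cong -_ (sym (⊛-identityˡ oneₛ i)) ⟩
        - (oneₛ ⊛ oneₛ) i                                  ∎
        where open ≡-Reasoning
      S-id zero (suc n) i = begin
        S fromℤ (suc (suc n)) 0 i                                              ≡⟨ S-x fromℤ (suc n) 0 z≤n i ⟩
        (S fromℤ (suc n) 0 +ₛ X (suc n) ⊛ S (λ k → fromℤ (k ℤ.+ + 1)) (suc n) 0) i
            ≡⟨ cong (λ z → S fromℤ (suc n) 0 i + z) (⊛-cong {f = X (suc n)} (λ _ → refl)
                                                                                      (λ j → trans (S-cong (λ k → fromℤ-+ k (+ 1)) (suc n) 0 j)
                                                                                          (S-+ fromℤ 1ℚ (suc n) 0 j)) i) ⟩
        (S fromℤ (suc n) 0 +ₛ X (suc n) ⊛ (S fromℤ (suc n) 0 +ₛ 1ℚ ·ₛ S one (suc n) 0)) i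
            ≡⟨ step (X (suc n)) (S fromℤ (suc n) 0) (S one (suc n) 0) 1ℚ (1 ℕ.* suc n) (S-one 0 n)
                                                                                      (λ j → cong (λ e → - 1ℚ * mono e j) (ℕP.*-comm (suc n) 1)) i ⟩
        ((oneₛ +ₛ (-ₛ Q^ (suc n))) ⊛ S fromℤ (suc n) 0) i                      ≡⟨ ⊛-cong {f = oneₛ +ₛ (-ₛ Q^ (suc n))} (λ _ → refl) (S-id zero n) i ⟩
        ((oneₛ +ₛ (-ₛ Q^ (suc n))) ⊛ (-ₛ (oneₛ ⊛ poch n))) i
            ≡⟨ P.solve 3 (λ o x p → (o P.:+ (P.:- x)) P.:* (P.:- (o P.:* p)) P.:= P.:- (o P.:* ((o P.:+ (P.:- x)) P.:* p))) (λ _ → refl)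
            oneₛ (Q^ (suc n)) (poch n) i ⟩
        - (oneₛ ⊛ poch (suc n)) i                                              ∎
        where
        open ≡-Reasoning
        module P = PSSolver
      S-id (suc m) n i = begin
        S fromℤ (suc L) (suc m) i                                          ≡⟨ S-y fromℤ L m i ⟩
        (S fromℤ L m +ₛ Y m ⊛ S (λ k → fromℤ (k ℤ.- + 1)) L m) i           ≡⟨ cong (λ z → S fromℤ L m i + z) (⊛-cong {f = Y m} (λ _ → refl)
                                                                                  (λ j → trans (S-cong (λ k → fromℤ-+ k (ℤ.- + 1)) L m j)
                                                                                      (S-+ fromℤ (- 1ℚ) L m j)) i) ⟩
        (S fromℤ L m +ₛ Y m ⊛ (S fromℤ L m +ₛ (- 1ℚ) ·ₛ S one L m)) i      ≡⟨ step (Y m) (S fromℤ L m) (S one L m) (- 1ℚ) (1 ℕ.* suc m) (S-one m n)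
                                                                                  (λ j → cong (λ e → - 1ℚ * mono e j) (ℕP.*-comm (suc m) 1)) i ⟩
        ((oneₛ +ₛ (-ₛ Q^ (suc m))) ⊛ S fromℤ L m) i                        ≡⟨ ⊛-cong {f = oneₛ +ₛ (-ₛ Q^ (suc m))} (λ _ → refl) (S-id m n) i ⟩
        ((oneₛ +ₛ (-ₛ Q^ (suc m))) ⊛ (-ₛ (poch m ⊛ poch n))) i
            ≡⟨ P.solve 3 (λ x p p′ → x P.:* (P.:- (p P.:* p′)) P.:= P.:- (x P.:* p P.:* p′)) (λ _ → refl) (oneₛ +ₛ (-ₛ Q^ (suc m))) (poch m) (poch n)
            i ⟩
        - (poch (suc m) ⊛ poch n) i                                        ∎
        where
        open ≡-Reasoning
        module P = PSSolver
        L = m ℕ.+ suc n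

    -- The limit of the preceding identity reads Σ (-1)^k k q^(k(k-1)/2) = - Π (1 - q^n)³: two
    -- finite products come from differentiation and the third from the normalisation by (Q)_N.
    cube : ∀ {p} → HasSpec p [ (1 , 1 , + 1) ] → gf (thetaFamily fromℤ Sign.- 0 1 (s≤s z≤n)) ≈ -ₛ (p ⊛ (p ⊛ p))
    cube {p} (hasSpec hp) n = begin
      gf (thetaFamily fromℤ Sign.- 0 1 (s≤s z≤n)) n     ≡⟨ limit fromℤ n n ℕP.≤-refl ⟩
      (poch N ⊛ S fromℤ (N ℕ.+ N) N) n                  ≡⟨ ⊛-cong {f = poch N} (λ _ → refl) (S-id N (n ℕ.+ n)) n ⟩
      (poch N ⊛ (-ₛ (poch N ⊛ poch (n ℕ.+ n)))) n       ≡⟨ P.solve 3 (λ x y z → x P.:* (P.:- (y P.:* z)) P.:= P.:- (x P.:* (y P.:* z))) (λ _ → refl)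
          (poch N) (poch N) (poch (n ℕ.+ n)) n ⟩
      - (poch N ⊛ (poch N ⊛ poch (n ℕ.+ n))) n          ≡⟨ cong -_ (trans (⊛-congˡ≤ (poch N ⊛ poch (n ℕ.+ n)) n (near N n≤N)) (⊛-congʳ≤ p n λ j j≤n →
                                                              trans (⊛-congˡ≤ (poch (n ℕ.+ n)) j (λ i i≤j → near N n≤N i (ℕP.≤-trans i≤j j≤n)))
                                                                    (⊛-congʳ≤ p j λ i i≤j → near (n ℕ.+ n) (ℕP.m≤m+n n n) i (ℕP.≤-trans i≤j j≤n)))) ⟩
      - (p ⊛ (p ⊛ p)) n                                 ∎
      where
      open ≡-Reasoning
      module P = PSSolver
      N = suc (n ℕ.+ n)
      n≤N = ℕP.m≤n⇒m≤1+n (ℕP.m≤m+n n n)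
      near : ∀ M → n ≤ M → ∀ i → i ≤ n → poch M i ≡ p i
      near M n≤M i i≤n = logDeriv-unique≤ (logDeriv-poch M) hp n (λ j j≤n → pochΛ≡ M j (ℕP.≤-trans j≤n n≤M)) i i≤n

open JacobiTripleProduct

-- Splitting lattice sums by residue classes

module ResidueClasses where

  open import Data.Rational using (_+_; _*_; -_)
  open import Data.List using (List; []; _∷_; map; upTo)
  open import Data.List.Membership.Propositional using (_∈_)
  open import Data.List.Membership.Propositional.Properties
  open import Data.List.Relation.Unary.Any using (here)
  open import Data.Sum using (inj₁; inj₂)

  divMod-unique : ∀ d r r′ j j′ → r < d → r′ < d → + r ℤ.+ j ℤ.* + d ≡ + r′ ℤ.+ j′ ℤ.* + d → r ≡ r′ × j ≡ j′
  divMod-unique d r r′ j j′ r<d r′<d eq = r≡r′ , j≡j′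
    where
    difference : (j ℤ.- j′) ℤ.* + d ≡ + r′ ℤ.- + r
    difference = trans (expand (+ r) j j′ (+ d)) (trans (cong (λ z → z ℤ.- + r ℤ.- j′ ℤ.* + d) eq) (collapse (+ r) (+ r′) j′ (+ d)))
      where
      expand : ∀ r j j′ d → (j ℤ.- j′) ℤ.* d ≡ r ℤ.+ j ℤ.* d ℤ.- r ℤ.- j′ ℤ.* d
      expand = ℤS.solve-∀
      collapse : ∀ r r′ j′ d → r′ ℤ.+ j′ ℤ.* d ℤ.- r ℤ.- j′ ℤ.* d ≡ r′ ℤ.- r
      collapse = ℤS.solve-∀
    ∣r′-r∣<d : ℤ.∣ + r′ ℤ.- + r ∣ < d
    ∣r′-r∣<d with ℕP.≤-total r′ r
    ... | inj₁ r′≤r = ℕP.≤-<-trans (ℕP.≤-trans (ℕP.≤-reflexive (trans (cong ℤ.∣_∣ (ℤP.m-n≡m⊖n r′ r)) (ℤP.∣⊖∣-≤ r′≤r))) (ℕP.m∸n≤m r r′)) r<d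
    ... | inj₂ r≤r′ = ℕP.≤-<-trans (ℕP.≤-trans (ℕP.≤-reflexive (cong ℤ.∣_∣ (trans (ℤP.m-n≡m⊖n r′ r) (ℤP.⊖-≥ r≤r′)))) (ℕP.m∸n≤m r′ r)) r′<d
    ∣j-j′∣≡0 : ℤ.∣ j ℤ.- j′ ∣ ≡ 0
    ∣j-j′∣≡0 with ℤ.∣ j ℤ.- j′ ∣ in e
    ... | zero  = refl
    ... | suc k = contradiction (ℕP.≤-<-trans (ℕP.m≤m+n d (k ℕ.* d))
      (subst (_< d) (trans (cong ℤ.∣_∣ (sym difference)) (trans (ℤP.abs-* (j ℤ.- j′) (+ d)) (cong (ℕ._* d) e))) ∣r′-r∣<d)) (ℕP.<-irrefl refl)
    j≡j′ : j ≡ j′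
    j≡j′ = ℤP.i-j≡0⇒i≡j j j′ (ℤP.∣i∣≡0⇒i≡0 ∣j-j′∣≡0)
    r≡r′ : r ≡ r′
    r≡r′ = ℤP.+-injective (sym (ℤP.i-j≡0⇒i≡j (+ r′) (+ r) (trans (sym difference)
        (trans (cong (ℤ._* + d) (trans (cong (λ z → z ℤ.- j′) j≡j′) (ℤP.+-inverseʳ j′))) refl))))

  module _ (d : ℕ) .{{_ : NonZero d}} where

    /-+* : ∀ r j → r < d → (+ r ℤ.+ j ℤ.* + d) %ℕ d ≡ r × (+ r ℤ.+ j ℤ.* + d) /ℕ d ≡ j
    /-+* r j r<d = divMod-unique d (i %ℕ d) r (i /ℕ d) j (ℤD.n%ℕd<d i d) r<d (sym (ℤD.a≡a%ℕn+[a/ℕn]*n i d))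
      where i = + r ℤ.+ j ℤ.* + d

  open Family

  -- The other classes receive weight 0 instead of being removed, so the enumeration of `G` can be
  -- kept.
  restrict : (G : Family) → (Index G → ℤ) → (d : ℕ) .{{_ : NonZero d}} → ℕ → Family
  restrict G ℓ d c = reweight G (λ i → if (ℓ i %ℕ d) ℕ.≡ᵇ c then coeff G i else 0ℚ)

  private
    ∑-zero : ∀ {I : Set} (is : List I) → ∑ is (λ _ → 0ℚ) ≡ 0ℚ
    ∑-zero []       = refl
    ∑-zero (i ∷ is) = trans (ℚP.+-identityˡ (∑ is (λ _ → 0ℚ))) (∑-zero is)

    ∑-swap : ∀ {I J : Set} (is : List I) (js : List J) (f : I → J → ℚ) → ∑ is (λ i → ∑ js (f i)) ≡ ∑ js (λ j → ∑ is (λ i → f i j))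
    ∑-swap []       js f = sym (∑-zero js)
    ∑-swap (i ∷ is) js f = trans (cong (λ z → ∑ js (f i) + z) (∑-swap is js f)) (sym (∑-+ js (f i) (λ j → ∑ is (λ i → f i j))))

    ≡ᵇ-true : ∀ n → (n ℕ.≡ᵇ n) ≡ true
    ≡ᵇ-true zero    = refl
    ≡ᵇ-true (suc n) = ≡ᵇ-true n

    ≡ᵇ-false : ∀ a b → a ≢ b → (a ℕ.≡ᵇ b) ≡ false
    ≡ᵇ-false a b a≢b with a ℕ.≡ᵇ b in eq
    ... | true  = contradiction (ℕP.≡ᵇ⇒≡ a b (subst T (sym eq) _)) a≢b
    ... | false = refl

    indicator-sum : ∀ d r w m → r < d → ∑ (upTo d) (λ c → (if r ℕ.≡ᵇ c then w else 0ℚ) * m) ≡ w * m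
    indicator-sum d r w m r<d = trans (∑-support f (Unique.upTo⁺ d) (All.[] AllPairs.∷ AllPairs.[])
        (λ c f≢0 → subst (_∈ upTo d) (r≡c c f≢0) (∈-upTo⁺ r<d)) (λ c f≢0 → here (sym (r≡c c f≢0))))
      (trans (ℚP.+-identityʳ (f r)) (cong (λ b → (if b then w else 0ℚ) * m) (≡ᵇ-true r)))
      where
      f = λ c → (if r ℕ.≡ᵇ c then w else 0ℚ) * m
      r≡c : ∀ c → f c ≢ 0ℚ → r ≡ c
      r≡c c f≢0 with r ℕ.≟ c
      ... | yes eq = eq
      ... | no  ne = contradiction (trans (cong (λ b → (if b then w else 0ℚ) * m) (≡ᵇ-false r c ne)) (ℚP.*-zeroˡ m)) f≢0

  gf-classes : ∀ G ℓ d .{{_ : NonZero d}} → gf G ≈ λ n → ∑ (upTo d) (λ c → gf (restrict G ℓ d c) n)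
  gf-classes G ℓ d n = trans (∑-cong (enum G n) λ i → sym (indicator-sum d (ℓ i %ℕ d) (coeff G i) (mono (exponent G i) n) (ℤD.n%ℕd<d (ℓ i) d)))
    (∑-swap (enum G n) (upTo d) (λ i c → (if (ℓ i %ℕ d) ℕ.≡ᵇ c then coeff G i else 0ℚ) * mono (exponent G i) n))

  -- A parametrisation by F of the indices i of G with ℓ i ≡ c (mod d); κ is the quotient of ℓ by d
  record Class (G : Family) (ℓ : Index G → ℤ) (d c : ℕ) (F : Family) : Set where
    field
      to          : Index F → Index G
      κ           : Index F → ℤ
      -- The quotient is an argument, so the inverse map needs no division by d, and its laws reduce
      -- to polynomial identities.
      from        : ℤ → Index G → Index F
      residue     : ∀ i → ℓ (to i) ≡ + c ℤ.+ κ i ℤ.* + d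
      from-to     : ∀ i → from (κ i) (to i) ≡ i
      to-from     : ∀ j z → ℓ z ≡ + c ℤ.+ j ℤ.* + d → to (from j z) ≡ z
      exponent-to : ∀ i → exponent G (to i) ≡ exponent F i
      coeff-to    : ∀ i → coeff G (to i) ≡ coeff F i

  gf-class : ∀ {G ℓ d c F} .{{_ : NonZero d}} → c < d → Class G ℓ d c F → gf (restrict G ℓ d c) ≈ gf F
  gf-class {G} {ℓ} {d} {c} {F} c<d C n = begin
    gf (restrict G ℓ d c) n                             ≡⟨ ∑-support (term (restrict G ℓ d c) n) (unique G n) (Unique.map⁺ inj (unique F n)) inG inF ⟩
    ∑ (map to (enum F n)) (term (restrict G ℓ d c) n)   ≡⟨ ∑-map to (enum F n) (term (restrict G ℓ d c) n) ⟩
    ∑ (enum F n) (term (restrict G ℓ d c) n ∘ to)       ≡⟨ ∑-cong (enum F n) (λ i → cong₂ (λ w e → w * mono e n) (on i) (exponent-to i)) ⟩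
    gf F n                                              ∎
    where
    open ≡-Reasoning
    open Class C
    on : ∀ i → (if (ℓ (to i) %ℕ d) ℕ.≡ᵇ c then coeff G (to i) else 0ℚ) ≡ coeff F i
    on i = trans (cong (if_then coeff G (to i) else 0ℚ) (trans (cong (ℕ._≡ᵇ c) (trans (cong (_%ℕ d) (residue i)) (proj₁ (/-+* d c (κ i) c<d))))
        (≡ᵇ-true c))) (coeff-to i)
    κ≡ : ∀ i → κ i ≡ ℓ (to i) /ℕ d
    κ≡ i = sym (trans (cong (_/ℕ d) (residue i)) (proj₂ (/-+* d c (κ i) c<d)))
    inj : ∀ {i j} → to i ≡ to j → i ≡ j
    inj {i} {j} eq = trans (sym (from-to i)) (trans (cong₂ from (trans (κ≡ i) (trans (cong (λ z → ℓ z /ℕ d) eq) (sym (κ≡ j)))) eq) (from-to j))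
    exponent≡ : ∀ z → term (restrict G ℓ d c) n z ≢ 0ℚ → exponent G z ≡ n
    exponent≡ z t≢0 with exponent G z ℕ.≟ n
    ... | yes e≡n = e≡n
    ... | no  e≢n = contradiction (trans (cong (coeff (restrict G ℓ d c) z *_) (mono-off (exponent G z) n e≢n))
        (ℚP.*-zeroʳ (coeff (restrict G ℓ d c) z))) t≢0
    inG : ∀ z → term (restrict G ℓ d c) n z ≢ 0ℚ → z ∈ enum G n
    inG z t≢0 = complete G n z (ℕP.≤-reflexive (exponent≡ z t≢0))
    inF : ∀ z → term (restrict G ℓ d c) n z ≢ 0ℚ → z ∈ map to (enum F n)
    inF z t≢0 with (ℓ z %ℕ d) ℕ.≟ c
    ... | no r≢c = contradiction (trans (cong (λ b → (if b then coeff G z else 0ℚ) * mono (exponent G z) n) (≡ᵇ-false (ℓ z %ℕ d) c r≢c))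
        (ℚP.*-zeroˡ (mono (exponent G z) n))) t≢0
    ... | yes r≡c = subst (_∈ map to (enum F n)) back (∈-map⁺ to (complete F n
        i (ℕP.≤-reflexive (trans (sym (exponent-to i)) (trans (cong (exponent G) back) (exponent≡ z t≢0))))))
      where
      i = from (ℓ z /ℕ d) z
      back : to i ≡ z
      back = to-from (ℓ z /ℕ d) z (trans (ℤD.a≡a%ℕn+[a/ℕn]*n (ℓ z) d) (cong (λ r → + r ℤ.+ (ℓ z /ℕ d) ℤ.* + d) r≡c))

  -- Carries a natural exponent together with the integer polynomial that is its double, so that two
  -- exponents are compared by the ring solver.
  record Twice (n : ℕ) (z : ℤ) : Set where
    constructor twice
    field doubled : + 2 ℤ.* + n ≡ z

  tw-θ : ∀ r s k → Twice (thetaExp r s k) (+ r ℤ.* (k ℤ.* (k ℤ.+ + 1)) ℤ.+ + s ℤ.* (k ℤ.* (k ℤ.- + 1)))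
  tw-θ r s k = twice (2thetaExp r s k)

  tw-+ : ∀ {m n y z} → Twice m y → Twice n z → Twice (m ℕ.+ n) (y ℤ.+ z)
  tw-+ {m} {n} (twice p) (twice p′) = twice (trans (ℤP.*-distribˡ-+ (+ 2) (+ m) (+ n)) (cong₂ ℤ._+_ p p′))

  tw-* : ∀ {n z} d → Twice n z → Twice (n ℕ.* d) (z ℤ.* + d)
  tw-* {n} d (twice p) = twice (trans (cong (+ 2 ℤ.*_) (ℤP.pos-* n d)) (trans (sym (ℤP.*-assoc (+ 2) (+ n) (+ d))) (cong (ℤ._* + d) p)))

  tw-const : ∀ c → Twice c (+ 2 ℤ.* + c)
  tw-const c = twice refl

  tw-≡ : ∀ {m n y z} → Twice m y → Twice n z → y ≡ z → m ≡ n
  tw-≡ (twice p) (twice p′) eq = double-injective (trans p (trans eq (sym p′)))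

  private
    1* : ∀ x → 1ℚ * x ≡ x
    1* = ℚP.*-identityˡ

  signAt² : ∀ ε k → signAt ε k * signAt ε k ≡ 1ℚ
  signAt² Sign.+ k = refl
  signAt² Sign.- k = go ℤ.∣ k ∣
    where
    square : ∀ x → - x * - x ≡ x * x
    square = solve 1 (λ x → (:- x) :* (:- x) := x :* x) refl
      where open +-*-Solver
    go : ∀ n → alternate n * alternate n ≡ 1ℚ
    go zero    = refl
    go (suc n) = trans (square (alternate n)) (go n)

  signAt-+ : ∀ ε k l → signAt ε (k ℤ.+ l) ≡ signAt ε k * signAt ε l
  signAt-+ Sign.+ k l = refl
  signAt-+ Sign.- k (+ n) = go k n
    where
    ε = Sign.-
    go : ∀ k n → signAt ε (k ℤ.+ + n) ≡ signAt ε k * signAt ε (+ n)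
    go k zero    = trans (cong (signAt ε) (ℤP.+-identityʳ k)) (sym (ℚP.*-identityʳ (signAt ε k)))
    go k (suc n) = begin
      signAt ε (k ℤ.+ + suc n)              ≡⟨ cong (signAt ε) (move k (+ n)) ⟩
      signAt ε (k ℤ.+ + n ℤ.+ + 1)          ≡⟨ signAt-suc ε (k ℤ.+ + n) ⟩
      - 1ℚ * signAt ε (k ℤ.+ + n)           ≡⟨ cong (- 1ℚ *_) (go k n) ⟩
      - 1ℚ * (signAt ε k * alternate n)     ≡⟨ swap (signAt ε k) (alternate n) ⟩
      signAt ε k * - alternate n            ∎
      where
      open ≡-Reasoning
      move : ∀ k n → k ℤ.+ (+ 1 ℤ.+ n) ≡ k ℤ.+ n ℤ.+ + 1
      move = ℤS.solve-∀
      swap : ∀ x y → - 1ℚ * (x * y) ≡ x * - y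
      swap = solve 2 (λ x y → con (- 1ℚ) :* (x :* y) := x :* (:- y)) refl
        where open +-*-Solver
  signAt-+ Sign.- k -[1+ n ] = begin
    signAt ε k′                                            ≡⟨ sym (ℚP.*-identityʳ (signAt ε k′)) ⟩
    signAt ε k′ * 1ℚ                                       ≡⟨ cong (signAt ε k′ *_) (sym (signAt² ε (+ suc n))) ⟩
    signAt ε k′ * (alternate (suc n) * alternate (suc n))  ≡⟨ sym (ℚP.*-assoc (signAt ε k′) (alternate (suc n)) (alternate (suc n))) ⟩
    signAt ε k′ * alternate (suc n) * alternate (suc n)    ≡⟨ cong (_* alternate (suc n)) (sym (signAt-+ Sign.- k′ (+ suc n))) ⟩
    signAt ε (k′ ℤ.+ + suc n) * alternate (suc n)          ≡⟨ cong (λ z → signAt ε z * alternate (suc n)) (cancel k (+ suc n)) ⟩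
    signAt ε k * alternate (suc n)                         ∎
    where
    open ≡-Reasoning
    ε = Sign.-
    k′ = k ℤ.+ -[1+ n ]
    cancel : ∀ k m → k ℤ.+ ℤ.- m ℤ.+ m ≡ k
    cancel = ℤS.solve-∀

  signAt-neg : ∀ ε k → signAt ε (ℤ.- k) ≡ signAt ε k
  signAt-neg Sign.+ k = refl
  signAt-neg Sign.- k = cong alternate (ℤP.∣-i∣≡∣i∣ k)

  signAt-double : ∀ ε k → signAt ε (k ℤ.+ k) ≡ 1ℚ
  signAt-double ε k = trans (signAt-+ ε k k) (signAt² ε k)

  one : ℤ → ℚ
  one _ = 1ℚ

  Fφ : Sign → Family
  Fφ ε = thetaFamily one ε 1 1 (s≤s z≤n)

  Fψ : Family
  Fψ = thetaFamily one Sign.+ 1 0 (s≤s z≤n)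

  -- Σ_{k ∈ ℤ} q^{k(k+1)/2}
  ψ₂ : PS
  ψ₂ = gf Fψ

  θ-dil : ∀ ε r s d .{{_ : NonZero r}} .{{_ : NonZero s}} .{{_ : NonZero d}} .{{_ : NonZero (r ℕ.* d)}} .{{_ : NonZero (s ℕ.* d)}} →
      dil d (θ ε r s) ≈ θ ε (r ℕ.* d) (s ℕ.* d)
  θ-dil ε (suc r) s (suc d) n = trans (sym (gf-dilate (suc d) F n)) (gf-≅ {F = dilate (suc d) F} {G = G} record
    { to = λ k → k ; from = λ k → k ; to-from = λ _ → refl ; from-to = λ _ → refl ; exponent-to = λ k →
        exponents (suc r) s (suc d) (tri k) (tri (ℤ.- k)) ; coeff-to = λ _ → refl } n)
    where
    F = thetaFamily one ε (suc r) s (s≤s z≤n)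
    G = thetaFamily one ε (suc r ℕ.* suc d) (s ℕ.* suc d) (s≤s z≤n)
    exponents : ∀ r s d t u → r ℕ.* d ℕ.* t ℕ.+ s ℕ.* d ℕ.* u ≡ (r ℕ.* t ℕ.+ s ℕ.* u) ℕ.* d
    exponents = ℕS.solve 5 (λ r s d t u → r ℕS.:* d ℕS.:* t ℕS.:+ s ℕS.:* d ℕS.:* u ℕS.:= (r ℕS.:* t ℕS.:+ s ℕS.:* u) ℕS.:* d) refl

  pair : ∀ {x x′ y y′ : ℤ} → x ≡ x′ → y ≡ y′ → (x , y) ≡ (x′ , y′)
  pair refl refl = refl

  -- A coordinate is recovered only modulo the equation that defines the residue class; `α` is the
  -- multiple of that equation which is needed.
  absorb : ∀ {x x′ ℓ r : ℤ} α → x′ ≡ x ℤ.+ α ℤ.* (r ℤ.- ℓ) → ℓ ≡ r → x′ ≡ x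
  absorb {x} {x′} {ℓ} α x′≡ refl = trans x′≡ (trans (cong (λ z → x ℤ.+ α ℤ.* z) (ℤP.+-inverseʳ ℓ))
      (trans (cong (λ z → x ℤ.+ z) (ℤP.*-zeroʳ α)) (ℤP.+-identityʳ x)))

  -- The parity of x - y decides: rotating by 45 degrees, x² + y² becomes 2(u² + v²) for equal
  -- parities and 1 + 2u(u + 1) + 2v(v + 1) otherwise. Since ψ₂ = 2ψ, the second term is ± 4q
  -- ψ(q⁴)².
  φ-square : ∀ ε → θ ε 1 1 ⊛ θ ε 1 1 ≈ dil 2 (θ Sign.+ 1 1 ⊛ θ Sign.+ 1 1) +ₛ signℚ ε ·ₛ shift 1 (dil 4 (ψ₂ ⊛ ψ₂))
  φ-square ε n = begin
    (θ ε 1 1 ⊛ θ ε 1 1) n                                         ≡⟨ sym (gf-⊗ (Fφ ε) (Fφ ε) n) ⟩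
    gf G n                                                        ≡⟨ gf-classes G ℓ 2 n ⟩
    gf (restrict G ℓ 2 0) n + (gf (restrict G ℓ 2 1) n + 0ℚ)      ≡⟨
        cong₂ (λ x y → x + (y + 0ℚ)) (gf-class (s≤s z≤n) class₀ n) (gf-class (s≤s (s≤s z≤n)) class₁ n) ⟩
    gf F₀ n + (gf F₁ n + 0ℚ)                                      ≡⟨ cong (λ z → gf F₀ n + z) (ℚP.+-identityʳ (gf F₁ n)) ⟩
    gf F₀ n + gf F₁ n                                             ≡⟨ cong₂
        _+_ (trans (gf-dilate 2 (Fφ Sign.+ ⊗ Fφ Sign.+) n) (dil-cong 2 (gf-⊗ (Fφ Sign.+) (Fφ Sign.+)) n))
                                                                       (trans (gf-scale (signℚ ε) (raise 1 (dilate 4 (Fψ ⊗ Fψ))) n) (cong (signℚ ε *_)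
                                                                         (trans (gf-raise 1 (dilate 4 (Fψ ⊗ Fψ)) n)
                                                                             (shift-cong 1 (λ m → trans (gf-dilate 4 (Fψ ⊗ Fψ) m)
                                                                             (dil-cong 4 (gf-⊗ Fψ Fψ) m)) n)))) ⟩
    (dil 2 (θ Sign.+ 1 1 ⊛ θ Sign.+ 1 1) +ₛ signℚ ε ·ₛ shift 1 (dil 4 (ψ₂ ⊛ ψ₂))) n ∎
    where
    open ≡-Reasoning
    G = Fφ ε ⊗ Fφ ε
    F₀ = dilate 2 (Fφ Sign.+ ⊗ Fφ Sign.+)
    F₁ = scale (signℚ ε) (raise 1 (dilate 4 (Fψ ⊗ Fψ)))
    ℓ : ℤ × ℤ → ℤ
    ℓ (x , y) = x ℤ.- y
    signs : ∀ x y → 1ℚ * signAt ε x * (1ℚ * signAt ε y) ≡ signAt ε (x ℤ.+ y)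
    signs x y = trans (cong₂ _*_ (1* (signAt ε x)) (1* (signAt ε y))) (sym (signAt-+ ε x y))
    class₀ : Class G ℓ 2 0 F₀
    class₀ = record
      { to = λ (u , v) → u ℤ.+ v , u ℤ.- v
      ; κ = λ (u , v) → v
      ; from = λ j (x , y) → y ℤ.+ j , j
      ; residue = λ (u , v) → residue u v
      ; from-to = λ (u , v) → pair (from-to₁ u v) (from-to₂ u v)
      ; to-from = λ j (x , y) eq → pair (absorb (+ 1) (to-from₁ j x y) eq) (absorb (+ 0) (to-from₂ j x y) eq)
      ; exponent-to = λ { (u , v) → tw-≡ (tw-+ (tw-θ 1 1 (u ℤ.+ v)) (tw-θ 1 1 (u ℤ.- v))) (tw-* 2 (tw-+ (tw-θ 1 1 u) (tw-θ 1 1 v)))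
          (ℤS.solve (u ∷ v ∷ [])) }
      ; coeff-to = λ (u , v) → trans (signs (u ℤ.+ v) (u ℤ.- v)) (trans (cong (signAt ε) (parity u v)) (signAt-double ε u))
      }
      where
      residue : ∀ u v → (u ℤ.+ v) ℤ.- (u ℤ.- v) ≡ + 0 ℤ.+ v ℤ.* + 2
      residue = ℤS.solve-∀
      from-to₁ : ∀ u v → (u ℤ.- v) ℤ.+ v ≡ u
      from-to₁ = ℤS.solve-∀
      from-to₂ : ∀ u v → v ≡ v
      from-to₂ = ℤS.solve-∀
      to-from₁ : ∀ j x y → (y ℤ.+ j) ℤ.+ j ≡ x ℤ.+ + 1 ℤ.* (+ 0 ℤ.+ j ℤ.* + 2 ℤ.- (x ℤ.- y))
      to-from₁ = ℤS.solve-∀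
      to-from₂ : ∀ j x y → (y ℤ.+ j) ℤ.- j ≡ y ℤ.+ + 0 ℤ.* (+ 0 ℤ.+ j ℤ.* + 2 ℤ.- (x ℤ.- y))
      to-from₂ = ℤS.solve-∀
      parity : ∀ u v → u ℤ.+ v ℤ.+ (u ℤ.- v) ≡ u ℤ.+ u
      parity = ℤS.solve-∀
    class₁ : Class G ℓ 2 1 F₁
    class₁ = record
      { to = λ (u , v) → u ℤ.+ v ℤ.+ + 1 , u ℤ.- v
      ; κ = λ (u , v) → v
      ; from = λ j (x , y) → y ℤ.+ j , j
      ; residue = λ (u , v) → residue u v
      ; from-to = λ (u , v) → pair (from-to₁ u v) (from-to₂ u v)
      ; to-from = λ j (x , y) eq → pair (absorb (+ 1) (to-from₁ j x y) eq) (absorb (+ 0) (to-from₂ j x y) eq)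
      ; exponent-to = λ { (u , v) → tw-≡ (tw-+ (tw-θ 1 1 (u ℤ.+ v ℤ.+ + 1)) (tw-θ 1 1 (u ℤ.- v)))
          (tw-+ (tw-const 1) (tw-* 4 (tw-+ (tw-θ 1 0 u) (tw-θ 1 0 v)))) (ℤS.solve (u ∷ v ∷ [])) }
      ; coeff-to = λ (u , v) → trans (signs (u ℤ.+ v ℤ.+ + 1) (u ℤ.- v))
          (trans (cong (signAt ε) (parity u v)) (trans (signAt-suc ε (u ℤ.+ u)) (cong (signℚ ε *_) (signAt-double ε u))))
      }
      where
      residue : ∀ u v → (u ℤ.+ v ℤ.+ + 1) ℤ.- (u ℤ.- v) ≡ + 1 ℤ.+ v ℤ.* + 2
      residue = ℤS.solve-∀
      from-to₁ : ∀ u v → (u ℤ.- v) ℤ.+ v ≡ u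
      from-to₁ = ℤS.solve-∀
      from-to₂ : ∀ u v → v ≡ v
      from-to₂ = ℤS.solve-∀
      to-from₁ : ∀ j x y → (y ℤ.+ j) ℤ.+ j ℤ.+ + 1 ≡ x ℤ.+ + 1 ℤ.* (+ 1 ℤ.+ j ℤ.* + 2 ℤ.- (x ℤ.- y))
      to-from₁ = ℤS.solve-∀
      to-from₂ : ∀ j x y → (y ℤ.+ j) ℤ.- j ≡ y ℤ.+ + 0 ℤ.* (+ 1 ℤ.+ j ℤ.* + 2 ℤ.- (x ℤ.- y))
      to-from₂ = ℤS.solve-∀
      parity : ∀ u v → u ℤ.+ v ℤ.+ + 1 ℤ.+ (u ℤ.- v) ≡ u ℤ.+ u ℤ.+ + 1
      parity = ℤS.solve-∀

open ResidueClasses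

-- Dissections by the Gaussian prime above 5 and by parity

module QuinticDissections where

  open import Data.Rational using (_+_; _*_; -_)
  open import Data.List using ([]; _∷_)

  open Family

  private
    sum₅ : ∀ {a b c d e x y : ℚ} → a ≡ x → b ≡ y → c ≡ y → d ≡ y → e ≡ y → a + (b + (c + (d + (e + 0ℚ)))) ≡ x + fromℤ (+ 4) * y
    sum₅ {x = x} {y} refl refl refl refl refl = +-*-Solver.solve 2 (λ x y → x :+ (y :+ (y :+ (y :+ (y :+ con 0ℚ)))) := x :+ con (fromℤ (+ 4)) :* y)
        refl x y
      where open +-*-Solver

  -- Multiplication by i doubles ℓ modulo 5 and so permutes the four nonzero classes cyclically in
  -- the order 1, 2, 4, 3. They have the same generating series, and the four parametrisations are
  -- rotations of one another. The zero class is an ideal of norm 5.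
  φ²-5-dissection : θ Sign.+ 1 1 ⊛ θ Sign.+ 1 1 ≈ dil 5 (θ Sign.+ 1 1 ⊛ θ Sign.+ 1 1) +ₛ fromℤ (+ 4) ·ₛ shift 1 (θ Sign.+ 9 1 ⊛ θ Sign.+ 7 3)
  φ²-5-dissection n = begin
    (θ Sign.+ 1 1 ⊛ θ Sign.+ 1 1) n             ≡⟨ sym (gf-⊗ (Fφ Sign.+) (Fφ Sign.+) n) ⟩
    gf G n                                      ≡⟨ gf-classes G ℓ 5 n ⟩
    g 0 + (g 1 + (g 2 + (g 3 + (g 4 + 0ℚ))))    ≡⟨ sum₅ (gf-class (s≤s z≤n) class₀ n) (gf-class (s≤s (s≤s z≤n)) class₁ n)
        (gf-class (s≤s (s≤s (s≤s z≤n))) class₂ n)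
                                                     (gf-class (s≤s (s≤s (s≤s (s≤s z≤n)))) class₃ n)
                                                         (gf-class (s≤s (s≤s (s≤s (s≤s (s≤s z≤n))))) class₄ n) ⟩
    gf F₀ n + fromℤ (+ 4) * gf F n              ≡⟨ cong₂ (λ x y → x + fromℤ (+ 4) * y)
        (trans (gf-dilate 5 (Fφ Sign.+ ⊗ Fφ Sign.+) n) (dil-cong 5 (gf-⊗ (Fφ Sign.+) (Fφ Sign.+)) n))
                                                     (trans (gf-raise 1 (F₉₁ ⊗ F₇₃) n) (shift-cong 1 (gf-⊗ F₉₁ F₇₃) n)) ⟩
    (dil 5 (θ Sign.+ 1 1 ⊛ θ Sign.+ 1 1) +ₛ fromℤ (+ 4) ·ₛ shift 1 (θ Sign.+ 9 1 ⊛ θ Sign.+ 7 3)) n ∎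
    where
    open ≡-Reasoning
    G = Fφ Sign.+ ⊗ Fφ Sign.+
    F₉₁ = thetaFamily one Sign.+ 9 1 (s≤s z≤n)
    F₇₃ = thetaFamily one Sign.+ 7 3 (s≤s z≤n)
    F₀ = dilate 5 (Fφ Sign.+ ⊗ Fφ Sign.+)
    F = raise 1 (F₉₁ ⊗ F₇₃)
    -- (2 + i)(x + iy) = (2x − y) + i(x + 2y), so ℓ vanishes modulo 5 on the multiples of 2 − i.
    ℓ : ℤ × ℤ → ℤ
    ℓ (x , y) = + 2 ℤ.* x ℤ.- y
    g : ℕ → ℚ
    g c = gf (restrict G ℓ 5 c) n
    class₀ : Class G ℓ 5 0 F₀
    class₀ = record
      { to = λ (u , v) → + 2 ℤ.* u ℤ.+ v , + 2 ℤ.* v ℤ.- u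
      ; κ = λ (u , v) → u
      ; from = λ j (x , y) → j , x ℤ.- + 2 ℤ.* j
      ; residue = λ (u , v) → residue u v
      ; from-to = λ (u , v) → pair (from-to₁ u v) (from-to₂ u v)
      ; to-from = λ j (x , y) eq → pair (absorb (+ 0) (to-from₁ j x y) eq) (absorb (ℤ.- + 1) (to-from₂ j x y) eq)
      ; exponent-to = λ { (u , v) → tw-≡ (tw-+ (tw-θ 1 1 (+ 2 ℤ.* u ℤ.+ v)) (tw-θ 1 1 (+ 2 ℤ.* v ℤ.- u))) (tw-* 5 (tw-+ (tw-θ 1 1 u) (tw-θ 1 1 v)))
          (ℤS.solve (u ∷ v ∷ [])) }
      ; coeff-to = λ (u , v) → refl
      }
      where
      residue : ∀ u v → + 2 ℤ.* (+ 2 ℤ.* u ℤ.+ v) ℤ.- (+ 2 ℤ.* v ℤ.- u) ≡ + 0 ℤ.+ u ℤ.* + 5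
      residue = ℤS.solve-∀
      from-to₁ : ∀ u v → u ≡ u
      from-to₁ = ℤS.solve-∀
      from-to₂ : ∀ u v → (+ 2 ℤ.* u ℤ.+ v) ℤ.- + 2 ℤ.* u ≡ v
      from-to₂ = ℤS.solve-∀
      to-from₁ : ∀ j x y → + 2 ℤ.* j ℤ.+ (x ℤ.- + 2 ℤ.* j) ≡ x ℤ.+ + 0 ℤ.* (+ 0 ℤ.+ j ℤ.* + 5 ℤ.- (+ 2 ℤ.* x ℤ.- y))
      to-from₁ = ℤS.solve-∀
      to-from₂ : ∀ j x y → + 2 ℤ.* (x ℤ.- + 2 ℤ.* j) ℤ.- j ≡ y ℤ.+ (ℤ.- + 1) ℤ.* (+ 0 ℤ.+ j ℤ.* + 5 ℤ.- (+ 2 ℤ.* x ℤ.- y))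
      to-from₂ = ℤS.solve-∀
    class₁ : Class G ℓ 5 1 F
    class₁ = record
      { to = λ (u , v) → + 2 ℤ.* v ℤ.- u , ℤ.- (+ 2 ℤ.* u ℤ.+ v ℤ.+ + 1)
      ; κ = λ (u , v) → v
      ; from = λ j (x , y) → + 2 ℤ.* j ℤ.- x , j
      ; residue = λ (u , v) → residue u v
      ; from-to = λ (u , v) → pair (from-to₁ u v) (from-to₂ u v)
      ; to-from = λ j (x , y) eq → pair (absorb (+ 0) (to-from₁ j x y) eq) (absorb (ℤ.- + 1) (to-from₂ j x y) eq)
      ; exponent-to = λ { (u , v) → tw-≡ (tw-+ (tw-θ 1 1 (+ 2 ℤ.* v ℤ.- u)) (tw-θ 1 1 (ℤ.- (+ 2 ℤ.* u ℤ.+ v ℤ.+ + 1))))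
          (tw-+ (tw-const 1) (tw-+ (tw-θ 9 1 u) (tw-θ 7 3 v))) (ℤS.solve (u ∷ v ∷ [])) }
      ; coeff-to = λ (u , v) → refl
      }
      where
      residue : ∀ u v → + 2 ℤ.* (+ 2 ℤ.* v ℤ.- u) ℤ.- (ℤ.- (+ 2 ℤ.* u ℤ.+ v ℤ.+ + 1)) ≡ + 1 ℤ.+ v ℤ.* + 5
      residue = ℤS.solve-∀
      from-to₁ : ∀ u v → + 2 ℤ.* v ℤ.- (+ 2 ℤ.* v ℤ.- u) ≡ u
      from-to₁ = ℤS.solve-∀
      from-to₂ : ∀ u v → v ≡ v
      from-to₂ = ℤS.solve-∀
      to-from₁ : ∀ j x y → + 2 ℤ.* j ℤ.- (+ 2 ℤ.* j ℤ.- x) ≡ x ℤ.+ + 0 ℤ.* (+ 1 ℤ.+ j ℤ.* + 5 ℤ.- (+ 2 ℤ.* x ℤ.- y))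
      to-from₁ = ℤS.solve-∀
      to-from₂ : ∀ j x y → ℤ.- (+ 2 ℤ.* (+ 2 ℤ.* j ℤ.- x) ℤ.+ j ℤ.+ + 1) ≡ y ℤ.+ (ℤ.- + 1) ℤ.* (+ 1 ℤ.+ j ℤ.* + 5 ℤ.- (+ 2 ℤ.* x ℤ.- y))
      to-from₂ = ℤS.solve-∀
    class₂ : Class G ℓ 5 2 F
    class₂ = record
      { to = λ (u , v) → + 2 ℤ.* u ℤ.+ v ℤ.+ + 1 , + 2 ℤ.* v ℤ.- u
      ; κ = λ (u , v) → u
      ; from = λ j (x , y) → j , x ℤ.- + 2 ℤ.* j ℤ.- + 1
      ; residue = λ (u , v) → residue u v
      ; from-to = λ (u , v) → pair (from-to₁ u v) (from-to₂ u v)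
      ; to-from = λ j (x , y) eq → pair (absorb (+ 0) (to-from₁ j x y) eq) (absorb (ℤ.- + 1) (to-from₂ j x y) eq)
      ; exponent-to = λ { (u , v) → tw-≡ (tw-+ (tw-θ 1 1 (+ 2 ℤ.* u ℤ.+ v ℤ.+ + 1)) (tw-θ 1 1 (+ 2 ℤ.* v ℤ.- u)))
          (tw-+ (tw-const 1) (tw-+ (tw-θ 9 1 u) (tw-θ 7 3 v))) (ℤS.solve (u ∷ v ∷ [])) }
      ; coeff-to = λ (u , v) → refl
      }
      where
      residue : ∀ u v → + 2 ℤ.* (+ 2 ℤ.* u ℤ.+ v ℤ.+ + 1) ℤ.- (+ 2 ℤ.* v ℤ.- u) ≡ + 2 ℤ.+ u ℤ.* + 5
      residue = ℤS.solve-∀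
      from-to₁ : ∀ u v → u ≡ u
      from-to₁ = ℤS.solve-∀
      from-to₂ : ∀ u v → (+ 2 ℤ.* u ℤ.+ v ℤ.+ + 1) ℤ.- + 2 ℤ.* u ℤ.- + 1 ≡ v
      from-to₂ = ℤS.solve-∀
      to-from₁ : ∀ j x y → + 2 ℤ.* j ℤ.+ (x ℤ.- + 2 ℤ.* j ℤ.- + 1) ℤ.+ + 1 ≡ x ℤ.+ + 0 ℤ.* (+ 2 ℤ.+ j ℤ.* + 5 ℤ.- (+ 2 ℤ.* x ℤ.- y))
      to-from₁ = ℤS.solve-∀
      to-from₂ : ∀ j x y → + 2 ℤ.* (x ℤ.- + 2 ℤ.* j ℤ.- + 1) ℤ.- j ≡ y ℤ.+ (ℤ.- + 1) ℤ.* (+ 2 ℤ.+ j ℤ.* + 5 ℤ.- (+ 2 ℤ.* x ℤ.- y))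
      to-from₂ = ℤS.solve-∀
    class₃ : Class G ℓ 5 3 F
    class₃ = record
      { to = λ (u , v) → ℤ.- (+ 2 ℤ.* u ℤ.+ v ℤ.+ + 1) , u ℤ.- + 2 ℤ.* v
      ; κ = λ (u , v) → ℤ.- u ℤ.- + 1
      ; from = λ j (x , y) → ℤ.- j ℤ.- + 1 , + 2 ℤ.* j ℤ.+ + 1 ℤ.- x
      ; residue = λ (u , v) → residue u v
      ; from-to = λ (u , v) → pair (from-to₁ u v) (from-to₂ u v)
      ; to-from = λ j (x , y) eq → pair (absorb (+ 0) (to-from₁ j x y) eq) (absorb (ℤ.- + 1) (to-from₂ j x y) eq)
      ; exponent-to = λ { (u , v) → tw-≡ (tw-+ (tw-θ 1 1 (ℤ.- (+ 2 ℤ.* u ℤ.+ v ℤ.+ + 1))) (tw-θ 1 1 (u ℤ.- + 2 ℤ.* v)))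
          (tw-+ (tw-const 1) (tw-+ (tw-θ 9 1 u) (tw-θ 7 3 v))) (ℤS.solve (u ∷ v ∷ [])) }
      ; coeff-to = λ (u , v) → refl
      }
      where
      residue : ∀ u v → + 2 ℤ.* (ℤ.- (+ 2 ℤ.* u ℤ.+ v ℤ.+ + 1)) ℤ.- (u ℤ.- + 2 ℤ.* v) ≡ + 3 ℤ.+ (ℤ.- u ℤ.- + 1) ℤ.* + 5
      residue = ℤS.solve-∀
      from-to₁ : ∀ u v → ℤ.- (ℤ.- u ℤ.- + 1) ℤ.- + 1 ≡ u
      from-to₁ = ℤS.solve-∀
      from-to₂ : ∀ u v → + 2 ℤ.* (ℤ.- u ℤ.- + 1) ℤ.+ + 1 ℤ.- (ℤ.- (+ 2 ℤ.* u ℤ.+ v ℤ.+ + 1)) ≡ v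
      from-to₂ = ℤS.solve-∀
      to-from₁ : ∀ j x y → ℤ.- (+ 2 ℤ.* (ℤ.- j ℤ.- + 1) ℤ.+ (+ 2 ℤ.* j ℤ.+ + 1 ℤ.- x) ℤ.+ + 1) ≡ x ℤ.+ + 0
          ℤ.* (+ 3 ℤ.+ j ℤ.* + 5 ℤ.- (+ 2 ℤ.* x ℤ.- y))
      to-from₁ = ℤS.solve-∀
      to-from₂ : ∀ j x y → (ℤ.- j ℤ.- + 1) ℤ.- + 2 ℤ.* (+ 2 ℤ.* j ℤ.+ + 1 ℤ.- x) ≡ y ℤ.+ (ℤ.- + 1) ℤ.* (+ 3 ℤ.+ j ℤ.* + 5 ℤ.- (+ 2 ℤ.* x ℤ.- y))
      to-from₂ = ℤS.solve-∀
    class₄ : Class G ℓ 5 4 F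
    class₄ = record
      { to = λ (u , v) → u ℤ.- + 2 ℤ.* v , + 2 ℤ.* u ℤ.+ v ℤ.+ + 1
      ; κ = λ (u , v) → ℤ.- v ℤ.- + 1
      ; from = λ j (x , y) → x ℤ.- + 2 ℤ.* j ℤ.- + 2 , ℤ.- j ℤ.- + 1
      ; residue = λ (u , v) → residue u v
      ; from-to = λ (u , v) → pair (from-to₁ u v) (from-to₂ u v)
      ; to-from = λ j (x , y) eq → pair (absorb (+ 0) (to-from₁ j x y) eq) (absorb (ℤ.- + 1) (to-from₂ j x y) eq)
      ; exponent-to = λ { (u , v) → tw-≡ (tw-+ (tw-θ 1 1 (u ℤ.- + 2 ℤ.* v)) (tw-θ 1 1 (+ 2 ℤ.* u ℤ.+ v ℤ.+ + 1)))
          (tw-+ (tw-const 1) (tw-+ (tw-θ 9 1 u) (tw-θ 7 3 v))) (ℤS.solve (u ∷ v ∷ [])) }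
      ; coeff-to = λ (u , v) → refl
      }
      where
      residue : ∀ u v → + 2 ℤ.* (u ℤ.- + 2 ℤ.* v) ℤ.- (+ 2 ℤ.* u ℤ.+ v ℤ.+ + 1) ≡ + 4 ℤ.+ (ℤ.- v ℤ.- + 1) ℤ.* + 5
      residue = ℤS.solve-∀
      from-to₁ : ∀ u v → (u ℤ.- + 2 ℤ.* v) ℤ.- + 2 ℤ.* (ℤ.- v ℤ.- + 1) ℤ.- + 2 ≡ u
      from-to₁ = ℤS.solve-∀
      from-to₂ : ∀ u v → ℤ.- (ℤ.- v ℤ.- + 1) ℤ.- + 1 ≡ v
      from-to₂ = ℤS.solve-∀
      to-from₁ : ∀ j x y → (x ℤ.- + 2 ℤ.* j ℤ.- + 2) ℤ.- + 2 ℤ.* (ℤ.- j ℤ.- + 1) ≡ x ℤ.+ + 0 ℤ.* (+ 4 ℤ.+ j ℤ.* + 5 ℤ.- (+ 2 ℤ.* x ℤ.- y))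
      to-from₁ = ℤS.solve-∀
      to-from₂ : ∀ j x y → + 2 ℤ.* (x ℤ.- + 2 ℤ.* j ℤ.- + 2) ℤ.+ (ℤ.- j ℤ.- + 1) ℤ.+ + 1 ≡ y ℤ.+ (ℤ.- + 1)
          ℤ.* (+ 4 ℤ.+ j ℤ.* + 5 ℤ.- (+ 2 ℤ.* x ℤ.- y))
      to-from₂ = ℤS.solve-∀

  -- The centre of symmetry of the exponent is (- 1/2, - 1/2), where ℓ = - 1/2, which is 2 modulo 5.
  -- Hence class 2 plays the role of the ideal, and quarter turns about the centre permute the other
  -- four classes.
  ψ²-5-dissection : ψ₂ ⊛ ψ₂ ≈ shift 1 (dil 5 (ψ₂ ⊛ ψ₂)) +ₛ fromℤ (+ 4) ·ₛ (θ Sign.+ 1 4 ⊛ θ Sign.+ 3 2)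
  ψ²-5-dissection n = begin
    (ψ₂ ⊛ ψ₂) n                                 ≡⟨ sym (gf-⊗ Fψ Fψ n) ⟩
    gf G n                                      ≡⟨ gf-classes G ℓ 5 n ⟩
    -- The exceptional class is brought to the front.
    g 0 + (g 1 + (g 2 + (g 3 + (g 4 + 0ℚ))))    ≡⟨ move (g 0) (g 1) (g 2) (g 3 + (g 4 + 0ℚ)) ⟩
    g 2 + (g 0 + (g 1 + (g 3 + (g 4 + 0ℚ))))    ≡⟨ sum₅ (gf-class (s≤s (s≤s (s≤s z≤n))) class₂ n) (gf-class (s≤s z≤n) class₀ n)
        (gf-class (s≤s (s≤s z≤n)) class₁ n)
                                                     (gf-class (s≤s (s≤s (s≤s (s≤s z≤n)))) class₃ n)
                                                         (gf-class (s≤s (s≤s (s≤s (s≤s (s≤s z≤n))))) class₄ n) ⟩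
    gf F₂ n + fromℤ (+ 4) * gf F n              ≡⟨ cong₂ (λ x y → x + fromℤ (+ 4) * y)
        (trans (gf-raise 1 (dilate 5 (Fψ ⊗ Fψ)) n) (shift-cong 1 (λ m → trans (gf-dilate 5 (Fψ ⊗ Fψ) m) (dil-cong 5 (gf-⊗ Fψ Fψ) m)) n))
                                                     (gf-⊗ F₁₄ F₃₂ n) ⟩
    (shift 1 (dil 5 (ψ₂ ⊛ ψ₂)) +ₛ fromℤ (+ 4) ·ₛ (θ Sign.+ 1 4 ⊛ θ Sign.+ 3 2)) n ∎
    where
    open ≡-Reasoning
    G = Fψ ⊗ Fψ
    F₁₄ = thetaFamily one Sign.+ 1 4 (s≤s z≤n)
    F₃₂ = thetaFamily one Sign.+ 3 2 (s≤s z≤n)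
    F₂ = raise 1 (dilate 5 (Fψ ⊗ Fψ))
    F = F₁₄ ⊗ F₃₂
    ℓ : ℤ × ℤ → ℤ
    ℓ (x , y) = + 2 ℤ.* x ℤ.- y
    g : ℕ → ℚ
    g c = gf (restrict G ℓ 5 c) n
    move : ∀ a b c d → a + (b + (c + d)) ≡ c + (a + (b + d))
    move = +-*-Solver.solve 4 (λ a b c d → a :+ (b :+ (c :+ d)) := c :+ (a :+ (b :+ d))) refl
      where open +-*-Solver
    class₀ : Class G ℓ 5 0 F
    class₀ = record
      { to = λ (u , v) → + 2 ℤ.* v ℤ.- u , ℤ.- (+ 2 ℤ.* u ℤ.+ v)
      ; κ = λ (u , v) → v
      ; from = λ j (x , y) → + 2 ℤ.* j ℤ.- x , j
      ; residue = λ (u , v) → residue u v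
      ; from-to = λ (u , v) → pair (from-to₁ u v) (from-to₂ u v)
      ; to-from = λ j (x , y) eq → pair (absorb (+ 0) (to-from₁ j x y) eq) (absorb (ℤ.- + 1) (to-from₂ j x y) eq)
      ; exponent-to = λ { (u , v) → tw-≡ (tw-+ (tw-θ 1 0 (+ 2 ℤ.* v ℤ.- u)) (tw-θ 1 0 (ℤ.- (+ 2 ℤ.* u ℤ.+ v)))) (tw-+ (tw-θ 1 4 u) (tw-θ 3 2 v))
          (ℤS.solve (u ∷ v ∷ [])) }
      ; coeff-to = λ (u , v) → refl
      }
      where
      residue : ∀ u v → + 2 ℤ.* (+ 2 ℤ.* v ℤ.- u) ℤ.- (ℤ.- (+ 2 ℤ.* u ℤ.+ v)) ≡ + 0 ℤ.+ v ℤ.* + 5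
      residue = ℤS.solve-∀
      from-to₁ : ∀ u v → + 2 ℤ.* v ℤ.- (+ 2 ℤ.* v ℤ.- u) ≡ u
      from-to₁ = ℤS.solve-∀
      from-to₂ : ∀ u v → v ≡ v
      from-to₂ = ℤS.solve-∀
      to-from₁ : ∀ j x y → + 2 ℤ.* j ℤ.- (+ 2 ℤ.* j ℤ.- x) ≡ x ℤ.+ + 0 ℤ.* (+ 0 ℤ.+ j ℤ.* + 5 ℤ.- (+ 2 ℤ.* x ℤ.- y))
      to-from₁ = ℤS.solve-∀
      to-from₂ : ∀ j x y → ℤ.- (+ 2 ℤ.* (+ 2 ℤ.* j ℤ.- x) ℤ.+ j) ≡ y ℤ.+ (ℤ.- + 1) ℤ.* (+ 0 ℤ.+ j ℤ.* + 5 ℤ.- (+ 2 ℤ.* x ℤ.- y))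
      to-from₂ = ℤS.solve-∀
    class₁ : Class G ℓ 5 1 F
    class₁ = record
      { to = λ (u , v) → ℤ.- (+ 2 ℤ.* u ℤ.+ v) , u ℤ.- + 2 ℤ.* v ℤ.- + 1
      ; κ = λ (u , v) → ℤ.- u
      ; from = λ j (x , y) → ℤ.- j , + 2 ℤ.* j ℤ.- x
      ; residue = λ (u , v) → residue u v
      ; from-to = λ (u , v) → pair (from-to₁ u v) (from-to₂ u v)
      ; to-from = λ j (x , y) eq → pair (absorb (+ 0) (to-from₁ j x y) eq) (absorb (ℤ.- + 1) (to-from₂ j x y) eq)
      ; exponent-to = λ { (u , v) → tw-≡ (tw-+ (tw-θ 1 0 (ℤ.- (+ 2 ℤ.* u ℤ.+ v))) (tw-θ 1 0 (u ℤ.- + 2 ℤ.* v ℤ.- + 1)))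
          (tw-+ (tw-θ 1 4 u) (tw-θ 3 2 v)) (ℤS.solve (u ∷ v ∷ [])) }
      ; coeff-to = λ (u , v) → refl
      }
      where
      residue : ∀ u v → + 2 ℤ.* (ℤ.- (+ 2 ℤ.* u ℤ.+ v)) ℤ.- (u ℤ.- + 2 ℤ.* v ℤ.- + 1) ≡ + 1 ℤ.+ (ℤ.- u) ℤ.* + 5
      residue = ℤS.solve-∀
      from-to₁ : ∀ u v → ℤ.- (ℤ.- u) ≡ u
      from-to₁ = ℤS.solve-∀
      from-to₂ : ∀ u v → + 2 ℤ.* (ℤ.- u) ℤ.- (ℤ.- (+ 2 ℤ.* u ℤ.+ v)) ≡ v
      from-to₂ = ℤS.solve-∀
      to-from₁ : ∀ j x y → ℤ.- (+ 2 ℤ.* (ℤ.- j) ℤ.+ (+ 2 ℤ.* j ℤ.- x)) ≡ x ℤ.+ + 0 ℤ.* (+ 1 ℤ.+ j ℤ.* + 5 ℤ.- (+ 2 ℤ.* x ℤ.- y))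
      to-from₁ = ℤS.solve-∀
      to-from₂ : ∀ j x y → (ℤ.- j) ℤ.- + 2 ℤ.* (+ 2 ℤ.* j ℤ.- x) ℤ.- + 1 ≡ y ℤ.+ (ℤ.- + 1) ℤ.* (+ 1 ℤ.+ j ℤ.* + 5 ℤ.- (+ 2 ℤ.* x ℤ.- y))
      to-from₂ = ℤS.solve-∀
    class₂ : Class G ℓ 5 2 F₂
    class₂ = record
      { to = λ (u , v) → + 2 ℤ.* u ℤ.+ v ℤ.+ + 1 , + 2 ℤ.* v ℤ.- u
      ; κ = λ (u , v) → u
      ; from = λ j (x , y) → j , x ℤ.- + 2 ℤ.* j ℤ.- + 1
      ; residue = λ (u , v) → residue u v
      ; from-to = λ (u , v) → pair (from-to₁ u v) (from-to₂ u v)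
      ; to-from = λ j (x , y) eq → pair (absorb (+ 0) (to-from₁ j x y) eq) (absorb (ℤ.- + 1) (to-from₂ j x y) eq)
      ; exponent-to = λ { (u , v) → tw-≡ (tw-+ (tw-θ 1 0 (+ 2 ℤ.* u ℤ.+ v ℤ.+ + 1)) (tw-θ 1 0 (+ 2 ℤ.* v ℤ.- u)))
          (tw-+ (tw-const 1) (tw-* 5 (tw-+ (tw-θ 1 0 u) (tw-θ 1 0 v)))) (ℤS.solve (u ∷ v ∷ [])) }
      ; coeff-to = λ (u , v) → refl
      }
      where
      residue : ∀ u v → + 2 ℤ.* (+ 2 ℤ.* u ℤ.+ v ℤ.+ + 1) ℤ.- (+ 2 ℤ.* v ℤ.- u) ≡ + 2 ℤ.+ u ℤ.* + 5
      residue = ℤS.solve-∀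
      from-to₁ : ∀ u v → u ≡ u
      from-to₁ = ℤS.solve-∀
      from-to₂ : ∀ u v → (+ 2 ℤ.* u ℤ.+ v ℤ.+ + 1) ℤ.- + 2 ℤ.* u ℤ.- + 1 ≡ v
      from-to₂ = ℤS.solve-∀
      to-from₁ : ∀ j x y → + 2 ℤ.* j ℤ.+ (x ℤ.- + 2 ℤ.* j ℤ.- + 1) ℤ.+ + 1 ≡ x ℤ.+ + 0 ℤ.* (+ 2 ℤ.+ j ℤ.* + 5 ℤ.- (+ 2 ℤ.* x ℤ.- y))
      to-from₁ = ℤS.solve-∀
      to-from₂ : ∀ j x y → + 2 ℤ.* (x ℤ.- + 2 ℤ.* j ℤ.- + 1) ℤ.- j ≡ y ℤ.+ (ℤ.- + 1) ℤ.* (+ 2 ℤ.+ j ℤ.* + 5 ℤ.- (+ 2 ℤ.* x ℤ.- y))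
      to-from₂ = ℤS.solve-∀
    class₃ : Class G ℓ 5 3 F
    class₃ = record
      { to = λ (u , v) → + 2 ℤ.* u ℤ.+ v ℤ.- + 1 , + 2 ℤ.* v ℤ.- u
      ; κ = λ (u , v) → u ℤ.- + 1
      ; from = λ j (x , y) → j ℤ.+ + 1 , x ℤ.- + 2 ℤ.* j ℤ.- + 1
      ; residue = λ (u , v) → residue u v
      ; from-to = λ (u , v) → pair (from-to₁ u v) (from-to₂ u v)
      ; to-from = λ j (x , y) eq → pair (absorb (+ 0) (to-from₁ j x y) eq) (absorb (ℤ.- + 1) (to-from₂ j x y) eq)
      ; exponent-to = λ { (u , v) → tw-≡ (tw-+ (tw-θ 1 0 (+ 2 ℤ.* u ℤ.+ v ℤ.- + 1)) (tw-θ 1 0 (+ 2 ℤ.* v ℤ.- u))) (tw-+ (tw-θ 1 4 u) (tw-θ 3 2 v))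
          (ℤS.solve (u ∷ v ∷ [])) }
      ; coeff-to = λ (u , v) → refl
      }
      where
      residue : ∀ u v → + 2 ℤ.* (+ 2 ℤ.* u ℤ.+ v ℤ.- + 1) ℤ.- (+ 2 ℤ.* v ℤ.- u) ≡ + 3 ℤ.+ (u ℤ.- + 1) ℤ.* + 5
      residue = ℤS.solve-∀
      from-to₁ : ∀ u v → (u ℤ.- + 1) ℤ.+ + 1 ≡ u
      from-to₁ = ℤS.solve-∀
      from-to₂ : ∀ u v → (+ 2 ℤ.* u ℤ.+ v ℤ.- + 1) ℤ.- + 2 ℤ.* (u ℤ.- + 1) ℤ.- + 1 ≡ v
      from-to₂ = ℤS.solve-∀
      to-from₁ : ∀ j x y → + 2 ℤ.* (j ℤ.+ + 1) ℤ.+ (x ℤ.- + 2 ℤ.* j ℤ.- + 1) ℤ.- + 1 ≡ x ℤ.+ + 0 ℤ.* (+ 3 ℤ.+ j ℤ.* + 5 ℤ.- (+ 2 ℤ.* x ℤ.- y))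
      to-from₁ = ℤS.solve-∀
      to-from₂ : ∀ j x y → + 2 ℤ.* (x ℤ.- + 2 ℤ.* j ℤ.- + 1) ℤ.- (j ℤ.+ + 1) ≡ y ℤ.+ (ℤ.- + 1) ℤ.* (+ 3 ℤ.+ j ℤ.* + 5 ℤ.- (+ 2 ℤ.* x ℤ.- y))
      to-from₂ = ℤS.solve-∀
    class₄ : Class G ℓ 5 4 F
    class₄ = record
      { to = λ (u , v) → u ℤ.- + 2 ℤ.* v ℤ.- + 1 , + 2 ℤ.* u ℤ.+ v ℤ.- + 1
      ; κ = λ (u , v) → ℤ.- v ℤ.- + 1
      ; from = λ j (x , y) → x ℤ.- + 2 ℤ.* j ℤ.- + 1 , ℤ.- j ℤ.- + 1
      ; residue = λ (u , v) → residue u v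
      ; from-to = λ (u , v) → pair (from-to₁ u v) (from-to₂ u v)
      ; to-from = λ j (x , y) eq → pair (absorb (+ 0) (to-from₁ j x y) eq) (absorb (ℤ.- + 1) (to-from₂ j x y) eq)
      ; exponent-to = λ { (u , v) → tw-≡ (tw-+ (tw-θ 1 0 (u ℤ.- + 2 ℤ.* v ℤ.- + 1)) (tw-θ 1 0 (+ 2 ℤ.* u ℤ.+ v ℤ.- + 1)))
          (tw-+ (tw-θ 1 4 u) (tw-θ 3 2 v)) (ℤS.solve (u ∷ v ∷ [])) }
      ; coeff-to = λ (u , v) → refl
      }
      where
      residue : ∀ u v → + 2 ℤ.* (u ℤ.- + 2 ℤ.* v ℤ.- + 1) ℤ.- (+ 2 ℤ.* u ℤ.+ v ℤ.- + 1) ≡ + 4 ℤ.+ (ℤ.- v ℤ.- + 1) ℤ.* + 5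
      residue = ℤS.solve-∀
      from-to₁ : ∀ u v → (u ℤ.- + 2 ℤ.* v ℤ.- + 1) ℤ.- + 2 ℤ.* (ℤ.- v ℤ.- + 1) ℤ.- + 1 ≡ u
      from-to₁ = ℤS.solve-∀
      from-to₂ : ∀ u v → ℤ.- (ℤ.- v ℤ.- + 1) ℤ.- + 1 ≡ v
      from-to₂ = ℤS.solve-∀
      to-from₁ : ∀ j x y → (x ℤ.- + 2 ℤ.* j ℤ.- + 1) ℤ.- + 2 ℤ.* (ℤ.- j ℤ.- + 1) ℤ.- + 1 ≡ x ℤ.+ + 0 ℤ.* (+ 4 ℤ.+ j ℤ.* + 5 ℤ.- (+ 2 ℤ.* x ℤ.- y))
      to-from₁ = ℤS.solve-∀
      to-from₂ : ∀ j x y → + 2 ℤ.* (x ℤ.- + 2 ℤ.* j ℤ.- + 1) ℤ.+ (ℤ.- j ℤ.- + 1) ℤ.- + 1 ≡ y ℤ.+ (ℤ.- + 1)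
          ℤ.* (+ 4 ℤ.+ j ℤ.* + 5 ℤ.- (+ 2 ℤ.* x ℤ.- y))
      to-from₂ = ℤS.solve-∀

  φ-dissection : ∀ ε → θ ε 1 1 ≈ dil 4 (θ Sign.+ 1 1) +ₛ signℚ ε ·ₛ shift 1 (dil 8 ψ₂)
  φ-dissection ε n = begin
    gf (Fφ ε) n                                                       ≡⟨ gf-classes (Fφ ε) (λ x → x) 2 n ⟩
    gf (restrict (Fφ ε) (λ x → x) 2 0) n + (gf (restrict (Fφ ε) (λ x → x) 2 1) n + 0ℚ)
        ≡⟨ cong₂ (λ x y → x + (y + 0ℚ)) (gf-class (s≤s z≤n) class₀ n) (gf-class (s≤s (s≤s z≤n)) class₁ n) ⟩
    gf F₀ n + (gf F₁ n + 0ℚ)                                          ≡⟨ cong (λ z → gf F₀ n + z) (ℚP.+-identityʳ (gf F₁ n)) ⟩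
    gf F₀ n + gf F₁ n
        ≡⟨ cong₂ _+_ (gf-dilate 4 (Fφ Sign.+) n) (trans (gf-scale (signℚ ε) (raise 1 (dilate 8 Fψ)) n)
                                                                           (cong (signℚ ε *_) (trans (gf-raise 1 (dilate 8 Fψ) n)
                                                                               (shift-cong 1 (gf-dilate 8 Fψ) n)))) ⟩
    (dil 4 (θ Sign.+ 1 1) +ₛ signℚ ε ·ₛ shift 1 (dil 8 ψ₂)) n         ∎
    where
    open ≡-Reasoning
    F₀ = dilate 4 (Fφ Sign.+)
    F₁ = scale (signℚ ε) (raise 1 (dilate 8 Fψ))
    class₀ : Class (Fφ ε) (λ x → x) 2 0 F₀
    class₀ = record
      { to = λ k → + 2 ℤ.* k ; κ = λ k → k ; from = λ j _ → j ; residue = residue ; from-to = λ _ → refl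
      ; to-from = λ j x eq → trans (residue j) (sym eq)
      ; exponent-to = λ k → tw-≡ (tw-θ 1 1 (+ 2 ℤ.* k)) (tw-* 4 (tw-θ 1 1 k)) (ℤS.solve (k ∷ []))
      ; coeff-to = λ k → cong (1ℚ *_) (trans (cong (signAt ε) (double k)) (signAt-double ε k)) }
      where
      residue : ∀ k → + 2 ℤ.* k ≡ + 0 ℤ.+ k ℤ.* + 2
      residue = ℤS.solve-∀
      double : ∀ k → + 2 ℤ.* k ≡ k ℤ.+ k
      double = ℤS.solve-∀
    class₁ : Class (Fφ ε) (λ x → x) 2 1 F₁
    class₁ = record
      { to = λ k → + 2 ℤ.* k ℤ.+ + 1 ; κ = λ k → k ; from = λ j _ → j ; residue = residue ; from-to = λ _ → refl
      ; to-from = λ j x eq → trans (residue j) (sym eq)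
      ; exponent-to = λ k → tw-≡ (tw-θ 1 1 (+ 2 ℤ.* k ℤ.+ + 1)) (tw-+ (tw-const 1) (tw-* 8 (tw-θ 1 0 k))) (ℤS.solve (k ∷ []))
      ; coeff-to = λ k → trans (cong (1ℚ *_) (trans (signAt-suc ε (+ 2 ℤ.* k))
          (cong (signℚ ε *_) (trans (cong (signAt ε) (double k)) (signAt-double ε k))))) (ℚP.*-identityˡ (signℚ ε * 1ℚ)) }
      where
      residue : ∀ k → + 2 ℤ.* k ℤ.+ + 1 ≡ + 1 ℤ.+ k ℤ.* + 2
      residue = ℤS.solve-∀
      double : ∀ k → + 2 ℤ.* k ≡ k ℤ.+ k
      double = ℤS.solve-∀

  -- The involution k ↦ - 1 - k preserves the exponent and interchanges parities, so even and odd k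
  -- contribute equally. The half has constant coefficient 1 and is the one with a product
  -- expansion.
  ψ₂≈2θ : ψ₂ ≈ fromℤ (+ 2) ·ₛ θ Sign.+ 3 1
  ψ₂≈2θ n = begin
    gf Fψ n                                                                          ≡⟨ gf-classes Fψ (λ x → x) 2 n ⟩
    gf (restrict Fψ (λ x → x) 2 0) n + (gf (restrict Fψ (λ x → x) 2 1) n + 0ℚ)
        ≡⟨ cong₂ (λ x y → x + (y + 0ℚ)) (gf-class (s≤s z≤n) class₀ n) (gf-class (s≤s (s≤s z≤n)) class₁ n) ⟩
    gf F n + (gf F n + 0ℚ)                                                           ≡⟨ double (gf F n) ⟩
    fromℤ (+ 2) * gf F n                                                             ∎
    where
    open ≡-Reasoning
    F = thetaFamily one Sign.+ 3 1 (s≤s z≤n)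
    double : ∀ x → x + (x + 0ℚ) ≡ fromℤ (+ 2) * x
    double = +-*-Solver.solve 1 (λ x → x :+ (x :+ con 0ℚ) := con (fromℤ (+ 2)) :* x) refl
      where open +-*-Solver
    class₀ : Class Fψ (λ x → x) 2 0 F
    class₀ = record
      { to = λ k → + 2 ℤ.* k ; κ = λ k → k ; from = λ j _ → j ; residue = residue ; from-to = λ _ → refl
      ; to-from = λ j x eq → trans (residue j) (sym eq)
      ; exponent-to = λ k → tw-≡ (tw-θ 1 0 (+ 2 ℤ.* k)) (tw-θ 3 1 k) (ℤS.solve (k ∷ []))
      ; coeff-to = λ k → refl }
      where
      residue : ∀ k → + 2 ℤ.* k ≡ + 0 ℤ.+ k ℤ.* + 2
      residue = ℤS.solve-∀
    class₁ : Class Fψ (λ x → x) 2 1 F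
    class₁ = record
      { to = λ k → ℤ.- (+ 2 ℤ.* k) ℤ.- + 1 ; κ = λ k → ℤ.- k ℤ.- + 1 ; from = λ j _ → ℤ.- j ℤ.- + 1 ; residue = residue ; from-to = back
      ; to-from = λ j x eq → trans (forth j) (sym eq)
      ; exponent-to = λ k → tw-≡ (tw-θ 1 0 (ℤ.- (+ 2 ℤ.* k) ℤ.- + 1)) (tw-θ 3 1 k) (ℤS.solve (k ∷ []))
      ; coeff-to = λ k → refl }
      where
      residue : ∀ k → ℤ.- (+ 2 ℤ.* k) ℤ.- + 1 ≡ + 1 ℤ.+ (ℤ.- k ℤ.- + 1) ℤ.* + 2
      residue = ℤS.solve-∀
      back : ∀ k → ℤ.- (ℤ.- k ℤ.- + 1) ℤ.- + 1 ≡ k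
      back = ℤS.solve-∀
      forth : ∀ j → ℤ.- (+ 2 ℤ.* (ℤ.- j ℤ.- + 1)) ℤ.- + 1 ≡ + 1 ℤ.+ j ℤ.* + 2
      forth = ℤS.solve-∀

open QuinticDissections

-- The product η(z)η(5z) as a combination of theta series

module EulerProduct where

  open import Data.Rational using (_+_; _*_; -_)
  open import Data.Sum using (inj₁; inj₂)

  open Family

  -- Euler's product Π (1 − q^n), as a theta series
  euler : PS
  euler = θ Sign.- 2 1

  Fη : Family
  Fη = thetaFamily one Sign.- 2 1 (s≤s z≤n)

  private
    -- Says that 4n + 1 = w. The 1 is 4 times the exponent (1 + 5)/24 of q in η(z)η(5z).
    Quad : ℕ → ℤ → Set
    Quad n w = + 2 ℤ.* (+ 2 ℤ.* + n) ℤ.+ + 1 ≡ w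

    quad : ∀ {n z} → Twice n z → Quad n (+ 2 ℤ.* z ℤ.+ + 1)
    quad (twice p) = cong (λ z → + 2 ℤ.* z ℤ.+ + 1) p

    quad-≡ : ∀ {m n w} → Quad m w → Quad n w → m ≡ n
    quad-≡ {m} {n} p p′ = double-injective (ℤP.*-cancelˡ-≡ (+ 2) (+ 2 ℤ.* + m) (+ 2 ℤ.* + n)
        (trans (strip (+ 2 ℤ.* (+ 2 ℤ.* + m))) (trans (cong (ℤ._- + 1) (trans p (sym p′))) (sym (strip (+ 2 ℤ.* (+ 2 ℤ.* + n)))))))
      where
      strip : ∀ x → x ≡ x ℤ.+ + 1 ℤ.- + 1
      strip = ℤS.solve-∀

  -- η(z)η(5z) = Σ (−1)^v q^{(u² + 5v²)/4} over u − v ≡ 1 (mod 6); the sum over u − v ≡ 3 (mod 6)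
  -- vanishes because (u , v) ↦ (u′ , v′) with v′ = − v − (u − v)/3, u′ − v′ = u − v reverses the sign.
  module Level5 where

    U V H PP : Family
    U = dilate 2 Fψ ⊗ dilate 5 (Fφ Sign.+)
    V = scale (- 1ℚ) (raise 1 (Fφ Sign.+ ⊗ dilate 10 Fψ))
    H = U ⊕ V
    PP = Fη ⊗ dilate 5 Fη

    -- inj₁ (i , j) and inj₂ (i , j) stand for (u , v) = (2i + 1 , 2j) and (2i , 2j + 1); u − v = 2 hOf + 1
    hOf vOf : Index H → ℤ
    hOf (inj₁ (i , j)) = i ℤ.- j
    hOf (inj₂ (i , j)) = i ℤ.- j ℤ.- + 1
    vOf (inj₁ (i , j)) = + 0 ℤ.+ j ℤ.* + 2
    vOf (inj₂ (i , j)) = + 1 ℤ.+ j ℤ.* + 2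

    private
      build : ℤ → ℕ → ℤ → Index H
      build h zero    j = inj₁ (h ℤ.+ j , j)
      build h (suc _) j = inj₂ (h ℤ.+ j ℤ.+ + 1 , j)

      norm : ℤ → ℤ → ℤ
      norm h v = (v ℤ.+ + 2 ℤ.* h ℤ.+ + 1) ℤ.* (v ℤ.+ + 2 ℤ.* h ℤ.+ + 1) ℤ.+ + 5 ℤ.* (v ℤ.* v)

      exponent-H : ∀ z → Quad (exponent H z) (norm (hOf z) (vOf z))
      exponent-H (inj₁ (i , j)) = trans (quad (tw-+ (tw-* 2 (tw-θ 1 0 i)) (tw-* 5 (tw-θ 1 1 j)))) (identity i j)
        where
        identity : ∀ i j → + 2 ℤ.* ((+ 1 ℤ.* (i ℤ.* (i ℤ.+ + 1)) ℤ.+ + 0 ℤ.* (i ℤ.* (i ℤ.- + 1))) ℤ.* + 2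
            ℤ.+ (+ 1 ℤ.* (j ℤ.* (j ℤ.+ + 1)) ℤ.+ + 1 ℤ.* (j ℤ.* (j ℤ.- + 1))) ℤ.* + 5) ℤ.+ + 1
          ≡ (+ 0 ℤ.+ j ℤ.* + 2 ℤ.+ + 2 ℤ.* (i ℤ.- j) ℤ.+ + 1) ℤ.* (+ 0 ℤ.+ j ℤ.* + 2 ℤ.+ + 2 ℤ.* (i ℤ.- j) ℤ.+ + 1) ℤ.+ + 5
              ℤ.* ((+ 0 ℤ.+ j ℤ.* + 2) ℤ.* (+ 0 ℤ.+ j ℤ.* + 2))
        identity = ℤS.solve-∀
      exponent-H (inj₂ (i , j)) = trans (quad (tw-+ (tw-const 1) (tw-+ (tw-θ 1 1 i) (tw-* 10 (tw-θ 1 0 j))))) (identity i j)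
        where
        identity : ∀ i j → + 2 ℤ.* (+ 2 ℤ.* + 1 ℤ.+ ((+ 1 ℤ.* (i ℤ.* (i ℤ.+ + 1)) ℤ.+ + 1 ℤ.* (i ℤ.* (i ℤ.- + 1)))
            ℤ.+ (+ 1 ℤ.* (j ℤ.* (j ℤ.+ + 1)) ℤ.+ + 0 ℤ.* (j ℤ.* (j ℤ.- + 1))) ℤ.* + 10)) ℤ.+ + 1
          ≡ (+ 1 ℤ.+ j ℤ.* + 2 ℤ.+ + 2 ℤ.* (i ℤ.- j ℤ.- + 1) ℤ.+ + 1) ℤ.* (+ 1 ℤ.+ j ℤ.* + 2 ℤ.+ + 2 ℤ.* (i ℤ.- j ℤ.- + 1) ℤ.+ + 1) ℤ.+ + 5
              ℤ.* ((+ 1 ℤ.+ j ℤ.* + 2) ℤ.* (+ 1 ℤ.+ j ℤ.* + 2))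
        identity = ℤS.solve-∀

      coeff-H : ∀ z → coeff H z ≡ signAt Sign.- (vOf z)
      coeff-H (inj₁ (i , j)) = sym (trans (cong (signAt Sign.-) (double j)) (signAt-double Sign.- j))
        where
        double : ∀ j → + 0 ℤ.+ j ℤ.* + 2 ≡ j ℤ.+ j
        double = ℤS.solve-∀
      coeff-H (inj₂ (i , j)) = sym (trans (cong (signAt Sign.-) (double j))
          (trans (signAt-suc Sign.- (j ℤ.+ j)) (cong (- 1ℚ *_) (signAt-double Sign.- j))))
        where
        double : ∀ j → + 1 ℤ.+ j ℤ.* + 2 ≡ j ℤ.+ j ℤ.+ + 1
        double = ℤS.solve-∀

      cancel : ∀ h j → h ℤ.+ j ℤ.- j ≡ h
      cancel = ℤS.solve-∀

      cancel₁ : ∀ h j → h ℤ.+ j ℤ.+ + 1 ℤ.- j ℤ.- + 1 ≡ h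
      cancel₁ = ℤS.solve-∀

      restore : ∀ i j → i ℤ.- j ℤ.+ j ≡ i
      restore = ℤS.solve-∀

      restore₁ : ∀ i j → i ℤ.- j ℤ.- + 1 ℤ.+ j ℤ.+ + 1 ≡ i
      restore₁ = ℤS.solve-∀

    -- The coordinates (h , v) treat both summands of `H` as one lattice; the parity of v decides in
    -- which summand the point lies.
    at : ℤ → ℤ → Index H
    at h v = build h (v %ℕ 2) (v /ℕ 2)

    hOf-at : ∀ h v → hOf (at h v) ≡ h
    hOf-at h v = go (v %ℕ 2) (v /ℕ 2)
      where
      go : ∀ r j → hOf (build h r j) ≡ h
      go zero    j = cancel h j
      go (suc _) j = cancel₁ h j

    vOf-at : ∀ h v → vOf (at h v) ≡ v
    vOf-at h v = go (v %ℕ 2) (v /ℕ 2) (ℤD.a≡a%ℕn+[a/ℕn]*n v 2) (ℤD.n%ℕd<d v 2)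
      where
      go : ∀ r j → v ≡ + r ℤ.+ j ℤ.* + 2 → r < 2 → vOf (build h r j) ≡ v
      go zero          j eq _ = sym eq
      go (suc zero)    j eq _ = sym eq
      go (suc (suc _)) j eq (s≤s (s≤s ()))

    at-of : ∀ z → at (hOf z) (vOf z) ≡ z
    at-of (inj₁ (i , j)) = trans (cong₂ (build (i ℤ.- j)) (proj₁ (/-+* 2 0 j (s≤s z≤n))) (proj₂ (/-+* 2 0 j (s≤s z≤n))))
        (cong (λ k → inj₁ (k , j)) (restore i j))
    at-of (inj₂ (i , j)) = trans (cong₂ (build (i ℤ.- j ℤ.- + 1)) (proj₁ (/-+* 2 1 j (s≤s (s≤s z≤n)))) (proj₂ (/-+* 2 1 j (s≤s (s≤s z≤n)))))
        (cong (λ k → inj₂ (k , j)) (restore₁ i j))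

    private
      exponent-at : ∀ h v → Quad (exponent H (at h v)) (norm h v)
      exponent-at h v = trans (exponent-H (at h v)) (cong₂ norm (hOf-at h v) (vOf-at h v))

      coeff-at : ∀ h v → coeff H (at h v) ≡ signAt Sign.- v
      coeff-at h v = trans (coeff-H (at h v)) (cong (signAt Sign.-) (vOf-at h v))

      exponent-PP : ∀ k l → Quad (exponent PP (k , l)) (norm (+ 3 ℤ.* l) (k ℤ.- l))
      exponent-PP k l = trans (quad (tw-+ (tw-θ 2 1 k) (tw-* 5 (tw-θ 2 1 l)))) (identity k l)
        where
        identity : ∀ k l → + 2 ℤ.* ((+ 2 ℤ.* (k ℤ.* (k ℤ.+ + 1)) ℤ.+ + 1 ℤ.* (k ℤ.* (k ℤ.- + 1)))
            ℤ.+ (+ 2 ℤ.* (l ℤ.* (l ℤ.+ + 1)) ℤ.+ + 1 ℤ.* (l ℤ.* (l ℤ.- + 1))) ℤ.* + 5) ℤ.+ + 1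
          ≡ (k ℤ.- l ℤ.+ + 2 ℤ.* (+ 3 ℤ.* l) ℤ.+ + 1) ℤ.* (k ℤ.- l ℤ.+ + 2 ℤ.* (+ 3 ℤ.* l) ℤ.+ + 1) ℤ.+ + 5 ℤ.* ((k ℤ.- l) ℤ.* (k ℤ.- l))
        identity = ℤS.solve-∀

      coeff-PP : ∀ k l → coeff PP (k , l) ≡ signAt Sign.- (k ℤ.- l)
      coeff-PP k l = trans (cong₂ _*_ (ℚP.*-identityˡ (signAt Sign.- k)) (ℚP.*-identityˡ (signAt Sign.- l)))
        (sym (trans (signAt-+ Sign.- k (ℤ.- l)) (cong (signAt Sign.- k *_) (signAt-neg Sign.- l))))

      class₀ : Class H hOf 3 0 PP
      class₀ = record
        { to = λ (k , l) → at (+ 3 ℤ.* l) (k ℤ.- l)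
        ; κ = λ (k , l) → l
        ; from = λ j z → vOf z ℤ.+ j , j
        ; residue = λ (k , l) → trans (hOf-at (+ 3 ℤ.* l) (k ℤ.- l)) (triple l)
        ; from-to = λ (k , l) → cong (_, l) (trans (cong (ℤ._+ l) (vOf-at (+ 3 ℤ.* l) (k ℤ.- l))) (restore k l))
        ; to-from = λ j z eq → trans (cong₂ at (trans (triple j) (sym eq)) (cancel (vOf z) j)) (at-of z)
        ; exponent-to = λ (k , l) → quad-≡ {w = norm (+ 3 ℤ.* l) (k ℤ.- l)} (exponent-at (+ 3 ℤ.* l) (k ℤ.- l)) (exponent-PP k l)
        ; coeff-to = λ (k , l) → trans (coeff-at (+ 3 ℤ.* l) (k ℤ.- l)) (sym (coeff-PP k l))
        }
        where
        triple : ∀ l → + 3 ℤ.* l ≡ + 0 ℤ.+ l ℤ.* + 3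
        triple = ℤS.solve-∀

      -- (u , v) ↦ (− u , − v)
      class₂ : Class H hOf 3 2 PP
      class₂ = record
        { to = λ (k , l) → at (+ 2 ℤ.+ (ℤ.- l ℤ.- + 1) ℤ.* + 3) (ℤ.- (k ℤ.- l))
        ; κ = λ (k , l) → ℤ.- l ℤ.- + 1
        ; from = λ j z → ℤ.- j ℤ.- + 1 ℤ.- vOf z , ℤ.- j ℤ.- + 1
        ; residue = λ (k , l) → hOf-at (+ 2 ℤ.+ (ℤ.- l ℤ.- + 1) ℤ.* + 3) (ℤ.- (k ℤ.- l))
        ; from-to = λ (k , l) → pair (trans (cong (λ v → ℤ.- (ℤ.- l ℤ.- + 1) ℤ.- + 1 ℤ.- v)
            (vOf-at (+ 2 ℤ.+ (ℤ.- l ℤ.- + 1) ℤ.* + 3) (ℤ.- (k ℤ.- l)))) (from-to₁ k l)) (from-to₂ l)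
        ; to-from = λ j z eq → trans (cong₂ at (trans (to-from₁ j) (sym eq)) (to-from₂ j (vOf z))) (at-of z)
        ; exponent-to = λ (k , l) → quad-≡ {w = norm (+ 3 ℤ.* l) (k ℤ.- l)}
            (trans (exponent-at (+ 2 ℤ.+ (ℤ.- l ℤ.- + 1) ℤ.* + 3) (ℤ.- (k ℤ.- l))) (reflect k l)) (exponent-PP k l)
        ; coeff-to = λ (k , l) → trans (coeff-at (+ 2 ℤ.+ (ℤ.- l ℤ.- + 1) ℤ.* + 3) (ℤ.- (k ℤ.- l)))
            (trans (signAt-neg Sign.- (k ℤ.- l)) (sym (coeff-PP k l)))
        }
        where
        from-to₁ : ∀ k l → ℤ.- (ℤ.- l ℤ.- + 1) ℤ.- + 1 ℤ.- (ℤ.- (k ℤ.- l)) ≡ k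
        from-to₁ = ℤS.solve-∀
        from-to₂ : ∀ l → ℤ.- (ℤ.- l ℤ.- + 1) ℤ.- + 1 ≡ l
        from-to₂ = ℤS.solve-∀
        to-from₁ : ∀ j → + 2 ℤ.+ (ℤ.- (ℤ.- j ℤ.- + 1) ℤ.- + 1) ℤ.* + 3 ≡ + 2 ℤ.+ j ℤ.* + 3
        to-from₁ = ℤS.solve-∀
        to-from₂ : ∀ j v → ℤ.- (ℤ.- j ℤ.- + 1 ℤ.- v ℤ.- (ℤ.- j ℤ.- + 1)) ≡ v
        to-from₂ = ℤS.solve-∀
        reflect : ∀ k l → (ℤ.- (k ℤ.- l) ℤ.+ + 2 ℤ.* (+ 2 ℤ.+ (ℤ.- l ℤ.- + 1) ℤ.* + 3) ℤ.+ + 1)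
            ℤ.* (ℤ.- (k ℤ.- l) ℤ.+ + 2 ℤ.* (+ 2 ℤ.+ (ℤ.- l ℤ.- + 1) ℤ.* + 3) ℤ.+ + 1) ℤ.+ + 5 ℤ.* (ℤ.- (k ℤ.- l) ℤ.* ℤ.- (k ℤ.- l))
          ≡ (k ℤ.- l ℤ.+ + 2 ℤ.* (+ 3 ℤ.* l) ℤ.+ + 1) ℤ.* (k ℤ.- l ℤ.+ + 2 ℤ.* (+ 3 ℤ.* l) ℤ.+ + 1) ℤ.+ + 5 ℤ.* ((k ℤ.- l) ℤ.* (k ℤ.- l))
        reflect = ℤS.solve-∀

      Z : Family
      Z = restrict H hOf 3 1

      -- On the class h = 3l + 1 one has u - v = 2h + 1 = 3(2l + 1), so 2l + 1 is the number (u -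
      -- v)/3.
      mirror : ℤ → ℤ → ℤ
      mirror l v = ℤ.- (+ 2 ℤ.* l ℤ.+ + 1) ℤ.- v

      flip : Index H → Index H
      flip z with hOf z %ℕ 3 ℕ.≟ 1
      ... | yes _ = at (hOf z) (mirror (hOf z /ℕ 3) (vOf z))
      ... | no  _ = z

      flip-yes : ∀ z → hOf z %ℕ 3 ≡ 1 → flip z ≡ at (hOf z) (mirror (hOf z /ℕ 3) (vOf z))
      flip-yes z h≡1 with hOf z %ℕ 3 ℕ.≟ 1
      ... | yes _ = refl
      ... | no h≢1 = contradiction h≡1 h≢1

      flip-no : ∀ z → hOf z %ℕ 3 ≢ 1 → flip z ≡ z
      flip-no z h≢1 with hOf z %ℕ 3 ℕ.≟ 1
      ... | yes h≡1 = contradiction h≡1 h≢1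
      ... | no _ = refl

      flip-involutive : ∀ z → flip (flip z) ≡ z
      flip-involutive z with hOf z %ℕ 3 ℕ.≟ 1
      ... | no h≢1 = flip-no z h≢1
      ... | yes h≡1 = trans (flip-yes z′ (trans (cong (_%ℕ 3) h′) h≡1))
          (trans (cong₂ at h′ (trans (cong₂ (λ h v → mirror (h /ℕ 3) v) h′ (vOf-at (hOf z) (mirror l (vOf z)))) (twice-mirror l (vOf z)))) (at-of z))
        where
        l = hOf z /ℕ 3
        z′ = at (hOf z) (mirror l (vOf z))
        h′ : hOf z′ ≡ hOf z
        h′ = hOf-at (hOf z) (mirror l (vOf z))
        twice-mirror : ∀ l v → ℤ.- (+ 2 ℤ.* l ℤ.+ + 1) ℤ.- (ℤ.- (+ 2 ℤ.* l ℤ.+ + 1) ℤ.- v) ≡ v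
        twice-mirror = ℤS.solve-∀

      -- With t = (u - v)/3 the form u² + 5v² is 6v² + 6vt + 9t², symmetric under v ↦ - t - v.
      flip-exponent : ∀ z → exponent H (flip z) ≡ exponent H z
      flip-exponent z with hOf z %ℕ 3 ℕ.≟ 1
      ... | no _ = refl
      ... | yes h≡1 = quad-≡ {w = norm (hOf z) (vOf z)} (trans (exponent-at (hOf z) (mirror l (vOf z)))
          (trans (cong (λ h → norm h (mirror l (vOf z))) h≡) (trans (isometry l (vOf z)) (cong (λ h → norm h (vOf z)) (sym h≡))))) (exponent-H z)
        where
        l = hOf z /ℕ 3
        h≡ : hOf z ≡ + 1 ℤ.+ l ℤ.* + 3
        h≡ = trans (ℤD.a≡a%ℕn+[a/ℕn]*n (hOf z) 3) (cong (λ r → + r ℤ.+ l ℤ.* + 3) h≡1)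
        isometry : ∀ l v → (ℤ.- (+ 2 ℤ.* l ℤ.+ + 1) ℤ.- v ℤ.+ + 2 ℤ.* (+ 1 ℤ.+ l ℤ.* + 3) ℤ.+ + 1)
            ℤ.* (ℤ.- (+ 2 ℤ.* l ℤ.+ + 1) ℤ.- v ℤ.+ + 2 ℤ.* (+ 1 ℤ.+ l ℤ.* + 3) ℤ.+ + 1) ℤ.+ + 5
            ℤ.* ((ℤ.- (+ 2 ℤ.* l ℤ.+ + 1) ℤ.- v) ℤ.* (ℤ.- (+ 2 ℤ.* l ℤ.+ + 1) ℤ.- v))
          ≡ (v ℤ.+ + 2 ℤ.* (+ 1 ℤ.+ l ℤ.* + 3) ℤ.+ + 1) ℤ.* (v ℤ.+ + 2 ℤ.* (+ 1 ℤ.+ l ℤ.* + 3) ℤ.+ + 1) ℤ.+ + 5 ℤ.* (v ℤ.* v)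
        isometry = ℤS.solve-∀

      -- The number t = 2l + 1 is odd, so v and - t - v have opposite parities and the signs (-1)^v
      -- are opposite.
      flip-coeff : ∀ z → (- 1ℚ) * coeff Z (flip z) ≡ coeff Z z
      flip-coeff z with hOf z %ℕ 3 ℕ.≟ 1
      ... | no h≢1 = trans (cong (λ b → - 1ℚ * (if b then coeff H z else 0ℚ)) (≡ᵇ-no (hOf z %ℕ 3) 1 h≢1))
          (sym (cong (if_then coeff H z else 0ℚ) (≡ᵇ-no (hOf z %ℕ 3) 1 h≢1)))
        where
        ≡ᵇ-no : ∀ a b → a ≢ b → (a ℕ.≡ᵇ b) ≡ false
        ≡ᵇ-no a b a≢b with a ℕ.≡ᵇ b in eq
        ... | true  = contradiction (ℕP.≡ᵇ⇒≡ a b (subst T (sym eq) _)) a≢b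
        ... | false = refl
      ... | yes h≡1 = begin
        - 1ℚ * coeff Z z′                         ≡⟨ cong (λ r → - 1ℚ * (if r ℕ.≡ᵇ 1 then coeff H z′ else 0ℚ))
            (trans (cong (_%ℕ 3) (hOf-at (hOf z) (mirror l (vOf z)))) h≡1) ⟩
        - 1ℚ * coeff H z′                         ≡⟨ cong (- 1ℚ *_) (coeff-at (hOf z) (mirror l (vOf z))) ⟩
        - 1ℚ * signAt Sign.- (mirror l (vOf z))   ≡⟨ cong (- 1ℚ *_) (trans (signAt-neg′ (vOf z)) (signAt-suc Sign.- (l ℤ.+ l ℤ.+ vOf z))) ⟩
        - 1ℚ * (- 1ℚ * signAt Sign.- (l ℤ.+ l ℤ.+ vOf z)) ≡⟨ undo (signAt Sign.- (l ℤ.+ l ℤ.+ vOf z)) ⟩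
        signAt Sign.- (l ℤ.+ l ℤ.+ vOf z)         ≡⟨ trans (signAt-+ Sign.- (l ℤ.+ l) (vOf z))
            (trans (cong (_* signAt Sign.- (vOf z)) (signAt-double Sign.- l)) (ℚP.*-identityˡ (signAt Sign.- (vOf z)))) ⟩
        signAt Sign.- (vOf z)                     ≡⟨ sym (coeff-H z) ⟩
        coeff H z                                 ≡⟨ sym (cong (λ r → if r ℕ.≡ᵇ 1 then coeff H z else 0ℚ) h≡1) ⟩
        coeff Z z                                 ∎
        where
        open ≡-Reasoning
        l = hOf z /ℕ 3
        z′ = at (hOf z) (mirror l (vOf z))
        undo : ∀ x → - 1ℚ * (- 1ℚ * x) ≡ x
        undo = +-*-Solver.solve 1 (λ x → con (- 1ℚ) :* (con (- 1ℚ) :* x) := x) refl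
          where open +-*-Solver
        signAt-neg′ : ∀ v → signAt Sign.- (mirror l v) ≡ signAt Sign.- (l ℤ.+ l ℤ.+ v ℤ.+ + 1)
        signAt-neg′ v = trans (cong (signAt Sign.-) (negate l v)) (signAt-neg Sign.- (l ℤ.+ l ℤ.+ v ℤ.+ + 1))
          where
          negate : ∀ l v → ℤ.- (+ 2 ℤ.* l ℤ.+ + 1) ℤ.- v ≡ ℤ.- (l ℤ.+ l ℤ.+ v ℤ.+ + 1)
          negate = ℤS.solve-∀

      class₁-vanishes : gf Z ≈ 0ₛ
      class₁-vanishes n = zero-of (gf Z n) (trans (gf-≅ {Z} {scale (- 1ℚ) Z} record
        { to = flip ; from = flip ; to-from = flip-involutive ; from-to = flip-involutive ; exponent-to = flip-exponent ; coeff-to = flip-coeff } n)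
            (gf-scale (- 1ℚ) Z n))
        where
        zero-of : ∀ x → x ≡ - 1ℚ * x → x ≡ 0ℚ
        zero-of x eq = trans (halve x) (trans (cong (λ y → ½ * (x + y)) eq) (trans (vanish x) refl))
          where
          halve : ∀ x → x ≡ ½ * (x + x)
          halve = +-*-Solver.solve 1 (λ x → x := con ½ :* (x :+ x)) refl
            where open +-*-Solver
          vanish : ∀ x → ½ * (x + - 1ℚ * x) ≡ 0ℚ
          vanish = +-*-Solver.solve 1 (λ x → con ½ :* (x :+ con (- 1ℚ) :* x) := con 0ℚ) refl
            where open +-*-Solver

    -- The classes u - v ≡ 1 and u - v ≡ 5 (mod 6) each contribute one copy of the product of the
    -- two Euler series, whence the factor 2; on the right the same sum is arranged by the parity of
    -- v.
    η₁η₅ : fromℤ (+ 2) ·ₛ (euler ⊛ dil 5 euler) ≈ dil 2 ψ₂ ⊛ dil 5 (θ Sign.+ 1 1) +ₛ (- 1ℚ) ·ₛ shift 1 (θ Sign.+ 1 1 ⊛ dil 10 ψ₂)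
    η₁η₅ n = sym (begin
      (dil 2 ψ₂ ⊛ dil 5 (θ Sign.+ 1 1)) n + - 1ℚ * shift 1 (θ Sign.+ 1 1 ⊛ dil 10 ψ₂) n
        ≡⟨ cong₂ _+_ (sym (trans (gf-⊗ (dilate 2 Fψ) (dilate 5 (Fφ Sign.+)) n) (⊛-cong (gf-dilate 2 Fψ) (gf-dilate 5 (Fφ Sign.+)) n)))
             (sym (trans (gf-scale (- 1ℚ) (raise 1 (Fφ Sign.+ ⊗ dilate 10 Fψ)) n) (cong (- 1ℚ *_) (trans (gf-raise 1 (Fφ Sign.+ ⊗ dilate 10 Fψ) n)
               (shift-cong 1 (λ m → trans (gf-⊗ (Fφ Sign.+) (dilate 10 Fψ) m) (⊛-cong {f = θ Sign.+ 1 1} (λ _ → refl) (gf-dilate 10 Fψ) m)) n))))) ⟩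
      gf U n + gf V n
        ≡⟨ sym (gf-⊕ U V n) ⟩
      gf H n
        ≡⟨ gf-classes H hOf 3 n ⟩
      gf (restrict H hOf 3 0) n + (gf Z n + (gf (restrict H hOf 3 2) n + 0ℚ))
        ≡⟨ cong₂ (λ x y → x + y) (gf-class (s≤s z≤n) class₀ n) (cong₂ (λ x y → x + (y + 0ℚ)) (class₁-vanishes n)
            (gf-class (s≤s (s≤s (s≤s z≤n))) class₂ n)) ⟩
      gf PP n + (0ℚ + (gf PP n + 0ℚ))
        ≡⟨ double (gf PP n) ⟩
      fromℤ (+ 2) * gf PP n
        ≡⟨ cong (fromℤ (+ 2) *_) (trans (gf-⊗ Fη (dilate 5 Fη) n) (⊛-cong {f = euler} (λ _ → refl) (gf-dilate 5 Fη) n)) ⟩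
      fromℤ (+ 2) * (euler ⊛ dil 5 euler) n ∎)
      where
      open ≡-Reasoning
      double : ∀ x → x + (0ℚ + (x + 0ℚ)) ≡ fromℤ (+ 2) * x
      double = +-*-Solver.solve 1 (λ x → x :+ (con 0ℚ :+ (x :+ con 0ℚ)) := con (fromℤ (+ 2)) :* x) refl
        where open +-*-Solver

open EulerProduct

-- The Wronskian of two theta series of modulus 8

module EisensteinWronskian where

  open import Data.Rational using (_+_; _*_; -_)
  open import Data.List using ([]; _∷_; [_])

  open Family

  Fcube : Family
  Fcube = thetaFamily (λ j → fromℤ (+ 4 ℤ.* j ℤ.+ + 1)) Sign.+ 3 1 (s≤s z≤n)

  -- In Σ (-1)^k k q^(k(k-1)/2) the indices - 2j and 2j + 1 have the same exponent, and their
  -- contributions add up to - (4j + 1).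
  euler³ : HasSpec euler [ (1 , 1 , + 1) ] → gf Fcube ≈ euler ⊛ (euler ⊛ euler)
  euler³ spec n = negate-≡ (gf Fcube n) ((euler ⊛ (euler ⊛ euler)) n) (trans (sym split) (Jacobi.cube spec n))
    where
    open ≡-Reasoning
    G = thetaFamily fromℤ Sign.- 0 1 (s≤s z≤n)
    F : (ℤ → ℚ) → Family
    F u = thetaFamily u Sign.+ 3 1 (s≤s z≤n)
    u₀ u₁ : ℤ → ℚ
    u₀ j = fromℤ (ℤ.- (+ 2 ℤ.* j))
    u₁ j = fromℤ (ℤ.- (+ 2 ℤ.* j ℤ.+ + 1))
    class₀ : Class G (λ k → k) 2 0 (F u₀)
    class₀ = record
      { to = λ j → ℤ.- (+ 2 ℤ.* j) ; κ = λ j → ℤ.- j ; from = λ j _ → ℤ.- j ; residue = residue ; from-to = ℤP.neg-involutive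
      ; to-from = λ j k eq → trans (back j) (sym eq)
      ; exponent-to = λ j → tw-≡ (tw-θ 0 1 (ℤ.- (+ 2 ℤ.* j))) (tw-θ 3 1 j) (ℤS.solve (j ∷ []))
      ; coeff-to = λ j → cong (fromℤ (ℤ.- (+ 2 ℤ.* j)) *_) (trans (cong (signAt Sign.-) (double j)) (signAt-double Sign.- (ℤ.- j))) }
      where
      residue : ∀ j → ℤ.- (+ 2 ℤ.* j) ≡ + 0 ℤ.+ (ℤ.- j) ℤ.* + 2
      residue = ℤS.solve-∀
      back : ∀ j → ℤ.- (+ 2 ℤ.* (ℤ.- j)) ≡ + 0 ℤ.+ j ℤ.* + 2
      back = ℤS.solve-∀
      double : ∀ j → ℤ.- (+ 2 ℤ.* j) ≡ ℤ.- j ℤ.+ ℤ.- j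
      double = ℤS.solve-∀
    class₁ : Class G (λ k → k) 2 1 (F u₁)
    class₁ = record
      { to = λ j → + 2 ℤ.* j ℤ.+ + 1 ; κ = λ j → j ; from = λ j _ → j ; residue = residue ; from-to = λ _ → refl
      ; to-from = λ j k eq → trans (residue j) (sym eq)
      ; exponent-to = λ j → tw-≡ (tw-θ 0 1 (+ 2 ℤ.* j ℤ.+ + 1)) (tw-θ 3 1 j) (ℤS.solve (j ∷ []))
      ; coeff-to = λ j → trans (cong (fromℤ (+ 2 ℤ.* j ℤ.+ + 1) *_) (trans (signAt-suc Sign.- (+ 2 ℤ.* j))
          (cong (- 1ℚ *_) (trans (cong (signAt Sign.-) (double j)) (signAt-double Sign.- j)))))
          (trans (sign-out (fromℤ (+ 2 ℤ.* j ℤ.+ + 1))) (cong (_* 1ℚ) (sym (fromℤ-neg (+ 2 ℤ.* j ℤ.+ + 1))))) }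
      where
      residue : ∀ j → + 2 ℤ.* j ℤ.+ + 1 ≡ + 1 ℤ.+ j ℤ.* + 2
      residue = ℤS.solve-∀
      double : ∀ j → + 2 ℤ.* j ≡ j ℤ.+ j
      double = ℤS.solve-∀
      sign-out : ∀ x → x * (- 1ℚ * 1ℚ) ≡ - x * 1ℚ
      sign-out = +-*-Solver.solve 1 (λ x → x :* (con (- 1ℚ) :* con 1ℚ) := (:- x) :* con 1ℚ) refl
        where open +-*-Solver
    split : gf G n ≡ - gf Fcube n
    split = begin
      gf G n                                                                    ≡⟨ gf-classes G (λ k → k) 2 n ⟩
      gf (restrict G (λ k → k) 2 0) n + (gf (restrict G (λ k → k) 2 1) n + 0ℚ)
          ≡⟨ cong₂ (λ x y → x + (y + 0ℚ)) (gf-class (s≤s z≤n) class₀ n) (gf-class (s≤s (s≤s z≤n)) class₁ n) ⟩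
      gf (F u₀) n + (gf (F u₁) n + 0ℚ)                                          ≡⟨ cong (λ z → gf (F u₀) n + z) (ℚP.+-identityʳ (gf (F u₁) n)) ⟩
      gf (F u₀) n + gf (F u₁) n                                                 ≡⟨ sym (gf-reweight-+ Fcube (λ j → u₀ j * 1ℚ) (λ j → u₁ j * 1ℚ) n) ⟩
      gf (reweight Fcube (λ j → u₀ j * 1ℚ + u₁ j * 1ℚ)) n
          ≡⟨ gf-≅ {reweight Fcube (λ j → u₀ j * 1ℚ + u₁ j * 1ℚ)} {scale (- 1ℚ) Fcube} record
                                                                                     { to = λ j → j ; from = λ j → j ; to-from =
                                                                                         λ _ → refl ; from-to = λ _ → refl ; exponent-to =
                                                                                         λ _ → refl ; coeff-to = combine } n ⟩
      gf (scale (- 1ℚ) Fcube) n                                                 ≡⟨ gf-scale (- 1ℚ) Fcube n ⟩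
      - 1ℚ * gf Fcube n
          ≡⟨ trans (sym (ℚP.neg-distribˡ-* 1ℚ (gf Fcube n))) (cong -_ (ℚP.*-identityˡ (gf Fcube n))) ⟩
      - gf Fcube n                                                              ∎
      where
      combine : ∀ j → - 1ℚ * (fromℤ (+ 4 ℤ.* j ℤ.+ + 1) * 1ℚ) ≡ u₀ j * 1ℚ + u₁ j * 1ℚ
      combine j = begin
        - 1ℚ * (fromℤ (+ 4 ℤ.* j ℤ.+ + 1) * 1ℚ)   ≡⟨ out (fromℤ (+ 4 ℤ.* j ℤ.+ + 1)) ⟩
        - fromℤ (+ 4 ℤ.* j ℤ.+ + 1) * 1ℚ          ≡⟨ cong (_* 1ℚ) (trans (sym (fromℤ-neg (+ 4 ℤ.* j ℤ.+ + 1))) (cong fromℤ (sum j))) ⟩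
        fromℤ (ℤ.- (+ 2 ℤ.* j) ℤ.+ ℤ.- (+ 2 ℤ.* j ℤ.+ + 1)) * 1ℚ ≡⟨ cong (_* 1ℚ) (fromℤ-+ (ℤ.- (+ 2 ℤ.* j)) (ℤ.- (+ 2 ℤ.* j ℤ.+ + 1))) ⟩
        (u₀ j + u₁ j) * 1ℚ                        ≡⟨ ℚP.*-distribʳ-+ 1ℚ (u₀ j) (u₁ j) ⟩
        u₀ j * 1ℚ + u₁ j * 1ℚ                     ∎
        where
        out : ∀ x → - 1ℚ * (x * 1ℚ) ≡ - x * 1ℚ
        out = +-*-Solver.solve 1 (λ x → con (- 1ℚ) :* (x :* con 1ℚ) := (:- x) :* con 1ℚ) refl
          where open +-*-Solver
        sum : ∀ j → ℤ.- (+ 4 ℤ.* j ℤ.+ + 1) ≡ ℤ.- (+ 2 ℤ.* j) ℤ.+ ℤ.- (+ 2 ℤ.* j ℤ.+ + 1)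
        sum = ℤS.solve-∀
    negate-≡ : ∀ x y → - x ≡ - y → x ≡ y
    negate-≡ x y eq = trans (sym (involutive x)) (trans (cong -_ eq) (involutive y))
      where
      involutive : ∀ x → - - x ≡ x
      involutive = +-*-Solver.solve 1 (λ x → :- (:- x) := x) refl
        where open +-*-Solver

  Θ-family : Family → Family
  Θ-family F = reweight F (λ i → coeff F i * ℕ→ℚ (exponent F i))

  gf-Θ : ∀ F → gf (Θ-family F) ≈ Θ (gf F)
  gf-Θ F n = trans (∑-cong (enum F n) each) (∑-*ˡ (enum F n) (ℕ→ℚ n) (term F n))
    where
    rearrange : ∀ w e m → w * e * m ≡ w * (e * m)
    rearrange = ℚP.*-assoc
    swap : ∀ w n m → w * (n * m) ≡ n * (w * m)
    swap = +-*-Solver.solve 3 (λ w n m → w :* (n :* m) := n :* (w :* m)) refl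
      where open +-*-Solver
    each : ∀ i → coeff F i * ℕ→ℚ (exponent F i) * mono (exponent F i) n ≡ ℕ→ℚ n * (coeff F i * mono (exponent F i) n)
    each i = trans (rearrange (coeff F i) (ℕ→ℚ (exponent F i)) (mono (exponent F i) n))
      (trans (cong (coeff F i *_) (sym (Θ-mono 0 (exponent F i) n))) (swap (coeff F i) (ℕ→ℚ n) (mono (exponent F i) n)))

  -- With x = 8n + 3 and y = 8m + 1 the exponents of the two theta series are (x² − 9)/16 and (y² − 1)/16, so the
  -- Wronskian has coefficients ± (x² − y²)/8; the substitution x = 2v + u, y = 2v − u turns this into u v q^{(u² + 4v² − 5)/8}.
  module Wronskian where

    FA FB G J₀ J₁ : Family
    FA = thetaFamily one Sign.- 7 1 (s≤s z≤n)
    FB = thetaFamily one Sign.- 5 3 (s≤s z≤n)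
    -- The weight is 1 + 2(e - e′) = (x² - y²)/8 for exponents e, e′. The additional 1 is due to the
    -- fractional powers 9/16 and 1/16 of q that are missing from the two series: twice their
    -- difference is 1.
    G = reweight (FA ⊗ FB) (λ (n , m) → coeff FA n * coeff FB m
      + (fromℤ (+ 2) * (coeff FA n * ℕ→ℚ (exponent FA n) * coeff FB m) + fromℤ (ℤ.- + 2) * (coeff FA n * (coeff FB m * ℕ→ℚ (exponent FB m)))))
    J₀ = thetaFamily (λ i → fromℤ (+ 8 ℤ.* i ℤ.+ + 1)) Sign.+ 10 6 (s≤s z≤n)
    J₁ = raise 1 (thetaFamily (λ i → fromℤ (ℤ.- (+ 8 ℤ.* i ℤ.+ + 3))) Sign.+ 14 2 (s≤s z≤n))

    private
      A = θ Sign.- 7 1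
      B = θ Sign.- 5 3

      gf-G : gf G ≈ A ⊛ B +ₛ (fromℤ (+ 2) ·ₛ (Θ A ⊛ B) +ₛ fromℤ (ℤ.- + 2) ·ₛ (A ⊛ Θ B))
      gf-G n = begin
        gf G n
          ≡⟨ gf-reweight-+ (FA ⊗ FB) wt₀ (λ i → wt₁ i + wt₂ i) n ⟩
        gf (FA ⊗ FB) n + gf (reweight (FA ⊗ FB) (λ i → wt₁ i + wt₂ i)) n
          ≡⟨ cong₂ _+_ (gf-⊗ FA FB n) (trans (gf-reweight-+ (FA ⊗ FB) wt₁ wt₂ n)
              (cong₂ _+_ (gf-scale (fromℤ (+ 2)) (Θ-family FA ⊗ FB) n) (gf-scale (fromℤ (ℤ.- + 2)) (FA ⊗ Θ-family FB) n))) ⟩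
        (A ⊛ B) n + (fromℤ (+ 2) * gf (Θ-family FA ⊗ FB) n + fromℤ (ℤ.- + 2) * gf (FA ⊗ Θ-family FB) n)
          ≡⟨ cong₂ (λ x y → (A ⊛ B) n + (fromℤ (+ 2) * x + fromℤ (ℤ.- + 2) * y))
               (trans (gf-⊗ (Θ-family FA) FB n) (⊛-cong {g = B} (gf-Θ FA) (λ _ → refl) n))
                   (trans (gf-⊗ FA (Θ-family FB) n) (⊛-cong {f = A} (λ _ → refl) (gf-Θ FB) n)) ⟩
        (A ⊛ B +ₛ (fromℤ (+ 2) ·ₛ (Θ A ⊛ B) +ₛ fromℤ (ℤ.- + 2) ·ₛ (A ⊛ Θ B))) n ∎
        where
        open ≡-Reasoning
        wt₀ wt₁ wt₂ : ℤ × ℤ → ℚ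
        wt₀ (n , m) = coeff FA n * coeff FB m
        wt₁ (n , m) = fromℤ (+ 2) * (coeff FA n * ℕ→ℚ (exponent FA n) * coeff FB m)
        wt₂ (n , m) = fromℤ (ℤ.- + 2) * (coeff FA n * (coeff FB m * ℕ→ℚ (exponent FB m)))

      coeff-G : ∀ n m {y z} → Twice (exponent FA n) y → Twice (exponent FB m) z → coeff G (n , m) ≡ signAt Sign.- (n ℤ.+ m) * fromℤ (+ 1 ℤ.+ y ℤ.- z)
      coeff-G n m {y} {z} (twice p) (twice p′) = begin
        1ℚ * σₙ * (1ℚ * σₘ) + (2q * (1ℚ * σₙ * a * (1ℚ * σₘ)) + - 2q * (1ℚ * σₙ * (1ℚ * σₘ * b)))
          ≡⟨ +-*-Solver.solve 4 (λ s t a b → con 1ℚ :* s :* (con 1ℚ :* t)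
              :+ (con 2q :* (con 1ℚ :* s :* a :* (con 1ℚ :* t)) :+ con (- 2q) :* (con 1ℚ :* s :* (con 1ℚ :* t :* b))) :=
              s :* t :* (con 1ℚ :+ con 2q :* a :+ (:- (con 2q :* b)))) refl σₙ σₘ a b ⟩
        σₙ * σₘ * (1ℚ + 2q * a + - (2q * b))
          ≡⟨ cong₂ _*_ (sym (signAt-+ Sign.- n m)) (sym (trans (fromℤ-+ (+ 1 ℤ.+ y) (ℤ.- z))
              (cong₂ _+_ (trans (fromℤ-+ (+ 1) y) (cong (λ x → 1ℚ + x) (trans (cong fromℤ (sym p)) (fromℤ-* (+ 2) (+ exponent FA n)))))
               (trans (fromℤ-neg z) (cong -_ (trans (cong fromℤ (sym p′)) (fromℤ-* (+ 2) (+ exponent FB m)))))))) ⟩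
        signAt Sign.- (n ℤ.+ m) * fromℤ (+ 1 ℤ.+ y ℤ.- z) ∎
        where
        open ≡-Reasoning
        open +-*-Solver
        2q = fromℤ (+ 2)
        σₙ = signAt Sign.- n
        σₘ = signAt Sign.- m
        a = ℕ→ℚ (exponent FA n)
        b = ℕ→ℚ (exponent FB m)

      ℓ : ℤ × ℤ → ℤ
      ℓ (n , m) = n ℤ.+ m

      unit-product : ∀ x y → fromℤ (x ℤ.* y) ≡ fromℤ x * 1ℚ * (fromℤ y * 1ℚ)
      unit-product x y = trans (fromℤ-* x y) (cong₂ _*_ (sym (ℚP.*-identityʳ (fromℤ x))) (sym (ℚP.*-identityʳ (fromℤ y))))

      class₀ : Class G ℓ 2 0 (J₀ ⊗ dilate 4 Fcube)
      class₀ = record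
        { to = λ (u , v) → u ℤ.+ v , v ℤ.- u
        ; κ = λ (u , v) → v
        ; from = λ j (x , y) → x ℤ.- j , j
        ; residue = λ (u , v) → residue u v
        ; from-to = λ (u , v) → pair (from-to₁ u v) (from-to₂ u v)
        ; to-from = λ j (x , y) eq → pair (absorb (+ 0) (to-from₁ j x y) eq) (absorb (+ 1) (to-from₂ j x y) eq)
        ; exponent-to = λ { (u , v) → tw-≡ (tw-+ (tw-θ 7 1 (u ℤ.+ v)) (tw-θ 5 3 (v ℤ.- u))) (tw-+ (tw-θ 10 6 u) (tw-* 4 (tw-θ 3 1 v)))
            (ℤS.solve (u ∷ v ∷ [])) }
        ; coeff-to = λ (u , v) → trans (coeff-G (u ℤ.+ v) (v ℤ.- u) (tw-θ 7 1 (u ℤ.+ v)) (tw-θ 5 3 (v ℤ.- u)))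
            (trans (cong₂ (λ s z → signAt Sign.- s * fromℤ z) (parity u v) (harmonic u v))
            (trans (cong (_* fromℤ ((+ 8 ℤ.* u ℤ.+ + 1) ℤ.* (+ 4 ℤ.* v ℤ.+ + 1))) (signAt-double Sign.- v))
            (trans (ℚP.*-identityˡ (fromℤ ((+ 8 ℤ.* u ℤ.+ + 1) ℤ.* (+ 4 ℤ.* v ℤ.+ + 1)))) (unit-product (+ 8 ℤ.* u ℤ.+ + 1) (+ 4 ℤ.* v ℤ.+ + 1)))))
        }
        where
        residue : ∀ u v → (u ℤ.+ v) ℤ.+ (v ℤ.- u) ≡ + 0 ℤ.+ v ℤ.* + 2
        residue = ℤS.solve-∀
        from-to₁ : ∀ u v → (u ℤ.+ v) ℤ.- v ≡ u
        from-to₁ = ℤS.solve-∀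
        from-to₂ : ∀ u v → v ≡ v
        from-to₂ = ℤS.solve-∀
        to-from₁ : ∀ j x y → (x ℤ.- j) ℤ.+ j ≡ x ℤ.+ + 0 ℤ.* (+ 0 ℤ.+ j ℤ.* + 2 ℤ.- (x ℤ.+ y))
        to-from₁ = ℤS.solve-∀
        to-from₂ : ∀ j x y → j ℤ.- (x ℤ.- j) ≡ y ℤ.+ + 1 ℤ.* (+ 0 ℤ.+ j ℤ.* + 2 ℤ.- (x ℤ.+ y))
        to-from₂ = ℤS.solve-∀
        parity : ∀ u v → u ℤ.+ v ℤ.+ (v ℤ.- u) ≡ v ℤ.+ v
        parity = ℤS.solve-∀
        harmonic : ∀ u v → + 1 ℤ.+ (+ 7 ℤ.* ((u ℤ.+ v) ℤ.* ((u ℤ.+ v) ℤ.+ + 1)) ℤ.+ + 1 ℤ.* ((u ℤ.+ v) ℤ.* ((u ℤ.+ v) ℤ.- + 1)))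
            ℤ.- (+ 5 ℤ.* ((v ℤ.- u) ℤ.* ((v ℤ.- u) ℤ.+ + 1)) ℤ.+ + 3 ℤ.* ((v ℤ.- u) ℤ.* ((v ℤ.- u) ℤ.- + 1))) ≡ (+ 8 ℤ.* u ℤ.+ + 1)
            ℤ.* (+ 4 ℤ.* v ℤ.+ + 1)
        harmonic = ℤS.solve-∀
      -- With u′ = - (8u + 3) and v′ = 4v + 1 one has x = u′ - 2v′ and y = - u′ - 2v′, so x² - y² =
      -- - 8u′v′; the sign is compensated by (-1)^(n+m) = - 1.
      class₁ : Class G ℓ 2 1 (J₁ ⊗ dilate 4 Fcube)
      class₁ = record
        { to = λ (u , v) → ℤ.- u ℤ.- v ℤ.- + 1 , u ℤ.- v
        ; κ = λ (u , v) → ℤ.- v ℤ.- + 1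
        ; from = λ j (x , y) → j ℤ.- x , ℤ.- j ℤ.- + 1
        ; residue = λ (u , v) → residue u v
        ; from-to = λ (u , v) → pair (from-to₁ u v) (from-to₂ u v)
        ; to-from = λ j (x , y) eq → pair (absorb (+ 0) (to-from₁ j x y) eq) (absorb (+ 1) (to-from₂ j x y) eq)
        ; exponent-to = λ { (u , v) → tw-≡ (tw-+ (tw-θ 7 1 (ℤ.- u ℤ.- v ℤ.- + 1)) (tw-θ 5 3 (u ℤ.- v)))
            (tw-+ (tw-+ (tw-const 1) (tw-θ 14 2 u)) (tw-* 4 (tw-θ 3 1 v))) (ℤS.solve (u ∷ v ∷ [])) }
        ; coeff-to = λ (u , v) → trans (coeff-G (ℤ.- u ℤ.- v ℤ.- + 1) (u ℤ.- v) (tw-θ 7 1 (ℤ.- u ℤ.- v ℤ.- + 1)) (tw-θ 5 3 (u ℤ.- v)))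
            (trans (cong₂ (λ s z → signAt Sign.- s * fromℤ z) (parity u v) (harmonic u v))
            (trans (cong (_* fromℤ (ℤ.- (ℤ.- (+ 8 ℤ.* u ℤ.+ + 3) ℤ.* (+ 4 ℤ.* v ℤ.+ + 1))))
            (trans (signAt-suc Sign.- (ℤ.- v ℤ.- + 1 ℤ.+ (ℤ.- v ℤ.- + 1))) (cong (- 1ℚ *_) (signAt-double Sign.- (ℤ.- v ℤ.- + 1)))))
            (trans (negative (ℤ.- (+ 8 ℤ.* u ℤ.+ + 3) ℤ.* (+ 4 ℤ.* v ℤ.+ + 1))) (unit-product (ℤ.- (+ 8 ℤ.* u ℤ.+ + 3)) (+ 4 ℤ.* v ℤ.+ + 1)))))
        }
        where
        residue : ∀ u v → (ℤ.- u ℤ.- v ℤ.- + 1) ℤ.+ (u ℤ.- v) ≡ + 1 ℤ.+ (ℤ.- v ℤ.- + 1) ℤ.* + 2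
        residue = ℤS.solve-∀
        from-to₁ : ∀ u v → (ℤ.- v ℤ.- + 1) ℤ.- (ℤ.- u ℤ.- v ℤ.- + 1) ≡ u
        from-to₁ = ℤS.solve-∀
        from-to₂ : ∀ u v → ℤ.- (ℤ.- v ℤ.- + 1) ℤ.- + 1 ≡ v
        from-to₂ = ℤS.solve-∀
        to-from₁ : ∀ j x y → ℤ.- (j ℤ.- x) ℤ.- (ℤ.- j ℤ.- + 1) ℤ.- + 1 ≡ x ℤ.+ + 0 ℤ.* (+ 1 ℤ.+ j ℤ.* + 2 ℤ.- (x ℤ.+ y))
        to-from₁ = ℤS.solve-∀
        to-from₂ : ∀ j x y → (j ℤ.- x) ℤ.- (ℤ.- j ℤ.- + 1) ≡ y ℤ.+ + 1 ℤ.* (+ 1 ℤ.+ j ℤ.* + 2 ℤ.- (x ℤ.+ y))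
        to-from₂ = ℤS.solve-∀
        parity : ∀ u v → ℤ.- u ℤ.- v ℤ.- + 1 ℤ.+ (u ℤ.- v) ≡ ℤ.- v ℤ.- + 1 ℤ.+ (ℤ.- v ℤ.- + 1) ℤ.+ + 1
        parity = ℤS.solve-∀
        harmonic : ∀ u v → + 1 ℤ.+ (+ 7 ℤ.* ((ℤ.- u ℤ.- v ℤ.- + 1) ℤ.* ((ℤ.- u ℤ.- v ℤ.- + 1) ℤ.+ + 1)) ℤ.+ + 1
            ℤ.* ((ℤ.- u ℤ.- v ℤ.- + 1) ℤ.* ((ℤ.- u ℤ.- v ℤ.- + 1) ℤ.- + 1)))
            ℤ.- (+ 5 ℤ.* ((u ℤ.- v) ℤ.* ((u ℤ.- v) ℤ.+ + 1)) ℤ.+ + 3 ℤ.* ((u ℤ.- v) ℤ.* ((u ℤ.- v) ℤ.- + 1))) ≡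
            ℤ.- (ℤ.- (+ 8 ℤ.* u ℤ.+ + 3) ℤ.* (+ 4 ℤ.* v ℤ.+ + 1))
        harmonic = ℤS.solve-∀
        negative : ∀ z → - 1ℚ * 1ℚ * fromℤ (ℤ.- z) ≡ fromℤ z
        negative z = trans (cong (- 1ℚ * 1ℚ *_) (fromℤ-neg z)) (undo (fromℤ z))
          where
          undo : ∀ x → - 1ℚ * 1ℚ * - x ≡ x
          undo = +-*-Solver.solve 1 (λ x → con (- 1ℚ) :* con 1ℚ :* (:- x) := x) refl
            where open +-*-Solver

      -- The numbers congruent to 1 modulo 4 are the 8i + 1 and the - (8i + 3), so the two classes
      -- of the Wronskian recombine to one full series for the cube.
      cube-split : gf Fcube ≈ gf J₀ +ₛ gf J₁
      cube-split n = trans (gf-classes Fcube (λ k → k) 2 n) (trans (cong₂ (λ x y → x + (y + 0ℚ)) (gf-class (s≤s z≤n) even n)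
          (gf-class (s≤s (s≤s z≤n)) odd n))
        (cong (λ z → gf J₀ n + z) (ℚP.+-identityʳ (gf J₁ n))))
        where
        even : Class Fcube (λ k → k) 2 0 J₀
        even = record
          { to = λ i → + 2 ℤ.* i ; κ = λ i → i ; from = λ j _ → j ; residue = residue ; from-to = λ _ → refl
          ; to-from = λ j k eq → trans (residue j) (sym eq)
          ; exponent-to = λ i → tw-≡ (tw-θ 3 1 (+ 2 ℤ.* i)) (tw-θ 10 6 i) (ℤS.solve (i ∷ []))
          ; coeff-to = λ i → cong (λ z → fromℤ z * 1ℚ) (four i) }
          where
          residue : ∀ i → + 2 ℤ.* i ≡ + 0 ℤ.+ i ℤ.* + 2
          residue = ℤS.solve-∀
          four : ∀ i → + 4 ℤ.* (+ 2 ℤ.* i) ℤ.+ + 1 ≡ + 8 ℤ.* i ℤ.+ + 1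
          four = ℤS.solve-∀
        odd : Class Fcube (λ k → k) 2 1 J₁
        odd = record
          { to = λ i → ℤ.- (+ 2 ℤ.* i) ℤ.- + 1 ; κ = λ i → ℤ.- i ℤ.- + 1 ; from = λ j _ → ℤ.- j ℤ.- + 1 ; residue = residue ; from-to = back
          ; to-from = λ j k eq → trans (forth j) (sym eq)
          ; exponent-to = λ i → tw-≡ (tw-θ 3 1 (ℤ.- (+ 2 ℤ.* i) ℤ.- + 1)) (tw-+ (tw-const 1) (tw-θ 14 2 i)) (ℤS.solve (i ∷ []))
          ; coeff-to = λ i → cong (λ z → fromℤ z * 1ℚ) (four i) }
          where
          residue : ∀ i → ℤ.- (+ 2 ℤ.* i) ℤ.- + 1 ≡ + 1 ℤ.+ (ℤ.- i ℤ.- + 1) ℤ.* + 2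
          residue = ℤS.solve-∀
          back : ∀ i → ℤ.- (ℤ.- i ℤ.- + 1) ℤ.- + 1 ≡ i
          back = ℤS.solve-∀
          forth : ∀ j → ℤ.- (+ 2 ℤ.* (ℤ.- j ℤ.- + 1)) ℤ.- + 1 ≡ + 1 ℤ.+ j ℤ.* + 2
          forth = ℤS.solve-∀
          four : ∀ i → + 4 ℤ.* (ℤ.- (+ 2 ℤ.* i) ℤ.- + 1) ℤ.+ + 1 ≡ ℤ.- (+ 8 ℤ.* i ℤ.+ + 3)
          four = ℤS.solve-∀

    -- The harmonic polynomial u v and the exponent both separate the variables, so the double sum
    -- is a product of two copies of Jacobi's series for the cube, at q and at q⁴.
    wronskian : A ⊛ B +ₛ (fromℤ (+ 2) ·ₛ (Θ A ⊛ B) +ₛ fromℤ (ℤ.- + 2) ·ₛ (A ⊛ Θ B)) ≈ gf Fcube ⊛ dil 4 (gf Fcube)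
    wronskian n = begin
      (A ⊛ B +ₛ (fromℤ (+ 2) ·ₛ (Θ A ⊛ B) +ₛ fromℤ (ℤ.- + 2) ·ₛ (A ⊛ Θ B))) n
        ≡⟨ sym (gf-G n) ⟩
      gf G n
        ≡⟨ gf-classes G ℓ 2 n ⟩
      gf (restrict G ℓ 2 0) n + (gf (restrict G ℓ 2 1) n + 0ℚ)
        ≡⟨ cong₂ (λ x y → x + (y + 0ℚ)) (gf-class (s≤s z≤n) class₀ n) (gf-class (s≤s (s≤s z≤n)) class₁ n) ⟩
      gf (J₀ ⊗ dilate 4 Fcube) n + (gf (J₁ ⊗ dilate 4 Fcube) n + 0ℚ)
        ≡⟨ cong₂ _+_ (gf-⊗ J₀ (dilate 4 Fcube) n) (trans (ℚP.+-identityʳ _) (gf-⊗ J₁ (dilate 4 Fcube) n)) ⟩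
      (gf J₀ ⊛ gf (dilate 4 Fcube)) n + (gf J₁ ⊛ gf (dilate 4 Fcube)) n
        ≡⟨ sym (⊛-distribʳ (gf (dilate 4 Fcube)) (gf J₀) (gf J₁) n) ⟩
      ((gf J₀ +ₛ gf J₁) ⊛ gf (dilate 4 Fcube)) n
        ≡⟨ ⊛-cong (λ m → sym (cube-split m)) (gf-dilate 4 Fcube) n ⟩
      (gf Fcube ⊛ dil 4 (gf Fcube)) n ∎
      where open ≡-Reasoning

open EisensteinWronskian

-- Theta series and their products as eta quotients

module EtaQuotients where

  open import Data.Rational using (_+_; _*_; -_)
  open import Data.List using (List; []; _∷_; _++_; upTo)
  open import Relation.Nullary.Decidable using (True; toWitness)

  record Eta (f : PS) (L : List (ℕ × ℤ)) : Set where
    constructor eta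
    field spec : HasSpec f (etaSpec L)
  open Eta public

  module _ (N : ℕ) .{{_ : NonZero N}} where

    eta-of : ∀ {f} l L {_ : True (All.all? (level? N) l)} {_ : True (All.all? (level? N) (etaSpec L))}
      {_ : True (All.all? (λ m → mult l m ℤ.≟ mult (etaSpec L) m) (upTo N))} → HasSpec f l → Eta f L
    eta-of l L {p} {p′} {q} h = eta (spec-resp (etaSpec L) (λ _ → refl) (spec-≡ N l (etaSpec L) {p} {p′} {q}) h)

    eta-≈ : ∀ {f g} L L′ {_ : True (All.all? (level? N) (etaSpec L))} {_ : True (All.all? (level? N) (etaSpec L′))}
      {_ : True (All.all? (λ m → mult (etaSpec L) m ℤ.≟ mult (etaSpec L′) m) (upTo N))} → Eta f L → Eta g L′ → f ≈ g
    eta-≈ L L′ {p} {p′} {q} (eta h) (eta h′) = spec-unique h h′ (spec-≡ N (etaSpec L) (etaSpec L′) {p} {p′} {q})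

  eta-⊛ : ∀ {f g L L′} → Eta f L → Eta g L′ → Eta (f ⊛ g) (L ++ L′)
  eta-⊛ {L = L} {L′} (eta h) (eta h′) = eta (subst (HasSpec _) (sym (map-++ (λ (k , e) → k , k , e) L L′)) (spec-⊛ h h′))
    where open import Data.List.Properties using (map-++)
  infixr 7 _⊗ₑ_
  _⊗ₑ_ = eta-⊛

  spec-≈ : ∀ {f g l} → f ≈ g → HasSpec f l → HasSpec g l
  spec-≈ {l = l} f≈g = spec-resp l f≈g (λ _ → refl)

  θ-spec : ∀ ε r s d .{{_ : NonZero r}} .{{_ : NonZero s}} .{{_ : NonZero d}} .{{_ : NonZero (r ℕ.* d)}} .{{_ : NonZero (s ℕ.* d)}} →
    HasSpec (dil d (θ ε r s)) (thetaSpec ε (r ℕ.* d) (s ℕ.* d))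
  θ-spec ε r s d = spec-≈ (λ n → sym (θ-dil ε r s d n)) (tripleProduct ε (r ℕ.* d) (s ℕ.* d))

  φ₊ φ₋ ψ : PS
  φ₊ = θ Sign.+ 1 1
  φ₋ = θ Sign.- 1 1
  ψ  = θ Sign.+ 3 1

  -- 4 q Rφ = φ(q)² − φ(q⁵)² and Rψ = ψ(q)² − q ψ(q⁵)²
  Rφ Rψ : PS
  Rφ = θ Sign.+ 9 1 ⊛ θ Sign.+ 7 3
  Rψ = θ Sign.+ 1 4 ⊛ θ Sign.+ 3 2

  private
    -1ᶻ -2ᶻ -3ᶻ : ℤ
    -1ᶻ = ℤ.- + 1
    -2ᶻ = ℤ.- + 2
    -3ᶻ = ℤ.- + 3

  -- The classical quotients, up to powers of q: φ(q) = η(2z)⁵/(η(z)²η(4z)²), φ(-q) = η(z)²/η(2z)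
  -- and ψ(q) = η(2z)²/η(z), each at q^d.
  φL φ₋L ψL ηL : ℕ → List (ℕ × ℤ)
  φL d  = (d , -2ᶻ) ∷ (2 ℕ.* d , + 5) ∷ (4 ℕ.* d , -2ᶻ) ∷ []
  φ₋L d = (d , + 2) ∷ (2 ℕ.* d , -1ᶻ) ∷ []
  ψL d  = (d , -1ᶻ) ∷ (2 ℕ.* d , + 2) ∷ []
  ηL d  = (d , + 1) ∷ []

  φ-eta₁ : Eta φ₊ (φL 1)
  φ-eta₁ = eta-of 4 (thetaSpec Sign.+ 1 1) (φL 1) (tripleProduct Sign.+ 1 1)
  φ-eta₂ : Eta (dil 2 φ₊) (φL 2)
  φ-eta₂ = eta-of 8 (thetaSpec Sign.+ 2 2) (φL 2) (θ-spec Sign.+ 1 1 2)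
  φ-eta₅ : Eta (dil 5 φ₊) (φL 5)
  φ-eta₅ = eta-of 20 (thetaSpec Sign.+ 5 5) (φL 5) (θ-spec Sign.+ 1 1 5)
  φ-eta₁₀ : Eta (dil 10 φ₊) (φL 10)
  φ-eta₁₀ = eta-of 40 (thetaSpec Sign.+ 10 10) (φL 10) (θ-spec Sign.+ 1 1 10)

  φ₋-eta₁ : Eta φ₋ (φ₋L 1)
  φ₋-eta₁ = eta-of 2 (thetaSpec Sign.- 1 1) (φ₋L 1) (tripleProduct Sign.- 1 1)
  φ₋-eta₅ : Eta (dil 5 φ₋) (φ₋L 5)
  φ₋-eta₅ = eta-of 10 (thetaSpec Sign.- 5 5) (φ₋L 5) (θ-spec Sign.- 1 1 5)
  φ₋-eta₁₀ : Eta (dil 10 φ₋) (φ₋L 10)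
  φ₋-eta₁₀ = eta-of 20 (thetaSpec Sign.- 10 10) (φ₋L 10) (θ-spec Sign.- 1 1 10)

  ψ-eta₁ : Eta ψ (ψL 1)
  ψ-eta₁ = eta-of 8 (thetaSpec Sign.+ 3 1) (ψL 1) (tripleProduct Sign.+ 3 1)
  ψ-eta₂ : Eta (dil 2 ψ) (ψL 2)
  ψ-eta₂ = eta-of 16 (thetaSpec Sign.+ 6 2) (ψL 2) (θ-spec Sign.+ 3 1 2)
  ψ-eta₄ : Eta (dil 4 ψ) (ψL 4)
  ψ-eta₄ = eta-of 32 (thetaSpec Sign.+ 12 4) (ψL 4) (θ-spec Sign.+ 3 1 4)
  ψ-eta₅ : Eta (dil 5 ψ) (ψL 5)
  ψ-eta₅ = eta-of 40 (thetaSpec Sign.+ 15 5) (ψL 5) (θ-spec Sign.+ 3 1 5)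
  ψ-eta₁₀ : Eta (dil 10 ψ) (ψL 10)
  ψ-eta₁₀ = eta-of 80 (thetaSpec Sign.+ 30 10) (ψL 10) (θ-spec Sign.+ 3 1 10)
  ψ-eta₂₀ : Eta (dil 20 ψ) (ψL 20)
  ψ-eta₂₀ = eta-of 160 (thetaSpec Sign.+ 60 20) (ψL 20) (θ-spec Sign.+ 3 1 20)

  η-eta₁ : Eta euler (ηL 1)
  η-eta₁ = eta-of 3 (thetaSpec Sign.- 2 1) (ηL 1) (tripleProduct Sign.- 2 1)
  η-eta₂ : Eta (dil 2 euler) (ηL 2)
  η-eta₂ = eta-of 6 (thetaSpec Sign.- 4 2) (ηL 2) (θ-spec Sign.- 2 1 2)
  η-eta₄ : Eta (dil 4 euler) (ηL 4)
  η-eta₄ = eta-of 12 (thetaSpec Sign.- 8 4) (ηL 4) (θ-spec Sign.- 2 1 4)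
  η-eta₅ : Eta (dil 5 euler) (ηL 5)
  η-eta₅ = eta-of 15 (thetaSpec Sign.- 10 5) (ηL 5) (θ-spec Sign.- 2 1 5)
  η-eta₈ : Eta (dil 8 euler) (ηL 8)
  η-eta₈ = eta-of 24 (thetaSpec Sign.- 16 8) (ηL 8) (θ-spec Sign.- 2 1 8)
  η-eta₁₀ : Eta (dil 10 euler) (ηL 10)
  η-eta₁₀ = eta-of 30 (thetaSpec Sign.- 20 10) (ηL 10) (θ-spec Sign.- 2 1 10)
  η-eta₂₀ : Eta (dil 20 euler) (ηL 20)
  η-eta₂₀ = eta-of 60 (thetaSpec Sign.- 40 20) (ηL 20) (θ-spec Sign.- 2 1 20)
  η-eta₄₀ : Eta (dil 40 euler) (ηL 40)
  η-eta₄₀ = eta-of 120 (thetaSpec Sign.- 80 40) (ηL 40) (θ-spec Sign.- 2 1 40)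

  -- The residues ± 1, ± 3 modulo 10, respectively ± 1, ± 2 modulo 5, are all those prime to the
  -- modulus. Hence the product of the two theta series is an eta quotient although neither factor
  -- is one.
  RφL RψL : ℕ → List (ℕ × ℤ)
  RφL d = (d , -1ᶻ) ∷ (2 ℕ.* d , + 2) ∷ (4 ℕ.* d , -1ᶻ) ∷ (5 ℕ.* d , + 1) ∷ (20 ℕ.* d , + 1) ∷ []
  RψL d = (d , -1ᶻ) ∷ (2 ℕ.* d , + 1) ∷ (5 ℕ.* d , + 3) ∷ (10 ℕ.* d , -1ᶻ) ∷ []

  Rφ-eta₁ : Eta Rφ (RφL 1)
  Rφ-eta₁ = eta-of 20 (thetaSpec Sign.+ 9 1 ++ thetaSpec Sign.+ 7 3) (RφL 1) (spec-⊛ (tripleProduct Sign.+ 9 1) (tripleProduct Sign.+ 7 3))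
  Rφ-eta₂ : Eta (dil 2 Rφ) (RφL 2)
  Rφ-eta₂ = eta-of 40 (thetaSpec Sign.+ 18 2 ++ thetaSpec Sign.+ 14 6) (RφL 2)
    (spec-≈ (λ n → sym (dil-⊛ 2 (θ Sign.+ 9 1) (θ Sign.+ 7 3) n)) (spec-⊛ (θ-spec Sign.+ 9 1 2) (θ-spec Sign.+ 7 3 2)))
  Rψ-eta₁ : Eta Rψ (RψL 1)
  Rψ-eta₁ = eta-of 10 (thetaSpec Sign.+ 1 4 ++ thetaSpec Sign.+ 3 2) (RψL 1) (spec-⊛ (tripleProduct Sign.+ 1 4) (tripleProduct Sign.+ 3 2))
  Rψ-eta₂ : Eta (dil 2 Rψ) (RψL 2)
  Rψ-eta₂ = eta-of 20 (thetaSpec Sign.+ 2 8 ++ thetaSpec Sign.+ 6 4) (RψL 2)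
    (spec-≈ (λ n → sym (dil-⊛ 2 (θ Sign.+ 1 4) (θ Sign.+ 3 2) n)) (spec-⊛ (θ-spec Sign.+ 1 4 2) (θ-spec Sign.+ 3 2 2)))
  Rψ-eta₄ : Eta (dil 4 Rψ) (RψL 4)
  Rψ-eta₄ = eta-of 40 (thetaSpec Sign.+ 4 16 ++ thetaSpec Sign.+ 12 8) (RψL 4)
    (spec-≈ (λ n → sym (dil-⊛ 4 (θ Sign.+ 1 4) (θ Sign.+ 3 2) n)) (spec-⊛ (θ-spec Sign.+ 1 4 4) (θ-spec Sign.+ 3 2 4)))

  ψ² : ψ ⊛ ψ ≈ φ₊ ⊛ dil 2 ψ
  ψ² = eta-≈ 4 (ψL 1 ++ ψL 1) (φL 1 ++ ψL 2) (ψ-eta₁ ⊗ₑ ψ-eta₁) (φ-eta₁ ⊗ₑ ψ-eta₂)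

  Rφ-Rψ : Rφ ⊛ dil 2 Rψ ≈ (dil 5 ψ ⊛ dil 5 ψ) ⊛ Rψ
  Rφ-Rψ = eta-≈ 20 (RφL 1 ++ RψL 2) ((ψL 5 ++ ψL 5) ++ RψL 1) (Rφ-eta₁ ⊗ₑ Rψ-eta₂) ((ψ-eta₅ ⊗ₑ ψ-eta₅) ⊗ₑ Rψ-eta₁)

  -- The quotient of `dil 2 Rφ` by `dil 4 Rψ`. The exponents sum to 0 and Σ k e_k = 24, so with one
  -- factor q it is a modular function of level 40.
  lL : List (ℕ × ℤ)
  lL = (4 , + 3) ∷ (10 , + 1) ∷ (40 , + 2) ∷ (2 , -1ᶻ) ∷ (8 , -2ᶻ) ∷ (20 , -3ᶻ) ∷ []

  etaProd-eta : ∀ L {_ : True (All.all? (λ (k , e) → ℕP.nonZero? k) L)} → Eta (etaProd L) L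
  etaProd-eta L {nz} = eta (hasSpec (logDeriv-etaProd L (toWitness nz)))

  l₀ : PS
  l₀ = etaProd lL

  l₀-Rψ : l₀ ⊛ dil 4 Rψ ≈ dil 2 Rφ
  l₀-Rψ = eta-≈ 40 (lL ++ RψL 4) (RφL 2) (etaProd-eta lL ⊗ₑ Rψ-eta₄) Rφ-eta₂

  l₀² : (l₀ ⊛ l₀) ⊛ (dil 4 ψ ⊛ dil 10 φ₊) ≈ dil 2 φ₊ ⊛ dil 20 ψ
  l₀² = eta-≈ 40 ((lL ++ lL) ++ (ψL 4 ++ φL 10)) (φL 2 ++ ψL 20) ((etaProd-eta lL ⊗ₑ etaProd-eta lL) ⊗ₑ (ψ-eta₄ ⊗ₑ φ-eta₁₀)) (φ-eta₂ ⊗ₑ ψ-eta₂₀)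

  η₈η₄₀ : (dil 10 φ₊ ⊛ dil 10 φ₋) ⊛ (dil 8 euler ⊛ dil 40 euler) ≈ dil 4 Rψ ⊛ (dil 4 euler ⊛ dil 20 euler)
  η₈η₄₀ = eta-≈ 40 ((φL 10 ++ φ₋L 10) ++ (ηL 8 ++ ηL 40)) (RψL 4 ++ (ηL 4 ++ ηL 20))
    ((φ-eta₁₀ ⊗ₑ φ₋-eta₁₀) ⊗ₑ (η-eta₈ ⊗ₑ η-eta₄₀)) (Rψ-eta₄ ⊗ₑ (η-eta₄ ⊗ₑ η-eta₂₀))

  ψ₂ψ₁₀ : (dil 2 ψ ⊛ dil 10 ψ) ⊛ (dil 2 euler ⊛ dil 10 euler) ≈ (dil 4 euler ⊛ dil 20 euler) ⊛ (dil 4 euler ⊛ dil 20 euler)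
  ψ₂ψ₁₀ = eta-≈ 20 ((ψL 2 ++ ψL 10) ++ (ηL 2 ++ ηL 10)) ((ηL 4 ++ ηL 20) ++ (ηL 4 ++ ηL 20))
    ((ψ-eta₂ ⊗ₑ ψ-eta₁₀) ⊗ₑ (η-eta₂ ⊗ₑ η-eta₁₀)) ((η-eta₄ ⊗ₑ η-eta₂₀) ⊗ₑ (η-eta₄ ⊗ₑ η-eta₂₀))

  ABL : List (ℕ × ℤ)
  ABL = (1 , + 1) ∷ (2 , -1ᶻ) ∷ (8 , + 2) ∷ []

  AB-eta : Eta (θ Sign.- 7 1 ⊛ θ Sign.- 5 3) ABL
  AB-eta = eta-of 8 (thetaSpec Sign.- 7 1 ++ thetaSpec Sign.- 5 3) ABL (spec-⊛ (tripleProduct Sign.- 7 1) (tripleProduct Sign.- 5 3))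

  -- Identifies what remains of the Wronskian η(z)³η(4z)³ after division by the product of the two
  -- theta series.
  AB-φ : (θ Sign.- 7 1 ⊛ θ Sign.- 5 3) ⊛ ((φ₋ ⊛ φ₋) ⊛ (φ₊ ⊛ dil 2 φ₊)) ≈ (euler ⊛ (euler ⊛ euler)) ⊛ (dil 4 euler ⊛ (dil 4 euler ⊛ dil 4 euler))
  AB-φ = eta-≈ 8 (ABL ++ ((φ₋L 1 ++ φ₋L 1) ++ (φL 1 ++ φL 2))) ((ηL 1 ++ (ηL 1 ++ ηL 1)) ++ (ηL 4 ++ (ηL 4 ++ ηL 4)))
    (AB-eta ⊗ₑ ((φ₋-eta₁ ⊗ₑ φ₋-eta₁) ⊗ₑ (φ-eta₁ ⊗ₑ φ-eta₂))) ((η-eta₁ ⊗ₑ (η-eta₁ ⊗ₑ η-eta₁)) ⊗ₑ (η-eta₄ ⊗ₑ (η-eta₄ ⊗ₑ η-eta₄)))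

  C₁-eta : etaProd L₁ ≈ φ₋ ⊛ (dil 10 φ₋ ⊛ (dil 8 euler ⊛ dil 40 euler))
  C₁-eta = eta-≈ 40 L₁ (φ₋L 1 ++ (φ₋L 10 ++ (ηL 8 ++ ηL 40))) (etaProd-eta L₁) (φ₋-eta₁ ⊗ₑ (φ₋-eta₁₀ ⊗ₑ (η-eta₈ ⊗ₑ η-eta₄₀)))

  C₂-eta : etaProd L₂ ≈ (euler ⊛ dil 5 euler) ⊛ (dil 4 ψ ⊛ dil 10 ψ)
  C₂-eta = eta-≈ 40 L₂ ((ηL 1 ++ ηL 5) ++ (ψL 4 ++ ψL 10)) (etaProd-eta L₂) ((η-eta₁ ⊗ₑ η-eta₅) ⊗ₑ (ψ-eta₄ ⊗ₑ ψ-eta₁₀))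

  C₃-eta : etaProd L₃ ≈ (φ₊ ⊛ dil 20 ψ) ⊛ (dil 2 euler ⊛ dil 10 euler)
  C₃-eta = eta-≈ 40 L₃ ((φL 1 ++ ψL 20) ++ (ηL 2 ++ ηL 10)) (etaProd-eta L₃) ((φ-eta₁ ⊗ₑ ψ-eta₂₀) ⊗ₑ (η-eta₂ ⊗ₑ η-eta₁₀))

  C₄-eta : etaProd L₄ ≈ (dil 2 φ₊ ⊛ dil 5 φ₋) ⊛ (dil 4 euler ⊛ dil 20 euler)
  C₄-eta = eta-≈ 40 L₄ ((φL 2 ++ φ₋L 5) ++ (ηL 4 ++ ηL 20)) (etaProd-eta L₄) ((φ-eta₂ ⊗ₑ φ₋-eta₅) ⊗ₑ (η-eta₄ ⊗ₑ η-eta₂₀))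

open EtaQuotients

-- Characters, divisor sums and the twist by χ₂

module DivisorSums where

  open import Data.Nat.Divisibility
  open import Data.Nat.Induction using (<-rec)
  open import Data.Rational using (_+_; _*_; -_)
  open import Data.List using ([]; _∷_; _++_; map; upTo; applyUpTo)
  open import Data.List.Properties using (map-applyUpTo)
  open import Data.List.Membership.Propositional using (_∈_)
  open import Data.List.Membership.Propositional.Properties
  open import Data.Sum using (_⊎_; inj₁; inj₂)
  open import Relation.Nullary.Decidable using (toWitness)

  open Family

  if≡mono : ∀ a n w → (if a ℕ.≡ᵇ n then w else 0ℚ) ≡ w * mono a n
  if≡mono a n w with a ℕ.≡ᵇ n in eq
  ... | true  = sym (trans (cong (λ m → w * mono a m) (sym (ℕP.≡ᵇ⇒≡ a n (subst T (sym eq) _)))) (trans (cong (w *_) (mono-at a)) (ℚP.*-identityʳ w)))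
  ... | false = sym (trans (cong (w *_) (mono-off a n λ a≡n → subst T eq (ℕP.≡⇒≡ᵇ a n a≡n))) (ℚP.*-zeroʳ w))

  φ≈φ₊ : φ ≈ φ₊
  φ≈φ₊ n = begin
    φ n
      ≡⟨ sumTo≡∑ n f ⟩
    f 0 + ∑ (applyUpTo suc n) f
      ≡⟨ cong (λ is → f 0 + ∑ is f) (sym (map-applyUpTo id suc n)) ⟩
    f 0 + ∑ (map suc (upTo n)) f
      ≡⟨ cong₂ _+_ (if≡mono 0 n 1ℚ) (trans (∑-map suc (upTo n) f) (∑-cong (upTo n) λ k →
          trans (if≡mono (suc k ℕ.* suc k) n (ℕ→ℚ 2)) (double (mono (suc k ℕ.* suc k) n)))) ⟩
    h 0 + ∑ (upTo n) (λ k → h (suc k) + h (suc k))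
      ≡⟨ cong (λ z → h 0 + z) (∑-+ (upTo n) (h ∘ suc) (h ∘ suc)) ⟩
    h 0 + (∑ (upTo n) (h ∘ suc) + ∑ (upTo n) (h ∘ suc))
      ≡⟨ sym (ℚP.+-assoc (h 0) (∑ (upTo n) (h ∘ suc)) (∑ (upTo n) (h ∘ suc))) ⟩
    h 0 + ∑ (upTo n) (h ∘ suc) + ∑ (upTo n) (h ∘ suc)
      ≡⟨ cong (λ z → h 0 + z + ∑ (upTo n) (h ∘ suc)) (trans (sym (∑-map suc (upTo n) h)) (cong (λ is → ∑ is h) (map-applyUpTo id suc n))) ⟩
    ∑ (upTo (suc n)) h + ∑ (upTo n) (h ∘ suc)
      ≡⟨ cong₂ _+_ (trans (∑-cong (upTo (suc n)) λ k → sym (at (+ k))) (sym (∑-map +_ (upTo (suc n)) (term (Fφ Sign.+) n))))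
           (trans (∑-cong (upTo n) λ k → sym (at -[1+ k ])) (sym (∑-map -[1+_] (upTo n) (term (Fφ Sign.+) n)))) ⟩
    ∑ (map +_ (upTo (suc n))) (term (Fφ Sign.+) n) + ∑ (map -[1+_] (upTo n)) (term (Fφ Sign.+) n)
      ≡⟨ sym (∑-++ (map +_ (upTo (suc n))) (map -[1+_] (upTo n)) (term (Fφ Sign.+) n)) ⟩
    ∑ (map +_ (upTo (suc n)) ++ map -[1+_] (upTo n)) (term (Fφ Sign.+) n)
      ≡⟨ sym (gf-enum (Fφ Sign.+) n (Unique.++⁺ (Unique.map⁺ ℤP.+-injective (Unique.upTo⁺ (suc n))) (Unique.map⁺ ℤP.-[1+-injective (Unique.upTo⁺ n))
          disjoint) cover) ⟩
    φ₊ n ∎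
    where
    open ≡-Reasoning
    f h : ℕ → ℚ
    f k = if (k ℕ.* k) ℕ.≡ᵇ n then (if k ℕ.≡ᵇ 0 then 1ℚ else ℕ→ℚ 2) else 0ℚ
    h k = 1ℚ * mono (k ℕ.* k) n
    double : ∀ x → ℕ→ℚ 2 * x ≡ 1ℚ * x + 1ℚ * x
    double = +-*-Solver.solve 1 (λ x → con (ℕ→ℚ 2) :* x := con 1ℚ :* x :+ con 1ℚ :* x) refl
      where open +-*-Solver
    square : ∀ k → thetaExp 1 1 k ≡ ℤ.∣ k ∣ ℕ.* ℤ.∣ k ∣
    square k = tw-≡ (tw-θ 1 1 k) (twice (trans (cong (+ 2 ℤ.*_) (ℤP.pos-* ℤ.∣ k ∣ ℤ.∣ k ∣)) (cong (+ 2 ℤ.*_) (abs² k)))) (expand k)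
      where
      abs² : ∀ k → + ℤ.∣ k ∣ ℤ.* + ℤ.∣ k ∣ ≡ k ℤ.* k
      abs² (+ n)    = refl
      abs² -[1+ n ] = refl
      expand : ∀ k → + 1 ℤ.* (k ℤ.* (k ℤ.+ + 1)) ℤ.+ + 1 ℤ.* (k ℤ.* (k ℤ.- + 1)) ≡ + 2 ℤ.* (k ℤ.* k)
      expand = ℤS.solve-∀
    at : ∀ k → term (Fφ Sign.+) n k ≡ h ℤ.∣ k ∣
    at k = cong (λ e → 1ℚ * mono e n) (square k)
    disjoint : ∀ {x} → ¬ (x ∈ map +_ (upTo (suc n)) × x ∈ map -[1+_] (upTo n))
    disjoint (p , p′) with ∈-map⁻ +_ p | ∈-map⁻ -[1+_] p′
    ... | _ , _ , refl | _ , _ , ()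
    root≤ : ∀ k → k ≤ k ℕ.* k
    root≤ zero    = z≤n
    root≤ (suc k) = ℕP.m≤m*n (suc k) (suc k)
    cover : ∀ k → thetaExp 1 1 k ≡ n → k ∈ map +_ (upTo (suc n)) ++ map -[1+_] (upTo n)
    cover (+ k) e≡n = ∈-++⁺ˡ (∈-map⁺ +_ (∈-upTo⁺ (s≤s (ℕP.≤-trans (root≤ k) (ℕP.≤-reflexive (trans (sym (square (+ k))) e≡n))))))
    cover -[1+ k ] e≡n = ∈-++⁺ʳ (map +_ (upTo (suc n))) (∈-map⁺ -[1+_]
        (∈-upTo⁺ (ℕP.≤-trans (root≤ (suc k)) (ℕP.≤-reflexive (trans (sym (square -[1+ k ])) e≡n)))))

  -- The character on residues: multiplicativity and the values of its square reduce to finite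
  -- checks over 0, ..., 7.
  χᵣ : ℕ → ℚ
  χᵣ 1 = 1ℚ
  χᵣ 7 = 1ℚ
  χᵣ 3 = - 1ℚ
  χᵣ 5 = - 1ℚ
  χᵣ _ = 0ℚ

  χ₂≡χᵣ : ∀ m → χ₂ m ≡ χᵣ (m % 8)
  χ₂≡χᵣ m with m % 8
  ... | 0 = refl
  ... | 1 = refl
  ... | 2 = refl
  ... | 3 = refl
  ... | 4 = refl
  ... | 5 = refl
  ... | 6 = refl
  ... | 7 = refl
  ... | suc (suc (suc (suc (suc (suc (suc (suc _))))))) = refl

  private
    residues : {P : ℕ → Set} → All.All P (upTo 8) → ∀ m → P (m % 8)
    residues all m = All.lookup all (∈-upTo⁺ (DM.m%n<n m 8))

  χ₂-* : ∀ m k → χ₂ (m ℕ.* k) ≡ χ₂ m * χ₂ k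
  χ₂-* m k = trans (χ₂≡χᵣ (m ℕ.* k)) (trans (cong χᵣ (DM.%-distribˡ-* m k 8))
    (trans (residues (residues {λ r → All.All (λ s → χᵣ ((r ℕ.* s) % 8) ≡ χᵣ r * χᵣ s) (upTo 8)}
      (toWitness {a? = All.all? (λ r → All.all? (λ s → χᵣ ((r ℕ.* s) % 8) ℚP.≟ χᵣ r * χᵣ s) (upTo 8)) (upTo 8)} _) m) k)
    (sym (cong₂ _*_ (χ₂≡χᵣ m) (χ₂≡χᵣ k)))))

  χ₂-even : ∀ k → χ₂ (k ℕ.* 2) ≡ 0ℚ
  χ₂-even k = trans (χ₂-* k 2) (ℚP.*-zeroʳ (χ₂ k))

  χ₂-odd² : ∀ k → χ₂ (suc (k ℕ.* 2)) * χ₂ (suc (k ℕ.* 2)) ≡ 1ℚ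
  χ₂-odd² k = trans (cong₂ _*_ χ≡ χ≡) (residues (toWitness {a? = All.all? (λ r → χᵣ ((1 ℕ.+ r ℕ.* 2) % 8) * χᵣ ((1 ℕ.+ r ℕ.* 2) % 8) ℚP.≟ 1ℚ)
      (upTo 8)} _) k)
    where
    χ≡ : χ₂ (suc (k ℕ.* 2)) ≡ χᵣ ((1 ℕ.+ (k % 8) ℕ.* 2) % 8)
    χ≡ = trans (χ₂≡χᵣ (suc (k ℕ.* 2))) (cong χᵣ (trans (DM.%-distribˡ-+ 1 (k ℕ.* 2) 8)
        (trans (cong (λ z → (1 ℕ.+ z) % 8) (DM.%-distribˡ-* k 2 8)) (sym (trans (DM.%-distribˡ-+ 1 ((k % 8) ℕ.* 2) 8) refl)))))

  -- The product Π (1 - q^m)^{χ₂(m)}; its Lambert series is the non-constant part of `E₀₂`.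
  χSpec : Spec
  χSpec = (8 , 1 , + 1) ∷ (8 , 7 , + 1) ∷ (8 , 3 , ℤ.- + 1) ∷ (8 , 5 , ℤ.- + 1) ∷ []

  mult-χ : ∀ m → fromℤ (mult χSpec m) ≡ χ₂ m
  mult-χ m = trans (cong fromℤ (periodic 8 χSpec (toWitness {a? = All.all? (level? 8) χSpec} _) m))
    (trans (residues {λ r → fromℤ (mult χSpec r) ≡ χᵣ r} (toWitness {a? = All.all? (λ r → fromℤ (mult χSpec r) ℚP.≟ χᵣ r) (upTo 8)} _) m)
        (sym (χ₂≡χᵣ m)))

  codivisor : ℕ → ℕ → ℚ
  codivisor m n with m ∣? n
  ... | yes (divides k _) = χ₂ k * ℕ→ℚ m
  ... | no _              = 0ℚ

  mutual
    σ₀₂ : ∀ n → σ χ₀ χ₂ (suc n) ≡ sumTo (suc n) (λ m → χ₂ m * lambert m (suc n))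
    σ₀₂ n = sumTo-cong (suc n) (λ m _ → σ₀₂-term n m)

    -- The left side is the local summand of `σ`, inferred from the use in `σ₀₂`.
    σ₀₂-term : ∀ n m → _ ≡ χ₂ m * lambert m (suc n)
    σ₀₂-term n zero = sym (ℚP.*-zeroˡ (lambert 0 (suc n)))
    σ₀₂-term n (suc m) with suc m ∣? suc n
    ... | yes (divides k _) = cong (_* ℕ→ℚ (suc m)) (ℚP.*-identityʳ (χ₂ (suc m)))
    ... | no _ = sym (ℚP.*-zeroʳ (χ₂ (suc m)))

  mutual
    σ₂₀ : ∀ n → σ χ₂ χ₀ (suc n) ≡ sumTo (suc n) (λ m → codivisor m (suc n))
    σ₂₀ n = sumTo-cong (suc n) (λ m _ → σ₂₀-term n m)

    σ₂₀-term : ∀ n m → _ ≡ codivisor m (suc n)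
    σ₂₀-term n zero with 0 ∣? suc n
    ... | yes (divides k eq) = contradiction (trans eq (ℕP.*-zeroʳ k)) λ ()
    ... | no _ = refl
    σ₂₀-term n (suc m) with suc m ∣? suc n
    ... | yes (divides k _) = cong (_* ℕ→ℚ (suc m)) (ℚP.*-identityˡ (χ₂ k))
    ... | no _ = refl

  E₀₂≈ : E₀₂ ≈ constₛ (- (+ 1 Data.Rational./ 2)) +ₛ Λ χSpec
  E₀₂≈ zero = refl
  E₀₂≈ (suc n) = trans (σ₀₂ n) (trans (sumTo≡∑ (suc n) (λ m → χ₂ m * lambert m (suc n)))
    (trans (∑-cong (upTo (suc (suc n))) λ m → cong (_* lambert m (suc n)) (sym (mult-χ m)))
      (sym (trans (cong (_+ Λ χSpec (suc n)) (ℚP.*-zeroʳ (- (+ 1 Data.Rational./ 2)))) (ℚP.+-identityˡ (Λ χSpec (suc n)))))))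

  private
    parity : ∀ m → (∃ λ k → m ≡ k ℕ.* 2) ⊎ (∃ λ k → m ≡ suc (k ℕ.* 2))
    parity zero = inj₁ (0 , refl)
    parity (suc m) with parity m
    ... | inj₁ (k , eq) = inj₂ (k , cong suc eq)
    ... | inj₂ (k , eq) = inj₁ (suc k , cong suc eq)

    sumTo-even : ∀ k h → (∀ j → h (suc (j ℕ.* 2)) ≡ 0ℚ) → sumTo (k ℕ.* 2) h ≡ sumTo k (λ j → h (j ℕ.* 2))
    sumTo-even zero    h odd = refl
    sumTo-even (suc k) h odd = cong (_+ h (suc k ℕ.* 2)) (trans (cong₂ _+_ (sumTo-even k h odd) (odd k))
        (ℚP.+-identityʳ (sumTo k (λ j → h (j ℕ.* 2)))))

    evenPart : ℕ → ℕ → ℚ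
    evenPart m n with m % 2
    ... | 0 = codivisor m n
    ... | _ = 0ℚ

    evenPart-even : ∀ k n → evenPart (k ℕ.* 2) n ≡ codivisor (k ℕ.* 2) n
    evenPart-even k n with (k ℕ.* 2) % 2 | DM.m*n%n≡0 k 2
    ... | .0 | refl = refl

    evenPart-odd : ∀ k n → evenPart (suc (k ℕ.* 2)) n ≡ 0ℚ
    evenPart-odd k n with suc (k ℕ.* 2) % 2 | trans (DM.[m+kn]%n≡m%n 1 k 2) refl
    ... | .1 | refl = refl

    -- For an odd divisor m of n one has χ₂(n/m) = χ₂(n) χ₂(m), as χ₂(m)² = 1. So odd divisors give
    -- the twist of the other divisor sum, and even ones are collected separately.
    split-term : ∀ n m → codivisor m (suc n) ≡ χ₂ (suc n) * (χ₂ m * lambert m (suc n)) + evenPart m (suc n)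
    split-term n m with parity m
    ... | inj₁ (k , refl) = sym (trans (cong₂ _+_ (trans (cong (λ z → χ₂ (suc n) * (z * lambert (k ℕ.* 2) (suc n))) (χ₂-even k))
            (trans (cong (χ₂ (suc n) *_) (ℚP.*-zeroˡ (lambert (k ℕ.* 2) (suc n)))) (ℚP.*-zeroʳ (χ₂ (suc n))))) (evenPart-even k (suc n)))
                (ℚP.+-identityˡ _))
    ... | inj₂ (k , refl) = trans main (sym (trans (cong (λ z → χ₂ (suc n) * (χ₂ m * lambert m (suc n)) + z) (evenPart-odd k (suc n)))
        (ℚP.+-identityʳ _)))
      where
      main : codivisor (suc (k ℕ.* 2)) (suc n) ≡ χ₂ (suc n) * (χ₂ (suc (k ℕ.* 2)) * lambert (suc (k ℕ.* 2)) (suc n))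
      main with suc (k ℕ.* 2) ∣? suc n
      ... | no _ = sym (trans (cong (χ₂ (suc n) *_) (ℚP.*-zeroʳ (χ₂ (suc (k ℕ.* 2))))) (ℚP.*-zeroʳ (χ₂ (suc n))))
      ... | yes (divides j eq) = begin
        χ₂ j * w                  ≡⟨ cong (_* w) (sym (ℚP.*-identityʳ (χ₂ j))) ⟩
        χ₂ j * 1ℚ * w             ≡⟨ cong (λ z → χ₂ j * z * w) (sym (χ₂-odd² k)) ⟩
        χ₂ j * (c * c) * w        ≡⟨ regroup (χ₂ j) c w ⟩
        χ₂ j * c * (c * w)        ≡⟨ cong (_* (c * w)) (sym (trans (cong χ₂ eq) (χ₂-* j (suc (k ℕ.* 2))))) ⟩
        χ₂ (suc n) * (c * w)      ∎
        where
        open ≡-Reasoning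
        c = χ₂ (suc (k ℕ.* 2))
        w = ℕ→ℚ (suc (k ℕ.* 2))
        regroup : ∀ x y z → x * (y * y) * z ≡ x * y * (y * z)
        regroup = +-*-Solver.solve 3 (λ x y z → x :* (y :* y) :* z := x :* y :* (y :* z)) refl
          where open +-*-Solver

    -- The complementary divisor is unchanged when m and n are doubled; only the weight m doubles.
    codivisor-double : ∀ m n → codivisor (m ℕ.* 2) (n ℕ.* 2) ≡ ℕ→ℚ 2 * codivisor m n
    codivisor-double m n with m ∣? n | m ℕ.* 2 ∣? n ℕ.* 2
    ... | yes (divides j eq) | yes (divides j′ eq′) = values m eq eq′
      where
      swap : ∀ x y → x * (y * ℕ→ℚ 2) ≡ ℕ→ℚ 2 * (x * y)
      swap = +-*-Solver.solve 2 (λ x y → x :* (y :* con (ℕ→ℚ 2)) := con (ℕ→ℚ 2) :* (x :* y)) refl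
        where open +-*-Solver
      values : ∀ m → n ≡ j ℕ.* m → n ℕ.* 2 ≡ j′ ℕ.* (m ℕ.* 2) → χ₂ j′ * ℕ→ℚ (m ℕ.* 2) ≡ ℕ→ℚ 2 * (χ₂ j * ℕ→ℚ m)
      values zero    _  _   = trans (ℚP.*-zeroʳ (χ₂ j′)) (sym (trans (cong (ℕ→ℚ 2 *_) (ℚP.*-zeroʳ (χ₂ j))) (ℚP.*-zeroʳ (ℕ→ℚ 2))))
      values (suc m) eq eq′ = trans (cong₂ (λ i w → χ₂ i * w) j′≡j (trans (cong fromℤ (ℤP.pos-* (suc m) 2)) (fromℤ-* (+ suc m) (+ 2))))
          (swap (χ₂ j) (ℕ→ℚ (suc m)))
        where
        j′≡j : j′ ≡ j
        j′≡j = ℕP.*-cancelʳ-≡ j′ j (suc m ℕ.* 2) (trans (sym eq′) (trans (cong (ℕ._* 2) eq) (ℕP.*-assoc j (suc m) 2)))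
    ... | yes m∣n | no 2m∤2n = contradiction (*-monoˡ-∣ 2 m∣n) 2m∤2n
    ... | no m∤n | yes 2m∣2n = contradiction (*-cancelʳ-∣ 2 2m∣2n) m∤n
    ... | no _ | no _ = refl

    codivisor-odd : ∀ m k → codivisor (m ℕ.* 2) (suc (k ℕ.* 2)) ≡ 0ℚ
    codivisor-odd m k with m ℕ.* 2 ∣? suc (k ℕ.* 2)
    ... | no _ = refl
    ... | yes 2m∣ = contradiction (trans (sym (n∣m⇒m%n≡0 (suc (k ℕ.* 2)) 2 (∣-trans (n∣m*n m) 2m∣))) (DM.[m+kn]%n≡m%n 1 k 2)) λ ()

  twist : PS → PS
  twist f n = χ₂ n * f n

  -- Odd divisors contribute the twist of `E₀₂`. Even divisors exist only for even n, and halving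
  -- both m and n yields twice the coefficient at n/2.
  E₂₀-recursion : E₂₀ ≈ twist E₀₂ +ₛ fromℤ (+ 2) ·ₛ dil 2 E₂₀
  E₂₀-recursion zero = refl
  E₂₀-recursion (suc n) = begin
    E₂₀ (suc n)
      ≡⟨ σ₂₀ n ⟩
    sumTo (suc n) (λ m → codivisor m (suc n))
      ≡⟨ sumTo-cong (suc n) (λ m _ → split-term n m) ⟩
    sumTo (suc n) (λ m → χ₂ (suc n) * (χ₂ m * lambert m (suc n)) + evenPart m (suc n))
      ≡⟨ sumTo-+ (suc n) (λ m → χ₂ (suc n) * (χ₂ m * lambert m (suc n))) (λ m → evenPart m (suc n)) ⟩
    sumTo (suc n) (λ m → χ₂ (suc n) * (χ₂ m * lambert m (suc n))) + sumTo (suc n) (λ m → evenPart m (suc n))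
      ≡⟨ cong₂ _+_ (trans (sumTo-*ˡ (suc n) (χ₂ (suc n)) (λ m → χ₂ m * lambert m (suc n))) (cong (χ₂ (suc n) *_) (sym (σ₀₂ n))))
          (evens (suc n) (parity (suc n))) ⟩
    twist E₀₂ (suc n) + fromℤ (+ 2) * dil 2 E₂₀ (suc n) ∎
    where
    open ≡-Reasoning
    evens : ∀ n → (∃ λ k → n ≡ k ℕ.* 2) ⊎ (∃ λ k → n ≡ suc (k ℕ.* 2)) → .{{NonZero n}} → sumTo n (λ m → evenPart m n) ≡ fromℤ (+ 2) * dil 2 E₂₀ n
    evens .(suc k ℕ.* 2) (inj₁ (suc k , refl)) = begin
      sumTo (suc k ℕ.* 2) (λ m → evenPart m (suc k ℕ.* 2))         ≡⟨
          sumTo-even (suc k) (λ m → evenPart m (suc k ℕ.* 2)) (λ j → evenPart-odd j (suc k ℕ.* 2)) ⟩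
      sumTo (suc k) (λ j → evenPart (j ℕ.* 2) (suc k ℕ.* 2))       ≡⟨
          sumTo-cong (suc k) (λ j _ → trans (evenPart-even j (suc k ℕ.* 2)) (codivisor-double j (suc k))) ⟩
      sumTo (suc k) (λ j → ℕ→ℚ 2 * codivisor j (suc k))            ≡⟨ sumTo-*ˡ (suc k) (ℕ→ℚ 2) (λ j → codivisor j (suc k)) ⟩
      ℕ→ℚ 2 * sumTo (suc k) (λ j → codivisor j (suc k))            ≡⟨ cong (ℕ→ℚ 2 *_) (trans (sym (σ₂₀ k)) (sym (dil-at 2 E₂₀ (suc k)))) ⟩
      ℕ→ℚ 2 * dil 2 E₂₀ (suc k ℕ.* 2)                              ∎
    evens n (inj₂ (k , refl)) = trans (sumTo-0 n λ m _ → vanish m) (sym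
        (trans (cong (fromℤ (+ 2) *_) (dil-off 2 E₂₀ n odd)) (ℚP.*-zeroʳ (fromℤ (+ 2)))))
      where
      odd : ¬ 2 ∣ suc (k ℕ.* 2)
      odd 2∣ = contradiction (trans (sym (n∣m⇒m%n≡0 (suc (k ℕ.* 2)) 2 2∣)) (DM.[m+kn]%n≡m%n 1 k 2)) λ ()
      vanish : ∀ m → evenPart m (suc (k ℕ.* 2)) ≡ 0ℚ
      vanish m with parity m
      ... | inj₁ (j , refl) = trans (evenPart-even j (suc (k ℕ.* 2))) (codivisor-odd j k)
      ... | inj₂ (j , refl) = evenPart-odd j (suc (k ℕ.* 2))

  -- Odd coefficients of the right side vanish, and an even one is a multiple of the coefficient at
  -- half the index. Repeated halving ends at an odd index, or at 0.
  dil-fixed : ∀ c f → f ≈ c ·ₛ dil 2 f → f 0 ≡ 0ℚ → f ≈ 0ₛ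
  dil-fixed c f fix f0 = <-rec (λ n → f n ≡ 0ℚ) step
    where
    step : ∀ n → (∀ {m} → m < n → f m ≡ 0ℚ) → f n ≡ 0ℚ
    step zero    ih = f0
    step (suc n) ih with parity (suc n)
    ... | inj₂ (k , refl) = trans (fix (suc n)) (trans (cong (c *_) (dil-off 2 f (suc n) λ 2∣ →
        contradiction (trans (sym (n∣m⇒m%n≡0 (suc n) 2 2∣)) (DM.[m+kn]%n≡m%n 1 k 2)) λ ())) (ℚP.*-zeroʳ c))
    ... | inj₁ (suc k , refl) = trans (fix (suc n)) (trans (cong (c *_) (trans (dil-at 2 f (suc k)) (ih (ℕP.m<m*n (suc k) 2 (s≤s (s≤s z≤n))))))
        (ℚP.*-zeroʳ c))

  -- Series whose exponents lie in one residue class. Classes add under multiplication, and on a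
  -- single class modulo 8 the twist is a scalar.
  record Supp (M j : ℕ) .{{_ : NonZero M}} (f : PS) : Set where
    constructor supp
    field off : ∀ n → n % M ≢ j % M → f n ≡ 0ℚ
  open Supp

  module _ {M : ℕ} .{{_ : NonZero M}} where

    supp-⊛ : ∀ {j k f g} → Supp M j f → Supp M k g → Supp M (j ℕ.+ k) (f ⊛ g)
    supp-⊛ {j} {k} {f} {g} (supp sf) (supp sg) = supp λ n n≢ → sumTo-0 n λ i i≤n → vanish n n≢ i i≤n
      where
      vanish : ∀ n → n % M ≢ (j ℕ.+ k) % M → ∀ i → i ≤ n → f i * g (n ∸ i) ≡ 0ℚ
      vanish n n≢ i i≤n with i % M ℕ.≟ j % M | (n ∸ i) % M ℕ.≟ k % M
      ... | no i≢j | _ = trans (cong (_* g (n ∸ i)) (sf i i≢j)) (ℚP.*-zeroˡ (g (n ∸ i)))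
      ... | yes _ | no l≢k = trans (cong (f i *_) (sg (n ∸ i) l≢k)) (ℚP.*-zeroʳ (f i))
      ... | yes i≡j | yes l≡k = contradiction (begin
        n % M                           ≡⟨ cong (_% M) (sym (ℕP.m+[n∸m]≡n i≤n)) ⟩
        (i ℕ.+ (n ∸ i)) % M             ≡⟨ DM.%-distribˡ-+ i (n ∸ i) M ⟩
        (i % M ℕ.+ (n ∸ i) % M) % M     ≡⟨ cong₂ (λ x y → (x ℕ.+ y) % M) i≡j l≡k ⟩
        (j % M ℕ.+ k % M) % M           ≡⟨ sym (DM.%-distribˡ-+ j k M) ⟩
        (j ℕ.+ k) % M                   ∎) n≢
        where open ≡-Reasoning

    supp-dil : ∀ d .{{_ : NonZero d}} f → M ∣ d → Supp M 0 (dil d f)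
    supp-dil d f M∣d = supp λ n n≢ → dil-off d f n λ d∣n → n≢ (trans (n∣m⇒m%n≡0 n M (∣-trans M∣d d∣n)) (sym (n∣m⇒m%n≡0 0 M (M ∣0))))

    supp-mono : ∀ s → Supp M s (mono s)
    supp-mono s = supp λ n n≢ → mono-off s n λ s≡n → n≢ (cong (_% M) (sym s≡n))

  twist-class : ∀ j {f} → Supp 8 j f → twist f ≈ χᵣ (j % 8) ·ₛ f
  twist-class j {f} (supp sf) n with n % 8 ℕ.≟ j % 8
  ... | yes n≡j = cong (_* f n) (trans (χ₂≡χᵣ n) (cong χᵣ n≡j))
  ... | no n≢j  = trans (cong (χ₂ n *_) (sf n n≢j)) (trans (ℚP.*-zeroʳ (χ₂ n))
      (sym (trans (cong (χᵣ (j % 8) *_) (sf n n≢j)) (ℚP.*-zeroʳ (χᵣ (j % 8))))))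

  twist-even : ∀ {f} → Supp 2 0 f → twist f ≈ 0ₛ
  twist-even {f} (supp sf) n with parity n
  ... | inj₁ (k , refl) = trans (cong (_* f n) (χ₂-even k)) (ℚP.*-zeroˡ (f n))
  ... | inj₂ (k , refl) = trans (cong (χ₂ n *_) (sf n λ eq → contradiction (trans (sym (DM.[m+kn]%n≡m%n 1 k 2)) eq) λ ())) (ℚP.*-zeroʳ (χ₂ n))

open DivisorSums

-- Relations among the theta series at the levels dividing 40

module ThetaConstants where

  open import Data.Vec using (Vec; []; _∷_)
  open import Data.Vec.Relation.Binary.Pointwise.Inductive using (Pointwise; []; _∷_)
  open import Data.Rational using (_+_; _*_; -_)

  open Alg PS-ring ι-morphism hiding (κ)
  open PSSolver using (Polynomial; ⟦_⟧; op; [+]; [*]; var; con; _:+_; _:*_; _:-_; :-_; _:^_; _:=_; solve)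

  ·≈ι : ∀ z f → fromℤ z ·ₛ f ≈ ι z ⊛ f
  ·≈ι z f n = sym (·-one (fromℤ z) f n)

  dil-ι : ∀ d .{{_ : NonZero d}} z → dil d (ι z) ≈ ι z
  dil-ι d z n = trans (dil-· d (fromℤ z) oneₛ n) (cong (fromℤ z *_) (dil-one d n))

  -- The substitution q ↦ q^d is a ring endomorphism fixing constants, so it commutes with every
  -- polynomial expression; working on syntax handles all identities at once.
  dil-poly : ∀ d .{{_ : NonZero d}} {k} (e : Polynomial k) {ρ ρ′ : Vec PS k} → Pointwise (λ f g → dil d f ≈ g) ρ ρ′ → dil d (⟦ e ⟧ ρ) ≈ ⟦ e ⟧ ρ′
  dil-poly d (op [+] e e′) {ρ} h n = trans (dil-+ d (⟦ e ⟧ ρ) (⟦ e′ ⟧ ρ) n) (cong₂ _+_ (dil-poly d e h n) (dil-poly d e′ h n))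
  dil-poly d (op [*] e e′) {ρ} h n = trans (dil-⊛ d (⟦ e ⟧ ρ) (⟦ e′ ⟧ ρ) n) (⊛-cong (dil-poly d e h) (dil-poly d e′ h) n)
  dil-poly d (con c) h n = dil-ι d c n
  dil-poly d (var x) h n = Pointwise.lookup h x n
  dil-poly d (e :^ zero) h n = dil-one d n
  dil-poly d (e :^ suc j) {ρ} h n = trans (dil-⊛ d (⟦ e ⟧ ρ) (⟦ e :^ j ⟧ ρ) n) (⊛-cong (dil-poly d e h) (dil-poly d (e :^ j) h) n)
  dil-poly d (:- e) {ρ} h n = trans (dil-neg d (⟦ e ⟧ ρ) n) (cong -_ (dil-poly d e h n))

  dil-identity : ∀ d .{{_ : NonZero d}} {k} (e e′ : Polynomial k) {ρ ρ′ : Vec PS k} → Pointwise (λ f g → dil d f ≈ g) ρ ρ′ → ⟦ e ⟧ ρ ≈ ⟦ e′ ⟧ ρ →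
      ⟦ e ⟧ ρ′ ≈ ⟦ e′ ⟧ ρ′
  dil-identity d e e′ h eq n = trans (sym (dil-poly d e h n)) (trans (dil-cong d eq n) (dil-poly d e′ h n))

  private
    v₀ : ∀ {k} → Polynomial (1 ℕ.+ k)
    v₀ = var (# 0)
    v₁ : ∀ {k} → Polynomial (2 ℕ.+ k)
    v₁ = var (# 1)
    v₂ : ∀ {k} → Polynomial (3 ℕ.+ k)
    v₂ = var (# 2)
    v₃ : ∀ {k} → Polynomial (4 ℕ.+ k)
    v₃ = var (# 3)
    v₄ : ∀ {k} → Polynomial (5 ℕ.+ k)
    v₄ = var (# 4)
    v₅ : ∀ {k} → Polynomial (6 ℕ.+ k)
    v₅ = var (# 5)

  q q² q³ q⁴ q⁵ : PS
  q  = mono 1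
  q² = q ⊛ q
  q³ = q² ⊛ q
  q⁴ = q³ ⊛ q
  q⁵ = q⁴ ⊛ q

  private
    q-step : ∀ s {f} → mono s ≈ f → mono (s ℕ.+ 1) ≈ f ⊛ q
    q-step s h n = trans (mono-+ s 1 n) (⊛-cong {g = q} h (λ _ → refl) n)

  mono₂ : mono 2 ≈ q²
  mono₂ = q-step 1 (λ _ → refl)
  mono₃ : mono 3 ≈ q³
  mono₃ = q-step 2 mono₂
  mono₄ : mono 4 ≈ q⁴
  mono₄ = q-step 3 mono₃
  mono₅ : mono 5 ≈ q⁵
  mono₅ = q-step 4 mono₄

  dil-q₂ : dil 2 q ≈ q²
  dil-q₂ n = trans (dil-mono 2 1 n) (mono₂ n)
  dil-q₄ : dil 4 q ≈ q⁴
  dil-q₄ n = trans (dil-mono 4 1 n) (mono₄ n)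
  dil-q₅ : dil 5 q ≈ q⁵
  dil-q₅ n = trans (dil-mono 5 1 n) (mono₅ n)

  a b c d m n₅ o p p₅ s y₁ y₂ y₄ y₅ y₈ y₁₀ y₁₆ y₂₀ y₄₀ : PS
  a = φ₊
  b = dil 2 φ₊
  c = dil 5 φ₊
  d = dil 10 φ₊
  m = φ₋
  n₅ = dil 5 φ₋
  o = dil 10 φ₋
  p = dil 4 φ₊
  p₅ = dil 20 φ₊
  s = dil 8 φ₊
  y₁ = ψ
  y₂ = dil 2 ψ
  y₄ = dil 4 ψ
  y₅ = dil 5 ψ
  y₈ = dil 8 ψ
  y₁₀ = dil 10 ψ
  y₁₆ = dil 16 ψ
  y₂₀ = dil 20 ψ
  y₄₀ = dil 40 ψ

  -- η(4z)η(20z), η(2z)η(10z), η(z)η(5z), η(8z)η(40z) without the powers of q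
  e h k t : PS
  e = dil 4 euler ⊛ dil 20 euler
  h = dil 2 euler ⊛ dil 10 euler
  k = euler ⊛ dil 5 euler
  t = dil 8 euler ⊛ dil 40 euler

  S₂ S₄ R₂ : PS
  S₂ = dil 2 Rψ
  S₄ = dil 4 Rψ
  R₂ = dil 2 Rφ

  X Y g : PS
  X = ι (+ 4) ⊛ (q ⊛ (y₄ ⊛ y₄))
  Y = ι (+ 4) ⊛ (q⁵ ⊛ (y₂₀ ⊛ y₂₀))
  g = ι (+ 4) ⊛ (q³ ⊛ ((b ⊛ d) ⊛ (y₄ ⊛ y₂₀)))

  -- The odd parts of φ(q) and φ(q⁵), and the part of φ(q²) with exponents not divisible by 4.
  r r₅ τ : PS
  r = ι (+ 2) ⊛ (q ⊛ y₈)
  r₅ = ι (+ 2) ⊛ (q⁵ ⊛ y₄₀)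
  τ = ι (+ 2) ⊛ (q² ⊛ y₁₆)

  private
    refl≈ : ∀ {f} → f ≈ f
    refl≈ _ = refl

    ψ₂≈ : ψ₂ ≈ ι (+ 2) ⊛ ψ
    ψ₂≈ n = trans (ψ₂≈2θ n) (·≈ι (+ 2) ψ n)

    dil-ψ₂ : ∀ d .{{_ : NonZero d}} → dil d ψ₂ ≈ ι (+ 2) ⊛ dil d ψ
    dil-ψ₂ d n = trans (dil-cong d ψ₂≈ n) (dil-poly d (con (+ 2) :* v₀) {ρ = ψ ∷ []} (refl≈ ∷ []) n)

    shift₁ : ∀ {f g} → f ≈ g → shift 1 f ≈ q ⊛ g
    shift₁ {f} f≈g n = trans (shift≈mono 1 f n) (⊛-cong {f = q} refl≈ f≈g n)

    X≈ : shift 1 (dil 4 (ψ₂ ⊛ ψ₂)) ≈ X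
    X≈ n = trans (shift₁ (λ i → trans (dil-⊛ 4 ψ₂ ψ₂ i) (⊛-cong (dil-ψ₂ 4) (dil-ψ₂ 4) i)) n)
      (solve 2 (λ q y → q :* ((con (+ 2) :* y) :* (con (+ 2) :* y)) := con (+ 4) :* (q :* (y :* y))) refl≈ q y₄ n)

  φ₊² : a ⊛ a ≈ b ⊛ b +ₛ X
  φ₊² n = trans (φ-square Sign.+ n) (cong₂ _+_ (dil-⊛ 2 φ₊ φ₊ n) (trans (ℚP.*-identityˡ _) (X≈ n)))

  φ₋² : m ⊛ m ≈ b ⊛ b +ₛ (-ₛ X)
  φ₋² n = trans (φ-square Sign.- n) (cong₂ _+_ (dil-⊛ 2 φ₊ φ₊ n) (trans (sym (ℚP.neg-distribˡ-* 1ℚ (shift 1 (dil 4 (ψ₂ ⊛ ψ₂)) n)))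
      (cong -_ (trans (ℚP.*-identityˡ (shift 1 (dil 4 (ψ₂ ⊛ ψ₂)) n)) (X≈ n)))))

  φ₊²₅ : c ⊛ c ≈ d ⊛ d +ₛ Y
  φ₊²₅ = dil-identity 5 (v₀ :* v₀) (v₁ :* v₁ :+ con (+ 4) :* (v₂ :* (v₃ :* v₃)))
      {ρ = a ∷ b ∷ q ∷ y₄ ∷ []} (refl≈ ∷ dil-dil 5 2 φ₊ ∷ dil-q₅ ∷ dil-dil 5 4 ψ ∷ []) φ₊²

  φ₋²₅ : n₅ ⊛ n₅ ≈ d ⊛ d +ₛ (-ₛ Y)
  φ₋²₅ = dil-identity 5 (v₀ :* v₀) (v₁ :* v₁ :- con (+ 4) :* (v₂ :* (v₃ :* v₃)))
      {ρ = m ∷ b ∷ q ∷ y₄ ∷ []} (refl≈ ∷ dil-dil 5 2 φ₊ ∷ dil-q₅ ∷ dil-dil 5 4 ψ ∷ []) φ₋²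

  ψ²-dil : ∀ e .{{_ : NonZero e}} .{{_ : NonZero (e ℕ.* 2)}} → dil e ψ ⊛ dil e ψ ≈ dil e φ₊ ⊛ dil (e ℕ.* 2) ψ
  ψ²-dil e = dil-identity e (v₀ :* v₀) (v₁ :* v₂) {ρ = ψ ∷ φ₊ ∷ y₂ ∷ []} (refl≈ ∷ refl≈ ∷ dil-dil e 2 ψ ∷ []) ψ²

  y₂² : y₂ ⊛ y₂ ≈ b ⊛ y₄
  y₂² = ψ²-dil 2
  y₅² : y₅ ⊛ y₅ ≈ c ⊛ y₁₀
  y₅² = ψ²-dil 5
  y₁₀² : y₁₀ ⊛ y₁₀ ≈ d ⊛ y₂₀
  y₁₀² = ψ²-dil 10

  a²-c² : a ⊛ a +ₛ (-ₛ (c ⊛ c)) ≈ ι (+ 4) ⊛ (q ⊛ Rφ)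
  a²-c² n = trans (cong (_+ - (c ⊛ c) n) (φ²-5-dissection n)) (trans (cong₂ (λ x y → x + y + - (c ⊛ c) n) (dil-⊛ 5 φ₊ φ₊ n)
    (trans (·≈ι (+ 4) (shift 1 Rφ) n) (⊛-cong {f = ι (+ 4)} refl≈ (shift₁ {Rφ} refl≈) n)))
    (solve 2 (λ c x → c :+ x :- c := x) refl≈ (c ⊛ c) (ι (+ 4) ⊛ (q ⊛ Rφ)) n))

  b²-d² : b ⊛ b +ₛ (-ₛ (d ⊛ d)) ≈ ι (+ 4) ⊛ (q² ⊛ R₂)
  b²-d² = dil-identity 2 (v₀ :* v₀ :- v₁ :* v₁) (con (+ 4) :* (v₂ :* v₃)) {ρ = a ∷ c ∷ q ∷ Rφ ∷ []} (refl≈ ∷ dil-dil 2 5 φ₊ ∷ dil-q₂ ∷ refl≈ ∷ [])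
      a²-c²

  -- The dissection is available for ψ₂ = 2ψ, hence four times the claim, and 4 is cancelled.
  y₁²-y₅² : y₁ ⊛ y₁ +ₛ (-ₛ (q ⊛ (y₅ ⊛ y₅))) ≈ Rψ
  y₁²-y₅² = regular-cancel (regular-ι (+ 4) λ ()) (y₁ ⊛ y₁ +ₛ (-ₛ (q ⊛ (y₅ ⊛ y₅)))) Rψ λ n → begin
    (ι (+ 4) ⊛ (y₁ ⊛ y₁ +ₛ (-ₛ (q ⊛ (y₅ ⊛ y₅))))) n
      ≡⟨ solve 3 (λ y q z → con (+ 4) :* (y :* y :- q :* (z :* z)) :=
          (con (+ 2) :* y) :* (con (+ 2) :* y) :- q :* ((con (+ 2) :* z) :* (con (+ 2) :* z))) refl≈ y₁ q y₅ n ⟩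
    ((ι (+ 2) ⊛ y₁) ⊛ (ι (+ 2) ⊛ y₁)) n + - (q ⊛ ((ι (+ 2) ⊛ y₅) ⊛ (ι (+ 2) ⊛ y₅))) n
      ≡⟨ cong₂ (λ x y → x + - y) (sym (⊛-cong ψ₂≈ ψ₂≈ n)) (sym (shift₁ (λ i → trans (dil-⊛ 5 ψ₂ ψ₂ i) (⊛-cong (dil-ψ₂ 5) (dil-ψ₂ 5) i)) n)) ⟩
    (ψ₂ ⊛ ψ₂) n + - shift 1 (dil 5 (ψ₂ ⊛ ψ₂)) n
      ≡⟨ cong (_+ - shift 1 (dil 5 (ψ₂ ⊛ ψ₂)) n) (ψ²-5-dissection n) ⟩
    shift 1 (dil 5 (ψ₂ ⊛ ψ₂)) n + fromℤ (+ 4) * Rψ n + - shift 1 (dil 5 (ψ₂ ⊛ ψ₂)) n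
      ≡⟨ cancel (shift 1 (dil 5 (ψ₂ ⊛ ψ₂)) n) (fromℤ (+ 4) * Rψ n) ⟩
    fromℤ (+ 4) * Rψ n
      ≡⟨ ·≈ι (+ 4) Rψ n ⟩
    (ι (+ 4) ⊛ Rψ) n ∎
    where
    open ≡-Reasoning
    cancel : ∀ x y → x + y + - x ≡ y
    cancel = ℚS.solve 2 (λ x y → x ℚS.:+ y ℚS.:+ (ℚS.:- x) ℚS.:= y) refl

  y₂²-y₁₀² : y₂ ⊛ y₂ +ₛ (-ₛ (q² ⊛ (y₁₀ ⊛ y₁₀))) ≈ S₂
  y₂²-y₁₀² = dil-identity 2 (v₀ :* v₀ :- v₁ :* (v₂ :* v₂)) v₃ {ρ = y₁ ∷ q ∷ y₅ ∷ Rψ ∷ []} (refl≈ ∷ dil-q₂ ∷ dil-dil 2 5 ψ ∷ refl≈ ∷ []) y₁²-y₅²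

  y₄²-y₂₀² : y₄ ⊛ y₄ +ₛ (-ₛ (q⁴ ⊛ (y₂₀ ⊛ y₂₀))) ≈ S₄
  y₄²-y₂₀² = dil-identity 4 (v₀ :* v₀ :- v₁ :* (v₂ :* v₂)) v₃ {ρ = y₁ ∷ q ∷ y₅ ∷ Rψ ∷ []} (refl≈ ∷ dil-q₄ ∷ dil-dil 4 5 ψ ∷ refl≈ ∷ []) y₁²-y₅²

  R₂S₄ : R₂ ⊛ S₄ ≈ (y₁₀ ⊛ y₁₀) ⊛ S₂
  R₂S₄ = dil-identity 2 (v₀ :* v₁) ((v₂ :* v₂) :* v₃) {ρ = Rφ ∷ S₂ ∷ y₅ ∷ Rψ ∷ []} (refl≈ ∷ dil-dil 2 2 Rψ ∷ dil-dil 2 5 ψ ∷ refl≈ ∷ []) Rφ-Rψ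

  k≈ : k ≈ y₂ ⊛ c +ₛ (-ₛ (q ⊛ (a ⊛ y₁₀)))
  k≈ = regular-cancel (regular-ι (+ 2) λ ()) k (y₂ ⊛ c +ₛ (-ₛ (q ⊛ (a ⊛ y₁₀)))) λ n → begin
    (ι (+ 2) ⊛ k) n
      ≡⟨ sym (·≈ι (+ 2) k n) ⟩
    fromℤ (+ 2) * k n
      ≡⟨ Level5.η₁η₅ n ⟩
    (dil 2 ψ₂ ⊛ c) n + - 1ℚ * shift 1 (a ⊛ dil 10 ψ₂) n
      ≡⟨ cong₂ _+_ (⊛-cong {g = c} (dil-ψ₂ 2) refl≈ n) (trans (·≈ι (ℤ.- + 1) (shift 1 (a ⊛ dil 10 ψ₂)) n)
          (⊛-cong {f = ι (ℤ.- + 1)} refl≈ (shift₁ (⊛-cong {f = a} refl≈ (dil-ψ₂ 10))) n)) ⟩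
    ((ι (+ 2) ⊛ y₂) ⊛ c) n + (ι (ℤ.- + 1) ⊛ (q ⊛ (a ⊛ (ι (+ 2) ⊛ y₁₀)))) n
      ≡⟨ solve 5 (λ y c q a z → (con (+ 2) :* y) :* c :+ con (ℤ.- + 1) :* (q :* (a :* (con (+ 2) :* z))) := con (+ 2) :* (y :* c :- q :* (a :* z)))
          refl≈ y₂ c q a y₁₀ n ⟩
    (ι (+ 2) ⊛ (y₂ ⊛ c +ₛ (-ₛ (q ⊛ (a ⊛ y₁₀))))) n ∎
    where open ≡-Reasoning

  dil-η : ∀ e f .{{_ : NonZero e}} .{{_ : NonZero f}} .{{_ : NonZero (e ℕ.* f)}} → dil e (euler ⊛ dil f euler) ≈ dil e euler ⊛ dil (e ℕ.* f) euler
  dil-η e f = dil-poly e (v₀ :* v₁) {ρ = euler ∷ dil f euler ∷ []} (refl≈ ∷ dil-dil e f euler ∷ [])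

  h≈ : h ≈ y₄ ⊛ d +ₛ (-ₛ (q² ⊛ (b ⊛ y₂₀)))
  h≈ = dil-identity 2 v₀ (v₁ :* v₂ :- v₃ :* (v₄ :* v₅)) {ρ = k ∷ y₂ ∷ c ∷ q ∷ a ∷ y₁₀ ∷ []}
      (dil-η 2 5 ∷ dil-dil 2 2 ψ ∷ dil-dil 2 5 φ₊ ∷ dil-q₂ ∷ refl≈ ∷ dil-dil 2 10 ψ ∷ []) k≈

  e≈ : e ≈ y₈ ⊛ p₅ +ₛ (-ₛ (q⁴ ⊛ (p ⊛ y₄₀)))
  e≈ = dil-identity 4 v₀ (v₁ :* v₂ :- v₃ :* (v₄ :* v₅)) {ρ = k ∷ y₂ ∷ c ∷ q ∷ a ∷ y₁₀ ∷ []}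
      (dil-η 4 5 ∷ dil-dil 4 2 ψ ∷ dil-dil 4 5 φ₊ ∷ dil-q₄ ∷ refl≈ ∷ dil-dil 4 10 ψ ∷ []) k≈

  private
    r≈ : shift 1 (dil 8 ψ₂) ≈ r
    r≈ n = trans (shift₁ (dil-ψ₂ 8) n) (solve 2 (λ q y → q :* (con (+ 2) :* y) := con (+ 2) :* (q :* y)) refl≈ q y₈ n)

  a≈ : a ≈ p +ₛ r
  a≈ n = trans (φ-dissection Sign.+ n) (cong (λ z → p n + z) (trans (ℚP.*-identityˡ _) (r≈ n)))

  m≈ : m ≈ p +ₛ (-ₛ r)
  m≈ n = trans (φ-dissection Sign.- n) (cong (λ z → p n + z) (trans (sym (ℚP.neg-distribˡ-* 1ℚ (shift 1 (dil 8 ψ₂) n)))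
      (cong -_ (trans (ℚP.*-identityˡ (shift 1 (dil 8 ψ₂) n)) (r≈ n)))))

  c≈ : c ≈ p₅ +ₛ r₅
  c≈ = dil-identity 5 v₀ (v₁ :+ con (+ 2) :* (v₂ :* v₃)) {ρ = a ∷ p ∷ q ∷ y₈ ∷ []} (refl≈ ∷ dil-dil 5 4 φ₊ ∷ dil-q₅ ∷ dil-dil 5 8 ψ ∷ []) a≈

  n₅≈ : n₅ ≈ p₅ +ₛ (-ₛ r₅)
  n₅≈ = dil-identity 5 v₀ (v₁ :- con (+ 2) :* (v₂ :* v₃)) {ρ = m ∷ p ∷ q ∷ y₈ ∷ []} (refl≈ ∷ dil-dil 5 4 φ₊ ∷ dil-q₅ ∷ dil-dil 5 8 ψ ∷ []) m≈

  b≈ : b ≈ s +ₛ τ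
  b≈ = dil-identity 2 v₀ (v₁ :+ con (+ 2) :* (v₂ :* v₃)) {ρ = a ∷ p ∷ q ∷ y₈ ∷ []} (refl≈ ∷ dil-dil 2 4 φ₊ ∷ dil-q₂ ∷ dil-dil 2 8 ψ ∷ []) a≈

  p² : p ⊛ p ≈ s ⊛ s +ₛ τ ⊛ τ
  p² n = trans (dil-identity 4 (v₀ :* v₀) (v₁ :* v₁ :+ con (+ 4) :* (v₂ :* (v₃ :* v₃)))
      {ρ = a ∷ b ∷ q ∷ y₄ ∷ []} (refl≈ ∷ dil-dil 4 2 φ₊ ∷ dil-q₄ ∷ dil-dil 4 4 ψ ∷ []) φ₊² n)
    (solve 3 (λ s q y → s :* s :+ con (+ 4) :* (q :* q :* q :* q :* (y :* y)) :=
        s :* s :+ (con (+ 2) :* (q :* q :* y)) :* (con (+ 2) :* (q :* q :* y))) refl≈ s q y₁₆ n)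

  r² : r ⊛ r ≈ ι (+ 2) ⊛ (s ⊛ τ)
  r² n = trans (solve 2 (λ q y → (con (+ 2) :* (q :* y)) :* (con (+ 2) :* (q :* y)) := con (+ 4) :* (q :* q :* (y :* y))) refl≈ q y₈ n)
    (trans (⊛-cong {f = ι (+ 4)} refl≈ (⊛-cong {f = q²} refl≈ (ψ²-dil 8)) n)
      (solve 3 (λ q s y → con (+ 4) :* (q :* q :* (s :* y)) := con (+ 2) :* (s :* (con (+ 2) :* (q :* q :* y)))) refl≈ q s y₁₆ n))

  -- Comparing φ(q)² - φ(-q)² with the splitting φ(± q) = p ± r expresses X through series at q⁴ and
  -- q⁸, as needed when the quintic relation is used at q².
  X≈2pr : X ≈ ι (+ 2) ⊛ (p ⊛ r)
  X≈2pr = regular-cancel (regular-ι (+ 2) λ ()) X (ι (+ 2) ⊛ (p ⊛ r)) (odd-part (b ⊛ b) X a m p r a≈ m≈ φ₊² φ₋²)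

  Y≈2pr : Y ≈ ι (+ 2) ⊛ (p₅ ⊛ r₅)
  Y≈2pr = regular-cancel (regular-ι (+ 2) λ ()) Y (ι (+ 2) ⊛ (p₅ ⊛ r₅)) (odd-part (d ⊛ d) Y c n₅ p₅ r₅ c≈ n₅≈ φ₊²₅ φ₋²₅)

open ThetaConstants

-- Eisenstein series and eta quotients through theta series

module ThetaExpansions where

  open import Data.Nat.Divisibility using (divides)
  open import Data.List using (_++_)
  open import Data.Vec using ([]; _∷_)
  open import Data.Vec.Relation.Binary.Pointwise.Inductive using ([]; _∷_)
  open import Data.Rational using (_+_; _*_; -_)

  open Alg PS-ring ι-morphism hiding (κ)
  open PSSolver using (var; con; _:+_; _:*_; _:-_; :-_; _:=_; solve)
  open LogDeriv

  private
    refl≈ : ∀ {f} → f ≈ f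
    refl≈ _ = refl

    infixr 4 _⨾_
    _⨾_ : ∀ {f g h} → f ≈ g → g ≈ h → f ≈ h
    (p ⨾ p′) n = trans (p n) (p′ n)

    eta-head : ∀ {f L} → Eta f L → f 0 ≡ 1ℚ
    eta-head x = head≡1 (isLogDeriv (spec x))

    eta-regular : ∀ {f L} → Eta f L → Regular f
    eta-regular {f} x = regular-unit f (eta-head x)

  regular-≈ : ∀ {u v} → u ≈ v → Regular u → Regular v
  regular-≈ {u} {v} u≈v reg = regular λ f vf≈0 → nonZeroDivisor f (⊛-cong {g = f} u≈v refl≈ ⨾ vf≈0)
    where open Regular reg

  private
    A B : PS
    A = θ Sign.- 7 1
    B = θ Sign.- 5 3

    specA = thetaSpec Sign.- 7 1
    specB = thetaSpec Sign.- 5 3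

    Θθ : ∀ {f l} → HasSpec f l → Θ f ≈ -ₛ (Λ l ⊛ f)
    Θθ x = ode (isLogDeriv x)

    -- The product for `A` runs over m ≡ 0, ± 1 and that for `B` over m ≡ 0, ± 3 modulo 8, so their
    -- exponents differ by χ₂(m).
    ΛA≈ : Λ specA ≈ Λ specB +ₛ Λ χSpec
    ΛA≈ = Λ-cong specA (specB ++ χSpec) (spec-≡ 8 specA (specB ++ χSpec)) ⨾ Λ-++ specB χSpec

    1-2Λ : PS
    1-2Λ = ι (+ 1) +ₛ (-ₛ (ι (+ 2) ⊛ Λ χSpec))

    -- The two evaluations of the Wronskian are equated and `A B`, which has constant coefficient 1,
    -- is cancelled.
    1-2Λ≈ : 1-2Λ ≈ (m ⊛ m) ⊛ (a ⊛ b)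
    1-2Λ≈ = regular-cancel (eta-regular AB-eta) 1-2Λ ((m ⊛ m) ⊛ (a ⊛ b))
      ((λ n → sym (wronskian-lambert A B (Λ specA) (Λ specB) (Λ χSpec) (Θ A) (Θ B) (Θθ (tripleProduct Sign.- 7 1)) (Θθ (tripleProduct Sign.- 5 3))
          ΛA≈ n))
      ⨾ (λ n → cong (λ z → (A ⊛ B) n + z) (cong₂ _+_ (sym (·≈ι (+ 2) (Θ A ⊛ B) n))
          (trans (cong -_ (sym (·≈ι (+ 2) (A ⊛ Θ B) n))) (ℚP.neg-distribˡ-* (fromℤ (+ 2)) ((A ⊛ Θ B) n)))))
      ⨾ Wronskian.wronskian
      ⨾ ⊛-cong cube (dil-cong 4 cube ⨾ dil-poly 4 (var (# 0) :* (var (# 0) :* var (# 0))) {ρ = euler ∷ []} (refl≈ ∷ []))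
      ⨾ λ n → sym (AB-φ n))
      where
      cube : gf Fcube ≈ euler ⊛ (euler ⊛ euler)
      cube = euler³ (spec η-eta₁)

  E₀₂-theta : ι (+ 2) ⊛ E₀₂ ≈ -ₛ ((m ⊛ m) ⊛ (a ⊛ b))
  E₀₂-theta n = begin
    (ι (+ 2) ⊛ E₀₂) n                                                   ≡⟨ sym (·≈ι (+ 2) E₀₂ n) ⟩
    fromℤ (+ 2) * E₀₂ n                                                 ≡⟨ cong (fromℤ (+ 2) *_) (E₀₂≈ n) ⟩
    fromℤ (+ 2) * (- (+ 1 ℚ./ 2) * oneₛ n + Λ χSpec n)                  ≡⟨ double (oneₛ n) (Λ χSpec n) ⟩
    - (fromℤ (+ 1) * oneₛ n + - (fromℤ (+ 2) * Λ χSpec n))              ≡⟨ cong (λ z → - (fromℤ (+ 1) * oneₛ n + - z)) (·≈ι (+ 2) (Λ χSpec) n) ⟩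
    - 1-2Λ n                                                            ≡⟨ cong -_ (1-2Λ≈ n) ⟩
    - ((m ⊛ m) ⊛ (a ⊛ b)) n                                             ∎
    where
    open ≡-Reasoning
    double : ∀ x y → fromℤ (+ 2) * (- (+ 1 ℚ./ 2) * x + y) ≡ - (fromℤ (+ 1) * x + - (fromℤ (+ 2) * y))
    double = ℚS.solve 2 (λ x y → ℚS.con (fromℤ (+ 2)) ℚS.:* (ℚS.con (- (+ 1 ℚ./ 2)) ℚS.:* x ℚS.:+ y) ℚS.:=
        ℚS.:- (ℚS.con (fromℤ (+ 1)) ℚS.:* x ℚS.:+ (ℚS.:- (ℚS.con (fromℤ (+ 2)) ℚS.:* y)))) refl

  private
    supp-ι : ∀ {M} .{{_ : NonZero M}} z → Supp M 0 (ι z)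
    supp-ι {M} z = supp λ n n≢0 → trans (cong (fromℤ z *_) (Supp.off (supp-mono {M} 0) n n≢0)) (ℚP.*-zeroʳ (fromℤ z))

    supp-r : Supp 8 1 r
    supp-r = supp-⊛ (supp-ι (+ 2)) (supp-⊛ (supp-mono 1) (supp-dil 8 ψ (divides 1 refl)))
    supp-s : Supp 8 0 s
    supp-s = supp-dil 8 φ₊ (divides 1 refl)
    supp-τ : Supp 8 2 τ
    supp-τ = supp-⊛ (supp-ι (+ 2)) (supp-⊛ (supp-⊛ (supp-mono 1) (supp-mono 1)) (supp-dil 16 ψ (divides 2 refl)))

    even-s : Supp 2 0 s
    even-s = supp-dil 8 φ₊ (divides 4 refl)
    even-τ : Supp 2 0 τ
    even-τ = supp λ n n≢0 → Supp.off (supp-⊛ (supp-ι {2} (+ 2)) (supp-⊛ (supp-⊛ (supp-mono {2} 1) (supp-mono {2} 1))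
        (supp-dil {2} 16 ψ (divides 8 refl)))) n n≢0
    even-p : Supp 2 0 p
    even-p = supp-dil 4 φ₊ (divides 2 refl)

    supp-+ : ∀ {M j} .{{_ : NonZero M}} {f g} → Supp M j f → Supp M j g → Supp M j (f +ₛ g)
    supp-+ (supp sf) (supp sg) = supp λ n n≢ → cong₂ _+_ (sf n n≢) (sg n n≢)

    supp-neg : ∀ {M j} .{{_ : NonZero M}} {f} → Supp M j f → Supp M j (-ₛ f)
    supp-neg (supp sf) = supp λ n n≢ → cong -_ (sf n n≢)

    twist-neg : ∀ f → twist (-ₛ f) ≈ -ₛ twist f
    twist-neg f n = sym (ℚP.neg-distribʳ-* (χ₂ n) (f n))

    even-part s³ s²τ sτ² τ³ : PS
    even-part = p ⊛ ((s +ₛ (-ₛ τ)) ⊛ (s +ₛ (-ₛ τ)) ⊛ (s +ₛ τ))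
    s³ = r ⊛ (s ⊛ (s ⊛ s))
    s²τ = r ⊛ (s ⊛ (s ⊛ τ))
    sτ² = r ⊛ (s ⊛ (τ ⊛ τ))
    τ³ = r ⊛ (τ ⊛ (τ ⊛ τ))

    expansion : (m ⊛ m) ⊛ (a ⊛ b) ≈ even-part +ₛ (-ₛ s³) +ₛ s²τ +ₛ sτ² +ₛ (-ₛ τ³)
    expansion = eisenstein-expand a b m p r s τ a≈ m≈ b≈ p² r²

    -- The signs of the classes 1, 3, 5, 7 in the expansion are -, +, +, -, exactly opposite to χ₂;
    -- the twist makes all of them negative and kills the even part.
    twist-expansion : twist ((m ⊛ m) ⊛ (a ⊛ b)) ≈ -ₛ (r ⊛ b ⊛ (p ⊛ p))
    twist-expansion n = begin
      twist ((m ⊛ m) ⊛ (a ⊛ b)) n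
        ≡⟨ cong (χ₂ n *_) (expansion n) ⟩
      χ₂ n * (even-part n + - s³ n + s²τ n + sτ² n + - τ³ n)
        ≡⟨ distrib (χ₂ n) (even-part n) (s³ n) (s²τ n) (sτ² n) (τ³ n) ⟩
      twist even-part n + - twist s³ n + twist s²τ n + twist sτ² n + - twist τ³ n
        ≡⟨ cong₂ _+_ (cong₂ _+_ (cong₂ _+_ (cong₂ _+_ (twist-even even n)
            (cong -_ (twist-class 1 (supp-⊛ supp-r (supp-⊛ supp-s (supp-⊛ supp-s supp-s))) n)))
             (twist-class 3 (supp-⊛ supp-r (supp-⊛ supp-s (supp-⊛ supp-s supp-τ))) n))
                 (twist-class 5 (supp-⊛ supp-r (supp-⊛ supp-s (supp-⊛ supp-τ supp-τ))) n))
             (cong -_ (twist-class 7 (supp-⊛ supp-r (supp-⊛ supp-τ (supp-⊛ supp-τ supp-τ))) n)) ⟩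
      0ℚ + - (1ℚ * s³ n) + - 1ℚ * s²τ n + - 1ℚ * sτ² n + - (1ℚ * τ³ n)
        ≡⟨ collect (s³ n) (s²τ n) (sτ² n) (τ³ n) ⟩
      - (s³ n + s²τ n + sτ² n + τ³ n)
        ≡⟨ cong -_ (twisted-sum b p r s τ b≈ p² n) ⟩
      - (r ⊛ b ⊛ (p ⊛ p)) n ∎
      where
      open ≡-Reasoning
      even : Supp 2 0 even-part
      even = supp-⊛ even-p (supp-⊛ (supp-⊛ (supp-+ even-s (supp-neg even-τ)) (supp-+ even-s (supp-neg even-τ))) (supp-+ even-s even-τ))
      distrib : ∀ x e u v w z → x * (e + - u + v + w + - z) ≡ x * e + - (x * u) + x * v + x * w + - (x * z)
      distrib = ℚS.solve 6 (λ x e u v w z → x ℚS.:* (e ℚS.:+ (ℚS.:- u) ℚS.:+ v ℚS.:+ w ℚS.:+ (ℚS.:- z)) ℚS.:=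
          x ℚS.:* e ℚS.:+ (ℚS.:- (x ℚS.:* u)) ℚS.:+ x ℚS.:* v ℚS.:+ x ℚS.:* w ℚS.:+ (ℚS.:- (x ℚS.:* z))) refl
      collect : ∀ u v w z → 0ℚ + - (1ℚ * u) + - 1ℚ * v + - 1ℚ * w + - (1ℚ * z) ≡ - (u + v + w + z)
      collect = ℚS.solve 4 (λ u v w z → ℚS.con 0ℚ ℚS.:+ (ℚS.:- (ℚS.con 1ℚ ℚS.:* u)) ℚS.:+ ℚS.con (- 1ℚ) ℚS.:* v ℚS.:+ ℚS.con (- 1ℚ) ℚS.:* w
          ℚS.:+ (ℚS.:- (ℚS.con 1ℚ ℚS.:* z)) ℚS.:= ℚS.:- (u ℚS.:+ v ℚS.:+ w ℚS.:+ z)) refl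

    twist-E₀₂ : ∀ n → twist E₀₂ n ≡ ½ * (r ⊛ b ⊛ (p ⊛ p)) n
    twist-E₀₂ n = begin
      χ₂ n * E₀₂ n                              ≡⟨ halve (χ₂ n) (E₀₂ n) ⟩
      ½ * (χ₂ n * (fromℤ (+ 2) * E₀₂ n))        ≡⟨ cong (λ z → ½ * (χ₂ n * z)) (trans (·≈ι (+ 2) E₀₂ n) (E₀₂-theta n)) ⟩
      ½ * (χ₂ n * - ((m ⊛ m) ⊛ (a ⊛ b)) n)      ≡⟨ cong (½ *_) (trans (twist-neg ((m ⊛ m) ⊛ (a ⊛ b)) n) (cong -_ (twist-expansion n))) ⟩
      ½ * - - (r ⊛ b ⊛ (p ⊛ p)) n               ≡⟨ undo ((r ⊛ b ⊛ (p ⊛ p)) n) ⟩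
      ½ * (r ⊛ b ⊛ (p ⊛ p)) n                   ∎
      where
      open ≡-Reasoning
      halve : ∀ x y → x * y ≡ ½ * (x * (fromℤ (+ 2) * y))
      halve = ℚS.solve 2 (λ x y → x ℚS.:* y ℚS.:= ℚS.con ½ ℚS.:* (x ℚS.:* (ℚS.con (fromℤ (+ 2)) ℚS.:* y))) refl
      undo : ∀ x → ½ * - - x ≡ ½ * x
      undo = ℚS.solve 1 (λ x → ℚS.con ½ ℚS.:* (ℚS.:- (ℚS.:- x)) ℚS.:= ℚS.con ½ ℚS.:* x) refl

  -- Both sides satisfy F(q) = 2 r b p² + 2 F(q²), so the difference satisfies the homogeneous
  -- equation and has constant coefficient 0.
  E₂₀-theta : ∀ n → fromℤ (+ 4) * E₂₀ n ≡ (a ⊛ b ⊛ X) n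
  E₂₀-theta n = difference-zero (dil-fixed (fromℤ (+ 2)) δ fixed refl n)
    where
    δ : PS
    δ = fromℤ (+ 4) ·ₛ E₂₀ +ₛ (-ₛ (a ⊛ b ⊛ X))
    dil-X : dil 2 X ≈ r ⊛ r
    dil-X n = trans (dil-poly 2 (con (+ 4) :* (var (# 0) :* (var (# 1) :* var (# 1)))) {ρ = q ∷ y₄ ∷ []} (dil-q₂ ∷ dil-dil 2 4 ψ ∷ []) n)
      (solve 2 (λ q y → con (+ 4) :* ((q :* q) :* (y :* y)) := (con (+ 2) :* (q :* y)) :* (con (+ 2) :* (q :* y))) refl≈ q y₈ n)
    dil-abX : dil 2 (a ⊛ b ⊛ X) ≈ b ⊛ p ⊛ (r ⊛ r)
    dil-abX = dil-poly 2 (var (# 0) :* var (# 1) :* var (# 2)) {ρ = a ∷ b ∷ X ∷ []} (refl≈ ∷ dil-dil 2 2 φ₊ ∷ dil-X ∷ [])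
    fixed : δ ≈ fromℤ (+ 2) ·ₛ dil 2 δ
    fixed n = begin
      fromℤ (+ 4) * E₂₀ n + - (a ⊛ b ⊛ X) n
        ≡⟨ cong₂ (λ x y → fromℤ (+ 4) * x + - y) (trans (E₂₀-recursion n) (cong (_+ fromℤ (+ 2) * dil 2 E₂₀ n) (twist-E₀₂ n)))
             (trans (cross-product X a b p r a≈ X≈2pr n) (cong₂ _+_ (sym (·≈ι (+ 2) (r ⊛ b ⊛ (p ⊛ p)) n)) (sym (·≈ι (+ 2) (b ⊛ p ⊛ (r ⊛ r)) n)))) ⟩
      fromℤ (+ 4) * (½ * (r ⊛ b ⊛ (p ⊛ p)) n + fromℤ (+ 2) * dil 2 E₂₀ n) + - (fromℤ (+ 2) * (r ⊛ b ⊛ (p ⊛ p)) n + fromℤ (+ 2) * (b ⊛ p ⊛ (r ⊛ r)) n)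
        ≡⟨ combine ((r ⊛ b ⊛ (p ⊛ p)) n) (dil 2 E₂₀ n) ((b ⊛ p ⊛ (r ⊛ r)) n) ⟩
      fromℤ (+ 2) * (fromℤ (+ 4) * dil 2 E₂₀ n + - (b ⊛ p ⊛ (r ⊛ r)) n)
        ≡⟨ cong (fromℤ (+ 2) *_) (sym (trans (dil-+ 2 (fromℤ (+ 4) ·ₛ E₂₀) (-ₛ (a ⊛ b ⊛ X)) n)
            (cong₂ _+_ (dil-· 2 (fromℤ (+ 4)) E₂₀ n) (trans (dil-neg 2 (a ⊛ b ⊛ X) n) (cong -_ (dil-abX n)))))) ⟩
      fromℤ (+ 2) * dil 2 δ n ∎
      where
      open ≡-Reasoning
      combine : ∀ x y z → fromℤ (+ 4) * (½ * x + fromℤ (+ 2) * y) + - (fromℤ (+ 2) * x + fromℤ (+ 2) * z) ≡ fromℤ (+ 2) * (fromℤ (+ 4) * y + - z)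
      combine = ℚS.solve 3 (λ x y z → ℚS.con (fromℤ (+ 4)) ℚS.:* (ℚS.con ½ ℚS.:* x ℚS.:+ ℚS.con (fromℤ (+ 2)) ℚS.:* y)
          ℚS.:+ (ℚS.:- (ℚS.con (fromℤ (+ 2)) ℚS.:* x ℚS.:+ ℚS.con (fromℤ (+ 2)) ℚS.:* z)) ℚS.:=
          ℚS.con (fromℤ (+ 2)) ℚS.:* (ℚS.con (fromℤ (+ 4)) ℚS.:* y ℚS.:+ (ℚS.:- z))) refl
    difference-zero : ∀ {x y} → x + - y ≡ 0ℚ → x ≡ y
    difference-zero {x} {y} eq = trans (sym (restore x y)) (trans (cong (_+ y) eq) (ℚP.+-identityˡ y))
      where
      restore : ∀ x y → x + - y + y ≡ x
      restore = ℚS.solve 2 (λ x y → x ℚS.:+ (ℚS.:- y) ℚS.:+ y ℚS.:= x) refl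

  quintic : (b ⊛ b +ₛ (-ₛ (d ⊛ d))) ⊛ (X +ₛ (-ₛ Y)) ≈ ι (+ 4) ⊛ g +ₛ (-ₛ (ι (+ 4) ⊛ (d ⊛ d ⊛ Y)))
  quintic = quintic-product R₂ S₂ S₄ X Y b d g q y₁₀ y₂ y₂₀ y₄ b²-d² y₄²-y₂₀² R₂S₄ y₂²-y₁₀² y₂² y₁₀² refl≈ refl≈ refl≈

  4qe : ι (+ 4) ⊛ (q ⊛ e) ≈ a ⊛ n₅ +ₛ (-ₛ (c ⊛ m))
  4qe = difference-eta a c e p₅ m n₅ p q y₄₀ y₈ a≈ m≈ c≈ n₅≈ e≈

  -- 16 η²(4z) η²(20z)
  U : PS
  U = ι (+ 4) ⊛ (q ⊛ e) ⊛ (ι (+ 4) ⊛ (q ⊛ e))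

  U≈ : U ≈ (X +ₛ (-ₛ Y)) ⊛ (X +ₛ (-ₛ (ι (+ 5) ⊛ Y)))
  U≈ = eta-square X Y a c e p₅ m n₅ p q r r₅ 4qe a≈ m≈ c≈ n₅≈ X≈2pr Y≈2pr quintic₂
    where
    dil-X : dil 2 X ≈ r ⊛ r
    dil-X n = trans (dil-poly 2 (con (+ 4) :* (var (# 0) :* (var (# 1) :* var (# 1)))) {ρ = q ∷ y₄ ∷ []} (dil-q₂ ∷ dil-dil 2 4 ψ ∷ []) n)
      (solve 2 (λ q y → con (+ 4) :* ((q :* q) :* (y :* y)) := (con (+ 2) :* (q :* y)) :* (con (+ 2) :* (q :* y))) refl≈ q y₈ n)
    dil-Y : dil 2 Y ≈ r₅ ⊛ r₅
    dil-Y n = trans (dil-poly 2 (con (+ 4) :* (v :* v :* v :* v :* v :* (var (# 1) :* var (# 1)))) {ρ = q ∷ y₂₀ ∷ []} (dil-q₂ ∷ dil-dil 2 20 ψ ∷ [])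
        n)
      (solve 2 (λ q y → con (+ 4) :* (q :* q :* (q :* q) :* (q :* q) :* (q :* q) :* (q :* q) :* (y :* y))
        := (con (+ 2) :* (q :* q :* q :* q :* q :* y)) :* (con (+ 2) :* (q :* q :* q :* q :* q :* y))) refl≈ q y₄₀ n)
      where v = var (# 0)
    dil-g : dil 2 g ≈ (p ⊛ p₅) ⊛ (r ⊛ r₅)
    dil-g n = trans (dil-poly 2 (con (+ 4) :* (v :* v :* v :* ((var (# 1) :* var (# 2)) :* (var (# 3) :* var (# 4))))) {ρ = q ∷ b ∷ d ∷ y₄ ∷ y₂₀ ∷ []}
        (dil-q₂ ∷ dil-dil 2 2 φ₊ ∷ dil-dil 2 10 φ₊ ∷ dil-dil 2 4 ψ ∷ dil-dil 2 20 ψ ∷ []) n)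
      (solve 5 (λ q p p₅ y z → con (+ 4) :* (q :* q :* (q :* q) :* (q :* q) :* ((p :* p₅) :* (y :* z)))
        := (p :* p₅) :* ((con (+ 2) :* (q :* y)) :* (con (+ 2) :* (q :* q :* q :* q :* q :* z)))) refl≈ q p p₅ y₈ y₄₀ n)
      where v = var (# 0)
    quintic₂ : (p ⊛ p +ₛ (-ₛ (p₅ ⊛ p₅))) ⊛ (r ⊛ r +ₛ (-ₛ (r₅ ⊛ r₅))) ≈ ι (+ 4) ⊛ ((p ⊛ p₅) ⊛ (r ⊛ r₅)) +ₛ (-ₛ (ι (+ 4) ⊛ (p₅ ⊛ p₅ ⊛ (r₅ ⊛ r₅))))
    quintic₂ = dil-identity 2 ((v₀ :* v₀ :- v₁ :* v₁) :* (v₂ :- v₃)) (con (+ 4) :* var (# 4) :- con (+ 4) :* (v₁ :* v₁ :* v₃))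
      {ρ = b ∷ d ∷ X ∷ Y ∷ g ∷ []} (dil-dil 2 2 φ₊ ∷ dil-dil 2 10 φ₊ ∷ dil-X ∷ dil-Y ∷ dil-g ∷ []) quintic
      where
      v₀ = var (# 0)
      v₁ = var (# 1)
      v₂ = var (# 2)
      v₃ = var (# 3)

  -- (φ²(q) − φ²(q⁵))(5φ²(q⁵) − φ²(q)) = 16 η²(2z) η²(10z): the difference is invariant under q ↦ q².
  Ψ Ψ₂ : PS
  Ψ = (a ⊛ a +ₛ (-ₛ (c ⊛ c))) ⊛ (ι (+ 5) ⊛ (c ⊛ c) +ₛ (-ₛ (a ⊛ a))) +ₛ (-ₛ (ι (+ 16) ⊛ (q ⊛ (h ⊛ h))))
  Ψ₂ = (b ⊛ b +ₛ (-ₛ (d ⊛ d))) ⊛ (ι (+ 5) ⊛ (d ⊛ d) +ₛ (-ₛ (b ⊛ b))) +ₛ (-ₛ (ι (+ 16) ⊛ (q² ⊛ (e ⊛ e))))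

  Ψ≈Ψ₂ : Ψ ≈ Ψ₂
  Ψ≈Ψ₂ = descent X Y a b c d e g h q y₂₀ y₄ φ₊² φ₊²₅ h≈ refl≈ refl≈ refl≈ quintic U≈

  dil-Ψ : dil 2 Ψ ≈ Ψ₂
  dil-Ψ = dil-poly 2 ((v₀ :* v₀ :- v₁ :* v₁) :* (con (+ 5) :* (v₁ :* v₁) :- v₀ :* v₀) :- con (+ 16) :* (var (# 2) :* (var (# 3) :* var (# 3))))
    {ρ = a ∷ c ∷ q ∷ h ∷ []} (refl≈ ∷ dil-dil 2 5 φ₊ ∷ dil-q₂ ∷ dil-h ∷ [])
    where
    v₀ = var (# 0)
    v₁ = var (# 1)
    dil-h : dil 2 h ≈ e
    dil-h = dil-poly 2 (var (# 0) :* var (# 1)) {ρ = dil 2 euler ∷ dil 10 euler ∷ []} (dil-dil 2 2 euler ∷ dil-dil 2 10 euler ∷ [])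

  Ψ₂≈0 : Ψ₂ ≈ ι (+ 0)
  Ψ₂≈0 n = trans (sym (Ψ≈Ψ₂ n)) (trans (dil-fixed 1ℚ Ψ (λ i → trans (Ψ≈Ψ₂ i) (trans (sym (dil-Ψ i)) (sym (ℚP.*-identityˡ (dil 2 Ψ i))))) refl n)
      (sym (ℚP.*-zeroˡ (oneₛ n))))

  -- `l` is the common ratio (b² - d²)/M = (X - 5Y)/N of the two factorisations of `U`, and `M`, `N`
  -- are the denominators; `f` is the product whose square root ambiguity is settled by the identity
  -- for U f.
  l M N f : PS
  l = q ⊛ l₀
  M = X +ₛ (-ₛ Y)
  N = ι (+ 5) ⊛ (d ⊛ d) +ₛ (-ₛ (b ⊛ b))
  f = a ⊛ b ⊛ (c ⊛ d)

  M≈ : M ≈ ι (+ 4) ⊛ (q ⊛ S₄)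
  M≈ = XY-difference S₄ X Y q y₂₀ y₄ refl≈ refl≈ y₄²-y₂₀²

  β≈ : b ⊛ b +ₛ (-ₛ (d ⊛ d)) ≈ l ⊛ M
  β≈ = ratio R₂ S₄ X Y b d l₀ q b²-d² l₀-Rψ M≈

  private
    4≢0 : + 4 ≢ + 0
    4≢0 ()
    16≢0 : + 16 ≢ + 0
    16≢0 ()

    regular-M : Regular M
    regular-M = regular-≈ (λ n → sym (M≈ n)) (regular-⊛ (regular-ι (+ 4) 4≢0) (regular-⊛ (regular-mono 1) (eta-regular Rψ-eta₄)))

    regular-U : Regular U
    regular-U = regular-⊛ reg reg
      where
      reg : Regular (ι (+ 4) ⊛ (q ⊛ e))
      reg = regular-⊛ (regular-ι (+ 4) 4≢0) (regular-⊛ (regular-mono 1) (eta-regular (η-eta₄ ⊗ₑ η-eta₂₀)))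

    regular-l : Regular l
    regular-l = regular-⊛ (regular-mono 1) (eta-regular (etaProd-eta lL))

  ξ≈ : X +ₛ (-ₛ (ι (+ 5) ⊛ Y)) ≈ l ⊛ N
  ξ≈ = regular-cancel regular-M (X +ₛ (-ₛ (ι (+ 5) ⊛ Y))) (l ⊛ N) (dual-ratio X Y b d e l q U≈ Ψ₂≈0 β≈)

  g≈ : g ≈ l ⊛ l ⊛ (X ⊛ (d ⊛ d))
  g≈ = cross-term X b d g l₀ q y₂₀ y₄ refl≈ refl≈ l₀²

  U≈lMN : U ≈ l ⊛ (M ⊛ N)
  U≈lMN n = trans (U≈ n) (trans (⊛-cong {f = M} refl≈ ξ≈ n) (solve 3 (λ l M N → M :* (l :* N) := l :* (M :* N)) refl≈ l M N n))

  private
    B² D² A² C² : PS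
    A² = a ⊛ a
    B² = b ⊛ b
    C² = c ⊛ c
    D² = d ⊛ d

    4B = param-B B² D² M N l β≈ refl≈
    4D = param-D B² D² M N l β≈ refl≈
    4X = param-X M N X Y l ξ≈ refl≈
    4Y = param-Y M N X Y l ξ≈ refl≈
    4A = param-A A² B² M N X l φ₊² 4B 4X
    4C = param-C C² D² M N Y l φ₊²₅ 4D 4Y
    16g = param-g D² M N X g l g≈ 4X 4D
    onCurve = curve B² D² M N X Y g l 16g 4D 4Y β≈ refl≈ quintic

    mixed = mixed-product Rφ Rψ S₂ a c q y₁ y₁₀ y₂ y₅ a²-c² Rφ-Rψ y₁²-y₅² y₂²-y₁₀² ψ² y₅²
    g-sq = g-squares b d g q y₁₀ y₂ y₂₀ y₄ refl≈ y₂² y₁₀²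
    BX-sq = BX-squares X b q y₂ y₄ refl≈ y₂²
    DY-sq = DY-squares Y d q y₁₀ y₂₀ refl≈ y₁₀²

    U⊛f = four-thetas X Y a b c d e g h q y₁₀ y₂ y₂₀ y₄ mixed h≈ ψ₂ψ₁₀ y₂² y₁₀² g-sq BX-sq DY-sq

    open OnCurve A² B² C² D² M N X Y g l 4A 4B 4C 4D 4X 4Y 16g onCurve

    -- The identity for U f determines 256 l f after `U` is cancelled, and a further common factor
    -- 16 is removed.
    16lf : ι (+ 16) ⊛ (l ⊛ f) ≈ Values.fᶜ l M N
    16lf = regular-cancel (regular-ι (+ 16) 16≢0) (ι (+ 16) ⊛ (l ⊛ f)) (Values.fᶜ l M N)
      ((λ n → solve 1 (λ x → con (+ 16) :* (con (+ 16) :* x) := con (+ 256) :* x) refl≈ (l ⊛ f) n)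
      ⨾ regular-cancel regular-U (ι (+ 256) ⊛ (l ⊛ f)) (ι (+ 16) ⊛ Values.fᶜ l M N) (f-relation f U U≈lMN U⊛f))

    w : PS
    w = ι (+ 2) ⊛ (a ⊛ c ⊛ (m ⊛ n₅))

    16w = param-w w (w-formula B² D² X Y a c e m n₅ q (l ⊛ (M ⊛ N)) 4qe U≈lMN φ₋² φ₋²₅)

    rel₃ = relation₃ f 16lf
    rel₂ = relation₂ f 16lf
    rel₄ = relation₄ f w 16lf 16w
    rel₁ = relation₁ f w 16lf 16w

    shifted : ∀ s {f g μ} → mono s ≈ μ → f ≈ g → shift s f ≈ μ ⊛ g
    shifted s {f} mono≈ f≈g n = trans (shift≈mono s f n) (⊛-cong mono≈ f≈g n)

    C₁≈ = shifted 2 mono₂ C₁-eta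
    C₂≈ = shifted 2 mono₂ C₂-eta
    C₃≈ = shifted 3 mono₃ C₃-eta
    C₄≈ = shifted 1 refl≈ C₄-eta

    form₁ = C₁-form B² M S₄ X C₁ a c d e m n₅ o q t C₁≈ η₈η₄₀ M≈ 4qe φ₋²
    form₂ = C₂-form X C₂ a b c g k q y₁₀ y₂ y₄ C₂≈ k≈ mixed y₂² g-sq BX-sq
    form₃ = C₃-form Y C₃ a b d g h q y₂₀ y₄ C₃≈ h≈ refl≈ refl≈
    form₄ = C₄-form Y C₄ a b c d e m n₅ q C₄≈ 4qe φ₋²₅

    -- cancels 64 ν l u
    extract : ∀ {u} z ν Q Q′ {L} → Regular u → ν ≢ + 0 → u ⊛ (ι (ν ℤ.* z) ⊛ Q) ≈ L → ι (+ 64) ⊛ (l ⊛ L) ≈ ι ν ⊛ (ι (+ 64) ⊛ (l ⊛ (u ⊛ Q′))) →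
        ι z ⊛ Q ≈ Q′
    extract {u} z ν Q Q′ {L} reg ν≢0 form rel = regular-cancel (regular-⊛ (regular-⊛ (regular-ι (+ 64) λ ()) (regular-⊛ regular-l reg))
        (regular-ι ν ν≢0)) (ι z ⊛ Q) Q′
      ((λ n → trans (solve 6 (λ x l u y z Q → x :* (l :* u) :* y :* (z :* Q) := x :* (l :* (u :* (y :* z :* Q)))) refl≈ (ι (+ 64)) l u (ι ν) (ι z) Q
          n)
          (⊛-cong {f = ι (+ 64)} refl≈ (⊛-cong {f = l} refl≈ (⊛-cong {f = u} refl≈ (⊛-cong {g = Q} (λ i → sym (ι-* ν z i)) refl≈))) n))
      ⨾ ⊛-cong {f = ι (+ 64)} refl≈ (⊛-cong {f = l} refl≈ form)
      ⨾ rel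
      ⨾ solve 5 (λ x l u y Q → y :* (x :* (l :* (u :* Q))) := x :* (l :* u) :* y :* Q) refl≈ (ι (+ 64)) l u (ι ν) Q′)
      where
      ι-* : ∀ x y → ι (x ℤ.* y) ≈ ι x ⊛ ι y
      ι-* = _-Raw-AlmostCommutative⟶_.*-homo ι-morphism

    extract-ab : ∀ z ν Q U V {L} → ν ≢ + 0 → (a ⊛ b) ⊛ (ι (ν ℤ.* z) ⊛ Q) ≈ L →
      ι (+ 64) ⊛ (l ⊛ L) ≈ ι ν ⊛ (ι (+ 64) ⊛ (l ⊛ (f ⊛ U +ₛ A² ⊛ B² ⊛ V))) → ι z ⊛ Q ≈ (c ⊛ d) ⊛ U +ₛ (a ⊛ b) ⊛ V
    extract-ab z ν Q U V ν≢0 form rel = extract {a ⊛ b} z ν Q ((c ⊛ d) ⊛ U +ₛ (a ⊛ b) ⊛ V) (regular-⊛ (eta-regular φ-eta₁) (eta-regular φ-eta₂)) ν≢0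
        form
      (rel ⨾ ⊛-cong {f = ι ν} refl≈ (⊛-cong {f = ι (+ 64)} refl≈ (⊛-cong {f = l} refl≈
        (solve 6 (λ a b c d U V → a :* b :* (c :* d) :* U :+ a :* a :* (b :* b) :* V := (a :* b) :* ((c :* d) :* U :+ (a :* b) :* V)) refl≈ a b c d U
            V))))

    extract-cd : ∀ z ν Q U V {L} → ν ≢ + 0 → (c ⊛ d) ⊛ (ι (ν ℤ.* z) ⊛ Q) ≈ L →
      ι (+ 64) ⊛ (l ⊛ L) ≈ ι ν ⊛ (ι (+ 64) ⊛ (l ⊛ (f ⊛ V +ₛ C² ⊛ D² ⊛ U))) → ι z ⊛ Q ≈ (c ⊛ d) ⊛ U +ₛ (a ⊛ b) ⊛ V
    extract-cd z ν Q U V ν≢0 form rel = extract {c ⊛ d} z ν Q ((c ⊛ d) ⊛ U +ₛ (a ⊛ b) ⊛ V) (regular-⊛ (eta-regular φ-eta₅) (eta-regular φ-eta₁₀)) ν≢0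
        form
      (rel ⨾ ⊛-cong {f = ι ν} refl≈ (⊛-cong {f = ι (+ 64)} refl≈ (⊛-cong {f = l} refl≈
        (solve 6 (λ a b c d U V → a :* b :* (c :* d) :* V :+ c :* c :* (d :* d) :* U := (c :* d) :* ((c :* d) :* U :+ (a :* b) :* V)) refl≈ a b c d U
            V))))

  C₁-theta : ι (+ 8) ⊛ C₁ ≈
    (c ⊛ d) ⊛ (ι (+ 4) ⊛ (a ⊛ a) +ₛ ι (+ 3) ⊛ (b ⊛ b) +ₛ (-ₛ (ι (+ 10) ⊛ (c ⊛ c))) +ₛ ι (+ 5) ⊛ (d ⊛ d))
    +ₛ (a ⊛ b) ⊛ ((-ₛ (ι (+ 3))) ⊛ (a ⊛ a) +ₛ ι (+ 5) ⊛ (b ⊛ b) +ₛ c ⊛ c +ₛ (-ₛ (ι (+ 5) ⊛ (d ⊛ d))))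
  C₁-theta = extract-cd (+ 8) (+ 4) C₁
    (ι (+ 4) ⊛ (a ⊛ a) +ₛ ι (+ 3) ⊛ (b ⊛ b) +ₛ (-ₛ (ι (+ 10) ⊛ (c ⊛ c))) +ₛ ι (+ 5) ⊛ (d ⊛ d))
    ((-ₛ (ι (+ 3))) ⊛ (a ⊛ a) +ₛ ι (+ 5) ⊛ (b ⊛ b) +ₛ c ⊛ c +ₛ (-ₛ (ι (+ 5) ⊛ (d ⊛ d))))
    (λ ()) form₁ rel₁

  C₂-theta : ι (+ 16) ⊛ C₂ ≈
    (c ⊛ d) ⊛ (ι (+ 3) ⊛ (a ⊛ a) +ₛ ι (+ 8) ⊛ (b ⊛ b) +ₛ ι (+ 5) ⊛ (c ⊛ c) +ₛ (-ₛ (ι (+ 20) ⊛ (d ⊛ d))))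
    +ₛ (a ⊛ b) ⊛ ((-ₛ (ι (+ 5))) ⊛ (a ⊛ a) +ₛ ι (+ 6) ⊛ (b ⊛ b) +ₛ ι (+ 5) ⊛ (c ⊛ c) +ₛ (-ₛ (ι (+ 2) ⊛ (d ⊛ d))))
  C₂-theta = extract-ab (+ 16) (+ 1) C₂
    (ι (+ 3) ⊛ (a ⊛ a) +ₛ ι (+ 8) ⊛ (b ⊛ b) +ₛ ι (+ 5) ⊛ (c ⊛ c) +ₛ (-ₛ (ι (+ 20) ⊛ (d ⊛ d))))
    ((-ₛ (ι (+ 5))) ⊛ (a ⊛ a) +ₛ ι (+ 6) ⊛ (b ⊛ b) +ₛ ι (+ 5) ⊛ (c ⊛ c) +ₛ (-ₛ (ι (+ 2) ⊛ (d ⊛ d))))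
    (λ ()) form₂ rel₂

  C₃-theta : ι (+ 8) ⊛ C₃ ≈
    (c ⊛ d) ⊛ ((-ₛ (a ⊛ a)) +ₛ (-ₛ (ι (+ 2) ⊛ (b ⊛ b))) +ₛ (-ₛ (ι (+ 5) ⊛ (c ⊛ c))) +ₛ ι (+ 10) ⊛ (d ⊛ d))
    +ₛ (a ⊛ b) ⊛ (ι (+ 2) ⊛ (a ⊛ a) +ₛ (-ₛ (ι (+ 2) ⊛ (b ⊛ b))) +ₛ (-ₛ (ι (+ 4) ⊛ (c ⊛ c))) +ₛ ι (+ 2) ⊛ (d ⊛ d))
  C₃-theta = extract-ab (+ 8) (+ 1) C₃
    ((-ₛ (a ⊛ a)) +ₛ (-ₛ (ι (+ 2) ⊛ (b ⊛ b))) +ₛ (-ₛ (ι (+ 5) ⊛ (c ⊛ c))) +ₛ ι (+ 10) ⊛ (d ⊛ d))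
    (ι (+ 2) ⊛ (a ⊛ a) +ₛ (-ₛ (ι (+ 2) ⊛ (b ⊛ b))) +ₛ (-ₛ (ι (+ 4) ⊛ (c ⊛ c))) +ₛ ι (+ 2) ⊛ (d ⊛ d))
    (λ ()) form₃ rel₃

  C₄-theta : ι (+ 4) ⊛ C₄ ≈
    (c ⊛ d) ⊛ ((-ₛ (a ⊛ a)) +ₛ (-ₛ (b ⊛ b)) +ₛ ι (+ 5) ⊛ (c ⊛ c) +ₛ (-ₛ (ι (+ 5) ⊛ (d ⊛ d))))
    +ₛ (a ⊛ b) ⊛ (a ⊛ a +ₛ (-ₛ (ι (+ 2) ⊛ (b ⊛ b))) +ₛ (-ₛ (c ⊛ c)) +ₛ ι (+ 4) ⊛ (d ⊛ d))
  C₄-theta = extract-ab (+ 4) (+ 2) C₄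
    ((-ₛ (a ⊛ a)) +ₛ (-ₛ (b ⊛ b)) +ₛ ι (+ 5) ⊛ (c ⊛ c) +ₛ (-ₛ (ι (+ 5) ⊛ (d ⊛ d))))
    (a ⊛ a +ₛ (-ₛ (ι (+ 2) ⊛ (b ⊛ b))) +ₛ (-ₛ (c ⊛ c)) +ₛ ι (+ 4) ⊛ (d ⊛ d))
    (λ ()) form₄ rel₄

open ThetaExpansions

-- Linear algebra in the eight quartic products

module QuarticCoordinates where

  open import Data.Rational using (_+_; _*_; -_)
  open import Data.Vec using (Vec; []; _∷_; _++_; map; zipWith)
  open import Data.Vec.Relation.Binary.Pointwise.Inductive using ([]; _∷_)

  combination : ∀ {k} → Vec ℚ k → Vec PS k → PS
  combination []       []       n = 0ℚ
  combination (x ∷ xs) (f ∷ fs) n = x * f n + combination xs fs n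

  combination-+ : ∀ {k} (xs ys : Vec ℚ k) fs → combination (zipWith _+_ xs ys) fs ≈ combination xs fs +ₛ combination ys fs
  combination-+ []       []       []       n = refl
  combination-+ (x ∷ xs) (y ∷ ys) (f ∷ fs) n = trans (cong (λ z → (x + y) * f n + z) (combination-+ xs ys fs n))
    (ℚS.solve 5 (λ x y f u v → (x ℚS.:+ y) ℚS.:* f ℚS.:+ (u ℚS.:+ v) ℚS.:= (x ℚS.:* f ℚS.:+ u) ℚS.:+ (y ℚS.:* f ℚS.:+ v)) refl x
        y (f n) (combination xs fs n) (combination ys fs n))

  combination-· : ∀ {k} x (ys : Vec ℚ k) fs → combination (map (x *_) ys) fs ≈ x ·ₛ combination ys fs
  combination-· x []       []       n = sym (ℚP.*-zeroʳ x)
  combination-· x (y ∷ ys) (f ∷ fs) n = trans (cong (λ z → x * y * f n + z) (combination-· x ys fs n))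
    (ℚS.solve 4 (λ x y f u → x ℚS.:* y ℚS.:* f ℚS.:+ x ℚS.:* u ℚS.:= x ℚS.:* (y ℚS.:* f ℚS.:+ u)) refl x y (f n) (combination ys fs n))

  open PSSolver using (Polynomial; ⟦_⟧; ⟦_⟧↓; prove; solve; _:=_; var; con; _:+_; _:*_; _:-_; :-_; _:^_)

  linear : ∀ {k j} → Vec ℤ j → Vec (Polynomial k) j → Polynomial k
  linear []       []       = con (+ 0)
  linear (z ∷ zs) (e ∷ es) = con z :* e :+ linear zs es

  linear-combination : ∀ {k j} (zs : Vec ℤ j) (es : Vec (Polynomial k) j) (ρ : Vec PS k) →
      ⟦ linear zs es ⟧ ρ ≈ combination (map fromℤ zs) (map (λ e → ⟦ e ⟧ ρ) es)
  linear-combination []       []       ρ n = ℚP.*-zeroˡ (oneₛ n)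
  linear-combination (z ∷ zs) (e ∷ es) ρ n = cong₂ _+_ (·-one (fromℤ z) (⟦ e ⟧ ρ) n) (linear-combination zs es ρ n)

  abcd : Vec PS 4
  abcd = a ∷ b ∷ c ∷ d ∷ []

  private
    x y z w : Polynomial 4
    x = var (# 0)
    y = var (# 1)
    z = var (# 2)
    w = var (# 3)

  -- The monomials a³b, ab³, abc², abd², a²cd, b²cd, c³d, cd³.
  quartic : Vec (Polynomial 4) 8
  quartic = map (λ v → x :* y :* (v :* v)) (x ∷ y ∷ z ∷ w ∷ []) ++ map (λ v → z :* w :* (v :* v)) (x ∷ y ∷ z ∷ w ∷ [])

  -- The coordinate vector is an index of the type, so sums and multiples of expansions compute
  -- their coordinates, and each identity of the theorem becomes an equality of explicit rational
  -- vectors.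
  record Coordinates (f : PS) (xs : Vec ℚ 8) : Set where
    constructor coordinates
    field expansion : f ≈ combination xs (map (λ e → ⟦ e ⟧ abcd) quartic)

  infixl 6 _+ᶜ_
  infixl 7 _·ᶜ_

  _+ᶜ_ : ∀ {f g xs ys} → Coordinates f xs → Coordinates g ys → Coordinates (f +ₛ g) (zipWith _+_ xs ys)
  _+ᶜ_ {xs = xs} {ys} (coordinates p) (coordinates p′) = coordinates λ n → trans (cong₂ _+_ (p n) (p′ n)) (sym (combination-+ xs ys _ n))

  _·ᶜ_ : ∀ x {f xs} → Coordinates f xs → Coordinates (x ·ₛ f) (map (x *_) xs)
  _·ᶜ_ x {xs = xs} (coordinates p) = coordinates λ n → trans (cong (x *_) (p n)) (sym (combination-· x xs _ n))

  same-coordinates : ∀ {f g xs ys} → Coordinates f xs → Coordinates g ys → xs ≡ ys → f ≈ g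
  same-coordinates (coordinates p) (coordinates p′) refl n = trans (p n) (sym (p′ n))

  polynomial-coordinates : ∀ {f} (e : Polynomial 4) (zs : Vec ℤ 8) → f ≈ ⟦ e ⟧ abcd → ⟦ e ⟧↓ abcd ≈ ⟦ linear zs quartic ⟧↓ abcd →
      Coordinates f (map fromℤ zs)
  polynomial-coordinates e zs f≈ eq = coordinates λ n → trans (f≈ n)
      (trans (prove abcd e (linear zs quartic) eq n) (linear-combination zs quartic abcd n))

  divide : ∀ z x {f xs} → x * fromℤ z ≡ 1ℚ → Coordinates (ι z ⊛ f) xs → Coordinates f (map (x *_) xs)
  divide z x {f} {xs} xz≡1 p = coordinates λ n → trans (quotient n) (Coordinates.expansion (x ·ᶜ p) n)
    where
    quotient : f ≈ x ·ₛ (ι z ⊛ f)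
    quotient n = begin
      f n                   ≡⟨ ℚP.*-identityˡ (f n) ⟨
      1ℚ * f n              ≡⟨ cong (_* f n) xz≡1 ⟨
      x * fromℤ z * f n     ≡⟨ ℚP.*-assoc x (fromℤ z) (f n) ⟩
      x * (fromℤ z * f n)   ≡⟨ cong (x *_) (·-one (fromℤ z) f n) ⟨
      x * (ι z ⊛ f) n       ∎
      where open ≡-Reasoning

  private
    -- Here φ(-q)² = 2φ(q²)² - φ(q)² and X = φ(q)² - φ(q²)². Both forms involve only φ(q) and φ(q²),
    -- hence only φ(q⁵) and φ(q¹⁰) after q ↦ q⁵.
    e₀₂ e₂₀ : ∀ {k} → Polynomial k → Polynomial k → Polynomial k
    e₀₂ x y = :- ((con (+ 2) :* (y :* y) :- x :* x) :* (x :* y))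
    e₂₀ x y = x :* y :* (x :* x :- y :* y)

  E₀₂-quartic : ι (+ 2) ⊛ E₀₂ ≈ ⟦ e₀₂ x y ⟧ abcd
  E₀₂-quartic n = trans (E₀₂-theta n) (cong -_ (⊛-cong {g = a ⊛ b} m² (λ _ → refl) n))
    where
    m² : m ⊛ m ≈ ι (+ 2) ⊛ (b ⊛ b) +ₛ (-ₛ (a ⊛ a))
    m² n = trans (φ₋² n) (trans (solve 2 (λ B X → B :- X := con (+ 2) :* B :- (B :+ X)) (λ _ → refl) (b ⊛ b) X n)
      (cong (λ z → (ι (+ 2) ⊛ (b ⊛ b)) n + - z) (sym (φ₊² n))))

  E₂₀-quartic : ι (+ 4) ⊛ E₂₀ ≈ ⟦ e₂₀ x y ⟧ abcd
  E₂₀-quartic n = trans (·-one (fromℤ (+ 4)) E₂₀ n) (trans (E₂₀-theta n) (⊛-cong {f = a ⊛ b} (λ _ → refl) X≈ n))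
    where
    X≈ : X ≈ a ⊛ a +ₛ (-ₛ (b ⊛ b))
    X≈ n = trans (solve 2 (λ B X → X := (B :+ X) :- B) (λ _ → refl) (b ⊛ b) X n) (cong (_+ - (b ⊛ b) n) (sym (φ₊² n)))

  private
    at-q⁵ : ∀ k (e : ∀ {j} → Polynomial j → Polynomial j → Polynomial j) {f} → ι k ⊛ f ≈ ⟦ e (var (# 1)) (var (# 2)) ⟧ (f ∷ a ∷ b ∷ []) →
      ι k ⊛ dil 5 f ≈ ⟦ e (var (# 1)) (var (# 2)) ⟧ (dil 5 f ∷ c ∷ d ∷ [])
    at-q⁵ k e {f} = dil-identity 5 (con k :* var (# 0)) (e (var (# 1)) (var (# 2)))
        {ρ = f ∷ a ∷ b ∷ []} ((λ _ → refl) ∷ (λ _ → refl) ∷ dil-dil 5 2 φ₊ ∷ [])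

  E₀₂ᶜ : Coordinates E₀₂ _
  E₀₂ᶜ = divide (+ 2) ½ refl (polynomial-coordinates (e₀₂ x y) (+ 1 ∷ ℤ.- + 2 ∷ + 0 ∷ + 0 ∷ + 0 ∷ + 0 ∷ + 0 ∷ + 0 ∷ []) E₀₂-quartic (λ _ → refl))

  E₂₀ᶜ : Coordinates E₂₀ _
  E₂₀ᶜ = divide (+ 4) (+ 1 ℚ./ 4) refl (polynomial-coordinates (e₂₀ x y) (+ 1 ∷ ℤ.- + 1 ∷ + 0 ∷ + 0 ∷ + 0 ∷ + 0 ∷ + 0 ∷ + 0 ∷ [])
      E₂₀-quartic (λ _ → refl))

  dil-E₀₂ᶜ : Coordinates (dil 5 E₀₂) _
  dil-E₀₂ᶜ = divide (+ 2) ½ refl (polynomial-coordinates (e₀₂ z w) (+ 0 ∷ + 0 ∷ + 0 ∷ + 0 ∷ + 0 ∷ + 0 ∷ + 1 ∷ ℤ.- + 2 ∷ [])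
      (at-q⁵ (+ 2) e₀₂ {E₀₂} E₀₂-quartic) (λ _ → refl))

  dil-E₂₀ᶜ : Coordinates (dil 5 E₂₀) _
  dil-E₂₀ᶜ = divide (+ 4) (+ 1 ℚ./ 4) refl (polynomial-coordinates (e₂₀ z w) (+ 0 ∷ + 0 ∷ + 0 ∷ + 0 ∷ + 0 ∷ + 0 ∷ + 1 ∷ ℤ.- + 1 ∷ [])
      (at-q⁵ (+ 4) e₂₀ {E₂₀} E₂₀-quartic) (λ _ → refl))

  C₁ᶜ : Coordinates C₁ _
  C₁ᶜ = divide (+ 8) (+ 1 ℚ./ 8) refl (polynomial-coordinates
    (z :* w :* (con (+ 4) :* (x :* x) :+ con (+ 3) :* (y :* y) :- con (+ 10) :* (z :* z) :+ con (+ 5) :* (w :* w))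
      :+ x :* y :* ((:- con (+ 3)) :* (x :* x) :+ con (+ 5) :* (y :* y) :+ z :* z :- con (+ 5) :* (w :* w)))
    (ℤ.- + 3 ∷ + 5 ∷ + 1 ∷ ℤ.- + 5 ∷ + 4 ∷ + 3 ∷ ℤ.- + 10 ∷ + 5 ∷ []) C₁-theta (λ _ → refl))

  C₂ᶜ : Coordinates C₂ _
  C₂ᶜ = divide (+ 16) (+ 1 ℚ./ 16) refl (polynomial-coordinates
    (z :* w :* (con (+ 3) :* (x :* x) :+ con (+ 8) :* (y :* y) :+ con (+ 5) :* (z :* z) :- con (+ 20) :* (w :* w))
      :+ x :* y :* ((:- con (+ 5)) :* (x :* x) :+ con (+ 6) :* (y :* y) :+ con (+ 5) :* (z :* z) :- con (+ 2) :* (w :* w)))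
    (ℤ.- + 5 ∷ + 6 ∷ + 5 ∷ ℤ.- + 2 ∷ + 3 ∷ + 8 ∷ + 5 ∷ ℤ.- + 20 ∷ []) C₂-theta (λ _ → refl))

  C₃ᶜ : Coordinates C₃ _
  C₃ᶜ = divide (+ 8) (+ 1 ℚ./ 8) refl (polynomial-coordinates
    (z :* w :* ((:- (x :* x)) :- con (+ 2) :* (y :* y) :- con (+ 5) :* (z :* z) :+ con (+ 10) :* (w :* w))
      :+ x :* y :* (con (+ 2) :* (x :* x) :- con (+ 2) :* (y :* y) :- con (+ 4) :* (z :* z) :+ con (+ 2) :* (w :* w)))
    (+ 2 ∷ ℤ.- + 2 ∷ ℤ.- + 4 ∷ + 2 ∷ ℤ.- + 1 ∷ ℤ.- + 2 ∷ ℤ.- + 5 ∷ + 10 ∷ []) C₃-theta (λ _ → refl))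

  C₄ᶜ : Coordinates C₄ _
  C₄ᶜ = divide (+ 4) (+ 1 ℚ./ 4) refl (polynomial-coordinates
    (z :* w :* ((:- (x :* x)) :- y :* y :+ con (+ 5) :* (z :* z) :- con (+ 5) :* (w :* w))
      :+ x :* y :* (x :* x :- con (+ 2) :* (y :* y) :- z :* z :+ con (+ 4) :* (w :* w)))
    (+ 1 ∷ ℤ.- + 2 ∷ ℤ.- + 1 ∷ + 4 ∷ ℤ.- + 1 ∷ ℤ.- + 1 ∷ + 5 ∷ ℤ.- + 5 ∷ []) C₄-theta (λ _ → refl))

  private
    ^-cong : ∀ {f g} j → f ≈ g → f ^ₛ j ≈ g ^ₛ j
    ^-cong zero    f≈g n = refl
    ^-cong (suc j) f≈g n = ⊛-cong f≈g (^-cong j f≈g) n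

    φ₂ : dil 2 φ ≈ b
    φ₂ = dil-cong 2 φ≈φ₊
    φ₅ : dil 5 φ ≈ c
    φ₅ = dil-cong 5 φ≈φ₊
    φ₁₀ : dil 10 φ ≈ d
    φ₁₀ = dil-cong 10 φ≈φ₊

  φ³φ₂ᶜ : Coordinates (φ ^ₛ 3 ⊛ dil 2 φ) _
  φ³φ₂ᶜ = polynomial-coordinates (x :^ 3 :* y) (+ 1 ∷ + 0 ∷ + 0 ∷ + 0 ∷ + 0 ∷ + 0 ∷ + 0 ∷ + 0 ∷ []) (⊛-cong (^-cong 3 φ≈φ₊) φ₂) (λ _ → refl)

  φφ₂³ᶜ : Coordinates (φ ⊛ (dil 2 φ ^ₛ 3)) _
  φφ₂³ᶜ = polynomial-coordinates (x :* y :^ 3) (+ 0 ∷ + 1 ∷ + 0 ∷ + 0 ∷ + 0 ∷ + 0 ∷ + 0 ∷ + 0 ∷ []) (⊛-cong φ≈φ₊ (^-cong 3 φ₂)) (λ _ → refl)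

  φφ₂φ₅²ᶜ : Coordinates (φ ⊛ dil 2 φ ⊛ (dil 5 φ ^ₛ 2)) _
  φφ₂φ₅²ᶜ = polynomial-coordinates (x :* y :* z :^ 2) (+ 0 ∷ + 0 ∷ + 1 ∷ + 0 ∷ + 0 ∷ + 0 ∷ + 0 ∷ + 0 ∷ []) (⊛-cong (⊛-cong φ≈φ₊ φ₂) (^-cong 2 φ₅))
      (λ _ → refl)

  φφ₂φ₁₀²ᶜ : Coordinates (φ ⊛ dil 2 φ ⊛ (dil 10 φ ^ₛ 2)) _
  φφ₂φ₁₀²ᶜ = polynomial-coordinates (x :* y :* w :^ 2) (+ 0 ∷ + 0 ∷ + 0 ∷ + 1 ∷ + 0 ∷ + 0 ∷ + 0 ∷ + 0 ∷ []) (⊛-cong (⊛-cong φ≈φ₊ φ₂) (^-cong 2 φ₁₀))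
      (λ _ → refl)

  φ²φ₅φ₁₀ᶜ : Coordinates ((φ ^ₛ 2) ⊛ dil 5 φ ⊛ dil 10 φ) _
  φ²φ₅φ₁₀ᶜ = polynomial-coordinates (x :^ 2 :* z :* w) (+ 0 ∷ + 0 ∷ + 0 ∷ + 0 ∷ + 1 ∷ + 0 ∷ + 0 ∷ + 0 ∷ []) (⊛-cong (⊛-cong (^-cong 2 φ≈φ₊) φ₅) φ₁₀)
      (λ _ → refl)

  φ₂²φ₅φ₁₀ᶜ : Coordinates ((dil 2 φ ^ₛ 2) ⊛ dil 5 φ ⊛ dil 10 φ) _
  φ₂²φ₅φ₁₀ᶜ = polynomial-coordinates (y :^ 2 :* z :* w) (+ 0 ∷ + 0 ∷ + 0 ∷ + 0 ∷ + 0 ∷ + 1 ∷ + 0 ∷ + 0 ∷ []) (⊛-cong (⊛-cong (^-cong 2 φ₂) φ₅) φ₁₀)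
      (λ _ → refl)

open QuarticCoordinates
open import Data.Integer using (-_)

theorem2p7 : (∀ n → ((φ ^ₛ 3) ⊛ dil 2 φ) n
    ≡ (ℤ/ (- (+ 2)) 1 ·ₛ E₀₂ +ₛ ℤ/ (+ 8) 1 ·ₛ E₂₀) n)
    × (∀ n → ((φ ^ₛ 2) ⊛ dil 5 φ ⊛ dil 10 φ) n
    ≡ (ℤ/ (+ 2) 13 ·ₛ (ℤ/ (+ 2) 1 ·ₛ E₀₂ +ₛ ℤ/ (- (+ 15)) 1 ·ₛ dil 5 E₀₂ +ₛ ℤ/ (+ 8) 1 ·ₛ E₂₀ +ₛ ℤ/ (+ 60) 1 ·ₛ dil 5 E₂₀)
    +ₛ ℤ/ (+ 8) 13 ·ₛ (ℤ/ (+ 6) 1 ·ₛ C₁ +ₛ ℤ/ (- (+ 4)) 1 ·ₛ C₂ +ₛ ℤ/ (- (+ 3)) 1 ·ₛ C₃ +ₛ ℤ/ (+ 4) 1 ·ₛ C₄)) n)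
    × (∀ n → (φ ⊛ (dil 2 φ ^ₛ 3)) n
    ≡ (ℤ/ (- (+ 2)) 1 ·ₛ E₀₂ +ₛ ℤ/ (+ 4) 1 ·ₛ E₂₀) n)
    × (∀ n → (φ ⊛ dil 2 φ ⊛ (dil 5 φ ^ₛ 2)) n
    ≡ (ℤ/ (+ 2) 13 ·ₛ (ℤ/ (- (+ 3)) 1 ·ₛ E₀₂ +ₛ ℤ/ (- (+ 10)) 1 ·ₛ dil 5 E₀₂ +ₛ ℤ/ (+ 12) 1 ·ₛ E₂₀)
    +ₛ ℤ/ (- (+ 80)) 13 ·ₛ dil 5 E₂₀
    +ₛ ℤ/ (+ 8) 13 ·ₛ (ℤ/ (- (+ 2)) 1 ·ₛ C₂ +ₛ ℤ/ (- (+ 5)) 1 ·ₛ C₃ +ₛ ℤ/ (+ 1) 1 ·ₛ C₄)) n)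
    × (∀ n → (φ ⊛ dil 2 φ ⊛ (dil 10 φ ^ₛ 2)) n
    ≡ (ℤ/ (+ 2) 13 ·ₛ (ℤ/ (- (+ 3)) 1 ·ₛ E₀₂ +ₛ ℤ/ (- (+ 10)) 1 ·ₛ dil 5 E₀₂ +ₛ ℤ/ (+ 6) 1 ·ₛ E₂₀)
    +ₛ ℤ/ (- (+ 40)) 13 ·ₛ dil 5 E₂₀
    +ₛ ℤ/ (+ 4) 13 ·ₛ (ℤ/ (+ 2) 1 ·ₛ C₁ +ₛ ℤ/ (- (+ 2)) 1 ·ₛ C₃ +ₛ ℤ/ (+ 5) 1 ·ₛ C₄)) n)
    × (∀ n → ((dil 2 φ ^ₛ 2) ⊛ dil 5 φ ⊛ dil 10 φ) n
    ≡ (ℤ/ (+ 2) 13 ·ₛ (ℤ/ (+ 2) 1 ·ₛ E₀₂ +ₛ ℤ/ (- (+ 15)) 1 ·ₛ dil 5 E₀₂ +ₛ ℤ/ (+ 4) 1 ·ₛ E₂₀ +ₛ ℤ/ (+ 30) 1 ·ₛ dil 5 E₂₀)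
    +ₛ ℤ/ (+ 4) 13 ·ₛ (ℤ/ (- (+ 4)) 1 ·ₛ C₁ +ₛ ℤ/ (+ 12) 1 ·ₛ C₂ +ₛ ℤ/ (+ 8) 1 ·ₛ C₃ +ₛ ℤ/ (- (+ 3)) 1 ·ₛ C₄)) n)
theorem2p7 =
    -- In the products a³b and ab³ the right side is - (1, - 2) + 2 (1, - 1) = (1, 0). In the level
    -- 40 identities the numerators add up to 13 in one coordinate and to 0 in the others.
    same-coordinates φ³φ₂ᶜ (ℤ/ (- (+ 2)) 1 ·ᶜ E₀₂ᶜ +ᶜ ℤ/ (+ 8) 1 ·ᶜ E₂₀ᶜ) refl
  , same-coordinates φ²φ₅φ₁₀ᶜ
      (ℤ/ (+ 2) 13 ·ᶜ (ℤ/ (+ 2) 1 ·ᶜ E₀₂ᶜ +ᶜ ℤ/ (- (+ 15)) 1 ·ᶜ dil-E₀₂ᶜ +ᶜ ℤ/ (+ 8) 1 ·ᶜ E₂₀ᶜ +ᶜ ℤ/ (+ 60) 1 ·ᶜ dil-E₂₀ᶜ)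
        +ᶜ ℤ/ (+ 8) 13 ·ᶜ (ℤ/ (+ 6) 1 ·ᶜ C₁ᶜ +ᶜ ℤ/ (- (+ 4)) 1 ·ᶜ C₂ᶜ +ᶜ ℤ/ (- (+ 3)) 1 ·ᶜ C₃ᶜ +ᶜ ℤ/ (+ 4) 1 ·ᶜ C₄ᶜ)) refl
  , same-coordinates φφ₂³ᶜ (ℤ/ (- (+ 2)) 1 ·ᶜ E₀₂ᶜ +ᶜ ℤ/ (+ 4) 1 ·ᶜ E₂₀ᶜ) refl
  , same-coordinates φφ₂φ₅²ᶜ
      (ℤ/ (+ 2) 13 ·ᶜ (ℤ/ (- (+ 3)) 1 ·ᶜ E₀₂ᶜ +ᶜ ℤ/ (- (+ 10)) 1 ·ᶜ dil-E₀₂ᶜ +ᶜ ℤ/ (+ 12) 1 ·ᶜ E₂₀ᶜ)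
        +ᶜ ℤ/ (- (+ 80)) 13 ·ᶜ dil-E₂₀ᶜ
        +ᶜ ℤ/ (+ 8) 13 ·ᶜ (ℤ/ (- (+ 2)) 1 ·ᶜ C₂ᶜ +ᶜ ℤ/ (- (+ 5)) 1 ·ᶜ C₃ᶜ +ᶜ ℤ/ (+ 1) 1 ·ᶜ C₄ᶜ)) refl
  , same-coordinates φφ₂φ₁₀²ᶜ
      (ℤ/ (+ 2) 13 ·ᶜ (ℤ/ (- (+ 3)) 1 ·ᶜ E₀₂ᶜ +ᶜ ℤ/ (- (+ 10)) 1 ·ᶜ dil-E₀₂ᶜ +ᶜ ℤ/ (+ 6) 1 ·ᶜ E₂₀ᶜ)
        +ᶜ ℤ/ (- (+ 40)) 13 ·ᶜ dil-E₂₀ᶜ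
        +ᶜ ℤ/ (+ 4) 13 ·ᶜ (ℤ/ (+ 2) 1 ·ᶜ C₁ᶜ +ᶜ ℤ/ (- (+ 2)) 1 ·ᶜ C₃ᶜ +ᶜ ℤ/ (+ 5) 1 ·ᶜ C₄ᶜ)) refl
  , same-coordinates φ₂²φ₅φ₁₀ᶜ
      (ℤ/ (+ 2) 13 ·ᶜ (ℤ/ (+ 2) 1 ·ᶜ E₀₂ᶜ +ᶜ ℤ/ (- (+ 15)) 1 ·ᶜ dil-E₀₂ᶜ +ᶜ ℤ/ (+ 4) 1 ·ᶜ E₂₀ᶜ +ᶜ ℤ/ (+ 30) 1 ·ᶜ dil-E₂₀ᶜ)
        +ᶜ ℤ/ (+ 4) 13 ·ᶜ (ℤ/ (- (+ 4)) 1 ·ᶜ C₁ᶜ +ᶜ ℤ/ (+ 12) 1 ·ᶜ C₂ᶜ +ᶜ ℤ/ (+ 8) 1 ·ᶜ C₃ᶜ +ᶜ ℤ/ (- (+ 3)) 1 ·ᶜ C₄ᶜ)) refl
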